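{- Let $n\ge 2$ and let $F_n$ be the complex flag manifold of complete flags $V_1\subset V_2\subset\cdots\subset V_{n-1}\subset\mathbb{C}^n$ with $\dim V_k=k$. For $1\le k\le n-1$ let $\mathcal{V}_k$ be the tautological rank-$k$ bundle over $F_n$ and set $y_k=-c_1(\det\mathcal{V}_k)\in H^2(F_n;\mathbb{Z})$, put $y_0=y_n:=0$ and $x_k:=y_k-y_{k-1}$ for $1\le k\le n$. Let $q_1,\dots,q_n$ be variables and $K:=\mathbb{Z}[q_1,\dots,q_n]/(\prod_{i=1}^n q_i)$. Then there exists a product $\star$ on $H^*(F_n;\mathbb{Z})\otimes K$, and it is uniquely determined by the following properties: (i) $\star$ is $K$-bilinear; (ii) $\star$ preserves the grading induced by the usual grading of $H^*(F_n;\mathbb{Z})$ together with $\deg q_j=4$ for $1\le j\le n$; (iii) $\star$ is a deformation of the cup product: if all $q_j$ are formally replaced by $0$, one obtains the usual cup product on $H^*(F_n;\mathbb{Z})$; (iv) $\star$ is commutative; (v) $\star$ is associative; (vi) $\sum_{1\le i<j\le n} x_i\star x_j+\sum_{j=1}^n q_j=0$; (vii) for every $d=(d_1,\dots,d_n)\ge 0$, every $a\in H^*(F_n;\mathbb{Z})$ and all $1\le i,j\le n-1$, the coefficients $(y_i\star a)_d\in H^*(F_n;\mathbb{Z})$ of $q^d:=q_1^{d_1}\cdots q_n^{d_n}$ in $y_i\star a$ satisfy $(d_i-d_n)(y_j\star a)_d=(d_j-d_n)(y_i\star a)_d$.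
   Context: Cohomology is with integer coefficients. The classes $y_1,\dots,y_{n-1}$ generate $H^*(F_n;\mathbb{Z})$, and $H^*(F_n;\mathbb{Z})\cong\mathbb{Z}[Y_1,\dots,Y_{n-1}]/S(X_1,\dots,X_n)$ (Borel), where $X_k=Y_k-Y_{k-1}$, $Y_0=Y_n=0$, and $S$ denotes the ideal generated by symmetric polynomials in $X_1,\dots,X_n$ with zero constant term; $y_i$ corresponds to the coset of $Y_i$. Elements of $H^*(F_n;\mathbb{Z})\otimes K$ are written as $\sum_d a_d q^d$ with $a_d\in H^*(F_n;\mathbb{Z})$. -}

module Defs where

open import Data.Bool using (Bool; true; false; if_then_else_; _∨_)
open import Data.Nat as ℕ using (ℕ; zero; suc; _∸_)
open import Data.Integer as ℤ using (ℤ; +_; 0ℤ; 1ℤ)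
open import Data.Fin as F using (Fin; toℕ; fromℕ<; _↑ˡ_; _↑ʳ_; splitAt)
open import Data.Vec as V using (Vec; []; _∷_; lookup; tabulate; replicate; zipWith)
open import Data.Vec.Properties using (≡-dec)
open import Data.List as L using (List; []; _∷_; map; concatMap; foldr; allFin)
open import Data.Product using (Σ; _×_; _,_)
open import Data.Sum using (_⊎_; [_,_])
open import Relation.Binary.PropositionalEquality using (_≡_)
open import Relation.Nullary using (does; yes; no)
open import Data.Fin.Permutation using (Permutation; _⟨$⟩ʳ_)

-- Polynomials with integer coefficients in m variables (indexed by Fin m),
-- represented as finite lists of terms (coefficient , exponent vector).
-- Two representations denote the same polynomial iff all coefficients agree.

Mon : ℕ → Set
Mon m = Vec ℕ m

Poly : ℕ → Set
Poly m = List (ℤ × Mon m)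

coeff : {m : ℕ} → Poly m → Mon m → ℤ
coeff p e = foldr (λ t acc → step t acc) 0ℤ p
  where
  step : _ → ℤ → ℤ
  step (c , e′) acc = if does (≡-dec ℕ._≟_ e′ e) then c ℤ.+ acc else acc

_≈ₚ_ : {m : ℕ} → Poly m → Poly m → Set
p ≈ₚ q = ∀ e → coeff p e ≡ coeff q e

0ₚ : {m : ℕ} → Poly m
0ₚ = []

constₚ : {m : ℕ} → ℤ → Poly m
constₚ {m} c = (c , replicate m 0) ∷ []

1ₚ : {m : ℕ} → Poly m
1ₚ = constₚ 1ℤ

var : {m : ℕ} → Fin m → Poly m
var {m} i = (1ℤ , tabulate (λ j → if does (i F.≟ j) then 1 else 0)) ∷ []

infixl 6 _+ₚ_ _-ₚ_
infixl 7 _*ₚ_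

_+ₚ_ : {m : ℕ} → Poly m → Poly m → Poly m
p +ₚ q = p L.++ q

-ₚ_ : {m : ℕ} → Poly m → Poly m
-ₚ_ = map (λ { (c , e) → (ℤ.- c , e) })

_-ₚ_ : {m : ℕ} → Poly m → Poly m → Poly m
p -ₚ q = p +ₚ (-ₚ q)

_*ₚ_ : {m : ℕ} → Poly m → Poly m → Poly m
p *ₚ q = concatMap (λ { (c , e) → map (λ { (c′ , e′) → (c ℤ.* c′ , zipWith ℕ._+_ e e′) }) q }) p

_·ₚ_ : {m : ℕ} → ℤ → Poly m → Poly m
c ·ₚ p = constₚ c *ₚ p

_^ₚ_ : {m : ℕ} → Poly m → ℕ → Poly m
p ^ₚ zero = 1ₚ
p ^ₚ suc k = p *ₚ (p ^ₚ k)

sumₚ : {m : ℕ} → List (Poly m) → Poly m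
sumₚ = foldr _+ₚ_ 0ₚ

evalMon : {m k : ℕ} → Mon m → (Fin m → Poly k) → Poly k
evalMon [] σ = 1ₚ
evalMon (a ∷ e) σ = (σ F.zero ^ₚ a) *ₚ evalMon e (λ i → σ (F.suc i))

substₚ : {m k : ℕ} → Poly m → (Fin m → Poly k) → Poly k
substₚ p σ = sumₚ (map (λ { (c , e) → c ·ₚ evalMon e σ }) p)

InIdeal : {m : ℕ} → (Poly m → Set) → Poly m → Set
InIdeal {m} G f =
  Σ (List (Poly m × Σ (Poly m) G)) λ cs →
    f ≈ₚ sumₚ (map (λ { (h , (g , _)) → h *ₚ g }) cs)

permuteMon : {n : ℕ} → Permutation n n → Mon n → Mon n
permuteMon σ e = tabulate (λ i → lookup e (σ ⟨$⟩ʳ i))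

IsSymNoConst : {n : ℕ} → Poly n → Set
IsSymNoConst {n} p =
  (∀ (σ : Permutation n n) (e : Mon n) → coeff p (permuteMon σ e) ≡ coeff p e)
  × coeff p (replicate n 0) ≡ 0ℤ

at : {m : ℕ} → Vec ℕ m → ℕ → ℕ
at [] _ = 0
at (a ∷ _) zero = a
at (_ ∷ d) (suc t) = at d t

anyZero : {m : ℕ} → Vec ℕ m → Bool
anyZero [] = false
anyZero (zero ∷ d) = true
anyZero (suc _ ∷ d) = anyZero d

module Flag (n : ℕ) where

  -- number of variables Y_1 … Y_{n-1}; Fin index i stands for Y_{i+1}
  r : ℕ
  r = n ∸ 1

  -- Y_t (t : ℕ) inside a polynomial ring, given where the Y-variables sit;
  -- Y_0 = Y_n = 0
  Yat : {m : ℕ} → (Fin r → Fin m) → ℕ → Poly m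
  Yat ι zero = 0ₚ
  Yat ι (suc t) with t ℕ.<? r
  ... | yes p = var (ι (fromℕ< p))
  ... | no _ = 0ₚ

  -- X_{k+1} = Y_{k+1} - Y_k   for k : Fin n
  Xat : {m : ℕ} → (Fin r → Fin m) → Fin n → Poly m
  Xat ι k = Yat ι (suc (toℕ k)) -ₚ Yat ι (toℕ k)

  BorelGen : {m : ℕ} → (Fin r → Fin m) → Poly m → Set
  BorelGen ι g = Σ (Poly n) λ p → IsSymNoConst p × g ≡ substₚ p (Xat ι)

  -- H^*(F_n;ℤ) = ℤ[Y_1..Y_{n-1}] / S   (Borel presentation)

  PolyH : Set
  PolyH = Poly r

  _≈H_ : PolyH → PolyH → Set
  f ≈H g = InIdeal (BorelGen (λ i → i)) (f -ₚ g)

  -- H^*(F_n;ℤ) ⊗ K = ℤ[Y_1..Y_{n-1}, q_1..q_n] / (S + (q_1⋯q_n))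
  -- variables: Fin (r + n); first r are the Y's, last n are the q's

  M : ℕ
  M = r ℕ.+ n

  PolyHK : Set
  PolyHK = Poly M

  ιY : Fin r → Fin M
  ιY i = i ↑ˡ n

  ιq : Fin n → Fin M
  ιq j = r ↑ʳ j

  qvar : Fin n → PolyHK
  qvar j = var (ιq j)

  qprod : PolyHK
  qprod = foldr (λ j acc → qvar j *ₚ acc) 1ₚ (allFin n)

  HKGen : PolyHK → Set
  HKGen g = BorelGen ιY g ⊎ g ≡ qprod

  _≈_ : PolyHK → PolyHK → Set
  f ≈ g = InIdeal HKGen (f -ₚ g)

  embH : PolyH → PolyHK
  embH a = substₚ a (λ i → var (ιY i))

  embK : Poly n → PolyHK
  embK k = substₚ k qvar

  -- the classes y_i (i : Fin r stands for y_{i+1}) and x_k (k : Fin n for x_{k+1})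
  y : Fin r → PolyHK
  y i = var (ιY i)

  x : Fin n → PolyHK
  x k = Xat ιY k

  q↦0 : PolyHK → PolyH
  q↦0 f = substₚ f (λ v → [ var , (λ _ → 0ₚ) ] (splitAt r v))

  degMon : Mon M → ℕ
  degMon e = sumY (V.take r e) ℕ.+ sumQ (V.drop r e)
    where
    sumY : {k : ℕ} → Vec ℕ k → ℕ
    sumY = V.foldr _ (λ a acc → 2 ℕ.* a ℕ.+ acc) 0
    sumQ : {k : ℕ} → Vec ℕ k → ℕ
    sumQ = V.foldr _ (λ a acc → 4 ℕ.* a ℕ.+ acc) 0

  IsHomogeneousPoly : PolyHK → ℕ → Set
  IsHomogeneousPoly f k = ∀ e → (coeff f e ≡ 0ℤ → Data.Empty.⊥) → degMon e ≡ k
    where import Data.Empty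

  IsHomogeneous : PolyHK → ℕ → Set
  IsHomogeneous f k = Σ PolyHK λ g → f ≈ g × IsHomogeneousPoly g k

  -- coefficient a_d ∈ H of q^d in an element Σ_d a_d q^d of H⊗K, with respect
  -- to the ℤ-basis {q^d : some d_j = 0} of K; it is 0 if all d_j ≥ 1 (q^d = 0 in K)
  coeffQ : Vec ℕ n → PolyHK → PolyH
  coeffQ d f =
    if anyZero d
    then concatMap (λ { (c , e) →
           if does (≡-dec ℕ._≟_ (V.drop r e) d) then (c , V.take r e) ∷ [] else [] }) f
    else []

  -- The properties (i)–(vii) of a product ⋆ on H⊗K (given on representatives,
  -- required to be well defined on classes).

  record IsQuantumProduct (_⋆_ : PolyHK → PolyHK → PolyHK) : Set where
    field
      well-defined : ∀ a a′ b b′ → a ≈ a′ → b ≈ b′ → (a ⋆ b) ≈ (a′ ⋆ b′)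
      additiveˡ : ∀ a b c → ((a +ₚ b) ⋆ c) ≈ ((a ⋆ c) +ₚ (b ⋆ c))
      additiveʳ : ∀ a b c → (a ⋆ (b +ₚ c)) ≈ ((a ⋆ b) +ₚ (a ⋆ c))
      K-linearˡ : ∀ (k : Poly n) a b → ((embK k *ₚ a) ⋆ b) ≈ (embK k *ₚ (a ⋆ b))
      K-linearʳ : ∀ (k : Poly n) a b → (a ⋆ (embK k *ₚ b)) ≈ (embK k *ₚ (a ⋆ b))
      graded : ∀ a b ka kb → IsHomogeneous a ka → IsHomogeneous b kb →
               IsHomogeneous (a ⋆ b) (ka ℕ.+ kb)
      deformation : ∀ (a b : PolyH) → q↦0 (embH a ⋆ embH b) ≈H (a *ₚ b)
      comm : ∀ a b → (a ⋆ b) ≈ (b ⋆ a)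
      assoc : ∀ a b c → ((a ⋆ b) ⋆ c) ≈ (a ⋆ (b ⋆ c))
      relation :
        (sumₚ (concatMap (λ i → concatMap (λ j →
             if does (toℕ i ℕ.<? toℕ j) then (x i ⋆ x j) ∷ [] else [])
           (allFin n)) (allFin n))
         +ₚ sumₚ (map qvar (allFin n))) ≈ 0ₚ
      -- (vii) (d_i - d_n)(y_j ⋆ a)_d = (d_j - d_n)(y_i ⋆ a)_d
      --   (i : Fin r stands for index i+1, so d_{i+1} = at d (toℕ i); d_n = at d (n ∸ 1))
      coefficients : ∀ (d : Vec ℕ n) (a : PolyH) (i j : Fin r) →
        (((+ at d (toℕ i)) ℤ.- (+ at d (n ∸ 1))) ·ₚ coeffQ d (y j ⋆ embH a))
          ≈H
        (((+ at d (toℕ j)) ℤ.- (+ at d (n ∸ 1))) ·ₚ coeffQ d (y i ⋆ embH a))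

{-# OPTIONS --safe #-}

-- Existence.  The divided differences ∂ i act on H ⊗ K, with i read modulo n.  For the cyclic
-- interval [k, l) put V k l = q_k ⋯ q_{l−1} · ∂_{l−1} ⋯ ∂_{k+1} ∂_k ∂_{k+1} ⋯ ∂_{l−1}.  The nil-Hecke
-- relations together with q_1 ⋯ q_n = 0 imply that the operators
-- 𝒳 k = x_k + Σ_l (V k l − V l k) commute.  They agree with x_k up to terms of lower degree in the y,
-- so 1 is a cyclic vector and every f is L 1 for a unique operator L commuting with all 𝒳 k;
-- composing these operators gives ⋆.
--
-- Uniqueness.  For a product ∗ satisfying (i)–(vii) one shows x_k ∗ f = 𝒳 k f by induction on the
-- degree of f in the y.  The defect E i j = x_i ∗ (x_j ∗ f) − 𝒳 i (𝒳 j f) is symmetric in i and j, and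
-- by (vii) its coefficients at q^d satisfy u_m E l j = u_l E m j with u_m = d_m − d_{m−1}.  Hence
-- e₂(u) E l m = u_l u_m Σ_{i<j} E i j, which vanishes by (vi).  Since Σ u_m = 0, the scalar
-- e₂(u) = −½ Σ u_m² is nonzero unless d is constant, that is d = 0 (some d_j is 0 in K), where
-- ∗ is the cup product.  As H is torsion-free, E = 0.

module Submission where

open import Defs
open import Algebra.Bundles using (Ring; CommutativeRing)
import Algebra.Properties.CommutativeMonoid.Sum as MonoidSum
import Algebra.Properties.Ring as RingProps
open import Algebra.Structures using (IsCommutativeRing)
open import Data.Bool using (Bool; true; false; if_then_else_; not; _∧_; _xor_)
open import Data.Empty using (⊥; ⊥-elim)
open import Data.Fin as F using (Fin; toℕ; fromℕ<; splitAt; _↑ˡ_; _↑ʳ_)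
open import Data.Fin.Permutation as Perm using (Permutation; _⟨$⟩ʳ_; _⟨$⟩ˡ_; flip)
import Data.Fin.Permutation.Components as PC
import Data.Fin.Permutation.Transposition.List as TL
import Data.Fin.Properties as FP
open import Data.Integer as ℤ using (ℤ; +_; -[1+_]; 0ℤ; 1ℤ; -1ℤ)
import Data.Integer.Properties as ℤP
open import Data.Integer.Tactic.RingSolver using (solve-∀)
open import Data.List as L using (List; []; _∷_; length; allFin)
open import Data.List.Relation.Unary.All as All using (All; []; _∷_)
import Data.List.Relation.Unary.All.Properties as AllP
open import Data.Maybe using (Maybe; just; nothing)
open import Data.Nat as ℕ using (ℕ; zero; suc; _∸_; z≤n; s≤s; _≤_; _<_)
import Data.Nat.DivMod as DM
import Data.Nat.Properties as ℕP
open import Data.Product using (Σ; _×_; _,_; proj₁; proj₂)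
open import Data.Sum as Sum using (_⊎_; inj₁; inj₂; [_,_]′)
open import Data.Vec as V using (Vec; []; _∷_; lookup; tabulate; replicate; zipWith; take; drop)
import Data.Vec.Properties as VP
open import Function using (_∘_)
open import Level using (Level; 0ℓ; _⊔_)
open import Relation.Binary.Definitions using (tri<; tri≈; tri>)
open import Relation.Binary.PropositionalEquality as ≡ using (_≡_; _≢_; cong; cong₂; subst; module ≡-Reasoning)
import Relation.Binary.Reasoning.Setoid as SetoidReasoning
open import Relation.Nullary using (Dec; does; yes; no; ¬_)
open import Relation.Nullary.Decidable using (dec-true; dec-false)

-- When the last `q` is 0, only the intervals with k < l survive, and `𝒳 k` is the operator by which
-- Fomin, Gelfand and Postnikov quantise x_k; the formula here is its cyclic version. Two arcs that
-- together cover the circle have product 0 because q_1 ⋯ q_n = 0, so every remaining computation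
-- takes place in less than one period, where only relations of a finite nil-Hecke algebra occur.
-- These relations come from a rigidity principle: an operator that kills 1 and can be moved past
-- every x_k is 0. None of (i)-(vii) says that 1 is a unit for ∗. The law 1 ∗ f = f is therefore
-- proved in the same induction as x_k ∗ f = `𝒳 k` f; the degree bounds 0 and 2 < 4 start it. Since
-- (vii) speaks of products with classes of H only, that induction runs over elements free of q.
-- Torsion-freeness of H is not visible in the Borel presentation. Averaging over the symmetric
-- group would need denominators, so an integral symmetrizer built from divided differences takes
-- its place: a torsion class killed by all ∂ equals a symmetric polynomial without constant term.

infixl 6 _⊕_ _⊖_
infixl 7 _⊗_
infix 8 ⊝_

-- Deciding ring identities by normal forms

data Expr (k : ℕ) : Set where
  var′ : Fin k → Expr k
  𝟘 𝟙 : Expr k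
  _⊕_ _⊗_ : Expr k → Expr k → Expr k
  ⊝_ : Expr k → Expr k

_⊖_ : ∀ {k} → Expr k → Expr k → Expr k
a ⊖ b = a ⊕ ⊝ b

Word : ℕ → Set
Word k = List (Fin k)

-- A normal form is a list of signed words in which no word occurs with both
-- signs; an identity is decided by normalising lhs − rhs to the empty list.
Signed : ℕ → Set
Signed k = Bool × Word k

eqWord : ∀ {k} (u w : Word k) → Bool
eqWord [] [] = true
eqWord (i ∷ u) (j ∷ w) with i F.≟ j
... | yes _ = eqWord u w
... | no _ = false
eqWord _ _ = false

eqWord-sound : ∀ {k} (u w : Word k) → eqWord u w ≡ true → u ≡ w
eqWord-sound [] [] _ = ≡.refl
eqWord-sound (i ∷ u) (j ∷ w) p with i F.≟ j
... | yes ≡.refl = ≡.cong (i ∷_) (eqWord-sound u w p)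
eqWord-sound (i ∷ u) (j ∷ w) () | no _
eqWord-sound [] (_ ∷ _) ()
eqWord-sound (_ ∷ _) [] ()

-- `canon` is the identity for arbitrary rings and sorts the letters for commutative ones;
-- everything else is shared. Multiplicities are unary: a coefficient 3 is three copies of the word.
module Normalise (canon : ∀ {k} → Word k → Word k) where

  insertTerm : ∀ {k} → Signed k → List (Signed k) → List (Signed k)
  insertTerm t [] = t ∷ []
  insertTerm (s , u) ((s′ , w) ∷ l) =
    if (s xor s′) ∧ eqWord u w then l else (s′ , w) ∷ insertTerm (s , u) l

  merge : ∀ {k} → List (Signed k) → List (Signed k) → List (Signed k)
  merge l l′ = L.foldr insertTerm l′ l

  scale : ∀ {k} → Signed k → List (Signed k) → List (Signed k)
  scale (s , u) = L.map λ { (s′ , w) → s xor s′ , canon (u L.++ w) }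

  norm : ∀ {k} → Expr k → List (Signed k)
  norm (var′ i) = (false , i ∷ []) ∷ []
  norm 𝟘 = []
  norm 𝟙 = (false , []) ∷ []
  norm (a ⊕ b) = merge (norm a) (norm b)
  norm (a ⊗ b) = L.foldr (λ t → merge (scale t (norm b))) [] (norm a)
  norm (⊝ a) = L.map (λ { (s , u) → not s , u }) (norm a)

module Solve {c ℓ} (R : Ring c ℓ) where
  open Ring R
  open RingProps R using (-‿distribˡ-*; -‿distribʳ-*; -‿involutive; -‿+-comm; -0#≈0#)
  open SetoidReasoning setoid

  ⟦_⟧ : ∀ {k} → Expr k → Vec Carrier k → Carrier
  ⟦ var′ i ⟧ ρ = V.lookup ρ i
  ⟦ 𝟘 ⟧ ρ = 0#
  ⟦ 𝟙 ⟧ ρ = 1#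
  ⟦ a ⊕ b ⟧ ρ = ⟦ a ⟧ ρ + ⟦ b ⟧ ρ
  ⟦ a ⊗ b ⟧ ρ = ⟦ a ⟧ ρ * ⟦ b ⟧ ρ
  ⟦ ⊝ a ⟧ ρ = - ⟦ a ⟧ ρ

  word : ∀ {k} → Vec Carrier k → Word k → Carrier
  word ρ = L.foldr (λ i → V.lookup ρ i *_) 1#

  signed : Bool → Carrier → Carrier
  signed false x = x
  signed true x = - x

  signed-cong : ∀ s {x y} → x ≈ y → signed s x ≈ signed s y
  signed-cong false p = p
  signed-cong true p = -‿cong p

  signed-xor : ∀ s s′ x y → signed s x * signed s′ y ≈ signed (s xor s′) (x * y)
  signed-xor false false x y = refl
  signed-xor false true x y = sym (-‿distribʳ-* x y)
  signed-xor true false x y = sym (-‿distribˡ-* x y)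
  signed-xor true true x y =
    trans (sym (-‿distribˡ-* x (- y))) (trans (-‿cong (sym (-‿distribʳ-* x y))) (-‿involutive _))

  signed-not : ∀ s x → signed (not s) x ≈ - signed s x
  signed-not false x = refl
  signed-not true x = sym (-‿involutive x)

  signed-opposite : ∀ s s′ x → (s xor s′) ≡ true → signed s x + signed s′ x ≈ 0#
  signed-opposite false true x _ = -‿inverseʳ x
  signed-opposite true false x _ = -‿inverseˡ x

  term : ∀ {k} → Vec Carrier k → Signed k → Carrier
  term ρ (s , w) = signed s (word ρ w)

  total : ∀ {k} → Vec Carrier k → List (Signed k) → Carrier
  total ρ = L.foldr (λ t s → term ρ t + s) 0#

  word-++ : ∀ {k} (ρ : Vec Carrier k) u w → word ρ (u L.++ w) ≈ word ρ u * word ρ w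
  word-++ ρ [] w = sym (*-identityˡ _)
  word-++ ρ (i ∷ u) w = trans (*-congˡ (word-++ ρ u w)) (sym (*-assoc _ _ _))

  module Sound (canon : ∀ {k} → Word k → Word k)
               (canon-word : ∀ {k} (ρ : Vec Carrier k) w → word ρ (canon w) ≈ word ρ w) where
    open Normalise canon

    insertTerm-total : ∀ {k} (ρ : Vec Carrier k) t l → total ρ (insertTerm t l) ≈ term ρ t + total ρ l
    insertTerm-total ρ t [] = refl
    insertTerm-total ρ (s , u) ((s′ , w) ∷ l) with (s xor s′) in p | eqWord u w in q
    ... | true | true = begin
      total ρ l ≈⟨ +-identityˡ _ ⟨
      0# + total ρ l ≈⟨ +-congʳ (signed-opposite s s′ (word ρ w) p) ⟨
      (signed s (word ρ w) + signed s′ (word ρ w)) + total ρ l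
        ≡⟨ ≡.cong (λ v → (signed s (word ρ v) + signed s′ (word ρ w)) + total ρ l) (eqWord-sound u w q) ⟨
      (signed s (word ρ u) + signed s′ (word ρ w)) + total ρ l ≈⟨ +-assoc _ _ _ ⟩
      _ ∎
    ... | true | false = trans (+-congˡ (insertTerm-total ρ (s , u) l)) (x∙yz≈y∙xz′ _ _ _)
      where
      x∙yz≈y∙xz′ : ∀ x y z → x + (y + z) ≈ y + (x + z)
      x∙yz≈y∙xz′ x y z = trans (sym (+-assoc x y z)) (trans (+-congʳ (+-comm x y)) (+-assoc y x z))
    ... | false | _ = trans (+-congˡ (insertTerm-total ρ (s , u) l)) (x∙yz≈y∙xz′ _ _ _)
      where
      x∙yz≈y∙xz′ : ∀ x y z → x + (y + z) ≈ y + (x + z)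
      x∙yz≈y∙xz′ x y z = trans (sym (+-assoc x y z)) (trans (+-congʳ (+-comm x y)) (+-assoc y x z))

    merge-total : ∀ {k} (ρ : Vec Carrier k) l l′ → total ρ (merge l l′) ≈ total ρ l + total ρ l′
    merge-total ρ [] l′ = sym (+-identityˡ _)
    merge-total ρ (t ∷ l) l′ =
      trans (insertTerm-total ρ t (merge l l′)) (trans (+-congˡ (merge-total ρ l l′)) (sym (+-assoc _ _ _)))

    scale-total : ∀ {k} (ρ : Vec Carrier k) t l → total ρ (scale t l) ≈ term ρ t * total ρ l
    scale-total ρ t [] = sym (zeroʳ _)
    scale-total ρ (s , u) ((s′ , w) ∷ l) = begin
      signed (s xor s′) (word ρ (canon (u L.++ w))) + total ρ (scale (s , u) l)
        ≈⟨ +-cong (signed-cong (s xor s′) (trans (canon-word ρ (u L.++ w)) (word-++ ρ u w))) (scale-total ρ (s , u) l) ⟩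
      signed (s xor s′) (word ρ u * word ρ w) + term ρ (s , u) * total ρ l
        ≈⟨ +-congʳ (signed-xor s s′ _ _) ⟨
      term ρ (s , u) * term ρ (s′ , w) + term ρ (s , u) * total ρ l ≈⟨ distribˡ _ _ _ ⟨
      _ ∎

    norm-sound : ∀ {k} (ρ : Vec Carrier k) a → total ρ (norm a) ≈ ⟦ a ⟧ ρ
    norm-sound ρ (var′ i) = trans (+-identityʳ _) (*-identityʳ _)
    norm-sound ρ 𝟘 = refl
    norm-sound ρ 𝟙 = +-identityʳ _
    norm-sound ρ (a ⊕ b) =
      trans (merge-total ρ (norm a) (norm b)) (+-cong (norm-sound ρ a) (norm-sound ρ b))
    norm-sound ρ (a ⊗ b) = trans (product (norm a)) (*-cong (norm-sound ρ a) (norm-sound ρ b))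
      where
      product : ∀ l → total ρ (L.foldr (λ t → merge (scale t (norm b))) [] l) ≈ total ρ l * total ρ (norm b)
      product [] = sym (zeroˡ _)
      product (t ∷ l) = begin
        _ ≈⟨ merge-total ρ (scale t (norm b)) _ ⟩
        _ ≈⟨ +-cong (scale-total ρ t (norm b)) (product l) ⟩
        _ ≈⟨ distribʳ _ _ _ ⟨
        _ ∎
    norm-sound ρ (⊝ a) = trans (negate (norm a)) (-‿cong (norm-sound ρ a))
      where
      negate : ∀ l → total ρ (L.map (λ { (s , u) → not s , u }) l) ≈ - total ρ l
      negate [] = sym -0#≈0#
      negate ((s , u) ∷ l) = trans (+-cong (signed-not s _) (negate l)) (-‿+-comm _ _)

    variables : ∀ k → Vec (Expr k) k
    variables k = V.tabulate var′

    -- The normal form depends on the two expressions and not on `ρ`, so for closed expressions the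
    -- premise evaluates and is proved by `refl`.
    solve : ∀ {k} (f : Vec (Expr k) k → Expr k × Expr k) (ρ : Vec Carrier k) →
            norm (proj₁ (f (variables k)) ⊖ proj₂ (f (variables k))) ≡ [] →
            ⟦ proj₁ (f (variables k)) ⟧ ρ ≈ ⟦ proj₂ (f (variables k)) ⟧ ρ
    solve {k} f ρ p = begin
      x ≈⟨ +-identityʳ x ⟨
      x + 0# ≈⟨ +-congˡ (-‿inverseˡ y) ⟨
      x + (- y + y) ≈⟨ +-assoc _ _ _ ⟨
      (x + - y) + y ≈⟨ +-congʳ (norm-sound ρ (a ⊖ b)) ⟨
      total ρ (norm (a ⊖ b)) + y ≡⟨ ≡.cong (λ l → total ρ l + y) p ⟩
      0# + y ≈⟨ +-identityˡ _ ⟩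
      y ∎
      where
      a = proj₁ (f (variables k))
      b = proj₂ (f (variables k))
      x = ⟦ a ⟧ ρ
      y = ⟦ b ⟧ ρ

  open Sound (λ w → w) (λ _ _ → refl) public using (solve)

module CommutativeSolve {c ℓ} (A : CommutativeRing c ℓ) where
  open CommutativeRing A
  open Solve ring using (word; module Sound)

  insert : ∀ {k} → Fin k → Word k → Word k
  insert i [] = i ∷ []
  insert i (j ∷ w) with F.toℕ i ℕ.≤ᵇ F.toℕ j
  ... | true = i ∷ j ∷ w
  ... | false = j ∷ insert i w

  sort : ∀ {k} → Word k → Word k
  sort = L.foldr insert []

  insert-word : ∀ {k} (ρ : Vec Carrier k) i w → word ρ (insert i w) ≈ V.lookup ρ i * word ρ w
  insert-word ρ i [] = refl
  insert-word ρ i (j ∷ w) with F.toℕ i ℕ.≤ᵇ F.toℕ j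
  ... | true = refl
  ... | false = trans (*-congˡ (insert-word ρ i w)) (trans (sym (*-assoc _ _ _))
                  (trans (*-congʳ (*-comm _ _)) (*-assoc _ _ _)))

  sort-word : ∀ {k} (ρ : Vec Carrier k) w → word ρ (sort w) ≈ word ρ w
  sort-word ρ [] = refl
  sort-word ρ (i ∷ w) = trans (insert-word ρ i (sort w)) (*-congˡ (sort-word ρ w))

  open Sound sort sort-word public using (solve)

-- The polynomial ring on lists of terms

infix 4 _≃_
-- `_≈ₚ_` unfolds to a function type in which `f` and `g` occur only under `coeff`; the record keeps
-- them inferable.
record _≃_ {m : ℕ} (f g : Poly m) : Set where
  constructor mk≃
  field coeffs : f ≈ₚ g
open _≃_ public

infixl 6 _+ᵐ_
_+ᵐ_ : ∀ {m} → Mon m → Mon m → Mon m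
_+ᵐ_ = zipWith ℕ._+_

0ᵐ : ∀ {m} → Mon m
0ᵐ {m} = replicate m 0

unit : ∀ {m} → Fin m → Mon m
unit i = tabulate (λ j → if does (i F.≟ j) then 1 else 0)

+ᵐ-identityˡ : ∀ {m} (e : Mon m) → 0ᵐ +ᵐ e ≡ e
+ᵐ-identityˡ [] = ≡.refl
+ᵐ-identityˡ (a ∷ e) = cong (a ∷_) (+ᵐ-identityˡ e)

+ᵐ-comm : ∀ {m} (e e′ : Mon m) → e +ᵐ e′ ≡ e′ +ᵐ e
+ᵐ-comm = VP.zipWith-comm ℕP.+-comm

+ᵐ-assoc : ∀ {m} (a b c : Mon m) → (a +ᵐ b) +ᵐ c ≡ a +ᵐ (b +ᵐ c)
+ᵐ-assoc = VP.zipWith-assoc ℕP.+-assoc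

-- The linear functional on polynomials with prescribed values `φ` on monomials. Identities between
-- polynomials are tested on all functionals: products become iterated functionals, and the order of
-- the terms no longer matters.
ext : ∀ {m} → (Mon m → ℤ) → Poly m → ℤ
ext φ [] = 0ℤ
ext φ ((c , e) ∷ f) = c ℤ.* φ e ℤ.+ ext φ f

_≟ᵐ_ : ∀ {m} (e e′ : Mon m) → Dec (e ≡ e′)
_≟ᵐ_ = VP.≡-dec ℕ._≟_

δ : ∀ {m} → Mon m → Mon m → ℤ
δ x e = if does (e ≟ᵐ x) then 1ℤ else 0ℤ

coeff-ext : ∀ {m} (f : Poly m) x → coeff f x ≡ ext (δ x) f
coeff-ext [] x = ≡.refl
coeff-ext ((c , e) ∷ f) x with e ≟ᵐ x
... | yes _ = cong₂ ℤ._+_ (≡.sym (ℤP.*-identityʳ c)) (coeff-ext f x)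
... | no _ = ≡.trans (≡.trans (coeff-ext f x) (≡.sym (ℤP.+-identityˡ _))) (cong (ℤ._+ _) (≡.sym (ℤP.*-zeroʳ c)))

ext-cong : ∀ {m} {φ ψ : Mon m → ℤ} → (∀ e → φ e ≡ ψ e) → ∀ f → ext φ f ≡ ext ψ f
ext-cong p [] = ≡.refl
ext-cong p ((c , e) ∷ f) = cong₂ (λ u v → c ℤ.* u ℤ.+ v) (p e) (ext-cong p f)

ext-++ : ∀ {m} (φ : Mon m → ℤ) f g → ext φ (f +ₚ g) ≡ ext φ f ℤ.+ ext φ g
ext-++ φ [] g = ≡.sym (ℤP.+-identityˡ _)
ext-++ φ ((c , e) ∷ f) g =
  ≡.trans (cong (ℤ._+_ (c ℤ.* φ e)) (ext-++ φ f g)) (≡.sym (ℤP.+-assoc (c ℤ.* φ e) _ _))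

ext-neg : ∀ {m} (φ : Mon m → ℤ) f → ext φ (-ₚ f) ≡ ℤ.- ext φ f
ext-neg φ [] = ≡.refl
ext-neg φ ((c , e) ∷ f) = ≡.trans (cong (ℤ._+_ (ℤ.- c ℤ.* φ e)) (ext-neg φ f)) (lemma c (φ e) (ext φ f))
  where
  lemma : ∀ a b x → ℤ.- a ℤ.* b ℤ.+ ℤ.- x ≡ ℤ.- (a ℤ.* b ℤ.+ x)
  lemma = solve-∀

ext-0 : ∀ {m} (f : Poly m) → ext (λ _ → 0ℤ) f ≡ 0ℤ
ext-0 [] = ≡.refl
ext-0 ((c , e) ∷ f) = ≡.trans (cong₂ ℤ._+_ (ℤP.*-zeroʳ c) (ext-0 f)) ≡.refl

ext-*ˡ : ∀ {m} k (φ : Mon m → ℤ) f → ext (λ e → k ℤ.* φ e) f ≡ k ℤ.* ext φ f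
ext-*ˡ k φ [] = ≡.sym (ℤP.*-zeroʳ k)
ext-*ˡ k φ ((c , e) ∷ f) = ≡.trans (cong (ℤ._+_ (c ℤ.* (k ℤ.* φ e))) (ext-*ˡ k φ f)) (lemma c k (φ e) (ext φ f))
  where
  lemma : ∀ a b x y → a ℤ.* (b ℤ.* x) ℤ.+ b ℤ.* y ≡ b ℤ.* (a ℤ.* x ℤ.+ y)
  lemma = solve-∀

ext-+ : ∀ {m} (φ ψ : Mon m → ℤ) f → ext (λ e → φ e ℤ.+ ψ e) f ≡ ext φ f ℤ.+ ext ψ f
ext-+ φ ψ [] = ≡.refl
ext-+ φ ψ ((c , e) ∷ f) =
  ≡.trans (cong (ℤ._+_ (c ℤ.* (φ e ℤ.+ ψ e))) (ext-+ φ ψ f)) (lemma c (φ e) (ψ e) (ext φ f) (ext ψ f))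
  where
  lemma : ∀ c x y a b → c ℤ.* (x ℤ.+ y) ℤ.+ (a ℤ.+ b) ≡ (c ℤ.* x ℤ.+ a) ℤ.+ (c ℤ.* y ℤ.+ b)
  lemma = solve-∀

-- Exchange of two finite sums; commutativity of the product and multiplicativity of substitution
-- rest on it.
ext-swap : ∀ {m k} (ψ : Mon m → Mon k → ℤ) f g →
           ext (λ a → ext (ψ a) g) f ≡ ext (λ b → ext (λ a → ψ a b) f) g
ext-swap ψ [] g = ≡.sym (ext-0 g)
ext-swap ψ ((c , e) ∷ f) g = begin
  c ℤ.* ext (ψ e) g ℤ.+ ext (λ a → ext (ψ a) g) f
    ≡⟨ cong₂ ℤ._+_ (≡.sym (ext-*ˡ c (ψ e) g)) (ext-swap ψ f g) ⟩
  ext (λ b → c ℤ.* ψ e b) g ℤ.+ ext (λ b → ext (λ a → ψ a b) f) g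
    ≡⟨ ≡.sym (ext-+ _ _ g) ⟩
  _ ∎
  where open ≡-Reasoning

remove : ∀ {m} → Mon m → Poly m → Poly m
remove x [] = []
remove x ((c , e) ∷ f) = if does (e ≟ᵐ x) then remove x f else (c , e) ∷ remove x f

length-remove : ∀ {m} x (f : Poly m) → length (remove x f) ℕ.≤ length f
length-remove x [] = z≤n
length-remove x ((c , e) ∷ f) with e ≟ᵐ x
... | yes _ = ℕP.m≤n⇒m≤1+n (length-remove x f)
... | no _ = s≤s (length-remove x f)

ext-remove : ∀ {m} (φ : Mon m → ℤ) x f → ext φ f ≡ coeff f x ℤ.* φ x ℤ.+ ext φ (remove x f)
ext-remove φ x [] = ≡.refl
ext-remove φ x ((c , e) ∷ f) with e ≟ᵐ x
... | yes ≡.refl = ≡.trans (cong (ℤ._+_ (c ℤ.* φ e)) (ext-remove φ x f)) (lemma c (φ e) (coeff f e) (ext φ (remove e f)))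
  where
  lemma : ∀ c y d r → c ℤ.* y ℤ.+ (d ℤ.* y ℤ.+ r) ≡ (c ℤ.+ d) ℤ.* y ℤ.+ r
  lemma = solve-∀
... | no _ = ≡.trans (cong (ℤ._+_ (c ℤ.* φ e)) (ext-remove φ x f)) (lemma c (φ e) (coeff f x) (φ x) (ext φ (remove x f)))
  where
  lemma : ∀ c y d z r → c ℤ.* y ℤ.+ (d ℤ.* z ℤ.+ r) ≡ d ℤ.* z ℤ.+ (c ℤ.* y ℤ.+ r)
  lemma = solve-∀

coeff-remove-≢ : ∀ {m} x y (f : Poly m) → x ≢ y → coeff (remove x f) y ≡ coeff f y
coeff-remove-≢ x y [] _ = ≡.refl
coeff-remove-≢ x y ((c , e) ∷ f) x≢y with e ≟ᵐ x
coeff-remove-≢ x y ((c , e) ∷ f) x≢y | yes ≡.refl with e ≟ᵐ y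
... | yes ≡.refl = ⊥-elim (x≢y ≡.refl)
... | no _ = coeff-remove-≢ e y f x≢y
coeff-remove-≢ x y ((c , e) ∷ f) x≢y | no _ with e ≟ᵐ y
... | yes _ = cong (ℤ._+_ c) (coeff-remove-≢ x y f x≢y)
... | no _ = coeff-remove-≢ x y f x≢y

coeff-remove-≡ : ∀ {m} x (f : Poly m) → coeff (remove x f) x ≡ 0ℤ
coeff-remove-≡ x [] = ≡.refl
coeff-remove-≡ x ((c , e) ∷ f) with e ≟ᵐ x in eq
... | yes _ = coeff-remove-≡ x f
... | no _ rewrite eq = coeff-remove-≡ x f

-- Removing every term that carries the monomial of the head costs only the coefficient there, which
-- is 0, and leaves a shorter list, not a sublist given by the tail. Hence the induction on a bound
-- for the length.
ext-vanish : ∀ {m} (φ : Mon m → ℤ) k (f : Poly m) → length f ℕ.≤ k → (∀ e → coeff f e ≡ 0ℤ) → ext φ f ≡ 0ℤ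
ext-vanish φ k [] _ _ = ≡.refl
ext-vanish φ (suc k) f@((c , x) ∷ f′) (s≤s l) p = begin
  ext φ f ≡⟨ ext-remove φ x f ⟩
  coeff f x ℤ.* φ x ℤ.+ ext φ (remove x f)
    ≡⟨ cong₂ ℤ._+_ (≡.trans (cong (ℤ._* φ x) (p x)) (ℤP.*-zeroˡ (φ x))) (ext-vanish φ k (remove x f) len zeros) ⟩
  0ℤ ∎
  where
  open ≡-Reasoning
  len : length (remove x f) ℕ.≤ k
  len with x ≟ᵐ x
  ... | yes _ = ℕP.≤-trans (length-remove x f′) l
  ... | no ¬p = ⊥-elim (¬p ≡.refl)
  zeros : ∀ e → coeff (remove x f) e ≡ 0ℤ
  zeros e with x ≟ᵐ e
  ... | yes ≡.refl = coeff-remove-≡ x f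
  ... | no x≢e = ≡.trans (coeff-remove-≢ x e f x≢e) (p e)

coeff-+ : ∀ {m} (f g : Poly m) x → coeff (f +ₚ g) x ≡ coeff f x ℤ.+ coeff g x
coeff-+ f g x = ≡.trans (coeff-ext (f +ₚ g) x) (≡.trans (ext-++ (δ x) f g)
  (cong₂ ℤ._+_ (≡.sym (coeff-ext f x)) (≡.sym (coeff-ext g x))))

coeff-neg : ∀ {m} (f : Poly m) x → coeff (-ₚ f) x ≡ ℤ.- coeff f x
coeff-neg f x = ≡.trans (coeff-ext (-ₚ f) x) (≡.trans (ext-neg (δ x) f) (cong ℤ.-_ (≡.sym (coeff-ext f x))))

-- Coefficients are the functionals `δ x`; conversely the difference of `f` and `g` has zero
-- coefficients, so every functional kills it.
ext-resp : ∀ {m} {f g : Poly m} → f ≃ g → ∀ φ → ext φ f ≡ ext φ g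
ext-resp {f = f} {g} (mk≃ p) φ = ℤP.i-j≡0⇒i≡j (ext φ f) (ext φ g) (begin
  ext φ f ℤ.- ext φ g ≡⟨ cong (ℤ._+_ (ext φ f)) (≡.sym (ext-neg φ g)) ⟩
  ext φ f ℤ.+ ext φ (-ₚ g) ≡⟨ ≡.sym (ext-++ φ f (-ₚ g)) ⟩
  ext φ (f -ₚ g) ≡⟨ ext-vanish φ _ (f -ₚ g) ℕP.≤-refl (λ e → ≡.trans (coeff-+ f (-ₚ g) e)
     (≡.trans (cong₂ ℤ._+_ (p e) (coeff-neg g e)) (ℤP.+-inverseʳ (coeff g e)))) ⟩
  0ℤ ∎)
  where open ≡-Reasoning

ext-≃ : ∀ {m} {f g : Poly m} → (∀ φ → ext φ f ≡ ext φ g) → f ≃ g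
ext-≃ {f = f} {g} p = mk≃ λ e → ≡.trans (coeff-ext f e) (≡.trans (p (δ e)) (≡.sym (coeff-ext g e)))

ext-shift : ∀ {m} (φ : Mon m → ℤ) c e g →
            ext φ (L.map (λ { (c′ , e′) → (c ℤ.* c′ , zipWith ℕ._+_ e e′) }) g) ≡ c ℤ.* ext (λ e′ → φ (e +ᵐ e′)) g
ext-shift φ c e [] = ≡.sym (ℤP.*-zeroʳ c)
ext-shift φ c e ((c′ , e′) ∷ g) = ≡.trans (cong (ℤ._+_ (c ℤ.* c′ ℤ.* φ (e +ᵐ e′))) (ext-shift φ c e g))
  (lemma c c′ (φ (e +ᵐ e′)) (ext (λ e′ → φ (e +ᵐ e′)) g))
  where
  lemma : ∀ a b x y → a ℤ.* b ℤ.* x ℤ.+ a ℤ.* y ≡ a ℤ.* (b ℤ.* x ℤ.+ y)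
  lemma = solve-∀

ext-* : ∀ {m} (φ : Mon m → ℤ) f g → ext φ (f *ₚ g) ≡ ext (λ a → ext (λ b → φ (a +ᵐ b)) g) f
ext-* φ [] g = ≡.refl
ext-* φ ((c , e) ∷ f) g = ≡.trans (ext-++ φ (L.map _ g) (f *ₚ g)) (cong₂ ℤ._+_ (ext-shift φ c e g) (ext-* φ f g))

ext-const : ∀ {m} (φ : Mon m → ℤ) c → ext φ (constₚ c) ≡ c ℤ.* φ 0ᵐ
ext-const φ c = ℤP.+-identityʳ _

≃-refl : ∀ {m} {f : Poly m} → f ≃ f
≃-refl = mk≃ λ _ → ≡.refl

polyRing-isCommutativeRing : ∀ {m} → IsCommutativeRing (_≃_ {m}) _+ₚ_ _*ₚ_ -ₚ_ 0ₚ 1ₚ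
polyRing-isCommutativeRing {m} = record
  { isRing = record
    { +-isAbelianGroup = record
      { isGroup = record
        { isMonoid = record
          { isSemigroup = record
            { isMagma = record
              { isEquivalence = record
                { refl = ≃-refl
                ; sym = λ p → mk≃ λ e → ≡.sym (coeffs p e)
                ; trans = λ p q → mk≃ λ e → ≡.trans (coeffs p e) (coeffs q e) }
              ; ∙-cong = λ {f} {f′} {g} {g′} p q → ext-≃ λ φ → ≡.trans (ext-++ φ f g)
                  (≡.trans (cong₂ ℤ._+_ (ext-resp p φ) (ext-resp q φ)) (≡.sym (ext-++ φ f′ g′))) }
            ; assoc = λ f g h → ext-≃ λ φ → ≡.trans (ext-++ φ (f +ₚ g) h) (≡.trans (cong (ℤ._+ ext φ h) (ext-++ φ f g))
                (≡.trans (ℤP.+-assoc (ext φ f) _ _) (≡.sym (≡.trans (ext-++ φ f (g +ₚ h)) (cong (ℤ._+_ (ext φ f)) (ext-++ φ g h)))))) }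
          ; identity = (λ f → ≃-refl) , λ f → ext-≃ λ φ → ≡.trans (ext-++ φ f []) (ℤP.+-identityʳ _) }
        ; inverse = (λ f → ext-≃ λ φ → ≡.trans (ext-++ φ (-ₚ f) f) (≡.trans (cong (ℤ._+ ext φ f) (ext-neg φ f)) (ℤP.+-inverseˡ (ext φ f))))
                  , λ f → ext-≃ λ φ → ≡.trans (ext-++ φ f (-ₚ f)) (≡.trans (cong (ℤ._+_ (ext φ f)) (ext-neg φ f)) (ℤP.+-inverseʳ (ext φ f)))
        ; ⁻¹-cong = λ {f} {g} p → ext-≃ λ φ → ≡.trans (ext-neg φ f) (≡.trans (cong ℤ.-_ (ext-resp p φ)) (≡.sym (ext-neg φ g))) }
      ; comm = λ f g → ext-≃ λ φ → ≡.trans (ext-++ φ f g) (≡.trans (ℤP.+-comm (ext φ f) _) (≡.sym (ext-++ φ g f))) }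
    ; *-cong = λ {f} {f′} {g} {g′} p q → ext-≃ λ φ → ≡.trans (ext-* φ f g)
        (≡.trans (ext-cong (λ a → ext-resp q _) f) (≡.trans (ext-resp p _) (≡.sym (ext-* φ f′ g′))))
    ; *-assoc = λ f g h → ext-≃ λ φ → ≡.trans (ext-* φ (f *ₚ g) h) (≡.trans (ext-* _ f g)
        (≡.trans (ext-cong (λ a → ≡.trans (ext-cong (λ b → ext-cong (λ c → cong φ (+ᵐ-assoc a b c)) h) g)
           (≡.sym (ext-* (λ e → φ (a +ᵐ e)) g h))) f) (≡.sym (ext-* φ f (g *ₚ h)))))
    ; *-identity = identityˡ
                 , λ f → ext-≃ λ φ → ≡.trans (*-comm′ f 1ₚ φ) (ext-resp (identityˡ f) φ)
    ; distrib = (λ f g h → ext-≃ λ φ → ≡.trans (*-comm′ f (g +ₚ h) φ) (≡.trans (distribʳ′ φ f g h)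
                  (≡.trans (cong₂ ℤ._+_ (*-comm′ g f φ) (*-comm′ h f φ)) (≡.sym (ext-++ φ (f *ₚ g) (f *ₚ h))))))
              , λ f g h → ext-≃ λ φ → ≡.trans (distribʳ′ φ f g h) (≡.sym (ext-++ φ (g *ₚ f) (h *ₚ f))) }
  ; *-comm = λ f g → ext-≃ (*-comm′ f g) }
  where
  identityˡ : ∀ f → 1ₚ *ₚ f ≃ f
  identityˡ f = ext-≃ λ φ → ≡.trans (ext-* φ 1ₚ f) (≡.trans (ext-const {m} (λ a → ext (λ b → φ (a +ᵐ b)) f) 1ℤ)
    (≡.trans (ℤP.*-identityˡ _) (ext-cong (λ e → cong φ (+ᵐ-identityˡ e)) f)))
  *-comm′ : ∀ f g φ → ext φ (f *ₚ g) ≡ ext φ (g *ₚ f)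
  *-comm′ f g φ = ≡.trans (ext-* φ f g) (≡.trans (ext-swap (λ a b → φ (a +ᵐ b)) f g)
    (≡.trans (ext-cong (λ b → ext-cong (λ a → cong φ (+ᵐ-comm a b)) f) g) (≡.sym (ext-* φ g f))))
  distribʳ′ : ∀ φ f g h → ext φ ((g +ₚ h) *ₚ f) ≡ ext φ (g *ₚ f) ℤ.+ ext φ (h *ₚ f)
  distribʳ′ φ f g h = ≡.trans (ext-* φ (g +ₚ h) f) (≡.trans (ext-++ _ g h)
    (cong₂ ℤ._+_ (≡.sym (ext-* φ g f)) (≡.sym (ext-* φ h f))))

-- The operations are sealed so that unification treats them as rigid symbols.
infixl 6 _+′_ _-′_
infixl 7 _*′_
infix 8 -′_
infix 9 _[_]

opaque
  _+′_ _*′_ : ∀ {m} → Poly m → Poly m → Poly m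
  _+′_ = _+ₚ_
  _*′_ = _*ₚ_

  -′_ : ∀ {m} → Poly m → Poly m
  -′_ = -ₚ_

  0′ 1′ : ∀ {m} → Poly m
  0′ = 0ₚ
  1′ = 1ₚ

  κ : ∀ {m} → ℤ → Poly m
  κ = constₚ

  X : ∀ {m} → Fin m → Poly m
  X = var

  _[_] : ∀ {m k} → Poly m → (Fin m → Poly k) → Poly k
  f [ σ ] = substₚ f σ

  mono : ∀ {m} → ℤ → Mon m → Poly m
  mono c e = (c , e) ∷ []

_-′_ : ∀ {m} → Poly m → Poly m → Poly m
f -′ g = f +′ -′ g

opaque
  unfolding _+′_ -′_ 0′

  isCommutativeRing′ : ∀ {m} → IsCommutativeRing (_≃_ {m}) _+′_ _*′_ -′_ 0′ 1′
  isCommutativeRing′ = polyRing-isCommutativeRing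

polyRing : ℕ → CommutativeRing 0ℓ 0ℓ
polyRing m = record { isCommutativeRing = isCommutativeRing′ {m} }

module P {m : ℕ} = CommutativeRing (polyRing m)
module PP {m : ℕ} = RingProps (P.ring {m})
module PR {m : ℕ} = SetoidReasoning (P.setoid {m})
module PS {m : ℕ} = CommutativeSolve (polyRing m)

-- Induction on polynomials and substitution

unit-+-mono : ∀ {m} (e : Mon m) → V.tabulate {n = m} (λ _ → 0) +ᵐ e ≡ e
unit-+-mono [] = ≡.refl
unit-+-mono (a ∷ e) = cong (a ∷_) (unit-+-mono e)

mon-ind : ∀ {ℓ m} (Q : Mon m → Set ℓ) → Q 0ᵐ → (∀ v e → Q e → Q (unit v +ᵐ e)) → ∀ e → Q e
mon-ind Q q₀ q₊ [] = q₀
mon-ind {m = suc m} Q q₀ q₊ (a ∷ e) = head a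
  where
  head : ∀ a → Q (a ∷ e)
  head zero = mon-ind (λ e → Q (0 ∷ e)) q₀ (λ v e → q₊ (F.suc v) (0 ∷ e)) e
  -- The tail of `unit F.zero` evaluates to a tabulated zero vector, which has to be absorbed into
  -- `e` by hand.
  head (suc a) = subst (λ e′ → Q (suc a ∷ e′)) (unit-+-mono e) (q₊ F.zero (a ∷ e) (head a))

opaque
  unfolding κ X mono 0′

  mono-0ᵐ : ∀ {m} c → mono {m} c 0ᵐ ≡ κ c
  mono-0ᵐ c = ≡.refl

  mono-* : ∀ {m} a b (e e′ : Mon m) → mono a e *′ mono b e′ ≡ mono (a ℤ.* b) (e +ᵐ e′)
  mono-* a b e e′ = ≡.refl

  X-mono : ∀ {m} (v : Fin m) → X v ≡ mono 1ℤ (unit v)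
  X-mono v = ≡.refl

  κ-1 : ∀ {m} → κ {m} 1ℤ ≡ 1′
  κ-1 = ≡.refl

  []≡0 : ∀ {m} → [] ≡ 0′ {m}
  []≡0 = ≡.refl

  ∷≡+ : ∀ {m} c e (f : Poly m) → (c , e) ∷ f ≡ mono c e +′ f
  ∷≡+ c e f = ≡.refl

  ext-mono : ∀ {m} φ c (e : Mon m) → ext φ (mono c e) ≡ c ℤ.* φ e
  ext-mono φ c e = ℤP.+-identityʳ _

  ext-+′ : ∀ {m} (φ : Mon m → ℤ) f g → ext φ (f +′ g) ≡ ext φ f ℤ.+ ext φ g
  ext-+′ = ext-++

  ext--′ : ∀ {m} (φ : Mon m → ℤ) f → ext φ (-′ f) ≡ ℤ.- ext φ f
  ext--′ = ext-neg

  ext-*′ : ∀ {m} (φ : Mon m → ℤ) f g → ext φ (f *′ g) ≡ ext (λ a → ext (λ b → φ (a +ᵐ b)) g) f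
  ext-*′ = ext-*

  coeff-+′ : ∀ {m} (f g : Poly m) x → coeff (f +′ g) x ≡ coeff f x ℤ.+ coeff g x
  coeff-+′ = coeff-+

  coeff--′ : ∀ {m} (f : Poly m) x → coeff (-′ f) x ≡ ℤ.- coeff f x
  coeff--′ = coeff-neg

  ^-0 : ∀ {m} (f : Poly m) → f ^ₚ 0 ≡ 1′
  ^-0 f = ≡.refl

  ^-suc : ∀ {m} (f : Poly m) a → f ^ₚ suc a ≡ f *′ (f ^ₚ a)
  ^-suc f a = ≡.refl

  evalMon-[] : ∀ {k} (σ : Fin 0 → Poly k) → evalMon [] σ ≡ 1′
  evalMon-[] σ = ≡.refl

  evalMon-∷ : ∀ {m k} a (e : Mon m) (σ : Fin (suc m) → Poly k) →
              evalMon (a ∷ e) σ ≡ (σ F.zero ^ₚ a) *′ evalMon e (λ i → σ (F.suc i))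
  evalMon-∷ a e σ = ≡.refl

  []-∷ : ∀ {m k} c e f (σ : Fin m → Poly k) → ((c , e) ∷ f) [ σ ] ≡ κ c *′ evalMon e σ +′ f [ σ ]
  []-∷ c e f σ = ≡.refl

  []-[] : ∀ {m k} (σ : Fin m → Poly k) → [] [ σ ] ≡ 0′
  []-[] σ = ≡.refl

ext-κ : ∀ {m} (φ : Mon m → ℤ) c → ext φ (κ c) ≡ c ℤ.* φ 0ᵐ
ext-κ φ c = ≡.trans (cong (ext φ) (≡.sym (mono-0ᵐ c))) (ext-mono φ c 0ᵐ)

ext-0′ : ∀ {m} (φ : Mon m → ℤ) → ext φ 0′ ≡ 0ℤ
ext-0′ φ = cong (ext φ) (≡.sym []≡0)

κ-0 : ∀ {m} → κ {m} 0ℤ ≃ 0′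
κ-0 = ext-≃ λ φ → ≡.trans (ext-κ φ 0ℤ) (≡.trans (ℤP.*-zeroˡ (φ 0ᵐ)) (≡.sym (ext-0′ φ)))

κ-+ : ∀ {m} a b → κ {m} (a ℤ.+ b) ≃ κ a +′ κ b
κ-+ a b = ext-≃ λ φ → ≡.trans (ext-κ φ (a ℤ.+ b)) (≡.trans (ℤP.*-distribʳ-+ (φ 0ᵐ) a b)
  (≡.sym (≡.trans (ext-+′ φ (κ a) (κ b)) (cong₂ ℤ._+_ (ext-κ φ a) (ext-κ φ b)))))

κ-neg : ∀ {m} a → κ {m} (ℤ.- a) ≃ -′ κ a
κ-neg a = ext-≃ λ φ → ≡.trans (ext-κ φ (ℤ.- a)) (≡.trans (≡.sym (ℤP.neg-distribˡ-* a (φ 0ᵐ)))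
  (≡.sym (≡.trans (ext--′ φ (κ a)) (cong ℤ.-_ (ext-κ φ a)))))

κ-mono : ∀ {m} a b (e : Mon m) → mono (a ℤ.* b) e ≡ κ a *′ mono b e
κ-mono a b e = ≡.trans (cong (mono (a ℤ.* b)) (≡.sym (+ᵐ-identityˡ e)))
  (≡.trans (≡.sym (mono-* a b 0ᵐ e)) (cong (_*′ mono b e) (mono-0ᵐ a)))

κ-* : ∀ {m} a b → κ {m} (a ℤ.* b) ≡ κ a *′ κ b
κ-* a b = ≡.trans (≡.sym (mono-0ᵐ (a ℤ.* b))) (≡.trans (κ-mono a b 0ᵐ) (cong (κ a *′_) (mono-0ᵐ b)))

X*mono : ∀ {m} v c (e : Mon m) → X v *′ mono c e ≡ mono c (unit v +ᵐ e)
X*mono v c e = ≡.trans (cong (_*′ mono c e) (X-mono v))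
  (≡.trans (mono-* 1ℤ c (unit v) e) (cong (λ c → mono c (unit v +ᵐ e)) (ℤP.*-identityˡ c)))

-- The induction principle used throughout: substitutions, divided differences and coefficient
-- extractions are all controlled by their behaviour on constants, sums and multiplication by one
-- variable.
poly-ind : ∀ {ℓ m} (Q : Poly m → Set ℓ) → (∀ {f g} → f ≃ g → Q f → Q g) → (∀ c → Q (κ c)) →
           (∀ f g → Q f → Q g → Q (f +′ g)) → (∀ v f → Q f → Q (X v *′ f)) → ∀ f → Q f
poly-ind Q resp const plus times [] = subst Q (≡.sym []≡0) (resp κ-0 (const 0ℤ))
poly-ind Q resp const plus times ((c , e) ∷ f) = subst Q (≡.sym (∷≡+ c e f))
  (plus (mono c e) f
    (mon-ind (λ e → Q (mono c e)) (subst Q (≡.sym (mono-0ᵐ c)) (const c))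
      (λ v e q → subst Q (X*mono v c e) (times v (mono c e) q)) e)
    (poly-ind Q resp const plus times f))

^-+ : ∀ {m} (f : Poly m) a b → f ^ₚ (a ℕ.+ b) ≃ (f ^ₚ a) *′ (f ^ₚ b)
^-+ f zero b = P.sym (P.trans (P.*-congʳ (P.reflexive (^-0 f))) (P.*-identityˡ (f ^ₚ b)))
^-+ f (suc a) b = begin
  f ^ₚ suc (a ℕ.+ b) ≡⟨ ^-suc f (a ℕ.+ b) ⟩
  f *′ (f ^ₚ (a ℕ.+ b)) ≈⟨ P.*-congˡ (^-+ f a b) ⟩
  f *′ ((f ^ₚ a) *′ (f ^ₚ b)) ≈⟨ P.*-assoc f (f ^ₚ a) (f ^ₚ b) ⟨
  (f *′ (f ^ₚ a)) *′ (f ^ₚ b) ≡⟨ cong (_*′ (f ^ₚ b)) (^-suc f a) ⟨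
  (f ^ₚ suc a) *′ (f ^ₚ b) ∎
  where open PR

evalMon-+ : ∀ {m k} (a b : Mon m) (σ : Fin m → Poly k) → evalMon (a +ᵐ b) σ ≃ evalMon a σ *′ evalMon b σ
evalMon-+ [] [] σ = P.sym (P.trans (P.*-congʳ (P.reflexive (evalMon-[] σ))) (P.*-identityˡ _))
evalMon-+ (x ∷ a) (y ∷ b) σ = begin
  evalMon ((x ℕ.+ y) ∷ (a +ᵐ b)) σ ≡⟨ evalMon-∷ (x ℕ.+ y) (a +ᵐ b) σ ⟩
  (σ F.zero ^ₚ (x ℕ.+ y)) *′ evalMon (a +ᵐ b) σ′ ≈⟨ P.*-cong (^-+ (σ F.zero) x y) (evalMon-+ a b σ′) ⟩
  ((σ F.zero ^ₚ x) *′ (σ F.zero ^ₚ y)) *′ (evalMon a σ′ *′ evalMon b σ′)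
    ≈⟨ PS.solve (λ { (x ∷ y ∷ a ∷ b ∷ []) → (x ⊗ y) ⊗ (a ⊗ b) , (x ⊗ a) ⊗ (y ⊗ b) })
         (σ F.zero ^ₚ x ∷ σ F.zero ^ₚ y ∷ evalMon a σ′ ∷ evalMon b σ′ ∷ []) ≡.refl ⟩
  ((σ F.zero ^ₚ x) *′ evalMon a σ′) *′ ((σ F.zero ^ₚ y) *′ evalMon b σ′)
    ≡⟨ cong₂ _*′_ (evalMon-∷ x a σ) (evalMon-∷ y b σ) ⟨
  evalMon (x ∷ a) σ *′ evalMon (y ∷ b) σ ∎
  where
  open PR
  σ′ = λ i → σ (F.suc i)

evalMon-0 : ∀ {m k} (σ : Fin m → Poly k) → evalMon 0ᵐ σ ≃ 1′
evalMon-0 {zero} σ = P.reflexive (evalMon-[] σ)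
evalMon-0 {suc m} σ = P.trans (P.reflexive (evalMon-∷ 0 0ᵐ σ))
  (P.trans (P.*-cong (P.reflexive (^-0 (σ F.zero))) (evalMon-0 (λ i → σ (F.suc i)))) (P.*-identityˡ 1′))

evalMon-zeros : ∀ {m k} (σ : Fin m → Poly k) → evalMon (V.tabulate (λ _ → 0)) σ ≃ 1′
evalMon-zeros {m} σ = P.trans (P.reflexive (cong (λ e → evalMon e σ) (lemma m))) (evalMon-0 σ)
  where
  lemma : ∀ m → V.tabulate {n = m} (λ _ → 0) ≡ 0ᵐ
  lemma zero = ≡.refl
  lemma (suc m) = cong (0 ∷_) (lemma m)

evalMon-unit : ∀ {m k} v (σ : Fin m → Poly k) → evalMon (unit v) σ ≃ σ v
evalMon-unit {suc m} F.zero σ = begin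
  evalMon (1 ∷ V.tabulate (λ _ → 0)) σ ≡⟨ evalMon-∷ 1 (V.tabulate (λ _ → 0)) σ ⟩
  (σ F.zero ^ₚ 1) *′ evalMon (V.tabulate (λ _ → 0)) (λ i → σ (F.suc i))
    ≈⟨ P.*-cong (P.reflexive (≡.trans (^-suc (σ F.zero) 0) (cong (σ F.zero *′_) (^-0 (σ F.zero))))) (evalMon-zeros (λ i → σ (F.suc i))) ⟩
  (σ F.zero *′ 1′) *′ 1′ ≈⟨ P.trans (P.*-identityʳ _) (P.*-identityʳ _) ⟩
  σ F.zero ∎
  where open PR
evalMon-unit (F.suc v) σ = P.trans (P.reflexive (evalMon-∷ 0 (unit v) σ))
  (P.trans (P.*-congʳ (P.reflexive (^-0 (σ F.zero)))) (P.trans (P.*-identityˡ _) (evalMon-unit v (λ i → σ (F.suc i)))))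

ext-κ-* : ∀ {m} φ c (f : Poly m) → ext φ (κ c *′ f) ≡ c ℤ.* ext φ f
ext-κ-* φ c f = ≡.trans (ext-*′ φ (κ c) f) (≡.trans (ext-κ _ c)
  (cong (ℤ._*_ c) (ext-cong (λ e → cong φ (+ᵐ-identityˡ e)) f)))

ext-[] : ∀ {m k} φ (f : Poly m) (σ : Fin m → Poly k) → ext φ (f [ σ ]) ≡ ext (λ e → ext φ (evalMon e σ)) f
ext-[] φ [] σ = ≡.trans (cong (ext φ) ([]-[] σ)) (ext-0′ φ)
ext-[] φ ((c , e) ∷ f) σ =
  ≡.trans (cong (ext φ) ([]-∷ c e f σ))
  (≡.trans (ext-+′ φ (κ c *′ evalMon e σ) (f [ σ ])) (cong₂ ℤ._+_ (ext-κ-* φ c (evalMon e σ)) (ext-[] φ f σ)))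

module _ {m k : ℕ} (σ : Fin m → Poly k) where

  []-cong : ∀ {f g} → f ≃ g → f [ σ ] ≃ g [ σ ]
  []-cong {f} {g} p = ext-≃ λ φ → ≡.trans (ext-[] φ f σ) (≡.trans (ext-resp p _) (≡.sym (ext-[] φ g σ)))

  []-+ : ∀ f g → (f +′ g) [ σ ] ≃ f [ σ ] +′ g [ σ ]
  []-+ f g = ext-≃ λ φ → ≡.trans (ext-[] φ (f +′ g) σ) (≡.trans (ext-+′ _ f g)
    (≡.sym (≡.trans (ext-+′ φ (f [ σ ]) (g [ σ ])) (cong₂ ℤ._+_ (ext-[] φ f σ) (ext-[] φ g σ)))))

  []-neg : ∀ f → (-′ f) [ σ ] ≃ -′ (f [ σ ])
  []-neg f = ext-≃ λ φ → ≡.trans (ext-[] φ (-′ f) σ) (≡.trans (ext--′ _ f)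
    (≡.sym (≡.trans (ext--′ φ (f [ σ ])) (cong ℤ.-_ (ext-[] φ f σ)))))

  []-0 : 0′ [ σ ] ≃ 0′
  []-0 = P.trans (P.reflexive (cong (_[ σ ]) (≡.sym []≡0))) (P.reflexive ([]-[] σ))

  -- On a functional both sides become sums over the monomials of `f` and `g`; `evalMon-+` splits
  -- the image of a product of monomials, and `ext-swap` brings the sums into the same order.
  []-* : ∀ f g → (f *′ g) [ σ ] ≃ f [ σ ] *′ g [ σ ]
  []-* f g = ext-≃ λ φ → begin
    ext φ ((f *′ g) [ σ ]) ≡⟨ ext-[] φ (f *′ g) σ ⟩
    ext (λ e → ext φ (evalMon e σ)) (f *′ g) ≡⟨ ext-*′ _ f g ⟩
    ext (λ a → ext (λ b → ext φ (evalMon (a +ᵐ b) σ)) g) f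
      ≡⟨ ext-cong (λ a → ≡.trans (ext-cong (λ b → ≡.trans (ext-resp (evalMon-+ a b σ) φ) (ext-*′ φ (evalMon a σ) (evalMon b σ))) g)
           (≡.trans (ext-swap _ g (evalMon a σ)) (ext-cong (λ x → ≡.sym (ext-[] (λ y → φ (x +ᵐ y)) g σ)) (evalMon a σ)))) f ⟩
    ext (λ a → ext (λ x → ext (λ y → φ (x +ᵐ y)) (g [ σ ])) (evalMon a σ)) f
      ≡⟨ ≡.sym (ext-[] _ f σ) ⟩
    ext (λ x → ext (λ y → φ (x +ᵐ y)) (g [ σ ])) (f [ σ ]) ≡⟨ ≡.sym (ext-*′ φ (f [ σ ]) (g [ σ ])) ⟩
    ext φ (f [ σ ] *′ g [ σ ]) ∎
    where open ≡-Reasoning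

  mono-[] : ∀ c e → mono c e [ σ ] ≃ κ c *′ evalMon e σ
  mono-[] c e = ext-≃ λ φ → ≡.trans (ext-[] φ (mono c e) σ) (≡.trans (ext-mono _ c e) (≡.sym (ext-κ-* φ c (evalMon e σ))))

  []-κ : ∀ c → κ c [ σ ] ≃ κ c
  []-κ c = begin
    κ c [ σ ] ≡⟨ cong (_[ σ ]) (mono-0ᵐ c) ⟨
    mono c 0ᵐ [ σ ] ≈⟨ mono-[] c 0ᵐ ⟩
    κ c *′ evalMon 0ᵐ σ ≈⟨ P.*-congˡ (evalMon-0 σ) ⟩
    κ c *′ 1′ ≈⟨ P.*-identityʳ _ ⟩
    κ c ∎
    where open PR

  []-1 : 1′ [ σ ] ≃ 1′
  []-1 = P.trans (P.reflexive (cong (_[ σ ]) (≡.sym κ-1))) (P.trans ([]-κ 1ℤ) (P.reflexive κ-1))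

  []-X : ∀ v → X v [ σ ] ≃ σ v
  []-X v = begin
    X v [ σ ] ≡⟨ cong (_[ σ ]) (X-mono v) ⟩
    mono 1ℤ (unit v) [ σ ] ≈⟨ mono-[] 1ℤ (unit v) ⟩
    κ 1ℤ *′ evalMon (unit v) σ ≈⟨ P.*-cong (P.reflexive κ-1) (evalMon-unit v σ) ⟩
    1′ *′ σ v ≈⟨ P.*-identityˡ _ ⟩
    σ v ∎
    where open PR

  []-X* : ∀ v f → (X v *′ f) [ σ ] ≃ σ v *′ f [ σ ]
  []-X* v f = P.trans ([]-* (X v) f) (P.*-congʳ ([]-X v))

[]-ext : ∀ {m k} {σ τ : Fin m → Poly k} → (∀ v → σ v ≃ τ v) → ∀ f → f [ σ ] ≃ f [ τ ]
[]-ext {σ = σ} {τ} p = poly-ind _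
  (λ f≃g q → P.trans (P.sym ([]-cong σ f≃g)) (P.trans q ([]-cong τ f≃g)))
  (λ c → P.trans ([]-κ σ c) (P.sym ([]-κ τ c)))
  (λ f g q q′ → P.trans ([]-+ σ f g) (P.trans (P.+-cong q q′) (P.sym ([]-+ τ f g))))
  (λ v f q → P.trans ([]-X* σ v f) (P.trans (P.*-cong (p v) q) (P.sym ([]-X* τ v f))))

[]-∘ : ∀ {m k l} (σ : Fin m → Poly k) (τ : Fin k → Poly l) f →
          f [ σ ] [ τ ] ≃ f [ (λ v → σ v [ τ ]) ]
[]-∘ σ τ = poly-ind _
  (λ f≃g q → P.trans (P.sym ([]-cong τ ([]-cong σ f≃g))) (P.trans q ([]-cong (λ v → σ v [ τ ]) f≃g)))
  (λ c → P.trans ([]-cong τ ([]-κ σ c)) (P.trans ([]-κ τ c) (P.sym ([]-κ (λ v → σ v [ τ ]) c))))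
  (λ f g q q′ → P.trans ([]-cong τ ([]-+ σ f g)) (P.trans ([]-+ τ _ _) (P.trans (P.+-cong q q′) (P.sym ([]-+ (λ v → σ v [ τ ]) f g)))))
  (λ v f q → P.trans ([]-cong τ ([]-X* σ v f)) (P.trans ([]-* τ _ _) (P.trans (P.*-congˡ q) (P.sym ([]-X* (λ v → σ v [ τ ]) v f)))))

[]-id : ∀ {m} (f : Poly m) → f [ X ] ≃ f
[]-id = poly-ind _
  (λ f≃g q → P.trans (P.sym ([]-cong X f≃g)) (P.trans q f≃g))
  ([]-κ X)
  (λ f g q q′ → P.trans ([]-+ X f g) (P.+-cong q q′))
  (λ v f q → P.trans ([]-X* X v f) (P.*-congˡ q))

-- Ideals and quotient rings

-- Ideal membership in inductive form, with `≃` built into each constructor, so that maps between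
-- ideals are defined by recursion. `toInIdeal` and `fromInIdeal` connect it with `InIdeal`.
data ⟨_⟩ {m : ℕ} (G : Poly m → Set) : Poly m → Set where
  nil : ∀ {f} → f ≃ 0′ → ⟨ G ⟩ f
  cons : ∀ {f} h {g f′} → f ≃ h *′ g +′ f′ → G g → ⟨ G ⟩ f′ → ⟨ G ⟩ f

module _ {m : ℕ} {G : Poly m → Set} where

  ⟨⟩-resp : ∀ {f g} → f ≃ g → ⟨ G ⟩ f → ⟨ G ⟩ g
  ⟨⟩-resp p (nil q) = nil (P.trans (P.sym p) q)
  ⟨⟩-resp p (cons h q g i) = cons h (P.trans (P.sym p) q) g i

  ⟨⟩-+ : ∀ {f g} → ⟨ G ⟩ f → ⟨ G ⟩ g → ⟨ G ⟩ (f +′ g)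
  ⟨⟩-+ (nil p) j = ⟨⟩-resp (P.sym (P.trans (P.+-congʳ p) (P.+-identityˡ _))) j
  ⟨⟩-+ (cons h p g i) j = cons h (P.trans (P.+-congʳ p) (P.+-assoc (h *′ _) _ _)) g (⟨⟩-+ i j)

  ⟨⟩-* : ∀ k {f} → ⟨ G ⟩ f → ⟨ G ⟩ (k *′ f)
  ⟨⟩-* k (nil p) = nil (P.trans (P.*-congˡ {x = k} p) (P.zeroʳ k))
  ⟨⟩-* k (cons h {g} p q i) = cons (k *′ h)
    (P.trans (P.*-congˡ {x = k} p) (P.trans (P.distribˡ k _ _) (P.+-congʳ (P.sym (P.*-assoc k h g))))) q (⟨⟩-* k i)

  ⟨⟩-neg : ∀ {f} → ⟨ G ⟩ f → ⟨ G ⟩ (-′ f)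
  ⟨⟩-neg {f} i = ⟨⟩-resp (PP.-1*x≈-x f) (⟨⟩-* (-′ 1′) i)

  ⟨⟩-gen : ∀ {g} → G g → ⟨ G ⟩ g
  ⟨⟩-gen {g} p = cons 1′ (P.sym (P.trans (P.+-identityʳ _) (P.*-identityˡ g))) p (nil P.refl)

opaque
  unfolding _+′_ _*′_ 0′

  toInIdeal : ∀ {m} {G : Poly m → Set} {f} → ⟨ G ⟩ f → InIdeal G f
  toInIdeal (nil p) = [] , coeffs p
  toInIdeal (cons h {g} p q i) with toInIdeal i
  ... | cs , r = (h , (g , q)) ∷ cs , λ e → ≡.trans (coeffs p e)
    (≡.trans (coeff-+ (h *ₚ g) _ e) (≡.trans (cong (ℤ._+_ (coeff (h *ₚ g) e)) (r e)) (≡.sym (coeff-+ (h *ₚ g) _ e))))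

  fromInIdeal : ∀ {m} {G : Poly m → Set} {f} → InIdeal G f → ⟨ G ⟩ f
  fromInIdeal {m} {G} {f} (cs , p) = ⟨⟩-resp (mk≃ λ e → ≡.sym (p e)) (go cs)
    where
    go : ∀ cs → ⟨ G ⟩ (sumₚ (L.map (λ (c : Poly m × Σ (Poly m) G) → proj₁ c *ₚ proj₁ (proj₂ c)) cs))
    go [] = nil ≃-refl
    go ((h , (g , q)) ∷ cs) = cons h ≃-refl q (go cs)

-- `T` is asked to be additive and not multiplicative, because divided differences and coefficient
-- extractions are not ring maps; multiples of generators are treated by a separate premise.
⟨⟩-map : ∀ {m k} {G : Poly m → Set} {G′ : Poly k → Set} (T : Poly m → Poly k) →
         (∀ {f g} → f ≃ g → T f ≃ T g) → (∀ f g → T (f +′ g) ≃ T f +′ T g) → T 0′ ≃ 0′ →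
         (∀ h {g} → G g → ⟨ G′ ⟩ (T (h *′ g))) → ∀ {f} → ⟨ G ⟩ f → ⟨ G′ ⟩ (T f)
⟨⟩-map T T-cong T-+ T-0 T-gen (nil p) = nil (P.trans (T-cong p) T-0)
⟨⟩-map T T-cong T-+ T-0 T-gen (cons h p q i) =
  ⟨⟩-resp (P.sym (P.trans (T-cong p) (T-+ _ _))) (⟨⟩-+ (T-gen h q) (⟨⟩-map T T-cong T-+ T-0 T-gen i))

⟨⟩-[] : ∀ {m k} {G : Poly m → Set} {G′ : Poly k → Set} (σ : Fin m → Poly k) →
           (∀ {g} → G g → ⟨ G′ ⟩ ((g [ σ ]))) → ∀ {f} → ⟨ G ⟩ f → ⟨ G′ ⟩ ((f [ σ ]))
⟨⟩-[] σ p = ⟨⟩-map (_[ σ ]) ([]-cong σ) ([]-+ σ) ([]-0 σ)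
  (λ h {g} q → ⟨⟩-resp (P.sym ([]-* σ h g)) (⟨⟩-* ((h [ σ ])) (p q)))

infix 4 _≋[_]_
record _≋[_]_ {m : ℕ} (f : Poly m) (G : Poly m → Set) (g : Poly m) : Set where
  constructor mk≋
  field diff : ⟨ G ⟩ (f -′ g)
open _≋[_]_ public

minus-0 : ∀ {m} (f : Poly m) → f -′ 0′ ≃ f
minus-0 f = P.trans (P.+-congˡ PP.-0#≈0#) (P.+-identityʳ f)

module _ {m : ℕ} {G : Poly m → Set} where

  ≃⇒≋ : ∀ {f g} → f ≃ g → f ≋[ G ] g
  ≃⇒≋ {f} {g} p = mk≋ (nil (P.trans (P.+-congʳ p) (P.-‿inverseʳ g)))

  ≋0 : ∀ {f} → ⟨ G ⟩ f → f ≋[ G ] 0′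
  ≋0 {f} i = mk≋ (⟨⟩-resp (P.sym (minus-0 f)) i)

  ≋0⁻¹ : ∀ {f} → f ≋[ G ] 0′ → ⟨ G ⟩ f
  ≋0⁻¹ {f} i = ⟨⟩-resp (minus-0 f) (diff i)

quotientRing : ∀ {m} → (Poly m → Set) → CommutativeRing 0ℓ 0ℓ
quotientRing {m} G = record
  { Carrier = Poly m ; _≈_ = λ f g → f ≋[ G ] g ; _+_ = _+′_ ; _*_ = _*′_ ; -_ = -′_ ; 0# = 0′ ; 1# = 1′
  ; isCommutativeRing = record
    { isRing = record
      { +-isAbelianGroup = record
        { isGroup = record
          { isMonoid = record
            { isSemigroup = record
              { isMagma = record
                { isEquivalence = record
                  { refl = λ {f} → ≃⇒≋ P.refl
                  ; sym = λ {f} {g} p → mk≋ (⟨⟩-resp (eqs f g) (⟨⟩-neg (diff p)))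
                  ; trans = λ {f} {g} {h} p q → mk≋ (⟨⟩-resp (eqt f g h) (⟨⟩-+ (diff p) (diff q))) }
                ; ∙-cong = λ {f} {f′} {g} {g′} p q → mk≋ (⟨⟩-resp (eq+ f f′ g g′) (⟨⟩-+ (diff p) (diff q))) }
              ; assoc = λ f g h → ≃⇒≋ (P.+-assoc f g h) }
            ; identity = (λ f → ≃⇒≋ (P.+-identityˡ f)) , (λ f → ≃⇒≋ (P.+-identityʳ f)) }
          ; inverse = (λ f → ≃⇒≋ (P.-‿inverseˡ f)) , (λ f → ≃⇒≋ (P.-‿inverseʳ f))
          ; ⁻¹-cong = λ {f} {g} p → mk≋ (⟨⟩-resp (eq- f g) (⟨⟩-neg (diff p))) }
        ; comm = λ f g → ≃⇒≋ (P.+-comm f g) }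
      ; *-cong = λ {f} {f′} {g} {g′} p q → mk≋ (⟨⟩-resp (eq* f f′ g g′) (⟨⟩-+ (⟨⟩-* g (diff p)) (⟨⟩-* f′ (diff q))))
      ; *-assoc = λ f g h → ≃⇒≋ (P.*-assoc f g h)
      ; *-identity = (λ f → ≃⇒≋ (P.*-identityˡ f)) , (λ f → ≃⇒≋ (P.*-identityʳ f))
      ; distrib = (λ f g h → ≃⇒≋ (P.distribˡ f g h)) , (λ f g h → ≃⇒≋ (P.distribʳ f g h)) }
    ; *-comm = λ f g → ≃⇒≋ (P.*-comm f g) } }
  where
  eqs : ∀ (f g : Poly m) → -′ (f -′ g) ≃ g -′ f
  eqs f g = PS.solve (λ { (f ∷ g ∷ []) → ⊝ (f ⊖ g) , g ⊖ f }) (f ∷ g ∷ []) ≡.refl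
  eqt : ∀ (f g h : Poly m) → (f -′ g) +′ (g -′ h) ≃ f -′ h
  eqt f g h = PS.solve (λ { (f ∷ g ∷ h ∷ []) → (f ⊖ g) ⊕ (g ⊖ h) , f ⊖ h }) (f ∷ g ∷ h ∷ []) ≡.refl
  eq+ : ∀ (f f′ g g′ : Poly m) → (f -′ f′) +′ (g -′ g′) ≃ (f +′ g) -′ (f′ +′ g′)
  eq+ f f′ g g′ = PS.solve (λ { (f ∷ f′ ∷ g ∷ g′ ∷ []) → (f ⊖ f′) ⊕ (g ⊖ g′) , (f ⊕ g) ⊖ (f′ ⊕ g′) })
    (f ∷ f′ ∷ g ∷ g′ ∷ []) ≡.refl
  eq- : ∀ (f g : Poly m) → -′ (f -′ g) ≃ (-′ f) -′ (-′ g)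
  eq- f g = PS.solve (λ { (f ∷ g ∷ []) → ⊝ (f ⊖ g) , ⊝ f ⊖ ⊝ g }) (f ∷ g ∷ []) ≡.refl
  eq* : ∀ (f f′ g g′ : Poly m) → g *′ (f -′ f′) +′ f′ *′ (g -′ g′) ≃ f *′ g -′ f′ *′ g′
  eq* f f′ g g′ = PS.solve (λ { (f ∷ f′ ∷ g ∷ g′ ∷ []) → g ⊗ (f ⊖ f′) ⊕ f′ ⊗ (g ⊖ g′) , f ⊗ g ⊖ f′ ⊗ g′ })
    (f ∷ f′ ∷ g ∷ g′ ∷ []) ≡.refl

-- An identity modulo hypotheses u ≈ v is reduced to one identity valid in all rings
-- by adding multiples a (u − v) b of the hypotheses.
module Combination {c ℓ} (R : Ring c ℓ) where
  open Ring R
  open RingProps R using (-0#≈0#)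

  infixr 5 _⊞_
  infix 6 _∙⟨_⟩∙_

  _∙⟨_⟩∙_ : ∀ a {u v} → u ≈ v → ∀ b → a * (u - v) * b ≈ 0#
  a ∙⟨ p ⟩∙ b = trans (*-congʳ (trans (*-congˡ (trans (+-congʳ p) (-‿inverseʳ _))) (zeroʳ a))) (zeroˡ b)

  _⊞_ : ∀ {s t} → s ≈ 0# → t ≈ 0# → s + t ≈ 0#
  p ⊞ q = trans (+-cong p q) (+-identityˡ 0#)

  by : ∀ {a b s} → a ≈ b + s → s ≈ 0# → a ≈ b
  by p q = trans p (trans (+-congˡ q) (+-identityʳ _))

  -≈0⇒≈ : ∀ {a b} → a - b ≈ 0# → a ≈ b
  -≈0⇒≈ {a} {b} p = trans (sym (+-identityʳ a)) (trans (+-congˡ (sym (-‿inverseˡ b)))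
    (trans (sym (+-assoc a (- b) b)) (trans (+-congʳ p) (+-identityˡ b))))

-- Nil-Hecke relations from a faithful action

-- Here x i, ∂ i model the i-th variable and the divided difference exchanging x i and
-- x (i + 1), with indices read modulo n; Van φ says that φ annihilates 1.
record NilHecke {c ℓ} (R : Ring c ℓ) (n : ℕ) : Set (Level.suc (c ⊔ ℓ)) where
  open Ring R
  field
    x ∂ : ℕ → Carrier
    x-comm : ∀ i j → x i * x j ≈ x j * x i
    ∂x : ∀ i → ∂ i * x i ≈ x (suc i) * ∂ i + 1#
    ∂x⁺ : ∀ i → ∂ i * x (suc i) ≈ x i * ∂ i + - 1#
    -- In `∂x>` and in `∂x<` the two bounds keep `k` away from the residues of `i` and `i + 1`
    -- modulo `n`.
    ∂x> : ∀ {i k} → 2 ℕ.+ i ≤ k → suc k ≤ n ℕ.+ i → ∂ i * x k ≈ x k * ∂ i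
    ∂x< : ∀ {i k} → k < i → 2 ℕ.+ i ≤ n ℕ.+ k → ∂ i * x k ≈ x k * ∂ i
    Van : Carrier → Set ℓ
    van-∂ : ∀ φ i → Van (φ * ∂ i)
    van-- : ∀ {φ ψ} → Van φ → Van ψ → Van (φ - ψ)
    -- An operator killing 1 kills everything generated from 1 by the x k if it can be moved past
    -- them; `k` ranges over one full period, starting wherever is convenient.
    faithful : ∀ i φ → Van φ → (∀ k → i ≤ k → suc k ≤ n ℕ.+ i → Σ Carrier λ ψ → φ * x k ≈ ψ * φ) → φ ≈ 0#

module NilHeckeProps {c ℓ} {R : Ring c ℓ} {n : ℕ} (H : NilHecke R n) where
  open Ring R
  open NilHecke H
  open Solve R
  open Combination R

  Central : Carrier → Set (c ⊔ ℓ)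
  Central r = ∀ φ → φ * r ≈ r * φ

  central-0 : Central 0#
  central-0 φ = trans (zeroʳ φ) (sym (zeroˡ φ))

  central-1 : Central 1#
  central-1 φ = trans (*-identityʳ φ) (sym (*-identityˡ φ))

  central--1 : Central (- 1#)
  central--1 φ = solve (λ { (φ ∷ []) → φ ⊗ ⊝ 𝟙 , ⊝ 𝟙 ⊗ φ }) (φ ∷ []) ≡.refl

  plus-0 : ∀ {a b} → a ≈ b → a ≈ b + 0#
  plus-0 p = trans p (sym (+-identityʳ _))

  window : ∀ i k → i ≤ k → (k ≡ i) ⊎ ((k ≡ suc i) ⊎ (2 ℕ.+ i ≤ k))
  window i k i≤k with ℕP.m≤n⇒m<n∨m≡n i≤k
  ... | inj₂ p = inj₁ (≡.sym p)
  ... | inj₁ q with ℕP.m≤n⇒m<n∨m≡n q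
  ...   | inj₂ p = inj₂ (inj₁ (≡.sym p))
  ...   | inj₁ p = inj₂ (inj₂ p)

  -- By `faithful`: when x i or x (i + 1) is moved through both factors, the two inhomogeneous terms
  -- are `∂ i` with opposite signs and cancel.
  ∂² : ∀ i → ∂ i * ∂ i ≈ 0#
  ∂² i = faithful i _ (van-∂ (∂ i) i) step
    where
    step : ∀ k → i ≤ k → suc k ≤ n ℕ.+ i → Σ Carrier λ ψ → ∂ i * ∂ i * x k ≈ ψ * (∂ i * ∂ i)
    step k i≤k k<n with window i k i≤k
    ... | inj₁ ≡.refl = x i , by
          (solve (λ { (d ∷ a ∷ b ∷ []) → d ⊗ d ⊗ a ,
             a ⊗ (d ⊗ d) ⊕ (d ⊗ (d ⊗ a ⊖ (b ⊗ d ⊕ 𝟙)) ⊗ 𝟙 ⊕ 𝟙 ⊗ (d ⊗ b ⊖ (a ⊗ d ⊕ ⊝ 𝟙)) ⊗ d) })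
             (∂ i ∷ x i ∷ x (suc i) ∷ []) ≡.refl)
          (∂ i ∙⟨ ∂x i ⟩∙ 1# ⊞ 1# ∙⟨ ∂x⁺ i ⟩∙ ∂ i)
    ... | inj₂ (inj₁ ≡.refl) = x (suc i) , by
          (solve (λ { (d ∷ a ∷ b ∷ []) → d ⊗ d ⊗ b ,
             b ⊗ (d ⊗ d) ⊕ (d ⊗ (d ⊗ b ⊖ (a ⊗ d ⊕ ⊝ 𝟙)) ⊗ 𝟙 ⊕ 𝟙 ⊗ (d ⊗ a ⊖ (b ⊗ d ⊕ 𝟙)) ⊗ d) })
             (∂ i ∷ x i ∷ x (suc i) ∷ []) ≡.refl)
          (∂ i ∙⟨ ∂x⁺ i ⟩∙ 1# ⊞ 1# ∙⟨ ∂x i ⟩∙ ∂ i)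
    ... | inj₂ (inj₂ q) = x k , by
          (solve (λ { (d ∷ a ∷ []) → d ⊗ d ⊗ a ,
             a ⊗ (d ⊗ d) ⊕ (d ⊗ (d ⊗ a ⊖ a ⊗ d) ⊗ 𝟙 ⊕ 𝟙 ⊗ (d ⊗ a ⊖ a ⊗ d) ⊗ d) })
             (∂ i ∷ x k ∷ []) ≡.refl)
          (∂ i ∙⟨ ∂x> q k<n ⟩∙ 1# ⊞ 1# ∙⟨ ∂x> q k<n ⟩∙ ∂ i)

  -- Moving `a` through p q and through q p ends with the same `d`, and the remainders r q + p s and
  -- s p + q r agree because `r` and `s` are central.
  far-step : ∀ {p q a a′ b d r s} → p * a ≈ a′ * p + r → q * a ≈ b * q + s → p * b ≈ d * p + r → q * a′ ≈ d * q + s →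
             Central r → Central s → (p * q - q * p) * a ≈ d * (p * q - q * p)
  far-step {p} {q} {a} {a′} {b} {d} {r} {s} h₁ h₂ h₃ h₄ c₁ c₂ = by
    (solve (λ { (p ∷ q ∷ a ∷ a′ ∷ b ∷ d ∷ r ∷ s ∷ []) → (p ⊗ q ⊖ q ⊗ p) ⊗ a ,
       d ⊗ (p ⊗ q ⊖ q ⊗ p) ⊕ (p ⊗ (q ⊗ a ⊖ (b ⊗ q ⊕ s)) ⊗ 𝟙 ⊕ (⊝ q ⊗ (p ⊗ a ⊖ (a′ ⊗ p ⊕ r)) ⊗ 𝟙
        ⊕ (𝟙 ⊗ (p ⊗ b ⊖ (d ⊗ p ⊕ r)) ⊗ q ⊕ (⊝ 𝟙 ⊗ (q ⊗ a′ ⊖ (d ⊗ q ⊕ s)) ⊗ p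
        ⊕ (𝟙 ⊗ (p ⊗ s ⊖ s ⊗ p) ⊗ 𝟙 ⊕ ⊝ 𝟙 ⊗ (q ⊗ r ⊖ r ⊗ q) ⊗ 𝟙))))) })
       (p ∷ q ∷ a ∷ a′ ∷ b ∷ d ∷ r ∷ s ∷ []) ≡.refl)
    (p ∙⟨ h₂ ⟩∙ 1# ⊞ (- q) ∙⟨ h₁ ⟩∙ 1# ⊞ 1# ∙⟨ h₃ ⟩∙ q ⊞ (- 1#) ∙⟨ h₄ ⟩∙ p ⊞ 1# ∙⟨ c₂ p ⟩∙ 1# ⊞ (- 1#) ∙⟨ c₁ q ⟩∙ 1#)

  -- The two bounds say that `i` and `j` are neither equal nor neighbours on the circle, so each
  -- variable of the period is moved by at most one of the two operators, as `far-step` demands.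
  ∂-far : ∀ {i j} → 2 ℕ.+ i ≤ j → 2 ℕ.+ j ≤ n ℕ.+ i → ∂ i * ∂ j ≈ ∂ j * ∂ i
  ∂-far {i} {j} i≪j j≪i = -≈0⇒≈ (faithful i _ (van-- (van-∂ (∂ i) j) (van-∂ (∂ j) i)) step)
    where
    i<j : i < j
    i<j = ℕP.≤-trans (ℕP.n≤1+n _) i≪j
    j<n : suc j ≤ n ℕ.+ i
    j<n = ℕP.≤-trans (ℕP.n≤1+n _) j≪i
    step : ∀ k → i ≤ k → suc k ≤ n ℕ.+ i → Σ Carrier λ ψ → (∂ i * ∂ j - ∂ j * ∂ i) * x k ≈ ψ * (∂ i * ∂ j - ∂ j * ∂ i)
    step k i≤k k<n with window i k i≤k
    ... | inj₁ ≡.refl = _ , far-step (∂x i) (plus-0 (∂x< i<j j≪i)) (∂x i)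
            (plus-0 (∂x< i≪j (ℕP.≤-trans j≪i (ℕP.+-monoʳ-≤ n (ℕP.n≤1+n i))))) central-1 central-0
    ... | inj₂ (inj₁ ≡.refl) = _ , far-step (∂x⁺ i) (plus-0 (∂x< i≪j (ℕP.≤-trans j≪i (ℕP.+-monoʳ-≤ n (ℕP.n≤1+n i))))) (∂x⁺ i)
            (plus-0 (∂x< i<j j≪i)) central--1 central-0
    ... | inj₂ (inj₂ q) with ℕP.<-cmp k j
    ...   | tri< k<j _ _ = _ , far-step (plus-0 (∂x> q k<n)) (plus-0 ∂jk) (plus-0 (∂x> q k<n)) (plus-0 ∂jk) central-0 central-0
      where
      ∂jk : ∂ j * x k ≈ x k * ∂ j
      ∂jk = ∂x< k<j (ℕP.≤-trans j≪i (ℕP.+-monoʳ-≤ n i≤k))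
    ...   | tri≈ _ ≡.refl _ = _ , far-step (plus-0 (∂x> q k<n)) (∂x k)
              (plus-0 (∂x> (ℕP.≤-trans q (ℕP.n≤1+n k)) j≪i)) (∂x k) central-0 central-1
    ...   | tri> _ _ k>j with window j k (ℕP.<⇒≤ k>j)
    ...     | inj₁ p = ⊥-elim (ℕP.<⇒≢ k>j (≡.sym p))
    ...     | inj₂ (inj₁ ≡.refl) = _ , far-step (plus-0 (∂x> q k<n)) (∂x⁺ j)
                (plus-0 (∂x> i≪j j<n)) (∂x⁺ j) central-0 central--1
    ...     | inj₂ (inj₂ r) = _ , far-step (plus-0 (∂x> q k<n)) (plus-0 ∂jk) (plus-0 (∂x> q k<n)) (plus-0 ∂jk) central-0 central-0
      where
      ∂jk : ∂ j * x k ≈ x k * ∂ j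
      ∂jk = ∂x> r (ℕP.≤-trans k<n (ℕP.+-monoʳ-≤ n (ℕP.<⇒≤ i<j)))

  triple : ∀ {a b d y₀ y₁ y₂ y₃ r₁ r₂ r₃} → d * y₀ ≈ y₁ * d + r₁ → b * y₁ ≈ y₂ * b + r₂ → a * y₂ ≈ y₃ * a + r₃ →
           Central r₁ → Central r₂ →
           a * b * d * y₀ ≈ y₃ * (a * b * d) + (r₁ * (a * b) + r₂ * (a * d) + r₃ * (b * d))
  triple {a} {b} {d} {y₀} {y₁} {y₂} {y₃} {r₁} {r₂} {r₃} h₁ h₂ h₃ c₁ c₂ = by
    (solve (λ { (a ∷ b ∷ d ∷ y₀ ∷ y₁ ∷ y₂ ∷ y₃ ∷ r₁ ∷ r₂ ∷ r₃ ∷ []) → a ⊗ b ⊗ d ⊗ y₀ ,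
       y₃ ⊗ (a ⊗ b ⊗ d) ⊕ (r₁ ⊗ (a ⊗ b) ⊕ r₂ ⊗ (a ⊗ d) ⊕ r₃ ⊗ (b ⊗ d))
       ⊕ ((a ⊗ b) ⊗ (d ⊗ y₀ ⊖ (y₁ ⊗ d ⊕ r₁)) ⊗ 𝟙 ⊕ (a ⊗ (b ⊗ y₁ ⊖ (y₂ ⊗ b ⊕ r₂)) ⊗ d
        ⊕ (𝟙 ⊗ (a ⊗ y₂ ⊖ (y₃ ⊗ a ⊕ r₃)) ⊗ (b ⊗ d) ⊕ (𝟙 ⊗ ((a ⊗ b) ⊗ r₁ ⊖ r₁ ⊗ (a ⊗ b)) ⊗ 𝟙
        ⊕ 𝟙 ⊗ (a ⊗ r₂ ⊖ r₂ ⊗ a) ⊗ d)))) })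
       (a ∷ b ∷ d ∷ y₀ ∷ y₁ ∷ y₂ ∷ y₃ ∷ r₁ ∷ r₂ ∷ r₃ ∷ []) ≡.refl)
    ((a * b) ∙⟨ h₁ ⟩∙ 1# ⊞ a ∙⟨ h₂ ⟩∙ d ⊞ 1# ∙⟨ h₃ ⟩∙ (b * d) ⊞ 1# ∙⟨ c₁ (a * b) ⟩∙ 1# ⊞ 1# ∙⟨ c₂ a ⟩∙ d)

  braid-step : ∀ {u v a d s t} → u * a ≈ d * u + s → v * a ≈ d * v + t → s ≈ t → (u - v) * a ≈ d * (u - v)
  braid-step {u} {v} {a} {d} {s} {t} h₁ h₂ e = by
    (solve (λ { (u ∷ v ∷ a ∷ d ∷ s ∷ t ∷ []) → (u ⊖ v) ⊗ a , d ⊗ (u ⊖ v) ⊕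
       (𝟙 ⊗ (u ⊗ a ⊖ (d ⊗ u ⊕ s)) ⊗ 𝟙 ⊕ (⊝ 𝟙 ⊗ (v ⊗ a ⊖ (d ⊗ v ⊕ t)) ⊗ 𝟙 ⊕ 𝟙 ⊗ (s ⊖ t) ⊗ 𝟙)) })
       (u ∷ v ∷ a ∷ d ∷ s ∷ t ∷ []) ≡.refl)
    (1# ∙⟨ h₁ ⟩∙ 1# ⊞ (- 1#) ∙⟨ h₂ ⟩∙ 1# ⊞ 1# ∙⟨ e ⟩∙ 1#)

  -- Both words carry each variable to the same place, and their remainders differ only by multiples
  -- of squares of ∂. The bound on `n` makes i, i + 1 and i + 2 distinct residues, which `im` and
  -- `ji` rely on.
  braid : 3 ≤ n → ∀ i → ∂ i * ∂ (suc i) * ∂ i ≈ ∂ (suc i) * ∂ i * ∂ (suc i)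
  braid 3≤n i = -≈0⇒≈ (faithful i _ (van-- (van-∂ (∂ i * ∂ j) i) (van-∂ (∂ j * ∂ i) j)) step)
    where
    j = suc i
    m = suc j
    p = ∂ i
    q = ∂ j
    im : ∂ i * x m ≈ x m * ∂ i
    im = ∂x> ℕP.≤-refl (ℕP.+-monoˡ-≤ i 3≤n)
    ji : ∂ j * x i ≈ x i * ∂ j
    ji = ∂x< ℕP.≤-refl (ℕP.+-monoˡ-≤ i 3≤n)
    combine : ∀ {y₀ y₁ y₂ y₁′ y₂′ y₃ r₁ r₂ r₃ r₁′ r₂′ r₃′} →
      p * y₀ ≈ y₁ * p + r₁ → q * y₁ ≈ y₂ * q + r₂ → p * y₂ ≈ y₃ * p + r₃ → Central r₁ → Central r₂ →
      q * y₀ ≈ y₁′ * q + r₁′ → p * y₁′ ≈ y₂′ * p + r₂′ → q * y₂′ ≈ y₃ * q + r₃′ → Central r₁′ → Central r₂′ →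
      r₁ * (p * q) + r₂ * (p * p) + r₃ * (q * p) ≈ r₁′ * (q * p) + r₂′ * (q * q) + r₃′ * (p * q) →
      (p * q * p - q * p * q) * y₀ ≈ y₃ * (p * q * p - q * p * q)
    combine h₁ h₂ h₃ c₁ c₂ k₁ k₂ k₃ d₁ d₂ e = braid-step (triple h₁ h₂ h₃ c₁ c₂) (triple k₁ k₂ k₃ d₁ d₂) e
    step : ∀ k → i ≤ k → suc k ≤ n ℕ.+ i → Σ Carrier λ ψ → (p * q * p - q * p * q) * x k ≈ ψ * (p * q * p - q * p * q)
    step k i≤k k<n with window i k i≤k
    ... | inj₁ ≡.refl = _ , combine (∂x i) (∂x j) (plus-0 im) central-1 central-1
            (plus-0 ji) (∂x i) (∂x j) central-0 central-1
            (by (solve (λ { (p ∷ q ∷ []) → 𝟙 ⊗ (p ⊗ q) ⊕ 𝟙 ⊗ (p ⊗ p) ⊕ 𝟘 ⊗ (q ⊗ p) ,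
                  𝟘 ⊗ (q ⊗ p) ⊕ 𝟙 ⊗ (q ⊗ q) ⊕ 𝟙 ⊗ (p ⊗ q) ⊕ (𝟙 ⊗ (p ⊗ p ⊖ 𝟘) ⊗ 𝟙 ⊕ ⊝ 𝟙 ⊗ (q ⊗ q ⊖ 𝟘) ⊗ 𝟙) }) (p ∷ q ∷ []) ≡.refl)
              (1# ∙⟨ ∂² i ⟩∙ 1# ⊞ (- 1#) ∙⟨ ∂² j ⟩∙ 1#))
    ... | inj₂ (inj₁ ≡.refl) = _ , combine (∂x⁺ i) (plus-0 ji) (∂x i) central--1 central-0
            (∂x j) (plus-0 im) (∂x⁺ j) central-1 central-0
            (solve (λ { (p ∷ q ∷ []) → ⊝ 𝟙 ⊗ (p ⊗ q) ⊕ 𝟘 ⊗ (p ⊗ p) ⊕ 𝟙 ⊗ (q ⊗ p) ,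
                  𝟙 ⊗ (q ⊗ p) ⊕ 𝟘 ⊗ (q ⊗ q) ⊕ ⊝ 𝟙 ⊗ (p ⊗ q) }) (p ∷ q ∷ []) ≡.refl)
    ... | inj₂ (inj₂ r) with window m k r
    ...   | inj₁ ≡.refl = _ , combine (plus-0 im) (∂x⁺ j) (∂x⁺ i) central-0 central--1
            (∂x⁺ j) (∂x⁺ i) (plus-0 ji) central--1 central--1
            (by (solve (λ { (p ∷ q ∷ []) → 𝟘 ⊗ (p ⊗ q) ⊕ ⊝ 𝟙 ⊗ (p ⊗ p) ⊕ ⊝ 𝟙 ⊗ (q ⊗ p) ,
                  ⊝ 𝟙 ⊗ (q ⊗ p) ⊕ ⊝ 𝟙 ⊗ (q ⊗ q) ⊕ 𝟘 ⊗ (p ⊗ q) ⊕ (⊝ 𝟙 ⊗ (p ⊗ p ⊖ 𝟘) ⊗ 𝟙 ⊕ 𝟙 ⊗ (q ⊗ q ⊖ 𝟘) ⊗ 𝟙) }) (p ∷ q ∷ []) ≡.refl)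
              ((- 1#) ∙⟨ ∂² i ⟩∙ 1# ⊞ 1# ∙⟨ ∂² j ⟩∙ 1#))
    ...   | inj₂ s = _ , combine (plus-0 ik) (plus-0 jk) (plus-0 ik) central-0 central-0
              (plus-0 jk) (plus-0 ik) (plus-0 jk) central-0 central-0
            (solve (λ { (p ∷ q ∷ []) → 𝟘 ⊗ (p ⊗ q) ⊕ 𝟘 ⊗ (p ⊗ p) ⊕ 𝟘 ⊗ (q ⊗ p) ,
                  𝟘 ⊗ (q ⊗ p) ⊕ 𝟘 ⊗ (q ⊗ q) ⊕ 𝟘 ⊗ (p ⊗ q) }) (p ∷ q ∷ []) ≡.refl)
      where
      m<k : suc m ≤ k
      m<k = [ (λ e → ℕP.≤-reflexive (≡.sym e)) , ℕP.≤-trans (ℕP.n≤1+n _) ]′ s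
      ik : p * x k ≈ x k * p
      ik = ∂x> r k<n
      jk : q * x k ≈ x k * q
      jk = ∂x> m<k (ℕP.≤-trans k<n (ℕP.+-monoʳ-≤ n (ℕP.n≤1+n i)))

split< : ∀ {a b} → a < suc b → (a ≡ b) ⊎ (a < b)
split< p with ℕP.m<1+n⇒m<n∨m≡n p
... | inj₁ q = inj₂ q
... | inj₂ q = inj₁ q

-- Divided differences along intervals

module Intervals {c ℓ} {R : Ring c ℓ} {n : ℕ} (H : NilHecke R n) where
  open Ring R
  open NilHecke H
  open NilHeckeProps H
  open Solve R
  open Combination R
  open RingProps R using (-‿distribˡ-*; -‿distribʳ-*)

  Com : Carrier → Carrier → Set ℓ
  Com p q = p * q ≈ q * p

  com-* : ∀ {p q r} → Com p q → Com p r → Com p (q * r)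
  com-* {p} {q} {r} h₁ h₂ = by
    (solve (λ { (p ∷ q ∷ r ∷ []) → p ⊗ (q ⊗ r) , q ⊗ r ⊗ p ⊕ (𝟙 ⊗ (p ⊗ q ⊖ q ⊗ p) ⊗ r ⊕ q ⊗ (p ⊗ r ⊖ r ⊗ p) ⊗ 𝟙) })
      (p ∷ q ∷ r ∷ []) ≡.refl)
    (1# ∙⟨ h₁ ⟩∙ r ⊞ q ∙⟨ h₂ ⟩∙ 1#)

  com-cong : ∀ {p q q′} → q ≈ q′ → Com p q → Com p q′
  com-cong e h = trans (*-congˡ (sym e)) (trans h (*-congʳ e))

  -- T a b is the divided difference along the transposition of positions a < b
  T : ℕ → ℕ → Carrier
  T a zero = 0#
  T a (suc b) with a ℕ.≟ b
  ... | yes _ = ∂ b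
  ... | no _ = ∂ b * T a b * ∂ b

  T-one : ∀ a → T a (suc a) ≈ ∂ a
  T-one a with a ℕ.≟ a
  ... | yes _ = refl
  ... | no p = ⊥-elim (p ≡.refl)

  T-step : ∀ {a b} → a < b → T a (suc b) ≈ ∂ b * T a b * ∂ b
  T-step {a} {b} a<b with a ℕ.≟ b
  ... | yes p = ⊥-elim (ℕP.<⇒≢ a<b p)
  ... | no _ = refl

  com-T : ∀ {p a b} → a < b → (∀ k → a ≤ k → k < b → Com p (∂ k)) → Com p (T a b)
  com-T {p} {a} {suc b} a<b h with split< a<b
  ... | inj₁ ≡.refl = com-cong (sym (T-one a)) (h a ℕP.≤-refl ℕP.≤-refl)
  ... | inj₂ a<b′ = com-cong (sym (T-step a<b′))
    (com-* (com-* ∂b (com-T a<b′ λ k a≤k k<b → h k a≤k (ℕP.m<n⇒m<1+n k<b))) ∂b)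
    where
    ∂b = h b (ℕP.<⇒≤ a<b′) ℕP.≤-refl

  ∂T> : ∀ {a b j} → a < b → b < j → 2 ℕ.+ j ≤ n ℕ.+ a → Com (∂ j) (T a b)
  ∂T> a<b b<j j<n = com-T a<b λ k a≤k k<b →
    sym (∂-far (ℕP.≤-trans (s≤s k<b) b<j) (ℕP.≤-trans j<n (ℕP.+-monoʳ-≤ n a≤k)))

  -- The transposition of `a` and `b` has two palindromic reduced words; this is the one peeled from
  -- the left. A braid move handles length two, and far letters commute afterwards, which is where
  -- the interval must be shorter than a period.
  T-left : ∀ {a b} → suc a < b → b < n ℕ.+ a → T a b ≈ ∂ a * T (suc a) b * ∂ a
  T-left {a} {suc b} sa<b b<n with split< sa<b
  ... | inj₁ ≡.refl = trans (T-step ℕP.≤-refl) (trans (*-congʳ (*-congˡ (T-one a)))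
          (trans (sym (braid (ℕP.+-cancelʳ-≤ a 3 n b<n) a)) (*-congʳ (*-congˡ (sym (T-one (suc a)))))))
  ... | inj₂ sa<b′ = begin
    T a (suc b) ≈⟨ T-step (ℕP.<-trans (ℕP.n<1+n a) sa<b′) ⟩
    ∂ b * T a b * ∂ b ≈⟨ *-congʳ (*-congˡ (T-left sa<b′ (ℕP.<-trans (ℕP.n<1+n b) b<n))) ⟩
    ∂ b * (∂ a * T (suc a) b * ∂ a) * ∂ b ≈⟨ by
      (solve (λ { (a ∷ b ∷ t ∷ []) → b ⊗ (a ⊗ t ⊗ a) ⊗ b ,
        a ⊗ (b ⊗ t ⊗ b) ⊗ a ⊕ (⊝ 𝟙 ⊗ (a ⊗ b ⊖ b ⊗ a) ⊗ (t ⊗ a ⊗ b) ⊕ (a ⊗ b ⊗ t) ⊗ (a ⊗ b ⊖ b ⊗ a) ⊗ 𝟙) })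
        (∂ a ∷ ∂ b ∷ T (suc a) b ∷ []) ≡.refl)
      ((- 1#) ∙⟨ far ⟩∙ _ ⊞ _ ∙⟨ far ⟩∙ 1#) ⟩
    ∂ a * (∂ b * T (suc a) b * ∂ b) * ∂ a ≈⟨ *-congʳ (*-congˡ (T-step sa<b′)) ⟨
    ∂ a * T (suc a) (suc b) * ∂ a ∎
    where
    open SetoidReasoning setoid
    far = ∂-far sa<b′ b<n

  -- Letters far from `∂ i` commute with it. At its neighbour a braid move turns `∂ i` into
  -- `∂ (suc i)`, which passes through the inner `T a i`, and a second braid move turns it back.
  ∂-nest : ∀ {a i b} → a < i → suc i < b → b < n ℕ.+ a → Com (∂ i) (T a b)
  ∂-nest {a} {i} {suc b} a<i i<b b<n with split< i<b
  ... | inj₂ i<b′ = com-cong (sym (T-step (ℕP.<-trans a<i (ℕP.<-trans (ℕP.n<1+n i) i<b′))))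
          (com-* (com-* far (∂-nest a<i i<b′ (ℕP.<-trans (ℕP.n<1+n b) b<n))) far)
    where
    far : Com (∂ i) (∂ b)
    far = ∂-far i<b′ (ℕP.≤-trans b<n (ℕP.+-monoʳ-≤ n (ℕP.<⇒≤ a<i)))
  ... | inj₁ ≡.refl = com-cong (sym (trans (T-step (ℕP.m<n⇒m<1+n a<i)) (*-congʳ (*-congˡ (T-step a<i))))) (by
      (solve (λ { (p ∷ q ∷ t ∷ []) → p ⊗ (q ⊗ (p ⊗ t ⊗ p) ⊗ q) ,
        q ⊗ (p ⊗ t ⊗ p) ⊗ q ⊗ p ⊕ (𝟙 ⊗ (p ⊗ q ⊗ p ⊖ q ⊗ p ⊗ q) ⊗ (t ⊗ p ⊗ q) ⊕ ((q ⊗ p) ⊗ (q ⊗ t ⊖ t ⊗ q) ⊗ (p ⊗ q)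
         ⊕ (⊝ (q ⊗ p ⊗ t)) ⊗ (p ⊗ q ⊗ p ⊖ q ⊗ p ⊗ q) ⊗ 𝟙)) })
        (∂ i ∷ ∂ (suc i) ∷ T a i ∷ []) ≡.refl)
      (1# ∙⟨ br ⟩∙ _ ⊞ _ ∙⟨ ∂T> a<i ℕP.≤-refl b<n ⟩∙ _ ⊞ _ ∙⟨ br ⟩∙ 1#))
    where
    br = braid (ℕP.+-cancelʳ-≤ i 3 n (ℕP.≤-trans b<n (ℕP.+-monoʳ-≤ n (ℕP.<⇒≤ a<i)))) i

  T-nest : ∀ {a c d b} → a < c → c < d → d < b → b < n ℕ.+ a → Com (T c d) (T a b)
  T-nest a<c c<d d<b b<n = sym (com-T c<d λ k c≤k k<d →
    sym (∂-nest (ℕP.<-≤-trans a<c c≤k) (ℕP.≤-<-trans k<d d<b) b<n))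

  T-sep : ∀ {a b c d} → a < b → b < c → c < d → d < n ℕ.+ a → Com (T a b) (T c d)
  T-sep a<b b<c c<d d<n = com-T c<d λ k c≤k k<d →
    sym (∂T> a<b (ℕP.<-≤-trans b<c c≤k) (ℕP.≤-trans (s≤s k<d) d<n))

  *0* : ∀ {p q r} → q ≈ 0# → p * q * r ≈ 0#
  *0* e = trans (*-congʳ (trans (*-congˡ e) (zeroʳ _))) (zeroˡ _)

  T∂-start : ∀ {a b} → a < b → b < n ℕ.+ a → T a b * ∂ a ≈ 0#
  T∂-start {a} {suc b} a<b b<n with split< a<b
  ... | inj₁ ≡.refl = trans (*-congʳ (T-one a)) (∂² a)
  ... | inj₂ a<b′ = trans (*-congʳ (T-left (s≤s a<b′) b<n))
    (trans (solve (λ { (a ∷ t ∷ []) → (a ⊗ t ⊗ a) ⊗ a , (a ⊗ t) ⊗ (a ⊗ a) ⊗ 𝟙 }) (∂ a ∷ T (suc a) (suc b) ∷ []) ≡.refl) (*0* (∂² a)))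

  ∂T-end : ∀ {a b} → a < suc b → ∂ b * T a (suc b) ≈ 0#
  ∂T-end {a} {b} a<b with split< a<b
  ... | inj₁ ≡.refl = trans (*-congˡ (T-one a)) (∂² a)
  ... | inj₂ a<b′ = trans (*-congˡ (T-step a<b′))
    (trans (solve (λ { (a ∷ t ∷ []) → a ⊗ (a ⊗ t ⊗ a) , 𝟙 ⊗ (a ⊗ a) ⊗ (t ⊗ a) }) (∂ b ∷ T a b ∷ []) ≡.refl) (*0* (∂² b)))

  T∂-end : ∀ {a b} → a < suc b → T a (suc b) * ∂ b ≈ 0#
  T∂-end {a} {b} a<b with split< a<b
  ... | inj₁ ≡.refl = trans (*-congʳ (T-one a)) (∂² a)
  ... | inj₂ a<b′ = trans (*-congʳ (T-step a<b′))
    (trans (solve (λ { (a ∷ t ∷ []) → (a ⊗ t ⊗ a) ⊗ a , (a ⊗ t) ⊗ (a ⊗ a) ⊗ 𝟙 }) (∂ b ∷ T a b ∷ []) ≡.refl) (*0* (∂² b)))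

  -- In the left-peeled words the first factor ends and the second begins with `∂ a`, whose square
  -- is 0.
  T-same-start : ∀ {a b c} → a < b → b < n ℕ.+ a → a < c → c < n ℕ.+ a → T a b * T a c ≈ 0#
  T-same-start {a} {b} {suc c} a<b b<n a<c c<n with split< a<c
  ... | inj₁ ≡.refl = trans (*-congˡ (T-one a)) (T∂-start a<b b<n)
  ... | inj₂ a<c′ = trans (*-congˡ (T-left (s≤s a<c′) c<n))
    (trans (solve (λ { (s ∷ a ∷ t ∷ []) → s ⊗ (a ⊗ t ⊗ a) , 𝟙 ⊗ (s ⊗ a) ⊗ (t ⊗ a) })
      (T a b ∷ ∂ a ∷ T (suc a) (suc c) ∷ []) ≡.refl) (*0* (T∂-start a<b b<n)))

  T-same-end : ∀ {a b c} → a < b → c < b → T a b * T c b ≈ 0#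
  T-same-end {a} {suc b} {c} a<b c<b with split< c<b
  ... | inj₁ ≡.refl = trans (*-congˡ (T-one c)) (T∂-end a<b)
  ... | inj₂ c<b′ = trans (*-congˡ (T-step c<b′))
    (trans (solve (λ { (s ∷ a ∷ t ∷ []) → s ⊗ (a ⊗ t ⊗ a) , 𝟙 ⊗ (s ⊗ a) ⊗ (t ⊗ a) })
      (T a (suc b) ∷ ∂ b ∷ T c b ∷ []) ≡.refl) (*0* (T∂-end a<b)))

  -- The combined word is not reduced. The last letters of `T a b` lie strictly inside the other
  -- interval and commute past `T c d`; once b is c + 1, the letter `∂ c` meets its own copy.
  T-cross : ∀ {a c b d} → a < c → c < b → b < d → d < n ℕ.+ a → T a b * T c d ≈ 0# × T c d * T a b ≈ 0#
  T-cross {a} {c} {suc b} {d} a<c c<b b<d d<n with split< c<b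
  ... | inj₁ ≡.refl = trans (*-congˡ left) (trans (solve (λ { (s ∷ c ∷ t ∷ []) → s ⊗ (c ⊗ t ⊗ c) , 𝟙 ⊗ (s ⊗ c) ⊗ (t ⊗ c) })
                        (T a (suc c) ∷ ∂ c ∷ T (suc c) d ∷ []) ≡.refl) (*0* (T∂-end (ℕP.m<n⇒m<1+n a<c))))
                    , trans (*-congʳ left) (trans (solve (λ { (s ∷ c ∷ t ∷ []) → (c ⊗ t ⊗ c) ⊗ s , (c ⊗ t) ⊗ (c ⊗ s) ⊗ 𝟙 })
                        (T a (suc c) ∷ ∂ c ∷ T (suc c) d ∷ []) ≡.refl) (*0* (∂T-end (ℕP.m<n⇒m<1+n a<c))))
    where
    left = T-left b<d (ℕP.<-≤-trans d<n (ℕP.+-monoʳ-≤ n (ℕP.<⇒≤ a<c)))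
  ... | inj₂ c<b′ with T-cross a<c c<b′ (ℕP.<-trans (ℕP.n<1+n b) b<d) d<n
  ...   | z₁ , z₂ = trans (*-congʳ step) (by
            (solve (λ { (b ∷ s ∷ t ∷ []) → (b ⊗ s ⊗ b) ⊗ t , 𝟘 ⊕ ((b ⊗ s) ⊗ (b ⊗ t ⊖ t ⊗ b) ⊗ 𝟙 ⊕ b ⊗ (s ⊗ t ⊖ 𝟘) ⊗ b) })
              (∂ b ∷ T a b ∷ T c d ∷ []) ≡.refl)
            ((∂ b * T a b) ∙⟨ com ⟩∙ 1# ⊞ ∂ b ∙⟨ z₁ ⟩∙ ∂ b))
          , trans (*-congˡ step) (by
            (solve (λ { (b ∷ s ∷ t ∷ []) → t ⊗ (b ⊗ s ⊗ b) , 𝟘 ⊕ (⊝ 𝟙 ⊗ (b ⊗ t ⊖ t ⊗ b) ⊗ (s ⊗ b) ⊕ b ⊗ (t ⊗ s ⊖ 𝟘) ⊗ b) })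
              (∂ b ∷ T a b ∷ T c d ∷ []) ≡.refl)
            ((- 1#) ∙⟨ com ⟩∙ _ ⊞ ∂ b ∙⟨ z₂ ⟩∙ ∂ b))
    where
    step = T-step (ℕP.<-trans a<c c<b′)
    com = ∂-nest c<b′ b<d (ℕP.<-≤-trans d<n (ℕP.+-monoʳ-≤ n (ℕP.<⇒≤ a<c)))

  x-out : ∀ {a b k} → a < b → b < k → k < n ℕ.+ a → Com (x k) (T a b)
  x-out a<b b<k k<n = com-T a<b λ i a≤i i<b →
    sym (∂x> (ℕP.≤-trans (s≤s i<b) b<k) (ℕP.≤-trans k<n (ℕP.+-monoʳ-≤ n a≤i)))

  -- Source of the three-term relation. For b = c + 1 the two outer letters `∂ c` produce the
  -- Leibniz terms; each further letter commutes with x c and with `T a c`, so conjugation by it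
  -- carries the identity along.
  x-in : ∀ {a c b} → a < c → c < b → b < n ℕ.+ a →
         x c * T a b - T a b * x c ≈ T a c * T c b - T c b * T a c
  x-in {a} {c} {suc b} a<c c<b b<n with split< c<b
  ... | inj₁ ≡.refl = trans (+-cong (*-congˡ step) (-‿cong (*-congʳ step))) (trans (by
      (solve (λ { (x ∷ x′ ∷ d ∷ t ∷ []) → x ⊗ (d ⊗ t ⊗ d) ⊖ (d ⊗ t ⊗ d) ⊗ x , t ⊗ d ⊖ d ⊗ t
         ⊕ (⊝ 𝟙 ⊗ (d ⊗ x′ ⊖ (x ⊗ d ⊕ ⊝ 𝟙)) ⊗ (t ⊗ d) ⊕ (⊝ (d ⊗ t) ⊗ (d ⊗ x ⊖ (x′ ⊗ d ⊕ 𝟙)) ⊗ 𝟙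
         ⊕ d ⊗ (x′ ⊗ t ⊖ t ⊗ x′) ⊗ d)) })
        (x c ∷ x (suc c) ∷ ∂ c ∷ T a c ∷ []) ≡.refl)
      ((- 1#) ∙⟨ ∂x⁺ c ⟩∙ _ ⊞ _ ∙⟨ ∂x c ⟩∙ 1# ⊞ ∂ c ∙⟨ x-out a<c ℕP.≤-refl b<n ⟩∙ ∂ c))
      (sym (+-cong (*-congˡ (T-one c)) (-‿cong (*-congʳ (T-one c))))))
    where
    step = T-step a<c
  ... | inj₂ c<b′ = trans (+-cong (*-congˡ step) (-‿cong (*-congʳ step))) (trans (by
      (solve (λ { (x ∷ d ∷ t ∷ r ∷ s ∷ []) → x ⊗ (d ⊗ t ⊗ d) ⊖ (d ⊗ t ⊗ d) ⊗ x ,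
         r ⊗ (d ⊗ s ⊗ d) ⊖ (d ⊗ s ⊗ d) ⊗ r
         ⊕ (⊝ 𝟙 ⊗ (d ⊗ x ⊖ x ⊗ d) ⊗ (t ⊗ d) ⊕ (⊝ (d ⊗ t) ⊗ (d ⊗ x ⊖ x ⊗ d) ⊗ 𝟙
         ⊕ (d ⊗ (x ⊗ t ⊖ t ⊗ x ⊖ (r ⊗ s ⊖ s ⊗ r)) ⊗ d ⊕ (𝟙 ⊗ (d ⊗ r ⊖ r ⊗ d) ⊗ (s ⊗ d) ⊕ (d ⊗ s) ⊗ (d ⊗ r ⊖ r ⊗ d) ⊗ 𝟙)))) })
        (x c ∷ ∂ b ∷ T a b ∷ T a c ∷ T c b ∷ []) ≡.refl)
      ((- 1#) ∙⟨ xb ⟩∙ _ ⊞ _ ∙⟨ xb ⟩∙ 1# ⊞ ∂ b ∙⟨ x-in a<c c<b′ (ℕP.<-trans (ℕP.n<1+n b) b<n) ⟩∙ ∂ b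
       ⊞ 1# ∙⟨ bT ⟩∙ _ ⊞ _ ∙⟨ bT ⟩∙ 1#))
      (sym (+-cong (*-congˡ step′) (-‿cong (*-congʳ step′)))))
    where
    step = T-step (ℕP.<-trans a<c c<b′)
    step′ = T-step c<b′
    xb : ∂ b * x c ≈ x c * ∂ b
    xb = ∂x< c<b′ (ℕP.≤-trans b<n (ℕP.+-monoʳ-≤ n (ℕP.<⇒≤ a<c)))
    bT : Com (∂ b) (T a c)
    bT = ∂T> a<c c<b′ b<n

-- Finite sums, and commuting elements from three-term relations

module FinSum {c ℓ} (R : Ring c ℓ) where
  open Ring R
  open MonoidSum +-commutativeMonoid public using (sum; sum-cong-≋; sum-replicate-zero; ∑-distrib-+; ∑-comm; sum-permute)
  open RingProps R using (-0#≈0#; -‿+-comm)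

  sum-cong : ∀ {n} {f g : Fin n → Carrier} → (∀ i → f i ≈ g i) → sum f ≈ sum g
  sum-cong p = sum-cong-≋ p

  sum-zero : ∀ {n} {f : Fin n → Carrier} → (∀ i → f i ≈ 0#) → sum f ≈ 0#
  sum-zero {n} p = trans (sum-cong p) (sum-replicate-zero n)

  sum-*ˡ : ∀ {n} a (f : Fin n → Carrier) → a * sum f ≈ sum (λ i → a * f i)
  sum-*ˡ {zero} a f = zeroʳ a
  sum-*ˡ {suc n} a f = trans (distribˡ _ _ _) (+-congˡ (sum-*ˡ a (f ∘ F.suc)))

  sum-*ʳ : ∀ {n} a (f : Fin n → Carrier) → sum f * a ≈ sum (λ i → f i * a)
  sum-*ʳ {zero} a f = zeroˡ a
  sum-*ʳ {suc n} a f = trans (distribʳ _ _ _) (+-congˡ (sum-*ʳ a (f ∘ F.suc)))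

  sum-neg : ∀ {n} (f : Fin n → Carrier) → - sum f ≈ sum (λ i → - f i)
  sum-neg {zero} f = -0#≈0#
  sum-neg {suc n} f = trans (sym (-‿+-comm _ _)) (+-congˡ (sum-neg (f ∘ F.suc)))

  sum-only : ∀ {n} (f : Fin n → Carrier) k → (∀ i → i ≢ k → f i ≈ 0#) → sum f ≈ f k
  sum-only f F.zero p = trans (+-congˡ (sum-zero λ i → p (F.suc i) λ ())) (+-identityʳ _)
  sum-only f (F.suc k) p = trans (+-cong (p F.zero λ ()) (sum-only (f ∘ F.suc) k λ i q → p (F.suc i) (q ∘ FP.suc-injective))) (+-identityˡ _)

  sum-split : ∀ {n} (f g : Fin n → Carrier) k → (∀ i → i ≢ k → f i ≈ g i) → g k ≈ 0# → sum f ≈ f k + sum g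
  sum-split f g F.zero p e = trans (+-congˡ (sum-cong λ i → p (F.suc i) λ ())) (+-congˡ (sym (trans (+-congʳ e) (+-identityˡ _))))
  sum-split f g (F.suc k) p e = begin
    f F.zero + sum (f ∘ F.suc) ≈⟨ +-cong (p F.zero λ ()) (sum-split (f ∘ F.suc) (g ∘ F.suc) k (λ i q → p (F.suc i) (q ∘ FP.suc-injective)) e) ⟩
    g F.zero + (f (F.suc k) + sum (g ∘ F.suc)) ≈⟨ +-assoc _ _ _ ⟨
    (g F.zero + f (F.suc k)) + sum (g ∘ F.suc) ≈⟨ +-congʳ (+-comm _ _) ⟩
    (f (F.suc k) + g F.zero) + sum (g ∘ F.suc) ≈⟨ +-assoc _ _ _ ⟩
    f (F.suc k) + sum g ∎
    where open SetoidReasoning setoid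

-- Commuting Dunkl-type elements: antisymmetric A k l = V k l − V l k with commuting
-- disjoint pairs and a three-term relation for every triple.
module Dunkl {c ℓ} (R : Ring c ℓ) {n : ℕ} (x : Fin n → Ring.Carrier R) (V : Fin n → Fin n → Ring.Carrier R) where
  open Ring R
  open Solve R
  open Combination R
  open FinSum R

  com : Carrier → Carrier → Carrier
  com p q = p * q - q * p

  A : Fin n → Fin n → Carrier
  A k l = V k l - V l k

  D : Fin n → Carrier
  D k = x k + sum (A k)

  triple : Fin n → Fin n → Fin n → Carrier
  triple k l m = (com (x k) (A l m) + com (A k l) (A l m)) + ((com (x l) (A m k) + com (A l m) (A m k))
    + (com (x m) (A k l) + com (A m k) (A k l)))

  com-sumʳ : ∀ p (f : Fin n → Carrier) → com p (sum f) ≈ sum (λ i → com p (f i))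
  com-sumʳ p f = trans (+-cong (sum-*ˡ p f) (trans (-‿cong (sum-*ʳ p f)) (sum-neg (λ i → f i * p))))
    (sym (∑-distrib-+ (λ i → p * f i) (λ i → - (f i * p))))

  com-anti : ∀ p q → com p q ≈ - com q p
  com-anti p q = solve (λ { (p ∷ q ∷ []) → p ⊗ q ⊖ q ⊗ p , ⊝ (q ⊗ p ⊖ p ⊗ q) }) (p ∷ q ∷ []) ≡.refl

  com-sumˡ : ∀ p (f : Fin n → Carrier) → com (sum f) p ≈ sum (λ i → com (f i) p)
  com-sumˡ p f = trans (com-anti (sum f) p) (trans (-‿cong (com-sumʳ p f))
    (trans (sum-neg (λ i → com p (f i))) (sum-cong λ i → sym (com-anti (f i) p))))

  com-+ : ∀ a b p q → com (a + b) (p + q) ≈ ((com a p + com a q) + com b p) + com b q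
  com-+ a b p q = solve (λ { (a ∷ b ∷ p ∷ q ∷ []) → (a ⊕ b) ⊗ (p ⊕ q) ⊖ (p ⊕ q) ⊗ (a ⊕ b) ,
    (((a ⊗ p ⊖ p ⊗ a) ⊕ (a ⊗ q ⊖ q ⊗ a)) ⊕ (b ⊗ p ⊖ p ⊗ b)) ⊕ (b ⊗ q ⊖ q ⊗ b) }) (a ∷ b ∷ p ∷ q ∷ []) ≡.refl

  com-A₀ : ∀ k p → com (A k k) p ≈ 0#
  com-A₀ k p = solve (λ { (v ∷ p ∷ []) → (v ⊖ v) ⊗ p ⊖ p ⊗ (v ⊖ v) , 𝟘 }) (V k k ∷ p ∷ []) ≡.refl

  com-A₁ : ∀ k l → com (A k l) (A l k) ≈ 0#
  com-A₁ k l = solve (λ { (v ∷ w ∷ []) → (v ⊖ w) ⊗ (w ⊖ v) ⊖ (w ⊖ v) ⊗ (v ⊖ w) , 𝟘 }) (V k l ∷ V l k ∷ []) ≡.refl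

  module _ (x-com : ∀ k l → com (x k) (x l) ≈ 0#)
           (disjoint : ∀ {k b l m} → k ≢ b → k ≢ l → k ≢ m → b ≢ l → b ≢ m → l ≢ m → com (A k b) (A l m) ≈ 0#)
           (triple-0 : ∀ {k l m} → k ≢ l → k ≢ m → l ≢ m → triple k l m ≈ 0#)
           (x-sum : sum x ≈ 0#) where

    -- only pairs {k,b}, {l,m} sharing a point contribute
    row : ∀ {k l} → k ≢ l → ∀ b → b ≢ l → sum (λ m → com (A k b) (A l m)) ≈ com (A k b) (A l k) + com (A k b) (A l b)
    row {k} {l} k≢l b b≢l with k F.≟ b
    ... | yes ≡.refl = trans (sum-zero λ m → com-A₀ k (A l m)) (sym (trans (+-cong (com-A₀ k (A l k)) (com-A₀ k (A l k))) (+-identityˡ 0#)))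
    ... | no k≢b = begin
      sum f ≈⟨ sum-split f g k (λ m m≢k → f≈g m m≢k) gk ⟩
      f k + sum g ≈⟨ +-congˡ (trans (sum-only g b g-other) gb) ⟩
      f k + f b ∎
      where
      open SetoidReasoning setoid
      f : Fin n → Carrier
      f m = com (A k b) (A l m)
      g : Fin n → Carrier
      g m with m F.≟ k
      ... | yes _ = 0#
      ... | no _ = f m
      f≈g : ∀ m → m ≢ k → f m ≈ g m
      f≈g m m≢k with m F.≟ k
      ... | yes p = ⊥-elim (m≢k p)
      ... | no _ = refl
      gk : g k ≈ 0#
      gk with k F.≟ k
      ... | yes _ = refl
      ... | no p = ⊥-elim (p ≡.refl)
      gb : g b ≈ f b
      gb with b F.≟ k
      ... | yes p = ⊥-elim (k≢b (≡.sym p))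
      ... | no _ = refl
      g-other : ∀ m → m ≢ b → g m ≈ 0#
      g-other m m≢b with m F.≟ k
      ... | yes _ = refl
      ... | no m≢k with l F.≟ m
      ...   | yes ≡.refl = trans (com-anti _ _) (trans (-‿cong (com-A₀ l _)) (RingProps.-0#≈0# R))
      ...   | no l≢m = disjoint k≢b k≢l (m≢k ∘ ≡.sym) b≢l (m≢b ∘ ≡.sym) l≢m

    -- Expanding the commutator and grouping by a third index `m`, the three-term relation for k, l,
    -- m replaces each group by -[x m, A k l]; for m equal to k or l this holds formally. The total
    -- is -[Σ x, A k l], and Σ x = 0.
    D-comm : ∀ k l → D k * D l ≈ D l * D k
    D-comm k l with k F.≟ l
    ... | yes ≡.refl = refl
    ... | no k≢l = -≈0⇒≈ (begin
      com (D k) (D l) ≈⟨ com-+ _ _ _ _ ⟩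
      ((com (x k) (x l) + com (x k) (sum (A l))) + com (sum (A k)) (x l)) + com (sum (A k)) (sum (A l))
        ≈⟨ +-cong (+-cong (trans (+-cong (x-com k l) (com-sumʳ (x k) (A l))) (+-identityˡ _)) (com-sumˡ (x l) (A k))) quad ⟩
      (sum (λ m → com (x k) (A l m)) + sum (λ m → com (A k m) (x l))) + (sum f₁ + sum f₂)
        ≈⟨ +-cong (sym (∑-distrib-+ (λ m → com (x k) (A l m)) _)) (sym (∑-distrib-+ f₁ f₂)) ⟩
      sum (λ m → com (x k) (A l m) + com (A k m) (x l)) + sum (λ m → f₁ m + f₂ m)
        ≈⟨ ∑-distrib-+ (λ m → com (x k) (A l m) + com (A k m) (x l)) _ ⟨
      sum (λ m → (com (x k) (A l m) + com (A k m) (x l)) + (f₁ m + f₂ m)) ≈⟨ sum-cong each ⟩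
      sum (λ m → - com (x m) (A k l)) ≈⟨ sum-neg (λ m → com (x m) (A k l)) ⟨
      - sum (λ m → com (x m) (A k l)) ≈⟨ -‿cong (com-sumˡ (A k l) x) ⟨
      - com (sum x) (A k l) ≈⟨ -‿cong (+-cong (*-congʳ x-sum) (-‿cong (*-congˡ x-sum))) ⟩
      - com 0# (A k l) ≈⟨ solve (λ { (a ∷ []) → ⊝ (𝟘 ⊗ a ⊖ a ⊗ 𝟘) , 𝟘 }) (A k l ∷ []) ≡.refl ⟩
      0# ∎)
      where
      open SetoidReasoning setoid
      f₁ f₂ : Fin n → Carrier
      f₁ m = com (A k l) (A l m)
      f₂ m = com (A k m) (A l k) + com (A k m) (A l m)
      quad : com (sum (A k)) (sum (A l)) ≈ sum f₁ + sum f₂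
      quad = trans (com-sumˡ (sum (A l)) (A k)) (trans (sum-cong λ b → com-sumʳ (A k b) (A l))
        (sum-split _ f₂ l (λ b b≢l → row k≢l b b≢l) (trans (+-cong (com-A₁ k l)
           (trans (com-anti (A k l) (A l l)) (trans (-‿cong (com-A₀ l (A k l))) (RingProps.-0#≈0# R)))) (+-identityˡ 0#))))
      each : ∀ m → (com (x k) (A l m) + com (A k m) (x l)) + (f₁ m + f₂ m) ≈ - com (x m) (A k l)
      each m with m F.≟ k | m F.≟ l
      ... | yes ≡.refl | _ = solve (λ { (x ∷ y ∷ u ∷ v ∷ w ∷ []) →
              ((x ⊗ (v ⊖ u) ⊖ (v ⊖ u) ⊗ x) ⊕ ((w ⊖ w) ⊗ y ⊖ y ⊗ (w ⊖ w)))
                ⊕ (((u ⊖ v) ⊗ (v ⊖ u) ⊖ (v ⊖ u) ⊗ (u ⊖ v)) ⊕ (((w ⊖ w) ⊗ (v ⊖ u) ⊖ (v ⊖ u) ⊗ (w ⊖ w)) ⊕ ((w ⊖ w) ⊗ (v ⊖ u) ⊖ (v ⊖ u) ⊗ (w ⊖ w)))) ,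
              ⊝ (x ⊗ (u ⊖ v) ⊖ (u ⊖ v) ⊗ x) }) (x k ∷ x l ∷ V k l ∷ V l k ∷ V k k ∷ []) ≡.refl
      ... | no _ | yes ≡.refl = solve (λ { (x ∷ y ∷ u ∷ v ∷ w ∷ []) →
              ((x ⊗ (w ⊖ w) ⊖ (w ⊖ w) ⊗ x) ⊕ ((u ⊖ v) ⊗ y ⊖ y ⊗ (u ⊖ v)))
                ⊕ (((u ⊖ v) ⊗ (w ⊖ w) ⊖ (w ⊖ w) ⊗ (u ⊖ v)) ⊕ (((u ⊖ v) ⊗ (v ⊖ u) ⊖ (v ⊖ u) ⊗ (u ⊖ v)) ⊕ ((u ⊖ v) ⊗ (w ⊖ w) ⊖ (w ⊖ w) ⊗ (u ⊖ v)))) ,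
              ⊝ (y ⊗ (u ⊖ v) ⊖ (u ⊖ v) ⊗ y) }) (x k ∷ x l ∷ V k l ∷ V l k ∷ V l l ∷ []) ≡.refl
      ... | no m≢k | no m≢l = by
              (solve (λ { (xk ∷ xl ∷ xm ∷ kl ∷ lk ∷ lm ∷ ml ∷ mk ∷ km ∷ []) →
                 let c : Expr 9 → Expr 9 → Expr 9
                     c = λ p q → p ⊗ q ⊖ q ⊗ p
                 in (c xk (lm ⊖ ml) ⊕ c (km ⊖ mk) xl) ⊕ (c (kl ⊖ lk) (lm ⊖ ml) ⊕ (c (km ⊖ mk) (lk ⊖ kl) ⊕ c (km ⊖ mk) (lm ⊖ ml))) ,
                    ⊝ c xm (kl ⊖ lk) ⊕ 𝟙 ⊗ (((c xk (lm ⊖ ml) ⊕ c (kl ⊖ lk) (lm ⊖ ml)) ⊕ ((c xl (mk ⊖ km) ⊕ c (lm ⊖ ml) (mk ⊖ km))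
                       ⊕ (c xm (kl ⊖ lk) ⊕ c (mk ⊖ km) (kl ⊖ lk)))) ⊖ 𝟘) ⊗ 𝟙 })
                (x k ∷ x l ∷ x m ∷ V k l ∷ V l k ∷ V l m ∷ V m l ∷ V m k ∷ V k m ∷ []) ≡.refl)
              (1# ∙⟨ triple-0 k≢l (m≢k ∘ ≡.sym) (m≢l ∘ ≡.sym) ⟩∙ 1#)

-- Quantum intervals and the commutation of the operators 𝒳

module IntervalProduct {c ℓ} (R : Ring c ℓ) (q : ℕ → Ring.Carrier R)
                       (q-central : ∀ i φ → Ring._≈_ R (Ring._*_ R (q i) φ) (Ring._*_ R φ (q i))) where
  open Ring R
  open Solve R
  open Combination R

  -- This is q_a ⋯ q_{b-1} when a < b; outside this range the value carries no meaning. The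
  -- recursion follows that of `T`.
  Q : ℕ → ℕ → Carrier
  Q a zero = 1#
  Q a (suc b) with a ℕ.≟ b
  ... | yes _ = q b
  ... | no _ = q b * Q a b

  Q-one : ∀ a → Q a (suc a) ≈ q a
  Q-one a with a ℕ.≟ a
  ... | yes _ = refl
  ... | no p = ⊥-elim (p ≡.refl)

  Q-step : ∀ {a b} → a < b → Q a (suc b) ≈ q b * Q a b
  Q-step {a} {b} a<b with a ℕ.≟ b
  ... | yes p = ⊥-elim (ℕP.<⇒≢ a<b p)
  ... | no _ = refl

  central-* : ∀ {p r} → (∀ φ → p * φ ≈ φ * p) → (∀ φ → r * φ ≈ φ * r) → ∀ φ → (p * r) * φ ≈ φ * (p * r)
  central-* {p} {r} h k φ = by
    (solve (λ { (p ∷ r ∷ φ ∷ []) → p ⊗ r ⊗ φ , φ ⊗ (p ⊗ r) ⊕ (p ⊗ (r ⊗ φ ⊖ φ ⊗ r) ⊗ 𝟙 ⊕ 𝟙 ⊗ (p ⊗ φ ⊖ φ ⊗ p) ⊗ r) }) (p ∷ r ∷ φ ∷ []) ≡.refl)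
    (p ∙⟨ k φ ⟩∙ 1# ⊞ 1# ∙⟨ h φ ⟩∙ r)

  Q-central : ∀ a b φ → Q a b * φ ≈ φ * Q a b
  Q-central a zero φ = trans (*-identityˡ φ) (sym (*-identityʳ φ))
  Q-central a (suc b) φ with a ℕ.≟ b
  ... | yes _ = q-central b φ
  ... | no _ = central-* (q-central b) (Q-central a b) φ

  Q-split : ∀ {a c b} → a < c → c < b → Q a b ≈ Q a c * Q c b
  Q-split {a} {c} {suc b} a<c c<b with split< c<b
  ... | inj₁ ≡.refl = trans (Q-step a<c) (trans (q-central c _) (*-congˡ (sym (Q-one c))))
  ... | inj₂ c<b′ = trans (Q-step (ℕP.<-trans a<c c<b′)) (trans (*-congˡ (Q-split a<c c<b′)) (by
      (solve (λ { (q ∷ r ∷ s ∷ []) → q ⊗ (r ⊗ s) , r ⊗ (q ⊗ s) ⊕ 𝟙 ⊗ (q ⊗ r ⊖ r ⊗ q) ⊗ s }) (q b ∷ Q a c ∷ Q c b ∷ []) ≡.refl)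
      (trans (1# ∙⟨ q-central b (Q a c) ⟩∙ _) refl)) ⟫ *-congˡ (sym (Q-step c<b′)))
    where
    infixl 4 _⟫_
    _⟫_ = trans

record QuantumNilHecke {c ℓ} (R : Ring c ℓ) (n : ℕ) : Set (Level.suc (c ⊔ ℓ)) where
  open Ring R
  field
    nilHecke : NilHecke R n
  open NilHecke nilHecke public
  field
    q : ℕ → Carrier
    q-central : ∀ i φ → q i * φ ≈ φ * q i
    x-per : ∀ i → x (n ℕ.+ i) ≈ x i
    ∂-per : ∀ i → ∂ (n ℕ.+ i) ≈ ∂ i
    q-per : ∀ i → q (n ℕ.+ i) ≈ q i
    Q-full : ∀ a → IntervalProduct.Q R q q-central a (n ℕ.+ a) ≈ 0#
    x-sum : FinSum.sum R (λ (k : Fin n) → x (toℕ k)) ≈ 0#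

module Commutation {c ℓ} {R : Ring c ℓ} {n : ℕ} (H : QuantumNilHecke R n) where
  open Ring R
  open QuantumNilHecke H
  open IntervalProduct R q q-central public
  open NilHeckeProps nilHecke
  open Intervals nilHecke public
  open Solve R
  open Combination R

  -- `T` and `Q` are unfolded together since degree counts compare the number of letters of one with
  -- the number of factors of the other.
  TQ-elim : (P : Carrier → Carrier → Set) → (∀ b → P (∂ b) (q b)) → (∀ b {t s} → P t s → P (∂ b * t * ∂ b) (q b * s)) →
            ∀ {a b} → a < b → P (T a b) (Q a b)
  TQ-elim P base step {a} {suc b} a<b with a ℕ.≟ b
  ... | yes _ = base b
  ... | no p = step b (TQ-elim P base step (ℕP.≤∧≢⇒< (ℕP.m<1+n⇒m≤n a<b) p))

  U : ℕ → ℕ → Carrier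
  U a b = Q a b * T a b

  U-def : ∀ a b → U a b ≡ Q a b * T a b
  U-def a b = ≡.refl

  module _ {r s p t : Carrier} (hr : ∀ φ → r * φ ≈ φ * r) (hs : ∀ φ → s * φ ≈ φ * s) where

    U*U : (r * p) * (s * t) ≈ (r * s) * (p * t)
    U*U = by (solve (λ { (r ∷ s ∷ p ∷ t ∷ []) → (r ⊗ p) ⊗ (s ⊗ t) , (r ⊗ s) ⊗ (p ⊗ t) ⊕ ⊝ r ⊗ (s ⊗ p ⊖ p ⊗ s) ⊗ t }) (r ∷ s ∷ p ∷ t ∷ []) ≡.refl)
             ((- r) ∙⟨ hs p ⟩∙ t)

  UU : ∀ a b c d → U a b * U c d ≈ (Q a b * Q c d) * (T a b * T c d)
  UU a b c d = U*U (Q-central a b) (Q-central c d)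

  UU-0 : ∀ a b c d → T a b * T c d ≈ 0# → U a b * U c d ≈ 0#
  UU-0 a b c d e = trans (UU a b c d) (trans (*-congˡ e) (zeroʳ _))

  UU-0′ : ∀ a b c d → Q a b * Q c d ≈ 0# → U a b * U c d ≈ 0#
  UU-0′ a b c d e = trans (UU a b c d) (trans (*-congʳ e) (zeroˡ _))

  UU-com : ∀ a b c d → Com (T a b) (T c d) → Com (U a b) (U c d)
  UU-com a b c d h = trans (UU a b c d) (trans (*-cong (Q-central a b (Q c d)) h) (sym (UU c d a b)))

  com-0 : ∀ {p r} → p * r ≈ 0# → r * p ≈ 0# → Com p r
  com-0 e f = trans e (sym f)

  T-per : ∀ {a b} → a < b → T (n ℕ.+ a) (n ℕ.+ b) ≈ T a b
  T-per {a} {suc b} a<b rewrite ℕP.+-suc n b with split< a<b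
  ... | inj₁ ≡.refl = trans (T-one (n ℕ.+ a)) (trans (∂-per a) (sym (T-one a)))
  ... | inj₂ a<b′ = trans (T-step (ℕP.+-monoʳ-< n a<b′))
    (trans (*-cong (*-cong (∂-per b) (T-per a<b′)) (∂-per b)) (sym (T-step a<b′)))

  Q-per : ∀ {a b} → a < b → Q (n ℕ.+ a) (n ℕ.+ b) ≈ Q a b
  Q-per {a} {suc b} a<b rewrite ℕP.+-suc n b with split< a<b
  ... | inj₁ ≡.refl = trans (Q-one (n ℕ.+ a)) (trans (q-per a) (sym (Q-one a)))
  ... | inj₂ a<b′ = trans (Q-step (ℕP.+-monoʳ-< n a<b′))
    (trans (*-cong (q-per b) (Q-per a<b′)) (sym (Q-step a<b′)))

  U-per : ∀ {a b} → a < b → U (n ℕ.+ a) (n ℕ.+ b) ≈ U a b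
  U-per a<b = *-cong (Q-per a<b) (T-per a<b)

  -- The two intervals overlap and together contain the full period from `a` to n + a; the factors
  -- over [a, c) and [c, n + a) already multiply to q_1 ⋯ q_n = 0.
  Q-cover : ∀ {a c b d} → a < c → c < b → c < n ℕ.+ a → n ℕ.+ a ≤ d → Q a b * Q c d ≈ 0#
  Q-cover {a} {c} {b} {d} a<c c<b c<n n≤d = begin
    Q a b * Q c d ≈⟨ *-cong (trans (Q-split a<c c<b) (Q-central a c _)) (proj₂ tail) ⟩
    (Q c b * Q a c) * (Q c (n ℕ.+ a) * proj₁ tail)
      ≈⟨ solve (λ { (u ∷ v ∷ w ∷ z ∷ []) → (u ⊗ v) ⊗ (w ⊗ z) , u ⊗ (v ⊗ w) ⊗ z }) (Q c b ∷ Q a c ∷ Q c (n ℕ.+ a) ∷ proj₁ tail ∷ []) ≡.refl ⟩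
    Q c b * (Q a c * Q c (n ℕ.+ a)) * proj₁ tail ≈⟨ *0* (trans (sym (Q-split a<c c<n)) (Q-full a)) ⟩
    0# ∎
    where
    open SetoidReasoning setoid
    tail : Σ Carrier λ z → Q c d ≈ Q c (n ℕ.+ a) * z
    tail with ℕP.m≤n⇒m<n∨m≡n n≤d
    ... | inj₂ ≡.refl = 1# , sym (*-identityʳ _)
    ... | inj₁ n<d = Q (n ℕ.+ a) d , Q-split c<n n<d

  U-cover : ∀ {a c b d} → a < c → c < b → c < n ℕ.+ a → n ℕ.+ a ≤ d → U a b * U c d ≈ 0# × U c d * U a b ≈ 0#
  U-cover {a} {c} {b} {d} a<c c<b c<n n≤d = UU-0′ a b c d e , UU-0′ c d a b (trans (Q-central c d (Q a b)) e)
    where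
    e = Q-cover a<c c<b c<n n≤d

  U-cross : ∀ {a c b d} → a < c → c < b → b < d → d < n ℕ.+ a → Com (U a b) (U c d)
  U-cross {a} {c} {b} {d} a<c c<b b<d d<n = com-0 (UU-0 a b c d (proj₁ z)) (UU-0 c d a b (proj₂ z))
    where
    z = T-cross a<c c<b b<d d<n

  U-nest : ∀ {a c d b} → a < c → c < d → d < b → b < n ℕ.+ a → Com (U c d) (U a b)
  U-nest {a} {c} {d} {b} a<c c<d d<b b<n = UU-com c d a b (T-nest a<c c<d d<b b<n)

  U-sep : ∀ {a b c d} → a < b → b < c → c < d → d < n ℕ.+ a → Com (U a b) (U c d)
  U-sep {a} {b} {c} {d} a<b b<c c<d d<n = UU-com a b c d (T-sep a<b b<c c<d d<n)

  U-same-start : ∀ {a b c} → a < b → b < n ℕ.+ a → a < c → c < n ℕ.+ a → U a b * U a c ≈ 0#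
  U-same-start {a} {b} {c} a<b b<n a<c c<n = UU-0 a b a c (T-same-start a<b b<n a<c c<n)

  U-same-end : ∀ {a b c} → a < b → c < b → U a b * U c b ≈ 0#
  U-same-end {a} {b} {c} a<b c<b = UU-0 a b c b (T-same-end a<b c<b)

  Ux-out : ∀ {a b k} → a < b → b < k → k < n ℕ.+ a → Com (x k) (U a b)
  Ux-out {a} {b} {k} a<b b<k k<n = com-* (sym (Q-central a b (x k))) (x-out a<b b<k k<n)

  -- `x-in` with its q-factor: `Q a b` splits at `c` exactly into the factors that `U a c` and
  -- `U c b` require.
  Ux-in : ∀ {a c b} → a < c → c < b → b < n ℕ.+ a → x c * U a b - U a b * x c ≈ U a c * U c b - U c b * U a c
  Ux-in {a} {c} {b} a<c c<b b<n = begin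
    x c * U a b - U a b * x c ≈⟨ by
      (solve (λ { (x ∷ r ∷ t ∷ []) → x ⊗ (r ⊗ t) ⊖ (r ⊗ t) ⊗ x , r ⊗ (x ⊗ t ⊖ t ⊗ x) ⊕ ⊝ 𝟙 ⊗ (r ⊗ x ⊖ x ⊗ r) ⊗ t }) (x c ∷ Q a b ∷ T a b ∷ []) ≡.refl)
      ((- 1#) ∙⟨ Q-central a b (x c) ⟩∙ T a b) ⟩
    Q a b * (x c * T a b - T a b * x c) ≈⟨ *-cong (Q-split a<c c<b) (x-in a<c c<b b<n) ⟩
    (Q a c * Q c b) * (T a c * T c b - T c b * T a c) ≈⟨ by
      (solve (λ { (r ∷ s ∷ p ∷ t ∷ []) → (r ⊗ s) ⊗ (p ⊗ t ⊖ t ⊗ p) , ((r ⊗ s) ⊗ (p ⊗ t) ⊖ (s ⊗ r) ⊗ (t ⊗ p)) ⊕ ⊝ 𝟙 ⊗ (r ⊗ s ⊖ s ⊗ r) ⊗ (t ⊗ p) })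
        (Q a c ∷ Q c b ∷ T a c ∷ T c b ∷ []) ≡.refl)
      ((- 1#) ∙⟨ Q-central a c (Q c b) ⟩∙ _) ⟩
    (Q a c * Q c b) * (T a c * T c b) - (Q c b * Q a c) * (T c b * T a c) ≈⟨ +-cong (sym (UU a c c b)) (-‿cong (sym (UU c b a c))) ⟩
    U a c * U c b - U c b * U a c ∎
    where open SetoidReasoning setoid

  -- U of the cyclic interval from k to l, which for k = l is a full period, where U vanishes
  V : ℕ → ℕ → Carrier
  V k l with k ℕ.<? l
  ... | yes _ = U k l
  ... | no _ = U k (n ℕ.+ l)

  V< : ∀ {k l} → k < l → V k l ≈ U k l
  V< {k} {l} k<l with k ℕ.<? l
  ... | yes _ = refl
  ... | no p = ⊥-elim (p k<l)

  V> : ∀ {k l} → k < l → V l k ≈ U l (n ℕ.+ k)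
  V> {k} {l} k<l with l ℕ.<? k
  ... | yes p = ⊥-elim (ℕP.<-asym k<l p)
  ... | no _ = refl

  V-elim : (P : Carrier → Set) → (∀ {a b} → a < b → P (U a b)) → ∀ {k l} → k < n → P (V k l)
  V-elim P h {k} {l} k<n with k ℕ.<? l
  ... | yes p = h p
  ... | no _ = h (ℕP.<-≤-trans k<n (ℕP.m≤m+n n l))

  -- Straightens the arc from `k` to `l` to an interval starting at `k`, so that later arguments
  -- avoid the case distinction in `V`; b = n + k occurs exactly for k = l.
  V-interval : ∀ {k l} → k < n → l < n → Σ ℕ λ b → k < b × b ≤ n ℕ.+ k × (b ≡ l ⊎ b ≡ n ℕ.+ l) × V k l ≡ U k b
  V-interval {k} {l} k<n l<n with k ℕ.<? l
  ... | yes p = l , p , ℕP.<⇒≤ (up l<n) , inj₁ ≡.refl , ≡.refl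
    where
    up : l < n → l < n ℕ.+ k
    up q = ℕP.<-≤-trans q (ℕP.m≤m+n n k)
  ... | no p = n ℕ.+ l , ℕP.<-≤-trans k<n (ℕP.m≤m+n n l) , ℕP.+-monoʳ-≤ n (ℕP.≮⇒≥ p) , inj₂ ≡.refl , ≡.refl

  xᶠ : Fin n → Carrier
  xᶠ k = x (toℕ k)

  Vᶠ : Fin n → Fin n → Carrier
  Vᶠ k l = V (toℕ k) (toℕ l)

  open Dunkl R xᶠ Vᶠ using (A; D; com; triple; D-comm)

  Aⁿ : ℕ → ℕ → Carrier
  Aⁿ k l = V k l - V l k

  up : ∀ {k l} → l < n → l < n ℕ.+ k
  up {k} l<n = ℕP.<-≤-trans l<n (ℕP.m≤m+n n k)

  shift : ∀ {k l} → k < l → n ℕ.+ k < n ℕ.+ l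
  shift = ℕP.+-monoʳ-< n

  com-sym : ∀ {p r} → Com p r → Com r p
  com-sym = sym

  com-congˡ : ∀ {p p′ r} → p ≈ p′ → Com p r → Com p′ r
  com-congˡ e h = com-sym (com-cong e (com-sym h))

  com-both : ∀ {p p′ r r′} → p ≈ p′ → r ≈ r′ → Com p′ r′ → Com p r
  com-both e f h = com-congˡ (sym e) (com-cong (sym f) h)

  com-minus : ∀ {p r s} → Com p r → Com p s → Com p (r - s)
  com-minus {p} {r} {s} h k = by (solve (λ { (p ∷ r ∷ s ∷ []) → p ⊗ (r ⊖ s) , (r ⊖ s) ⊗ p ⊕ (𝟙 ⊗ (p ⊗ r ⊖ r ⊗ p) ⊗ 𝟙 ⊕ ⊝ 𝟙 ⊗ (p ⊗ s ⊖ s ⊗ p) ⊗ 𝟙) })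
    (p ∷ r ∷ s ∷ []) ≡.refl) (1# ∙⟨ h ⟩∙ 1# ⊞ (- 1#) ∙⟨ k ⟩∙ 1#)

  com-A : ∀ k b l c → Com (V k b) (V l c) → Com (V k b) (V c l) → Com (V b k) (V l c) → Com (V b k) (V c l) →
          Com (Aⁿ k b) (Aⁿ l c)
  com-A k b l c h₁ h₂ h₃ h₄ = com-sym (com-minus (com-sym (com-minus h₁ h₂)) (com-sym (com-minus h₃ h₄)))

  com-A-flip : ∀ k b {r} → Com (Aⁿ k b) r → Com (Aⁿ b k) r
  com-A-flip k b {r} h = by (solve (λ { (v ∷ w ∷ r ∷ []) → (w ⊖ v) ⊗ r , r ⊗ (w ⊖ v) ⊕ ⊝ 𝟙 ⊗ ((v ⊖ w) ⊗ r ⊖ r ⊗ (v ⊖ w)) ⊗ 𝟙 })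
    (V k b ∷ V b k ∷ r ∷ []) ≡.refl) ((- 1#) ∙⟨ h ⟩∙ 1#)

  module _ {k b l c : ℕ} (k<b : k < b) (l<c : l < c) (k<l : k < l) (b<n : b < n) (c<n : c < n) where

    -- Each A holds an arc and its complementary arc. For chords that are separate, crossing or
    -- nested, the four pairs of arcs are disjoint or nested, where the operators commute, or
    -- crossing or covering the circle, where both products vanish.
    disjoint-sorted : b ≢ l → b ≢ c → Com (Aⁿ k b) (Aⁿ l c)
    disjoint-sorted b≢l b≢c with ℕP.<-cmp b l | ℕP.<-cmp b c
    ... | tri≈ _ p _ | _ = ⊥-elim (b≢l p)
    ... | _ | tri≈ _ p _ = ⊥-elim (b≢c p)
    ... | tri< b<l _ _ | _ = com-A k b l c
      (com-both (V< k<b) (V< l<c) (U-sep k<b b<l l<c (up c<n)))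
      (com-both (trans (V< k<b) (sym (U-per k<b))) (V> l<c) (U-nest (up c<n) (shift k<b) (shift b<l) (shift l<c)))
      (com-both (V> k<b) (V< l<c) (com-sym (U-nest b<l l<c (up c<n) (shift k<b))))
      (com-both (V> k<b) (V> l<c) (com-0 (proj₁ z) (proj₂ z)))
      where
      z = U-cover (ℕP.<-trans b<l l<c) (up {k} c<n) (up {b} c<n) (ℕP.+-monoʳ-≤ n (ℕP.<⇒≤ b<l))
    ... | tri> _ _ l<b | tri< b<c _ _ = com-A k b l c
      (com-both (V< k<b) (V< l<c) (U-cross k<l l<b b<c (up c<n)))
      (com-both (trans (V< k<b) (sym (U-per k<b))) (V> l<c) (com-sym (U-cross (up c<n) (shift k<l) (shift l<b) (shift b<c))))
      (com-both (V> k<b) (V< l<c) (com-sym (U-cross l<b b<c (up c<n) (shift k<l))))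
      (com-both (V> k<b) (V> l<c) (U-cross b<c (up c<n) (shift k<l) (shift l<b)))
    ... | tri> _ _ l<b | tri> _ _ c<b = com-A k b l c
      (com-both (V< k<b) (V< l<c) (com-sym (U-nest k<l l<c c<b (up b<n))))
      (com-both (V< k<b) (V> l<c) (com-0 (proj₁ z) (proj₂ z)))
      (com-both (V> k<b) (V< l<c) (com-sym (U-sep l<c c<b (up b<n) (shift k<l))))
      (com-both (V> k<b) (V> l<c) (U-nest c<b (up b<n) (shift k<l) (shift l<c)))
      where
      z = U-cover (ℕP.<-trans k<l l<c) c<b (up {k} c<n) (ℕP.+-monoʳ-≤ n (ℕP.<⇒≤ k<l))

  disjoint< : ∀ {k b l c} → k < b → l < c → b < n → c < n → k ≢ l → k ≢ c → b ≢ l → b ≢ c → Com (Aⁿ k b) (Aⁿ l c)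
  disjoint< {k} {b} {l} {c} k<b l<c b<n c<n kl kc bl bc with ℕP.<-cmp k l
  ... | tri< k<l _ _ = disjoint-sorted k<b l<c k<l b<n c<n bl bc
  ... | tri≈ _ p _ = ⊥-elim (kl p)
  ... | tri> _ _ l<k = com-sym (disjoint-sorted l<c k<b l<k c<n b<n (kc ∘ ≡.sym) (bc ∘ ≡.sym))

  disjoint : ∀ {k b l c} → b < n → c < n → k < n → l < n → k ≢ b → k ≢ l → k ≢ c → b ≢ l → b ≢ c → l ≢ c → Com (Aⁿ k b) (Aⁿ l c)
  disjoint {k} {b} {l} {c} b<n c<n k<n l<n kb kl kc bl bc lc with ℕP.<-cmp k b | ℕP.<-cmp l c
  ... | tri≈ _ p _ | _ = ⊥-elim (kb p)
  ... | _ | tri≈ _ p _ = ⊥-elim (lc p)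
  ... | tri< k<b _ _ | tri< l<c _ _ = disjoint< k<b l<c b<n c<n kl kc bl bc
  ... | tri> _ _ b<k | tri< l<c _ _ = com-A-flip b k (disjoint< b<k l<c k<n c<n bl bc kl kc)
  ... | tri< k<b _ _ | tri> _ _ c<l = com-sym (com-A-flip c l (com-sym (disjoint< k<b c<l b<n l<n kc kl bc bl)))
  ... | tri> _ _ b<k | tri> _ _ c<l = com-A-flip b k (com-sym (com-A-flip c l (com-sym (disjoint< b<k c<l k<n l<n bc bl kc kl))))

  tripleⁿ : ℕ → ℕ → ℕ → Carrier
  tripleⁿ k l m = (com (x k) (Aⁿ l m) + com (Aⁿ k l) (Aⁿ l m)) + ((com (x l) (Aⁿ m k) + com (Aⁿ l m) (Aⁿ m k))
    + (com (x m) (Aⁿ k l) + com (Aⁿ m k) (Aⁿ k l)))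

  triple-flip : ∀ k l m → tripleⁿ k l m ≈ 0# → tripleⁿ l k m ≈ 0#
  triple-flip k l m h = by
    (solve (λ { (xk ∷ xl ∷ xm ∷ kl ∷ lk ∷ lm ∷ ml ∷ mk ∷ km ∷ []) →
       let c : Expr 9 → Expr 9 → Expr 9
           c = λ p q → p ⊗ q ⊖ q ⊗ p
       in (c xl (km ⊖ mk) ⊕ c (lk ⊖ kl) (km ⊖ mk)) ⊕ ((c xk (ml ⊖ lm) ⊕ c (km ⊖ mk) (ml ⊖ lm)) ⊕ (c xm (lk ⊖ kl) ⊕ c (ml ⊖ lm) (lk ⊖ kl))) ,
          𝟘 ⊕ ⊝ 𝟙 ⊗ (((c xk (lm ⊖ ml) ⊕ c (kl ⊖ lk) (lm ⊖ ml)) ⊕ ((c xl (mk ⊖ km) ⊕ c (lm ⊖ ml) (mk ⊖ km))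
                       ⊕ (c xm (kl ⊖ lk) ⊕ c (mk ⊖ km) (kl ⊖ lk)))) ⊖ 𝟘) ⊗ 𝟙 })
      (x k ∷ x l ∷ x m ∷ V k l ∷ V l k ∷ V l m ∷ V m l ∷ V m k ∷ V k m ∷ []) ≡.refl)
    ((- 1#) ∙⟨ h ⟩∙ 1#)

  triple-rotate : ∀ k l m → tripleⁿ k l m ≈ 0# → tripleⁿ l m k ≈ 0#
  triple-rotate k l m h = trans (trans (sym (+-assoc _ _ _)) (+-comm _ _)) h

  -- Three commutators of x with an arc through that point cancel against products of the two halves
  -- of the arc, by `Ux-in`. In three others x lies outside the arc. The remaining nine pairs share
  -- a starting point, share an end point or cover the circle, so they commute.
  triple-sorted : ∀ {a b c} → a < b → b < c → c < n → tripleⁿ a b c ≈ 0#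
  triple-sorted {a} {b} {c} a<b b<c c<n = trans (+-cong (+-cong (cc refl Abc) (cc Aab Abc)) (+-cong (+-cong (cc refl Aca) (cc Abc Aca)) (+-cong (cc refl Aab) (cc Aca Aab))))
    (by (solve (λ { (xa ∷ xb ∷ xc ∷ ab ∷ ba ∷ bc ∷ cb ∷ ca ∷ ac ∷ []) →
       let k : Expr 9 → Expr 9 → Expr 9
           k = λ p q → p ⊗ q ⊖ q ⊗ p
       in (k xa (bc ⊖ cb) ⊕ k (ab ⊖ ba) (bc ⊖ cb)) ⊕ ((k xb (ca ⊖ ac) ⊕ k (bc ⊖ cb) (ca ⊖ ac)) ⊕ (k xc (ab ⊖ ba) ⊕ k (ca ⊖ ac) (ab ⊖ ba))) ,
          𝟘 ⊕ (𝟙 ⊗ (xa ⊗ bc ⊖ bc ⊗ xa) ⊗ 𝟙 ⊕ (⊝ 𝟙 ⊗ (k xa cb ⊖ k ca ab) ⊗ 𝟙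
            ⊕ (𝟙 ⊗ (xb ⊗ ca ⊖ ca ⊗ xb) ⊗ 𝟙 ⊕ (⊝ 𝟙 ⊗ (k xb ac ⊖ k ab bc) ⊗ 𝟙
            ⊕ (𝟙 ⊗ (xc ⊗ ab ⊖ ab ⊗ xc) ⊗ 𝟙 ⊕ (⊝ 𝟙 ⊗ (k xc ba ⊖ k bc ca) ⊗ 𝟙
            ⊕ (⊝ 𝟙 ⊗ (ab ⊗ cb ⊖ cb ⊗ ab) ⊗ 𝟙 ⊕ (⊝ 𝟙 ⊗ (ba ⊗ bc ⊖ bc ⊗ ba) ⊗ 𝟙 ⊕ (𝟙 ⊗ (ba ⊗ cb ⊖ cb ⊗ ba) ⊗ 𝟙
            ⊕ (⊝ 𝟙 ⊗ (bc ⊗ ac ⊖ ac ⊗ bc) ⊗ 𝟙 ⊕ (⊝ 𝟙 ⊗ (cb ⊗ ca ⊖ ca ⊗ cb) ⊗ 𝟙 ⊕ (𝟙 ⊗ (cb ⊗ ac ⊖ ac ⊗ cb) ⊗ 𝟙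
            ⊕ (⊝ 𝟙 ⊗ (ca ⊗ ba ⊖ ba ⊗ ca) ⊗ 𝟙 ⊕ (⊝ 𝟙 ⊗ (ac ⊗ ab ⊖ ab ⊗ ac) ⊗ 𝟙 ⊕ 𝟙 ⊗ (ac ⊗ ba ⊖ ba ⊗ ac) ⊗ 𝟙)))))))))))))) })
        (x a ∷ x b ∷ x c ∷ U a b ∷ U b (n ℕ.+ a) ∷ U b c ∷ U c (n ℕ.+ b) ∷ U c (n ℕ.+ a) ∷ U a c ∷ []) ≡.refl)
      (1# ∙⟨ com-congˡ (x-per a) (Ux-out b<c (up c<n) (shift a<b)) ⟩∙ 1#
       ⊞ (- 1#) ∙⟨ in-cb ⟩∙ 1#
       ⊞ 1# ∙⟨ com-congˡ (x-per b) (Ux-out (up c<n) (shift a<b) (shift b<c)) ⟩∙ 1#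
       ⊞ (- 1#) ∙⟨ Ux-in a<b b<c (up c<n) ⟩∙ 1#
       ⊞ 1# ∙⟨ Ux-out a<b b<c (up c<n) ⟩∙ 1#
       ⊞ (- 1#) ∙⟨ Ux-in b<c (up c<n) (shift a<b) ⟩∙ 1#
       ⊞ (- 1#) ∙⟨ com-congˡ (U-per a<b) (com-0 (U-same-end (shift a<b) (up c<n)) (U-same-end (up c<n) (shift a<b))) ⟩∙ 1#
       ⊞ (- 1#) ∙⟨ com-0 (U-same-start (up b<n) (shift a<b) b<c (up c<n)) (U-same-start b<c (up c<n) (up b<n) (shift a<b)) ⟩∙ 1#
       ⊞ 1# ∙⟨ com-0 (proj₁ z₁) (proj₂ z₁) ⟩∙ 1#
       ⊞ (- 1#) ∙⟨ com-0 (U-same-end b<c a<c) (U-same-end a<c b<c) ⟩∙ 1#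
       ⊞ (- 1#) ∙⟨ com-0 (U-same-start (up c<n) (shift b<c) (up c<n) (shift a<c)) (U-same-start (up c<n) (shift a<c) (up c<n) (shift b<c)) ⟩∙ 1#
       ⊞ 1# ∙⟨ com-cong (U-per a<c) (com-0 (proj₁ z₂) (proj₂ z₂)) ⟩∙ 1#
       ⊞ (- 1#) ∙⟨ com-0 (U-same-end (up c<n) (up b<n)) (U-same-end (up b<n) (up c<n)) ⟩∙ 1#
       ⊞ (- 1#) ∙⟨ com-0 (U-same-start a<c (up c<n) a<b (up b<n)) (U-same-start a<b (up b<n) a<c (up c<n)) ⟩∙ 1#
       ⊞ 1# ∙⟨ com-0 (proj₁ z₃) (proj₂ z₃) ⟩∙ 1#))
    where
    a<c = ℕP.<-trans a<b b<c
    b<n = ℕP.<-trans b<c c<n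
    Aab : Aⁿ a b ≈ U a b - U b (n ℕ.+ a)
    Aab = +-cong (V< a<b) (-‿cong (V> a<b))
    Abc : Aⁿ b c ≈ U b c - U c (n ℕ.+ b)
    Abc = +-cong (V< b<c) (-‿cong (V> b<c))
    Aca : Aⁿ c a ≈ U c (n ℕ.+ a) - U a c
    Aca = +-cong (V> a<c) (-‿cong (V< a<c))
    cc : ∀ {p p′ r r′} → p ≈ p′ → r ≈ r′ → com p r ≈ com p′ r′
    cc e f = +-cong (*-cong e f) (-‿cong (*-cong f e))
    in-cb : x a * U c (n ℕ.+ b) - U c (n ℕ.+ b) * x a ≈ U c (n ℕ.+ a) * U a b - U a b * U c (n ℕ.+ a)
    in-cb = trans (cc (sym (x-per a)) refl) (trans (Ux-in (up c<n) (shift a<b) (shift b<c)) (cc refl (U-per a<b)))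
    z₁ = U-cover {b} {c} {n ℕ.+ a} {n ℕ.+ b} b<c (up c<n) (up c<n) ℕP.≤-refl
    z₂ = U-cover {c} {n ℕ.+ a} {n ℕ.+ b} {n ℕ.+ c} (up c<n) (shift a<b) (shift a<c) ℕP.≤-refl
    z₃ = U-cover {a} {b} {c} {n ℕ.+ a} a<b b<c (up b<n) ℕP.≤-refl

  -- The expression is invariant under rotation and changes sign under an exchange, which reduces
  -- every order to the sorted one.
  triple-distinct : ∀ {k l m} → k < n → l < n → m < n → k ≢ l → k ≢ m → l ≢ m → tripleⁿ k l m ≈ 0#
  triple-distinct {k} {l} {m} k<n l<n m<n kl km lm with ℕP.<-cmp k l | ℕP.<-cmp l m | ℕP.<-cmp k m
  ... | tri≈ _ p _ | _ | _ = ⊥-elim (kl p)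
  ... | _ | tri≈ _ p _ | _ = ⊥-elim (lm p)
  ... | _ | _ | tri≈ _ p _ = ⊥-elim (km p)
  ... | tri< p _ _ | tri< r _ _ | _ = triple-sorted p r m<n
  ... | tri< p _ _ | tri> _ _ r | tri< s _ _ = triple-rotate m k l (triple-flip k m l (triple-sorted s r l<n))
  ... | tri< p _ _ | tri> _ _ r | tri> _ _ s = triple-rotate m k l (triple-sorted s p l<n)
  ... | tri> _ _ p | tri< r _ _ | tri< s _ _ = triple-flip l k m (triple-sorted p s m<n)
  ... | tri> _ _ p | tri< r _ _ | tri> _ _ s = triple-rotate m k l (triple-rotate l m k (triple-sorted r s k<n))
  ... | tri> _ _ p | tri> _ _ r | _ = triple-flip l k m (triple-rotate m l k (triple-sorted r p k<n))

  𝒳 : Fin n → Carrier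
  𝒳 = D

  𝒳-comm : ∀ k l → 𝒳 k * 𝒳 l ≈ 𝒳 l * 𝒳 k
  𝒳-comm = D-comm
    (λ k l → trans (+-congʳ (x-comm (toℕ k) (toℕ l))) (-‿inverseʳ _))
    (λ {k} {b} {l} {m} kb kl km bl bm lm → trans (+-congʳ
      (disjoint (FP.toℕ<n b) (FP.toℕ<n m) (FP.toℕ<n k) (FP.toℕ<n l) (ne kb) (ne kl) (ne km) (ne bl) (ne bm) (ne lm))) (-‿inverseʳ _))
    (λ {k} {l} {m} kl km lm → triple-distinct (FP.toℕ<n k) (FP.toℕ<n l) (FP.toℕ<n m) (ne kl) (ne km) (ne lm))
    x-sum
    where
    ne : ∀ {i j : Fin n} → i ≢ j → toℕ i ≢ toℕ j
    ne p e = p (FP.toℕ-injective e)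


-- The ring of linear endomorphisms

module Endo (A : CommutativeRing 0ℓ 0ℓ) {J : Set} (s : J → CommutativeRing.Carrier A) where
  open CommutativeRing A
  open RingProps ring using (-0#≈0#; -‿distribʳ-*; -‿distribˡ-*; -‿+-comm; -‿involutive)
  open CommutativeSolve A using (solve)

  -- Linearity is asked over a chosen family of scalars `s`. For H ⊗ K these are the integer
  -- constants and the variables q, which makes the operators K-linear.
  record Op : Set where
    no-eta-equality
    field
      fn : Carrier → Carrier
      fn-cong : ∀ {f g} → f ≈ g → fn f ≈ fn g
      fn-+ : ∀ f g → fn (f + g) ≈ fn f + fn g
      fn-lin : ∀ j f → fn (s j * f) ≈ s j * fn f
  open Op public

  fn-0 : ∀ φ → fn φ 0# ≈ 0#
  fn-0 φ = begin
    fn φ 0# ≈⟨ solve (λ { (a ∷ []) → a , (a ⊕ a) ⊖ a }) (fn φ 0# ∷ []) ≡.refl ⟩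
    (fn φ 0# + fn φ 0#) - fn φ 0# ≈⟨ +-congʳ (trans (sym (fn-+ φ 0# 0#)) (fn-cong φ (+-identityˡ 0#))) ⟩
    fn φ 0# - fn φ 0# ≈⟨ -‿inverseʳ _ ⟩
    0# ∎
    where open SetoidReasoning setoid

  fn-neg : ∀ φ f → fn φ (- f) ≈ - fn φ f
  fn-neg φ f = begin
    fn φ (- f) ≈⟨ solve (λ { (a ∷ b ∷ []) → a , (a ⊕ b) ⊖ b }) (fn φ (- f) ∷ fn φ f ∷ []) ≡.refl ⟩
    (fn φ (- f) + fn φ f) - fn φ f ≈⟨ +-congʳ (trans (sym (fn-+ φ (- f) f)) (trans (fn-cong φ (-‿inverseˡ f)) (fn-0 φ))) ⟩
    0# - fn φ f ≈⟨ +-identityˡ _ ⟩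
    - fn φ f ∎
    where open SetoidReasoning setoid

  infix 4 _≈ᵒ_
  record _≈ᵒ_ (φ ψ : Op) : Set where
    constructor mkᵒ
    field app : ∀ f → fn φ f ≈ fn ψ f
  open _≈ᵒ_ public

  _+ᵒ_ _*ᵒ_ : Op → Op → Op
  fn (φ +ᵒ ψ) f = fn φ f + fn ψ f
  fn-cong (φ +ᵒ ψ) p = +-cong (fn-cong φ p) (fn-cong ψ p)
  fn-+ (φ +ᵒ ψ) f g = trans (+-cong (fn-+ φ f g) (fn-+ ψ f g))
    (solve (λ { (a ∷ b ∷ c ∷ d ∷ []) → (a ⊕ b) ⊕ (c ⊕ d) , (a ⊕ c) ⊕ (b ⊕ d) }) (_ ∷ _ ∷ _ ∷ _ ∷ []) ≡.refl)
  fn-lin (φ +ᵒ ψ) j f = trans (+-cong (fn-lin φ j f) (fn-lin ψ j f)) (sym (distribˡ _ _ _))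

  fn (φ *ᵒ ψ) f = fn φ (fn ψ f)
  fn-cong (φ *ᵒ ψ) p = fn-cong φ (fn-cong ψ p)
  fn-+ (φ *ᵒ ψ) f g = trans (fn-cong φ (fn-+ ψ f g)) (fn-+ φ _ _)
  fn-lin (φ *ᵒ ψ) j f = trans (fn-cong φ (fn-lin ψ j f)) (fn-lin φ j _)

  -ᵒ_ : Op → Op
  fn (-ᵒ φ) f = - fn φ f
  fn-cong (-ᵒ φ) p = -‿cong (fn-cong φ p)
  fn-+ (-ᵒ φ) f g = trans (-‿cong (fn-+ φ f g)) (sym (-‿+-comm _ _))
  fn-lin (-ᵒ φ) j f = trans (-‿cong (fn-lin φ j f)) (-‿distribʳ-* _ _)

  mul : Carrier → Op
  fn (mul a) f = a * f
  fn-cong (mul a) p = *-congˡ p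
  fn-+ (mul a) f g = distribˡ a f g
  fn-lin (mul a) j f = solve (λ { (a ∷ s ∷ f ∷ []) → a ⊗ (s ⊗ f) , s ⊗ (a ⊗ f) }) (a ∷ s j ∷ f ∷ []) ≡.refl

  0ᵒ 1ᵒ : Op
  fn 0ᵒ f = 0#
  fn-cong 0ᵒ _ = refl
  fn-+ 0ᵒ f g = sym (+-identityˡ 0#)
  fn-lin 0ᵒ j f = sym (zeroʳ _)

  fn 1ᵒ f = f
  fn-cong 1ᵒ p = p
  fn-+ 1ᵒ f g = refl
  fn-lin 1ᵒ j f = refl

  opRing : Ring 0ℓ 0ℓ
  opRing = record
    { Carrier = Op ; _≈_ = _≈ᵒ_ ; _+_ = _+ᵒ_ ; _*_ = _*ᵒ_ ; -_ = -ᵒ_ ; 0# = 0ᵒ ; 1# = 1ᵒ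
    ; isRing = record
      { +-isAbelianGroup = record
        { isGroup = record
          { isMonoid = record
            { isSemigroup = record
              { isMagma = record
                { isEquivalence = record
                  { refl = mkᵒ λ _ → refl ; sym = λ p → mkᵒ λ f → sym (app p f) ; trans = λ p q → mkᵒ λ f → trans (app p f) (app q f) }
                ; ∙-cong = λ p q → mkᵒ λ f → +-cong (app p f) (app q f) }
              ; assoc = λ _ _ _ → mkᵒ λ f → +-assoc _ _ _ }
            ; identity = (λ _ → mkᵒ λ f → +-identityˡ _) , λ _ → mkᵒ λ f → +-identityʳ _ }
          ; inverse = (λ _ → mkᵒ λ f → -‿inverseˡ _) , λ _ → mkᵒ λ f → -‿inverseʳ _
          ; ⁻¹-cong = λ p → mkᵒ λ f → -‿cong (app p f) }
        ; comm = λ _ _ → mkᵒ λ f → +-comm _ _ }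
      ; *-cong = λ {φ} p q → mkᵒ λ f → trans (fn-cong φ (app q f)) (app p _)
      ; *-assoc = λ _ _ _ → mkᵒ λ f → refl
      ; *-identity = (λ _ → mkᵒ λ f → refl) , λ _ → mkᵒ λ f → refl
      ; distrib = (λ φ _ _ → mkᵒ λ f → fn-+ φ _ _) , λ _ _ _ → mkᵒ λ f → refl } }

  mul-central : ∀ j φ → mul (s j) *ᵒ φ ≈ᵒ φ *ᵒ mul (s j)
  mul-central j φ = mkᵒ λ f → sym (fn-lin φ j f)

-- Divided differences of polynomials without division by a linear form

-- Divided differences.  Let f(v + D v · z) = f + z · g(z); then the divided difference of f
-- along the reflection v ↦ v − D v · α is g(−α).

divz : ∀ {m} → Poly (suc m) → Poly (suc m)
divz [] = []
divz ((c , zero ∷ e) ∷ f) = divz f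
divz ((c , suc a ∷ e) ∷ f) = (c , a ∷ e) ∷ divz f

shiftz : ∀ {m} → (Mon (suc m) → ℤ) → Mon (suc m) → ℤ
shiftz φ (zero ∷ e) = 0ℤ
shiftz φ (suc a ∷ e) = φ (a ∷ e)

ext-divz : ∀ {m} (φ : Mon (suc m) → ℤ) f → ext φ (divz f) ≡ ext (shiftz φ) f
ext-divz φ [] = ≡.refl
ext-divz φ ((c , zero ∷ e) ∷ f) = ≡.trans (ext-divz φ f)
  (≡.sym (≡.trans (cong (ℤ._+ ext (shiftz φ) f) (ℤP.*-zeroʳ c)) (ℤP.+-identityˡ _)))
ext-divz φ ((c , suc a ∷ e) ∷ f) = cong (ℤ._+_ (c ℤ.* φ (a ∷ e))) (ext-divz φ f)

ext-X* : ∀ {m} (φ : Mon m → ℤ) v f → ext φ (X v *′ f) ≡ ext (λ e → φ (unit v +ᵐ e)) f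
ext-X* φ v f = ≡.trans (cong (λ p → ext φ (p *′ f)) (X-mono v)) (≡.trans (ext-*′ φ (mono 1ℤ (unit v)) f)
  (≡.trans (ext-mono _ 1ℤ (unit v)) (ℤP.*-identityˡ _)))

divz-cong : ∀ {m} {f g : Poly (suc m)} → f ≃ g → divz f ≃ divz g
divz-cong {f = f} {g} p = ext-≃ λ φ → ≡.trans (ext-divz φ f) (≡.trans (ext-resp p _) (≡.sym (ext-divz φ g)))

divz-+ : ∀ {m} (f g : Poly (suc m)) → divz (f +′ g) ≃ divz f +′ divz g
divz-+ f g = ext-≃ λ φ → ≡.trans (ext-divz φ (f +′ g)) (≡.trans (ext-+′ _ f g)
  (≡.sym (≡.trans (ext-+′ φ (divz f) (divz g)) (cong₂ ℤ._+_ (ext-divz φ f) (ext-divz φ g)))))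

divz-κ* : ∀ {m} c (f : Poly (suc m)) → divz (κ c *′ f) ≃ κ c *′ divz f
divz-κ* c f = ext-≃ λ φ → ≡.trans (ext-divz φ (κ c *′ f)) (≡.trans (ext-κ-* _ c f)
  (≡.trans (cong (c ℤ.*_) (≡.sym (ext-divz φ f))) (≡.sym (ext-κ-* φ c (divz f)))))

divz-κ : ∀ {m} c → divz {m} (κ c) ≃ 0′
divz-κ c = ext-≃ λ φ → ≡.trans (ext-divz φ (κ c)) (≡.trans (ext-κ _ c) (≡.trans (ℤP.*-zeroʳ c) (≡.sym (ext-0′ φ))))

divz-z : ∀ {m} (f : Poly (suc m)) → divz (X F.zero *′ f) ≃ f
divz-z f = ext-≃ λ φ → ≡.trans (ext-divz φ (X F.zero *′ f)) (≡.trans (ext-X* _ F.zero f)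
  (ext-cong (λ { (a ∷ e) → cong (λ e → φ (a ∷ e)) (unit-+-mono e) }) f))

divz-X : ∀ {m} v (f : Poly (suc m)) → divz (X (F.suc v) *′ f) ≃ X (F.suc v) *′ divz f
divz-X v f = ext-≃ λ φ → ≡.trans (ext-divz φ (X (F.suc v) *′ f)) (≡.trans (ext-X* _ (F.suc v) f)
  (≡.trans (ext-cong (λ { (zero ∷ e) → ≡.refl ; (suc a ∷ e) → ≡.refl }) f)
    (≡.sym (≡.trans (ext-X* φ (F.suc v) (divz f)) (ext-divz _ f)))))

module _ {m : ℕ} where

  dropz : Fin (suc m) → Poly (suc m)
  dropz F.zero = 0′
  dropz (F.suc v) = X (F.suc v)

  divz-decompose : ∀ (h : Poly (suc m)) → h ≃ h [ dropz ] +′ X F.zero *′ divz h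
  divz-decompose = poly-ind _
    (λ f≃g p → P.trans (P.sym f≃g) (P.trans p (P.+-cong ([]-cong dropz f≃g) (P.*-congˡ (divz-cong f≃g)))))
    (λ c → P.sym (P.trans (P.+-cong ([]-κ dropz c) (P.trans (P.*-congˡ (divz-κ c)) (P.zeroʳ _))) (P.+-identityʳ _)))
    (λ f g p q → P.trans (P.+-cong p q) (P.trans
      (PS.solve (λ { (z ∷ a ∷ b ∷ c ∷ d ∷ []) → (a ⊕ z ⊗ b) ⊕ (c ⊕ z ⊗ d) , (a ⊕ c) ⊕ z ⊗ (b ⊕ d) })
        (X F.zero ∷ f [ dropz ] ∷ divz f ∷ g [ dropz ] ∷ divz g ∷ []) ≡.refl)
      (P.sym (P.+-cong ([]-+ dropz f g) (P.*-congˡ (divz-+ f g))))))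
    times
    where
    times : ∀ v f → f ≃ f [ dropz ] +′ X F.zero *′ divz f →
            X v *′ f ≃ (X v *′ f) [ dropz ] +′ X F.zero *′ divz (X v *′ f)
    times F.zero f p = P.sym (P.trans (P.+-cong (P.trans ([]-X* dropz F.zero f) (P.zeroˡ _)) (P.*-congˡ (divz-z f))) (P.+-identityˡ _))
    times (F.suc v) f p = P.trans (P.*-congˡ p) (P.trans
      (PS.solve (λ { (z ∷ x ∷ a ∷ b ∷ []) → x ⊗ (a ⊕ z ⊗ b) , x ⊗ a ⊕ z ⊗ (x ⊗ b) })
        (X F.zero ∷ X (F.suc v) ∷ f [ dropz ] ∷ divz f ∷ []) ≡.refl)
      (P.sym (P.+-cong ([]-X* dropz (F.suc v) f) (P.*-congˡ (divz-X v f)))))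

module Divided {m : ℕ} (D : Fin m → ℤ) (α : Poly m) where

  tilt : Fin m → Poly (suc m)
  tilt v = X (F.suc v) +′ κ (D v) *′ X F.zero

  atα : Fin (suc m) → Poly m
  atα F.zero = -′ α
  atα (F.suc v) = X v

  ∂ : Poly m → Poly m
  ∂ f = divz (f [ tilt ]) [ atα ]

  refl-α : Poly m → Poly m
  refl-α f = f -′ α *′ ∂ f

  ∂-cong : ∀ {f g} → f ≃ g → ∂ f ≃ ∂ g
  ∂-cong p = []-cong atα (divz-cong ([]-cong tilt p))

  ∂-+ : ∀ f g → ∂ (f +′ g) ≃ ∂ f +′ ∂ g
  ∂-+ f g = P.trans ([]-cong atα (P.trans (divz-cong ([]-+ tilt f g)) (divz-+ _ _))) ([]-+ atα _ _)

  ∂-κ : ∀ c → ∂ (κ c) ≃ 0′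
  ∂-κ c = P.trans ([]-cong atα (P.trans (divz-cong ([]-κ tilt c)) (divz-κ c))) ([]-0 atα)

  ∂-κ* : ∀ c f → ∂ (κ c *′ f) ≃ κ c *′ ∂ f
  ∂-κ* c f = P.trans ([]-cong atα (P.trans (divz-cong (P.trans ([]-* tilt (κ c) f) (P.*-congʳ ([]-κ tilt c)))) (divz-κ* c (f [ tilt ]))))
    (P.trans ([]-* atα (κ c) _) (P.*-congʳ ([]-κ atα c)))

  ∂-0 : ∂ 0′ ≃ 0′
  ∂-0 = P.trans (∂-cong (P.sym κ-0)) (∂-κ 0ℤ)

  -- Put z = -α in f(v + D v z) = f + z g(z). Thus `refl-α`, defined as a difference, is a
  -- substitution and hence multiplicative.
  tilt-at : ∀ f → f [ tilt ] [ atα ] ≃ refl-α f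
  tilt-at f = begin
    h [ atα ] ≈⟨ []-cong atα (divz-decompose h) ⟩
    (h [ dropz ] +′ X F.zero *′ divz h) [ atα ] ≈⟨ []-+ atα _ _ ⟩
    h [ dropz ] [ atα ] +′ (X F.zero *′ divz h) [ atα ] ≈⟨ P.+-cong back (P.trans ([]-X* atα F.zero (divz h)) (P.sym (PP.-‿distribˡ-* α (∂ f)))) ⟩
    refl-α f ∎
    where
    open PR
    h = f [ tilt ]
    back : h [ dropz ] [ atα ] ≃ f
    back = P.trans ([]-∘ dropz atα h) (P.trans ([]-∘ tilt (λ v → dropz v [ atα ]) f) (P.trans ([]-ext each f) ([]-id f)))
      where
      each : ∀ v → tilt v [ (λ v → dropz v [ atα ]) ] ≃ X v
      each v = P.trans ([]-+ τ (X (F.suc v)) _) (P.trans (P.+-cong (P.trans ([]-X τ (F.suc v)) ([]-X atα (F.suc v)))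
        (P.trans ([]-* τ (κ (D v)) (X F.zero)) (P.trans (P.*-congˡ (P.trans ([]-X τ F.zero) ([]-0 atα))) (P.zeroʳ _)))) (P.+-identityʳ _))
        where
        τ = λ v → dropz v [ atα ]

  ∂-X* : ∀ v f → ∂ (X v *′ f) ≃ X v *′ ∂ f +′ κ (D v) *′ refl-α f
  ∂-X* v f = begin
    divz ((X v *′ f) [ tilt ]) [ atα ] ≈⟨ []-cong atα (divz-cong (P.trans ([]-X* tilt v f) (P.trans (P.distribʳ F (X (F.suc v)) _) (P.+-congˡ (P.*-assoc (κ (D v)) _ F))))) ⟩
    divz (X (F.suc v) *′ F +′ κ (D v) *′ (X F.zero *′ F)) [ atα ]
      ≈⟨ []-cong atα (P.trans (divz-+ _ _) (P.+-cong (divz-X v F) (P.trans (divz-κ* (D v) _) (P.*-congˡ (divz-z F))))) ⟩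
    (X (F.suc v) *′ divz F +′ κ (D v) *′ F) [ atα ] ≈⟨ []-+ atα _ _ ⟩
    (X (F.suc v) *′ divz F) [ atα ] +′ (κ (D v) *′ F) [ atα ]
      ≈⟨ P.+-cong ([]-X* atα (F.suc v) (divz F)) (P.trans ([]-* atα (κ (D v)) F) (P.*-cong ([]-κ atα (D v)) (tilt-at f))) ⟩
    X v *′ ∂ f +′ κ (D v) *′ refl-α f ∎
    where
    open PR
    F = f [ tilt ]

  ∂-* : ∀ g f → ∂ (g *′ f) ≃ g *′ ∂ f +′ ∂ g *′ refl-α f
  ∂-* g f = poly-ind (λ g → ∂ (g *′ f) ≃ g *′ ∂ f +′ ∂ g *′ refl-α f)
    (λ p q → P.trans (P.sym (∂-cong (P.*-congʳ p))) (P.trans q (P.+-cong (P.*-congʳ p) (P.*-congʳ (∂-cong p)))))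
    (λ c → P.trans (∂-κ* c f) (P.sym (P.trans (P.+-congˡ (P.trans (P.*-congʳ (∂-κ c)) (P.zeroˡ _))) (P.+-identityʳ _))))
    (λ g h p q → P.trans (∂-cong (P.distribʳ f g h)) (P.trans (∂-+ _ _) (P.trans (P.+-cong p q) (P.trans
       (PS.solve (λ { (g ∷ h ∷ d ∷ r ∷ u ∷ v ∷ []) → (g ⊗ d ⊕ u ⊗ r) ⊕ (h ⊗ d ⊕ v ⊗ r) , (g ⊕ h) ⊗ d ⊕ (u ⊕ v) ⊗ r })
         (g ∷ h ∷ ∂ f ∷ refl-α f ∷ ∂ g ∷ ∂ h ∷ []) ≡.refl)
       (P.+-congˡ (P.*-congʳ (P.sym (∂-+ g h))))))))
    (λ v g p → P.trans (∂-cong (P.*-assoc (X v) g f)) (P.trans (∂-X* v (g *′ f)) (P.trans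
       (P.+-cong (P.*-congˡ p) (P.*-congˡ (P.+-congˡ (P.-‿cong (P.*-congˡ p))))) (P.trans
       (PS.solve (λ { (x ∷ k ∷ a ∷ g ∷ u ∷ f ∷ d ∷ []) →
            x ⊗ (g ⊗ d ⊕ u ⊗ (f ⊖ a ⊗ d)) ⊕ k ⊗ (g ⊗ f ⊖ a ⊗ (g ⊗ d ⊕ u ⊗ (f ⊖ a ⊗ d))) ,
            (x ⊗ g) ⊗ d ⊕ (x ⊗ u ⊕ k ⊗ (g ⊖ a ⊗ u)) ⊗ (f ⊖ a ⊗ d) })
         (X v ∷ κ (D v) ∷ α ∷ g ∷ ∂ g ∷ f ∷ ∂ f ∷ []) ≡.refl)
       (P.+-congˡ (P.*-congʳ (P.sym (∂-X* v g))))))))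
    g

  ∂-X : ∀ v → ∂ (X v) ≃ κ (D v)
  ∂-X v = P.trans (∂-cong (P.sym (P.*-identityʳ (X v)))) (P.trans (∂-X* v 1′) (P.trans
    (P.+-cong (P.trans (P.*-congˡ ∂1) (P.zeroʳ _)) (P.*-congˡ (P.trans (P.+-congˡ (P.trans (P.-‿cong (P.trans (P.*-congˡ ∂1) (P.zeroʳ α))) PP.-0#≈0#)) (P.+-identityʳ 1′))))
    (P.trans (P.+-identityˡ _) (P.*-identityʳ _))))
    where
    ∂1 : ∂ 1′ ≃ 0′
    ∂1 = P.trans (∂-cong (P.reflexive (≡.sym κ-1))) (∂-κ 1ℤ)

-- Indices modulo n, and the nil-Hecke action on rings with permuted linear forms

module Residue (n : ℕ) .{{_ : ℕ.NonZero n}} where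

  fin : ℕ → Fin n
  fin i = i DM.mod n

  toℕ-fin : ∀ i → toℕ (fin i) ≡ i DM.% n
  toℕ-fin i = FP.toℕ-fromℕ< (DM.m%n<n i n)

  fin-≡ : ∀ {i j} → i DM.% n ≡ j DM.% n → fin i ≡ fin j
  fin-≡ {i} {j} p = FP.toℕ-injective (≡.trans (toℕ-fin i) (≡.trans p (≡.sym (toℕ-fin j))))

  fin-per : ∀ i → fin (n ℕ.+ i) ≡ fin i
  fin-per i = fin-≡ (≡.trans (cong (DM._% n) (ℕP.+-comm n i)) (DM.[m+n]%n≡m%n i n))

  fin-toℕ : ∀ k → fin (toℕ k) ≡ k
  fin-toℕ k = FP.toℕ-injective (≡.trans (toℕ-fin (toℕ k)) (DM.m<n⇒m%n≡m (FP.toℕ<n k)))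

  fin-≢ : ∀ {i j} → i < j → j < n ℕ.+ i → fin i ≢ fin j
  fin-≢ {i} {j} i<j j<n p = ℕP.<⇒≱ a<b (ℕP.m<1+n⇒m≤n b<1+a)
    where
    a = i DM./ n
    b = j DM./ n
    ρ = i DM.% n
    i≡ : i ≡ ρ ℕ.+ a ℕ.* n
    i≡ = DM.m≡m%n+[m/n]*n i n
    j≡ : j ≡ ρ ℕ.+ b ℕ.* n
    j≡ = ≡.trans (DM.m≡m%n+[m/n]*n j n) (cong (ℕ._+ b ℕ.* n) (≡.trans (≡.sym (toℕ-fin j)) (≡.trans (cong toℕ (≡.sym p)) (toℕ-fin i))))
    a<b : a < b
    a<b = ℕP.*-cancelʳ-< n a b (ℕP.+-cancelˡ-< ρ _ _ (subst (ρ ℕ.+ a ℕ.* n <_) j≡ (subst (_< j) i≡ i<j)))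
    b<1+a : b < suc a
    b<1+a = ℕP.*-cancelʳ-< n b (suc a) (ℕP.+-cancelˡ-< ρ _ _ (subst (ρ ℕ.+ b ℕ.* n <_) rearrange
              (subst (_< n ℕ.+ (ρ ℕ.+ a ℕ.* n)) j≡ (subst (λ k → j < n ℕ.+ k) i≡ j<n))))
      where
      rearrange : n ℕ.+ (ρ ℕ.+ a ℕ.* n) ≡ ρ ℕ.+ (n ℕ.+ a ℕ.* n)
      rearrange = ≡.trans (≡.sym (ℕP.+-assoc n ρ _)) (≡.trans (cong (ℕ._+ a ℕ.* n) (ℕP.+-comm n ρ)) (ℕP.+-assoc ρ n _))

  -- Moving the window one step trades its first element `i` for n + i, which has the same residue.
  representative : ∀ i (k : Fin n) → Σ ℕ λ k′ → i ≤ k′ × suc k′ ≤ n ℕ.+ i × fin k′ ≡ k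
  representative zero k = toℕ k , z≤n , subst (toℕ k <_) (≡.sym (ℕP.+-identityʳ n)) (FP.toℕ<n k) , fin-toℕ k
  representative (suc i) k with representative i k
  ... | k′ , i≤k′ , k′<n , e with ℕP.m≤n⇒m<n∨m≡n i≤k′
  ...   | inj₁ i<k′ = k′ , i<k′ , ℕP.≤-trans k′<n (ℕP.+-monoʳ-≤ n (ℕP.n≤1+n i)) , e
  ...   | inj₂ ≡.refl = n ℕ.+ i , ℕP.m<n+m i (ℕP.n≢0⇒n>0 (ℕ.≢-nonZero⁻¹ n)) , ℕP.≤-reflexive (≡.sym (ℕP.+-suc n i)) , ≡.trans (fin-per i) e

kron : ∀ {n} → Fin n → Fin n → ℤ
kron u k = if does (u F.≟ k) then 1ℤ else 0ℤ

kron-≡ : ∀ {n} (u : Fin n) → kron u u ≡ 1ℤ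
kron-≡ u with u F.≟ u
... | yes _ = ≡.refl
... | no p = ⊥-elim (p ≡.refl)

kron-≢ : ∀ {n} {u k : Fin n} → u ≢ k → kron u k ≡ 0ℤ
kron-≢ {u = u} {k} p with u F.≟ k
... | yes q = ⊥-elim (p q)
... | no _ = ≡.refl

-- A polynomial ring with linear forms x k permuted by the symmetric group; d u v is the
-- coefficient with which x u enters the variable v.
record Forms (n : ℕ) : Set₁ where
  field
    m : ℕ
    G : Poly m → Set
    J : Set
    s : J → Poly m
    x : Fin n → Poly m
    d : Fin n → Fin m → ℤ
  ∂ : Fin n → Fin n → Poly m → Poly m
  ∂ u w = Divided.∂ (λ v → d u v ℤ.- d w v) (x u -′ x w)
  field
    ∂-x : ∀ u w k → ∂ u w (x k) ≃ κ (kron u k ℤ.- kron w k)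
    ∂-s : ∀ u w j → ∂ u w (s j) ≃ 0′
    ∂-G : ∀ {u w} → u ≢ w → ∀ {g} → G g → ∂ u w g ≃ 0′
    gen : ∀ (P : Poly m → Set) → (∀ {f g} → f ≃ g → P f → P g) → (∀ c → P (κ c)) → (∀ f g → P f → P g → P (f +′ g)) →
          (∀ k f → P f → P (x k *′ f)) → (∀ j f → P f → P (s j *′ f)) → ∀ f → P f

module FormOps {n : ℕ} (L : Forms n) where
  open Forms L

  A : CommutativeRing 0ℓ 0ℓ
  A = quotientRing G

  s′ : ℤ ⊎ J → Poly m
  s′ = [ κ , s ]′

  open Endo A s′ public
  module A = CommutativeRing A

  ∂-fixed : ∀ u w {g} → ∂ u w g ≃ 0′ → ∀ f → ∂ u w (g *′ f) ≃ g *′ ∂ u w f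
  ∂-fixed u w {g} p f = P.trans (Divided.∂-* _ _ g f) (P.trans (P.+-congˡ (P.trans (P.*-congʳ p) (P.zeroˡ _))) (P.+-identityʳ _))

  -- The generators are killed by ∂, so the twisted Leibniz rule makes ∂ linear over them.
  ∂-ideal : ∀ {u w} → u ≢ w → ∀ {f} → ⟨ G ⟩ f → ⟨ G ⟩ (∂ u w f)
  ∂-ideal {u} {w} u≢w = ⟨⟩-map (∂ u w) (Divided.∂-cong _ _) (Divided.∂-+ _ _) (Divided.∂-0 _ _)
    λ h {g} p → ⟨⟩-resp (P.sym (P.trans (Divided.∂-cong _ _ (P.*-comm h g)) (P.trans (∂-fixed u w (∂-G u≢w p) h) (P.*-comm g _)))) (⟨⟩-* _ (⟨⟩-gen p))

  ∂-neg : ∀ u w f → ∂ u w (-′ f) ≃ -′ ∂ u w f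
  ∂-neg u w f = begin
    ∂ u w (-′ f) ≈⟨ Divided.∂-cong _ _ (P.trans (P.sym (PP.-1*x≈-x f)) (P.*-congʳ -1≃)) ⟩
    ∂ u w (κ -1ℤ *′ f) ≈⟨ Divided.∂-κ* _ _ -1ℤ f ⟩
    κ -1ℤ *′ ∂ u w f ≈⟨ P.trans (P.*-congʳ (P.sym -1≃)) (PP.-1*x≈-x _) ⟩
    -′ ∂ u w f ∎
    where
    open PR
    -1≃ : -′ 1′ ≃ κ -1ℤ
    -1≃ = P.trans (P.-‿cong (P.reflexive (≡.sym κ-1))) (P.sym (κ-neg 1ℤ))

  ∂ᵒ : ∀ {u w} → u ≢ w → Op
  fn (∂ᵒ {u} {w} u≢w) = ∂ u w
  fn-cong (∂ᵒ {u} {w} u≢w) {f} {g} p = mk≋ (⟨⟩-resp (P.trans (Divided.∂-+ _ _ f (-′ g)) (P.+-congˡ (∂-neg u w g))) (∂-ideal u≢w (diff p)))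
  fn-+ (∂ᵒ u≢w) f g = ≃⇒≋ (Divided.∂-+ _ _ f g)
  fn-lin (∂ᵒ u≢w) (inj₁ c) f = ≃⇒≋ (Divided.∂-κ* _ _ c f)
  fn-lin (∂ᵒ {u} {w} u≢w) (inj₂ j) f = ≃⇒≋ (∂-fixed u w (∂-s u w j) f)

  xᵒ : Fin n → Op
  xᵒ k = mul (x k)

  ∂-x* : ∀ u w k f → ∂ u w (x k *′ f) ≃ x k *′ ∂ u w f +′ κ (kron u k ℤ.- kron w k) *′ (f -′ (x u -′ x w) *′ ∂ u w f)
  ∂-x* u w k f = P.trans (Divided.∂-* _ _ (x k) f) (P.+-congˡ (P.*-congʳ (∂-x u w k)))

  ∂-x*-other : ∀ {u w k} → u ≢ k → w ≢ k → ∀ f → ∂ u w (x k *′ f) ≃ x k *′ ∂ u w f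
  ∂-x*-other {u} {w} {k} u≢k w≢k f = P.trans (∂-x* u w k f) (P.trans (P.+-congˡ (P.trans (P.*-congʳ
    (P.trans (P.reflexive (cong κ (cong₂ ℤ._-_ (kron-≢ u≢k) (kron-≢ w≢k)))) κ-0)) (P.zeroˡ _))) (P.+-identityʳ _))

  ∂-x*-first : ∀ {u w} → u ≢ w → ∀ f → ∂ u w (x u *′ f) ≃ x w *′ ∂ u w f +′ f
  ∂-x*-first {u} {w} u≢w f = P.trans (∂-x* u w u f) (P.trans (P.+-congˡ (P.*-congʳ
    (P.reflexive (≡.trans (cong κ (cong₂ ℤ._-_ (kron-≡ u) (kron-≢ (u≢w ∘ ≡.sym)))) κ-1))))
    (PS.solve (λ { (x ∷ y ∷ f ∷ d ∷ []) → x ⊗ d ⊕ 𝟙 ⊗ (f ⊖ (x ⊖ y) ⊗ d) , y ⊗ d ⊕ f }) (x u ∷ x w ∷ f ∷ ∂ u w f ∷ []) ≡.refl))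

  ∂-x*-second : ∀ {u w} → u ≢ w → ∀ f → ∂ u w (x w *′ f) ≃ x u *′ ∂ u w f -′ f
  ∂-x*-second {u} {w} u≢w f = P.trans (∂-x* u w w f) (P.trans (P.+-congˡ (P.*-congʳ
    (P.trans (P.reflexive (cong κ (cong₂ ℤ._-_ (kron-≢ u≢w) (kron-≡ w)))) (P.trans (κ-neg 1ℤ) (P.-‿cong (P.reflexive κ-1))))))
    (PS.solve (λ { (x ∷ y ∷ f ∷ d ∷ []) → y ⊗ d ⊕ ⊝ 𝟙 ⊗ (f ⊖ (x ⊖ y) ⊗ d) , x ⊗ d ⊖ f }) (x u ∷ x w ∷ f ∷ ∂ u w f ∷ []) ≡.refl))

  ∂-1 : ∀ u w → ∂ u w 1′ ≃ 0′
  ∂-1 u w = P.trans (Divided.∂-cong _ _ (P.reflexive (≡.sym κ-1))) (Divided.∂-κ _ _ 1ℤ)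

  module _ .{{_ : ℕ.NonZero n}} (2≤n : 2 ≤ n) where
    open Residue n

    next≢ : ∀ i → fin i ≢ fin (suc i)
    next≢ i = fin-≢ (ℕP.n<1+n i) (ℕP.+-monoˡ-≤ i 2≤n)

    nilHecke : NilHecke opRing n
    nilHecke = record
      { x = λ i → xᵒ (fin i)
      ; ∂ = λ i → ∂ᵒ (next≢ i)
      ; x-comm = λ i j → mkᵒ λ f → ≃⇒≋ (PS.solve (λ { (x ∷ y ∷ f ∷ []) → x ⊗ (y ⊗ f) , y ⊗ (x ⊗ f) }) (x (fin i) ∷ x (fin j) ∷ f ∷ []) ≡.refl)
      ; ∂x = λ i → mkᵒ λ f → ≃⇒≋ (∂-x*-first (next≢ i) f)
      ; ∂x⁺ = λ i → mkᵒ λ f → ≃⇒≋ (∂-x*-second (next≢ i) f)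
      ; ∂x> = λ {i} {k} p q → mkᵒ λ f → ≃⇒≋ (∂-x*-other (fin-≢ (ℕP.≤-trans (ℕP.n≤1+n _) p) q)
                (fin-≢ p (ℕP.≤-trans q (ℕP.+-monoʳ-≤ n (ℕP.n≤1+n i)))) f)
      ; ∂x< = λ {i} {k} p q → mkᵒ λ f → ≃⇒≋ (∂-x*-other (fin-≢ p (ℕP.≤-trans (ℕP.n≤1+n _) q) ∘ ≡.sym)
                (fin-≢ (ℕP.m<n⇒m<1+n p) q ∘ ≡.sym) f)
      ; Van = λ φ → fn φ 1′ ≋[ G ] 0′
      ; van-∂ = λ φ i → A.trans (fn-cong φ (≃⇒≋ (∂-1 (fin i) (fin (suc i))))) (fn-0 φ)
      ; van-- = λ p q → A.trans (A.+-cong p (A.-‿cong q)) (A.-‿inverseʳ 0′)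
      ; faithful = faithful
      }
      where
      -- The ring is generated by scalars and the x k: linearity settles the former, and φ (x k f) =
      -- ψ (φ f) the latter, with `k` represented inside the given window.
      faithful : ∀ i φ → fn φ 1′ ≋[ G ] 0′ → (∀ k → i ≤ k → suc k ≤ n ℕ.+ i → Σ Op λ ψ → φ *ᵒ xᵒ (fin k) ≈ᵒ ψ *ᵒ φ) → φ ≈ᵒ 0ᵒ
      faithful i φ van h = mkᵒ (gen (λ f → fn φ f ≋[ G ] 0′)
        (λ p q → A.trans (fn-cong φ (≃⇒≋ (P.sym p))) q)
        (λ c → A.trans (fn-cong φ (≃⇒≋ (P.sym (P.*-identityʳ (κ c))))) (A.trans (fn-lin φ (inj₁ c) 1′) (A.trans (A.*-congˡ van) (A.zeroʳ _))))
        (λ f g p q → A.trans (fn-+ φ f g) (A.trans (A.+-cong p q) (A.+-identityˡ _)))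
        step
        (λ j f p → A.trans (fn-lin φ (inj₂ j) f) (A.trans (A.*-congˡ p) (A.zeroʳ _))))
        where
        step : ∀ k f → fn φ f ≋[ G ] 0′ → fn φ (x k *′ f) ≋[ G ] 0′
        step k f p with representative i k
        ... | k′ , i≤k′ , k′<n , ≡.refl with h k′ i≤k′ k′<n
        ...   | ψ , e = A.trans (app e f) (A.trans (fn-cong ψ p) (fn-0 ψ))

-- Coefficients under shifts and permutations of the variables

vec-ext : ∀ {n} {u v : Mon n} → (∀ i → lookup u i ≡ lookup v i) → u ≡ v
vec-ext {u = u} {v} p = ≡.trans (≡.sym (VP.tabulate∘lookup u)) (≡.trans (VP.tabulate-cong p) (VP.tabulate∘lookup v))

lookup-+ᵐ : ∀ {n} (u v : Mon n) i → lookup (u +ᵐ v) i ≡ lookup u i ℕ.+ lookup v i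
lookup-+ᵐ u v i = VP.lookup-zipWith ℕ._+_ i u v

lookup-0ᵐ : ∀ {n} (i : Fin n) → lookup 0ᵐ i ≡ 0
lookup-0ᵐ i = VP.lookup-replicate i 0

lookup-unit-≡ : ∀ {n} (v : Fin n) → lookup (unit v) v ≡ 1
lookup-unit-≡ v rewrite VP.lookup∘tabulate (λ j → if does (v F.≟ j) then 1 else 0) v with v F.≟ v
... | yes _ = ≡.refl
... | no p = ⊥-elim (p ≡.refl)

lookup-unit-≢ : ∀ {n} {v i : Fin n} → v ≢ i → lookup (unit v) i ≡ 0
lookup-unit-≢ {v = v} {i} p rewrite VP.lookup∘tabulate (λ j → if does (v F.≟ j) then 1 else 0) i with v F.≟ i
... | yes q = ⊥-elim (p q)
... | no _ = ≡.refl

δ-cong : ∀ {m k} {x e : Mon m} {x′ e′ : Mon k} → (e ≡ x → e′ ≡ x′) → (e′ ≡ x′ → e ≡ x) → δ x e ≡ δ x′ e′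
δ-cong {x = x} {e} {x′} {e′} p q with e ≟ᵐ x | e′ ≟ᵐ x′
... | yes _ | yes _ = ≡.refl
... | yes a | no b = ⊥-elim (b (p a))
... | no a | yes b = ⊥-elim (a (q b))
... | no _ | no _ = ≡.refl

δ-≢ : ∀ {m} {x e : Mon m} → e ≢ x → δ x e ≡ 0ℤ
δ-≢ {x = x} {e} p with e ≟ᵐ x
... | yes q = ⊥-elim (p q)
... | no _ = ≡.refl

+ᵐ-cancelˡ : ∀ {n} (u : Mon n) {v w} → u +ᵐ v ≡ u +ᵐ w → v ≡ w
+ᵐ-cancelˡ u {v} {w} p = vec-ext λ i → ℕP.+-cancelˡ-≡ (lookup u i) _ _
  (≡.trans (≡.sym (lookup-+ᵐ u v i)) (≡.trans (cong (λ e → lookup e i) p) (lookup-+ᵐ u w i)))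

coeff-X*-shift : ∀ {m} v (g : Poly m) e → coeff (X v *′ g) (unit v +ᵐ e) ≡ coeff g e
coeff-X*-shift v g e = ≡.trans (coeff-ext (X v *′ g) _) (≡.trans (ext-X* _ v g)
  (≡.trans (ext-cong (λ e′ → δ-cong (+ᵐ-cancelˡ (unit v)) (cong (unit v +ᵐ_))) g) (≡.sym (coeff-ext g e))))

coeff-X*-zero : ∀ {m} v (g : Poly m) x → lookup x v ≡ 0 → coeff (X v *′ g) x ≡ 0ℤ
coeff-X*-zero v g x p = ≡.trans (coeff-ext (X v *′ g) x) (≡.trans (ext-X* _ v g)
  (≡.trans (ext-cong (λ e → δ-≢ {x = x} {unit v +ᵐ e} (λ q → ℕP.1+n≢0 {lookup e v} (≡.trans (≡.sym (≡.trans (lookup-+ᵐ (unit v) e v) (cong (ℕ._+ lookup e v) (lookup-unit-≡ v))))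
    (≡.trans (cong (λ e → lookup e v) q) p)))) g) (ext-0 g)))

take-var : ∀ {m} v (e : Mon m) k → lookup e v ≡ suc k → Σ (Mon m) λ e′ → e ≡ unit v +ᵐ e′ × lookup e′ v ≡ k
take-var v e k p = tabulate (λ i → lookup e i ∸ lookup (unit v) i) ,
  vec-ext (λ i → ≡.sym (≡.trans (lookup-+ᵐ (unit v) _ i) (≡.trans (cong (lookup (unit v) i ℕ.+_) (VP.lookup∘tabulate _ i)) (ℕP.m+[n∸m]≡n (le i))))) ,
  ≡.trans (VP.lookup∘tabulate _ v) (cong₂ _∸_ p (lookup-unit-≡ v))
  where
  le : ∀ i → lookup (unit v) i ≤ lookup e i
  le i with v F.≟ i
  ... | yes ≡.refl = subst (_≤ lookup e v) (≡.sym (lookup-unit-≡ v)) (subst (1 ≤_) (≡.sym p) (s≤s z≤n))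
  ... | no q = subst (_≤ lookup e i) (≡.sym (lookup-unit-≢ q)) z≤n

X-X-cancel : ∀ {m} {u w : Fin m} → u ≢ w → ∀ g → (X u -′ X w) *′ g ≃ 0′ → g ≃ 0′
X-X-cancel {m} {u} {w} u≢w g p = mk≃ λ e → ≡.trans (vanish (lookup e w) e ≡.refl) (≡.sym (cong (λ f → coeff f e) (≡.sym []≡0)))
  where
  balance : ∀ x → coeff (X u *′ g) x ≡ coeff (X w *′ g) x
  balance x = ℤP.i-j≡0⇒i≡j _ _ (begin
    coeff (X u *′ g) x ℤ.- coeff (X w *′ g) x ≡⟨ cong (ℤ._+_ (coeff (X u *′ g) x)) (coeff--′ (X w *′ g) x) ⟨
    coeff (X u *′ g) x ℤ.+ coeff (-′ (X w *′ g)) x ≡⟨ coeff-+′ (X u *′ g) (-′ (X w *′ g)) x ⟨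
    coeff (X u *′ g -′ X w *′ g) x ≡⟨ coeffs (PS.solve (λ { (a ∷ b ∷ g ∷ []) → a ⊗ g ⊖ b ⊗ g , (a ⊖ b) ⊗ g }) (X u ∷ X w ∷ g ∷ []) ≡.refl) x ⟩
    coeff ((X u -′ X w) *′ g) x ≡⟨ coeffs p x ⟩
    coeff 0′ x ≡⟨ cong (λ f → coeff f x) []≡0 ⟨
    0ℤ ∎)
    where open ≡-Reasoning
  vanish : ∀ k e → lookup e w ≡ k → coeff g e ≡ 0ℤ
  vanish zero e q = ≡.trans (≡.sym (coeff-X*-shift u g e)) (≡.trans (balance (unit u +ᵐ e))
    (coeff-X*-zero w g _ (≡.trans (lookup-+ᵐ (unit u) e w) (cong₂ ℕ._+_ (lookup-unit-≢ u≢w) q))))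
  vanish (suc k) e q with take-var w e k q
  ... | e′ , ≡.refl , r = ≡.trans (≡.sym (coeff-X*-shift u g (unit w +ᵐ e′))) (≡.trans (balance _)
    (≡.trans (cong (coeff (X w *′ g)) (≡.trans (≡.sym (+ᵐ-assoc (unit u) (unit w) e′)) (≡.trans (cong (_+ᵐ e′) (+ᵐ-comm (unit u) (unit w))) (+ᵐ-assoc (unit w) (unit u) e′))))
      (≡.trans (coeff-X*-shift w g (unit u +ᵐ e′))
        (vanish k (unit u +ᵐ e′) (≡.trans (lookup-+ᵐ (unit u) e′ w) (cong₂ ℕ._+_ (lookup-unit-≢ u≢w) r))))))

lookup-permute : ∀ {n} (π : Permutation n n) e i → lookup (permuteMon π e) i ≡ lookup e (π ⟨$⟩ʳ i)
lookup-permute π e i = VP.lookup∘tabulate _ i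

-- The substitution carries the exponent at i to position π i, while `permuteMon` reads an exponent
-- from position π i; hence the inverse.
evalMon-permute : ∀ {n} (π : Permutation n n) e → evalMon e (λ i → X (π ⟨$⟩ʳ i)) ≃ mono 1ℤ (permuteMon (flip π) e)
evalMon-permute {n} π = mon-ind _ base step
  where
  base : evalMon 0ᵐ (λ i → X (π ⟨$⟩ʳ i)) ≃ mono 1ℤ (permuteMon (flip π) 0ᵐ)
  base = P.trans (evalMon-0 (λ i → X (π ⟨$⟩ʳ i))) (P.reflexive (≡.trans (≡.sym κ-1) (≡.trans (≡.sym (mono-0ᵐ 1ℤ))
    (cong (mono 1ℤ) (vec-ext λ i → ≡.trans (lookup-0ᵐ i) (≡.sym (≡.trans (lookup-permute (flip π) 0ᵐ i) (lookup-0ᵐ (flip π ⟨$⟩ʳ i)))))))))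
  step : ∀ v e → evalMon e (λ i → X (π ⟨$⟩ʳ i)) ≃ mono 1ℤ (permuteMon (flip π) e) →
         evalMon (unit v +ᵐ e) (λ i → X (π ⟨$⟩ʳ i)) ≃ mono 1ℤ (permuteMon (flip π) (unit v +ᵐ e))
  step v e p = begin
    evalMon (unit v +ᵐ e) σ ≈⟨ evalMon-+ (unit v) e σ ⟩
    evalMon (unit v) σ *′ evalMon e σ ≈⟨ P.*-cong (evalMon-unit v σ) p ⟩
    X (π ⟨$⟩ʳ v) *′ mono 1ℤ (permuteMon (flip π) e) ≡⟨ X*mono (π ⟨$⟩ʳ v) 1ℤ _ ⟩
    mono 1ℤ (unit (π ⟨$⟩ʳ v) +ᵐ permuteMon (flip π) e) ≡⟨ cong (mono 1ℤ) (vec-ext eq) ⟩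
    mono 1ℤ (permuteMon (flip π) (unit v +ᵐ e)) ∎
    where
    open PR
    σ = λ i → X (π ⟨$⟩ʳ i)
    unit-eq : ∀ i → lookup (unit (π ⟨$⟩ʳ v)) i ≡ lookup (unit v) (π ⟨$⟩ˡ i)
    unit-eq i with v F.≟ (π ⟨$⟩ˡ i)
    ... | yes ≡.refl = ≡.trans (cong (λ j → lookup (unit j) i) (Perm.inverseʳ π)) (≡.trans (lookup-unit-≡ {n} i) (≡.sym (lookup-unit-≡ {n} v)))
    ... | no q = ≡.trans (lookup-unit-≢ {v = π ⟨$⟩ʳ v} {i} (λ { ≡.refl → q (≡.sym (Perm.inverseˡ π)) })) (≡.sym (lookup-unit-≢ {v = v} {π ⟨$⟩ˡ i} q))
    eq : ∀ i → lookup (unit (π ⟨$⟩ʳ v) +ᵐ permuteMon (flip π) e) i ≡ lookup (permuteMon (flip π) (unit v +ᵐ e)) i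
    eq i = ≡.trans (lookup-+ᵐ (unit (π ⟨$⟩ʳ v)) (permuteMon (flip π) e) i) (≡.trans (cong₂ ℕ._+_ (unit-eq i) (lookup-permute (flip π) e i))
      (≡.sym (≡.trans (lookup-permute (flip π) (unit v +ᵐ e) i) (lookup-+ᵐ (unit v) e (π ⟨$⟩ˡ i)))))

coeff-permute : ∀ {n} (π : Permutation n n) f x → coeff (f [ (λ i → X (π ⟨$⟩ʳ i)) ]) x ≡ coeff f (permuteMon π x)
coeff-permute π f x = begin
  coeff (f [ σ ]) x ≡⟨ coeff-ext (f [ σ ]) x ⟩
  ext (δ x) (f [ σ ]) ≡⟨ ext-[] (δ x) f σ ⟩
  ext (λ e → ext (δ x) (evalMon e σ)) f ≡⟨ ext-cong each f ⟩
  ext (δ (permuteMon π x)) f ≡⟨ coeff-ext f (permuteMon π x) ⟨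
  coeff f (permuteMon π x) ∎
  where
  open ≡-Reasoning
  σ = λ i → X (π ⟨$⟩ʳ i)
  there : ∀ e → permuteMon π (permuteMon (flip π) e) ≡ e
  there e = vec-ext λ i → ≡.trans (lookup-permute π (permuteMon (flip π) e) i) (≡.trans (lookup-permute (flip π) e (π ⟨$⟩ʳ i)) (cong (lookup e) (Perm.inverseˡ π)))
  back : ∀ e → permuteMon (flip π) (permuteMon π e) ≡ e
  back e = vec-ext λ i → ≡.trans (lookup-permute (flip π) (permuteMon π e) i) (≡.trans (lookup-permute π e (π ⟨$⟩ˡ i)) (cong (lookup e) (Perm.inverseʳ π)))
  each : ∀ e → ext (δ x) (evalMon e σ) ≡ δ (permuteMon π x) e
  each e = ≡.trans (ext-resp (evalMon-permute π e) (δ x)) (≡.trans (ext-mono (δ x) 1ℤ _) (≡.trans (ℤP.*-identityˡ _)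
    (δ-cong (λ p → ≡.trans (≡.sym (there e)) (cong (permuteMon π) p)) (λ p → ≡.trans (cong (permuteMon (flip π)) p) (back x)))))

-- Symmetric polynomials

variableForms : ∀ n → Forms n
variableForms n = record
  { m = n ; G = λ _ → ⊥ ; J = ⊥ ; s = λ () ; x = X ; d = kron
  ; ∂-x = λ u w k → Divided.∂-X _ _ k
  ; ∂-s = λ u w () ; ∂-G = λ _ ()
  ; gen = λ Q r c p t _ → poly-ind Q r c p t }

module _ {n : ℕ} where
  open Forms (variableForms n) using (∂)

  swapped : Fin n → Fin n → Fin n → Poly n
  swapped u w v = X (PC.transpose u w v)

  ∂-swap : ∀ {u w} → u ≢ w → ∀ f → f [ swapped u w ] ≃ f -′ (X u -′ X w) *′ ∂ u w f
  ∂-swap {u} {w} u≢w f = P.trans (P.sym (P.trans ([]-∘ tilt atα f) ([]-ext each f))) (tilt-at f)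
    where
    open Divided (λ v → kron u v ℤ.- kron w v) (X u -′ X w) using (tilt; atα; tilt-at)
    tilted : ∀ v → tilt v [ atα ] ≃ X v +′ κ (kron u v ℤ.- kron w v) *′ -′ (X u -′ X w)
    tilted v = P.trans ([]-+ atα _ _) (P.+-cong ([]-X atα (F.suc v)) (P.trans ([]-* atα _ _) (P.*-cong ([]-κ atα _) ([]-X atα F.zero))))
    each : ∀ v → tilt v [ atα ] ≃ X (PC.transpose u w v)
    each v with v F.≟ u
    ... | yes ≡.refl = P.trans (tilted v) (P.trans (P.+-congˡ (P.*-congʳ (P.reflexive (≡.trans (cong κ (cong₂ ℤ._-_ (kron-≡ v) (kron-≢ (u≢w ∘ ≡.sym)))) κ-1))))
            (PS.solve (λ { (a ∷ b ∷ []) → a ⊕ 𝟙 ⊗ ⊝ (a ⊖ b) , b }) (X u ∷ X w ∷ []) ≡.refl))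
    ... | no v≢u with v F.≟ w
    ...   | yes ≡.refl = P.trans (tilted v) (P.trans (P.+-congˡ (P.*-congʳ (P.trans (P.reflexive (cong κ (cong₂ ℤ._-_ (kron-≢ u≢w) (kron-≡ v))))
              (P.trans (κ-neg 1ℤ) (P.-‿cong (P.reflexive κ-1))))))
            (PS.solve (λ { (a ∷ b ∷ []) → b ⊕ ⊝ 𝟙 ⊗ ⊝ (a ⊖ b) , a }) (X u ∷ X w ∷ []) ≡.refl))
    ...   | no v≢w = P.trans (tilted v) (P.trans (P.+-congˡ (P.*-congʳ (P.trans (P.reflexive (cong κ (cong₂ ℤ._-_ (kron-≢ (v≢u ∘ ≡.sym)) (kron-≢ (v≢w ∘ ≡.sym))))) κ-0)))
            (PS.solve (λ { (v ∷ a ∷ []) → v ⊕ 𝟘 ⊗ a , v }) (X v ∷ -′ (X u -′ X w) ∷ []) ≡.refl))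

  -- The multiple (X u - X w) ∂ p equals p minus its transposed version, and X u - X w can be
  -- cancelled.
  symmetric⇒∂≃0 : ∀ {p} → IsSymNoConst p → ∀ {u w} → u ≢ w → ∂ u w p ≃ 0′
  symmetric⇒∂≃0 {p} (inv , _) {u} {w} u≢w = X-X-cancel u≢w (∂ u w p) (begin
    (X u -′ X w) *′ ∂ u w p
      ≈⟨ PS.solve (λ { (a ∷ f ∷ []) → a , f ⊖ (f ⊖ a) }) ((X u -′ X w) *′ ∂ u w p ∷ p ∷ []) ≡.refl ⟩
    p -′ (p -′ (X u -′ X w) *′ ∂ u w p) ≈⟨ P.+-congˡ (P.-‿cong (∂-swap u≢w p)) ⟨
    p -′ p [ swapped u w ] ≈⟨ P.+-congˡ (P.-‿cong (mk≃ λ e → ≡.trans (coeff-permute (Perm.transpose u w) p e) (inv (Perm.transpose u w) e))) ⟩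
    p -′ p ≈⟨ P.-‿inverseʳ p ⟩
    0′ ∎)
    where open PR

  -- The index map is a bare function, so that permutations are compared pointwise.
  Fixed : Poly n → (Fin n → Fin n) → Set
  Fixed f π = f [ X ∘ π ] ≃ f

  fixed-∘ : ∀ {f π ρ} → Fixed f π → Fixed f ρ → Fixed f (ρ ∘ π)
  fixed-∘ {f} {π} {ρ} p q = P.trans (P.sym (P.trans ([]-∘ (X ∘ π) (X ∘ ρ) f) ([]-ext (λ v → []-X (X ∘ ρ) (π v)) f)))
    (P.trans ([]-cong (X ∘ ρ) p) q)

  fixed-ext : ∀ {f π ρ} → (∀ i → π i ≡ ρ i) → Fixed f π → Fixed f ρ
  fixed-ext {f} e p = P.trans ([]-ext (λ v → P.reflexive (cong X (≡.sym (e v)))) f) p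

  transpose-first : ∀ (u w : Fin n) → PC.transpose u w u ≡ w
  transpose-first u w with u F.≟ u
  ... | yes _ = ≡.refl
  ... | no p = ⊥-elim (p ≡.refl)

  transpose-second : ∀ (u w : Fin n) → PC.transpose u w w ≡ u
  transpose-second u w with w F.≟ u
  ... | yes p = p
  ... | no _ with w F.≟ w
  ...   | yes _ = ≡.refl
  ...   | no p = ⊥-elim (p ≡.refl)

  transpose-other : ∀ {u w v : Fin n} → v ≢ u → v ≢ w → PC.transpose u w v ≡ v
  transpose-other {u} {w} {v} p q with v F.≟ u
  ... | yes r = ⊥-elim (p r)
  ... | no _ with v F.≟ w
  ...   | yes r = ⊥-elim (q r)
  ...   | no _ = ≡.refl

  transpose-conj : ∀ {i j k : Fin n} → i ≢ j → i ≢ k → j ≢ k → ∀ v →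
                   PC.transpose j k (PC.transpose i j (PC.transpose j k v)) ≡ PC.transpose i k v
  transpose-conj {i} {j} {k} ij ik jk v = cases (v F.≟ i) (v F.≟ k) (v F.≟ j)
    where
    cases : Dec (v ≡ i) → Dec (v ≡ k) → Dec (v ≡ j) → PC.transpose j k (PC.transpose i j (PC.transpose j k v)) ≡ PC.transpose i k v
    cases (yes ≡.refl) _ _ = ≡.trans (cong (PC.transpose j k ∘ PC.transpose i j) (transpose-other ij ik))
      (≡.trans (cong (PC.transpose j k) (transpose-first i j)) (≡.trans (transpose-first j k) (≡.sym (transpose-first i k))))
    cases _ (yes ≡.refl) _ = ≡.trans (cong (PC.transpose j k ∘ PC.transpose i j) (transpose-second j k))
      (≡.trans (cong (PC.transpose j k) (transpose-second i j)) (≡.trans (transpose-other ij ik) (≡.sym (transpose-second i k))))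
    cases (no vi) (no vk) (yes ≡.refl) = ≡.trans (cong (PC.transpose j k ∘ PC.transpose i j) (transpose-first j k))
      (≡.trans (cong (PC.transpose j k) (transpose-other (ik ∘ ≡.sym) (jk ∘ ≡.sym))) (≡.trans (transpose-second j k) (≡.sym (transpose-other vi vk))))
    cases (no vi) (no vk) (no vj) = ≡.trans (cong (PC.transpose j k ∘ PC.transpose i j) (transpose-other vj vk))
      (≡.trans (cong (PC.transpose j k) (transpose-other vi vj)) (≡.trans (transpose-other vj vk) (≡.sym (transpose-other vi vk))))

  module _ {f : Poly n} (adjacent : ∀ u w → toℕ w ≡ suc (toℕ u) → Fixed f (PC.transpose u w)) where

    -- The transposition (i k) is (i k-1) conjugated by the adjacent transposition (k-1 k), which
    -- lowers `b` by one.
    fixed-< : ∀ b (i k : Fin n) → toℕ k ≡ b → toℕ i < b → Fixed f (PC.transpose i k)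
    fixed-< (suc b) i k p i<b with ℕP.m<1+n⇒m<n∨m≡n i<b
    ... | inj₂ q = adjacent i k (≡.trans p (cong suc (≡.sym q)))
    ... | inj₁ i<b′ = fixed-ext {f} (transpose-conj (λ e → ℕP.<⇒≢ i<b′ (≡.trans (cong toℕ e) jb)) (λ e → ℕP.<⇒≢ i<b (≡.trans (cong toℕ e) p))
              (λ e → ℕP.1+n≢n (≡.trans (≡.sym p) (≡.trans (cong toℕ (≡.sym e)) jb))))
            (fixed-∘ {f} (fixed-∘ {f} t (fixed-< b i j jb i<b′)) t)
      where
      b<n : b < n
      b<n = ℕP.<-trans (ℕP.n<1+n b) (subst (_< n) p (FP.toℕ<n k))
      j : Fin n
      j = F.fromℕ< b<n
      jb : toℕ j ≡ b
      jb = FP.toℕ-fromℕ< b<n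
      t = adjacent j k (≡.trans p (cong suc (≡.sym jb)))

    fixed-transpose : ∀ i k → Fixed f (PC.transpose i k)
    fixed-transpose i k with ℕP.<-cmp (toℕ i) (toℕ k)
    ... | tri< i<k _ _ = fixed-< (toℕ k) i k ≡.refl i<k
    ... | tri≈ _ e _ = fixed-ext {f} (same (FP.toℕ-injective e)) ([]-id f)
      where
      same : ∀ {i k : Fin n} → i ≡ k → ∀ v → v ≡ PC.transpose i k v
      same {i} ≡.refl v with v F.≟ i
      ... | yes q = q
      ... | no _ with v F.≟ i
      ...   | yes q = q
      ...   | no _ = ≡.refl
    ... | tri> _ _ k<i = fixed-ext {f} flipped (fixed-< (toℕ i) k i ≡.refl k<i)
      where
      flipped : ∀ v → PC.transpose k i v ≡ PC.transpose i k v
      flipped v = cases (v F.≟ i) (v F.≟ k)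
        where
        cases : Dec (v ≡ i) → Dec (v ≡ k) → PC.transpose k i v ≡ PC.transpose i k v
        cases (yes ≡.refl) _ = ≡.trans (transpose-second k v) (≡.sym (transpose-first v k))
        cases _ (yes ≡.refl) = ≡.trans (transpose-first v i) (≡.sym (transpose-second i v))
        cases (no vi) (no vk) = ≡.trans (transpose-other vk vi) (≡.sym (transpose-other vi vk))

    fixed-eval : ∀ ts → Fixed f (TL.eval ts ⟨$⟩ʳ_)
    fixed-eval [] = []-id f
    fixed-eval ((i , k) ∷ ts) = fixed-∘ {f} (fixed-transpose i k) (fixed-eval ts)

    fixed-all : ∀ (π : Permutation n n) → Fixed f (π ⟨$⟩ʳ_)
    fixed-all π = fixed-ext {f} (TL.eval-decompose π) (fixed-eval (TL.decompose π))

  -- Vanishing of ∂ means invariance under the corresponding transposition, and adjacent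
  -- transpositions generate all permutations.
  ∂≃0⇒symmetric : ∀ {f} → (∀ u w → toℕ w ≡ suc (toℕ u) → ∂ u w f ≃ 0′) → coeff f 0ᵐ ≡ 0ℤ → IsSymNoConst f
  ∂≃0⇒symmetric {f} h c = (λ π e → ≡.trans (≡.sym (coeff-permute π f e)) (coeffs (fixed-all {f} adjacent π) e)) , c
    where
    adjacent : ∀ u w → toℕ w ≡ suc (toℕ u) → Fixed f (PC.transpose u w)
    adjacent u w p = P.trans (∂-swap (λ { ≡.refl → ℕP.1+n≢n (≡.sym p) }) f)
      (P.trans (P.+-congˡ (P.trans (P.-‿cong (P.trans (P.*-congˡ (h u w p)) (P.zeroʳ _))) PP.-0#≈0#)) (P.+-identityʳ f))

-- Gradings

wdeg : ∀ {m} → (Fin m → ℤ) → Mon m → ℤ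
wdeg w [] = 0ℤ
wdeg w (a ∷ e) = + a ℤ.* w F.zero ℤ.+ wdeg (w ∘ F.suc) e

wdeg-+ : ∀ {m} (w : Fin m → ℤ) a b → wdeg w (a +ᵐ b) ≡ wdeg w a ℤ.+ wdeg w b
wdeg-+ w [] [] = ≡.refl
wdeg-+ w (x ∷ a) (y ∷ b) = ≡.trans (cong₂ (λ p q → p ℤ.* w F.zero ℤ.+ q) (ℤP.pos-+ x y) (wdeg-+ (w ∘ F.suc) a b))
  (lemma (+ x) (+ y) (w F.zero) (wdeg (w ∘ F.suc) a) (wdeg (w ∘ F.suc) b))
  where
  lemma : ∀ x y z p q → (x ℤ.+ y) ℤ.* z ℤ.+ (p ℤ.+ q) ≡ (x ℤ.* z ℤ.+ p) ℤ.+ (y ℤ.* z ℤ.+ q)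
  lemma = solve-∀

wdeg-0 : ∀ {m} (w : Fin m → ℤ) → wdeg w 0ᵐ ≡ 0ℤ
wdeg-0 {zero} w = ≡.refl
wdeg-0 {suc m} w = ≡.trans (ℤP.+-identityˡ _) (wdeg-0 (w ∘ F.suc))

wdeg-zeros : ∀ {m} (w : Fin m → ℤ) → wdeg w (tabulate (λ _ → 0)) ≡ 0ℤ
wdeg-zeros {zero} w = ≡.refl
wdeg-zeros {suc m} w = ≡.trans (ℤP.+-identityˡ _) (wdeg-zeros (w ∘ F.suc))

wdeg-unit : ∀ {m} (w : Fin m → ℤ) v → wdeg w (unit v) ≡ w v
wdeg-unit w F.zero = ≡.trans (cong₂ ℤ._+_ (ℤP.*-identityˡ (w F.zero)) (wdeg-zeros (w ∘ F.suc))) (ℤP.+-identityʳ (w F.zero))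
wdeg-unit w (F.suc v) = ≡.trans (ℤP.+-identityˡ _) (wdeg-unit (w ∘ F.suc) v)

module Graded {m : ℕ} (v w : Fin m → ℤ) where

  Ok : ℤ → ℤ → ℤ × Mon m → Set
  Ok N z t = wdeg v (proj₂ t) ℤ.≤ N × wdeg w (proj₂ t) ≡ z

  -- `v` gives a filtration and `w` a grading, recorded together. The condition is on some list
  -- representing `f`, since the given list may contain terms that cancel.
  Bd : ℤ → ℤ → Poly m → Set
  Bd N z f = Σ (Poly m) λ g → f ≃ g × All (Ok N z) g

  Bd-resp : ∀ {N z f g} → f ≃ g → Bd N z f → Bd N z g
  Bd-resp p (h , q , a) = h , P.trans (P.sym p) q , a

  Bd-mono : ∀ {N N′ z f} → N ℤ.≤ N′ → Bd N z f → Bd N′ z f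
  Bd-mono l (h , q , a) = h , q , All.map (λ { (p , r) → ℤP.≤-trans p l , r }) a

  Bd-≡ : ∀ {N N′ z z′ f} → N ≡ N′ → z ≡ z′ → Bd N z f → Bd N′ z′ f
  Bd-≡ ≡.refl ≡.refl b = b

  opaque
    unfolding _+′_ _*′_ -′_ 0′ κ X mono

    Bd-0 : ∀ {N z} → Bd N z 0′
    Bd-0 = [] , ≃-refl , []

    Bd-+ : ∀ {N z f g} → Bd N z f → Bd N z g → Bd N z (f +′ g)
    Bd-+ (h , q , a) (h′ , q′ , a′) = h +′ h′ , P.+-cong q q′ , AllP.++⁺ a a′

    Bd-neg : ∀ {N z f} → Bd N z f → Bd N z (-′ f)
    Bd-neg (h , q , a) = -′ h , P.-‿cong q , AllP.map⁺ (All.map (λ x → x) a)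

    Bd-mono-term : ∀ {N z} c e → wdeg v e ℤ.≤ N → wdeg w e ≡ z → Bd N z (mono c e)
    Bd-mono-term c e p q = (c , e) ∷ [] , ≃-refl , (p , q) ∷ []

    All-scale : ∀ {N N′ z z′} {t : ℤ × Mon m} {g} → Ok N z t → All (Ok N′ z′) g →
                All (Ok (N ℤ.+ N′) (z ℤ.+ z′)) (L.map (λ { (c′ , e′) → (proj₁ t ℤ.* c′ , zipWith ℕ._+_ (proj₂ t) e′) }) g)
    All-scale o [] = []
    All-scale {t = c , e} (p , q) (_∷_ {x = c′ , e′} (p′ , q′) a) =
      (subst (ℤ._≤ _) (≡.sym (wdeg-+ v e e′)) (ℤP.+-mono-≤ p p′) , ≡.trans (wdeg-+ w e e′) (cong₂ ℤ._+_ q q′)) ∷ All-scale {t = c , e} (p , q) a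

    All-* : ∀ {N N′ z z′} {f g} → All (Ok N z) f → All (Ok N′ z′) g → All (Ok (N ℤ.+ N′) (z ℤ.+ z′)) (f *ₚ g)
    All-* [] b = []
    All-* (_∷_ {x = t} o a) b = AllP.++⁺ (All-scale {t = t} o b) (All-* a b)

    Bd-* : ∀ {N N′ z z′ f g} → Bd N z f → Bd N′ z′ g → Bd (N ℤ.+ N′) (z ℤ.+ z′) (f *′ g)
    Bd-* (h , q , a) (h′ , q′ , a′) = h *′ h′ , P.*-cong q q′ , All-* a a′

  Bd-κ : ∀ c → Bd 0ℤ 0ℤ (κ c)
  Bd-κ c = subst (Bd 0ℤ 0ℤ) (mono-0ᵐ c) (Bd-mono-term c 0ᵐ (ℤP.≤-reflexive (wdeg-0 v)) (wdeg-0 w))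

  Bd-X : ∀ u → Bd (v u) (w u) (X u)
  Bd-X u = subst (Bd (v u) (w u)) (≡.sym (X-mono u)) (Bd-mono-term 1ℤ (unit u) (ℤP.≤-reflexive (wdeg-unit v u)) (wdeg-unit w u))

  Bd-1 : Bd 0ℤ 0ℤ 1′
  Bd-1 = subst (Bd 0ℤ 0ℤ) κ-1 (Bd-κ 1ℤ)

  Bd-κ* : ∀ {N z f} c → Bd N z f → Bd N z (κ c *′ f)
  Bd-κ* c b = Bd-≡ (ℤP.+-identityˡ _) (ℤP.+-identityˡ _) (Bd-* (Bd-κ c) b)

  Bd-^ : ∀ {N z f} a → Bd N z f → Bd (+ a ℤ.* N) (+ a ℤ.* z) (f ^ₚ a)
  Bd-^ {f = f} zero b = subst (Bd _ _) (≡.sym (^-0 f)) Bd-1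
  Bd-^ {N} {z} {f} (suc a) b = subst (Bd _ _) (≡.sym (^-suc f a)) (Bd-≡ (lemma N) (lemma z) (Bd-* b (Bd-^ a b)))
    where
    lemma : ∀ x → x ℤ.+ + a ℤ.* x ≡ + suc a ℤ.* x
    lemma x = ≡.trans (lem (+ a) x) (cong (ℤ._* x) (≡.sym (ℤP.pos-+ 1 a)))
      where
      lem : ∀ a x → x ℤ.+ a ℤ.* x ≡ (1ℤ ℤ.+ a) ℤ.* x
      lem = solve-∀

module _ {k : ℕ} (v′ w′ : Fin k → ℤ) where
  open Graded v′ w′

  Bd-evalMon : ∀ {m} (v w : Fin m → ℤ) (σ : Fin m → Poly k) → (∀ u → Bd (v u) (w u) (σ u)) →
               ∀ e → Bd (wdeg v e) (wdeg w e) (evalMon e σ)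
  Bd-evalMon v w σ b [] = subst (Bd _ _) (≡.sym (evalMon-[] σ)) Bd-1
  Bd-evalMon v w σ b (a ∷ e) = subst (Bd _ _) (≡.sym (evalMon-∷ a e σ))
    (Bd-* (Bd-^ a (b F.zero)) (Bd-evalMon (v ∘ F.suc) (w ∘ F.suc) (σ ∘ F.suc) (b ∘ F.suc) e))

  Bd-[] : ∀ {m} (v w : Fin m → ℤ) (σ : Fin m → Poly k) → (∀ u → Bd (v u) (w u) (σ u)) →
          ∀ {N z f} → Graded.Bd v w N z f → Bd N z (f [ σ ])
  Bd-[] v w σ b {N} {z} (h , q , a) = Bd-resp ([]-cong σ (P.sym q)) (go h a)
    where
    go : ∀ h → All (Graded.Ok v w N z) h → Bd N z (h [ σ ])
    go [] [] = subst (Bd N z) (≡.sym ([]-[] σ)) Bd-0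
    go ((c , e) ∷ h) ((p , r) ∷ a) = subst (Bd N z) (≡.sym ([]-∷ c e h σ))
      (Bd-+ (Bd-κ* c (Bd-mono p (Bd-≡ ≡.refl r (Bd-evalMon v w σ b e)))) (go h a))

extend : ∀ {m} → ℤ → (Fin m → ℤ) → Fin (suc m) → ℤ
extend a v F.zero = a
extend a v (F.suc u) = v u

All-divz : ∀ {m} (v w : Fin m → ℤ) a b {N z} f → All (Graded.Ok (extend a v) (extend b w) N z) f →
           All (Graded.Ok (extend a v) (extend b w) (N ℤ.- a) (z ℤ.- b)) (divz f)
All-divz v w a b [] [] = []
All-divz v w a b ((c , zero ∷ e) ∷ f) (o ∷ os) = All-divz v w a b f os
All-divz v w a b {N} {z} ((c , suc k ∷ e) ∷ f) ((p , q) ∷ os) =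
  (subst (ℤ._≤ N ℤ.- a) (lemma a v) (ℤP.+-monoˡ-≤ (ℤ.- a) p) , ≡.trans (≡.sym (lemma b w)) (cong (ℤ._- b) q)) ∷ All-divz v w a b f os
  where
  lemma : ∀ a v → wdeg (extend a v) (suc k ∷ e) ℤ.- a ≡ wdeg (extend a v) (k ∷ e)
  lemma a v = ≡.trans (cong (λ s → s ℤ.* a ℤ.+ wdeg v e ℤ.- a) (ℤP.pos-+ 1 k)) (lem (+ k) a (wdeg v e))
    where
    lem : ∀ k a d → (1ℤ ℤ.+ k) ℤ.* a ℤ.+ d ℤ.- a ≡ k ℤ.* a ℤ.+ d
    lem = solve-∀

module _ {m : ℕ} (v w : Fin m → ℤ) (D : Fin m → ℤ) {α : Poly m} {a b : ℤ} where
  open Graded v w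

  -- Give the auxiliary variable z the weights of `α`. The tilt is then homogeneous because
  -- variables with D u ≠ 0 have these weights too; dividing by z subtracts them, and substituting
  -- -α for z preserves weights.
  Bd-∂ : Bd a b α → (∀ u → D u ≡ 0ℤ ⊎ (v u ≡ a × w u ≡ b)) →
         ∀ {N z f} → Bd N z f → Bd (N ℤ.- a) (z ℤ.- b) (Divided.∂ D α f)
  Bd-∂ bα bD bf with Bd-[] v⁺ w⁺ v w tilt bd-tilt bf
    where
    open Divided D α
    v⁺ = extend a v
    w⁺ = extend b w
    module B⁺ = Graded v⁺ w⁺
    bd-tilt : ∀ u → B⁺.Bd (v u) (w u) (tilt u)
    bd-tilt u with bD u
    ... | inj₁ e = B⁺.Bd-resp (P.sym (P.trans (P.+-congˡ (P.trans (P.*-congʳ (P.trans (P.reflexive (cong κ e)) κ-0)) (P.zeroˡ _))) (P.+-identityʳ _))) (B⁺.Bd-X (F.suc u))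
    ... | inj₂ (≡.refl , ≡.refl) = B⁺.Bd-+ (B⁺.Bd-X (F.suc u)) (B⁺.Bd-κ* (D u) (B⁺.Bd-X F.zero))
  ... | h , q , all = Bd-[] v w v⁺ w⁺ atα bd-at (divz h , divz-cong q , All-divz v w a b h all)
    where
    open Divided D α
    v⁺ = extend a v
    w⁺ = extend b w
    bd-at : ∀ u → Bd (v⁺ u) (w⁺ u) (atα u)
    bd-at F.zero = Bd-neg bα
    bd-at (F.suc u) = Bd-X u

-- The ring H ⊗ K with its nil-Hecke operators

module PSum {m : ℕ} = FinSum (P.ring {m})

opaque
  unfolding _+′_ -′_ _*′_ 0′ 1′ X κ _[_]

  X≡var : ∀ {m} (v : Fin m) → X v ≡ var v
  X≡var v = ≡.refl

  0′≡0ₚ : ∀ {m} → 0′ {m} ≡ 0ₚ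
  0′≡0ₚ = ≡.refl

  1′≡1ₚ : ∀ {m} → 1′ {m} ≡ 1ₚ
  1′≡1ₚ = ≡.refl

  +′≡+ₚ : ∀ {m} (f g : Poly m) → f +′ g ≡ f +ₚ g
  +′≡+ₚ f g = ≡.refl

  *′≡*ₚ : ∀ {m} (f g : Poly m) → f *′ g ≡ f *ₚ g
  *′≡*ₚ f g = ≡.refl

  -′≡-ₚ : ∀ {m} (f g : Poly m) → f -′ g ≡ f -ₚ g
  -′≡-ₚ f g = ≡.refl

  []≡substₚ : ∀ {m l} (f : Poly m) (σ : Fin m → Poly l) → f [ σ ] ≡ substₚ f σ
  []≡substₚ f σ = ≡.refl

  κ≡constₚ : ∀ {m} c → κ {m} c ≡ constₚ c
  κ≡constₚ c = ≡.refl

-- The coefficient of x_u in Y_t, since Y_t is the sum of the first t of the x.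
below : ∀ {n} → Fin n → ℕ → ℤ
below u t with toℕ u ℕ.<? t
... | yes _ = 1ℤ
... | no _ = 0ℤ

below-yes : ∀ {n} {u : Fin n} {t} → toℕ u < t → below u t ≡ 1ℤ
below-yes {u = u} {t} p with toℕ u ℕ.<? t
... | yes _ = ≡.refl
... | no q = ⊥-elim (q p)

below-no : ∀ {n} {u : Fin n} {t} → t ≤ toℕ u → below u t ≡ 0ℤ
below-no {u = u} {t} p with toℕ u ℕ.<? t
... | yes q = ⊥-elim (ℕP.<⇒≱ q p)
... | no _ = ≡.refl

below-step : ∀ {n} (u k : Fin n) → below u (suc (toℕ k)) ≡ below u (toℕ k) ℤ.+ kron u k
below-step u k with ℕP.<-cmp (toℕ u) (toℕ k)
... | tri< p _ _ = ≡.trans (below-yes {u = u} (ℕP.m<n⇒m<1+n p)) (≡.sym (cong₂ ℤ._+_ (below-yes {u = u} p) (kron-≢ {u = u} {k} λ e → ℕP.<⇒≢ p (cong toℕ e))))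
... | tri≈ _ p _ with FP.toℕ-injective p
...   | ≡.refl = ≡.trans (below-yes {u = u} (ℕP.n<1+n (toℕ u))) (≡.sym (cong₂ ℤ._+_ (below-no {u = u} ℕP.≤-refl) (kron-≡ u)))
below-step u k | tri> _ _ p = ≡.trans (below-no {u = u} p) (≡.sym (cong₂ ℤ._+_ (below-no {u = u} (ℕP.<⇒≤ p)) (kron-≢ {u = u} {k} λ e → ℕP.<⇒≢ p (cong toℕ (≡.sym e)))))

sum-telescope : ∀ {m} N (g : ℕ → Poly m) → PSum.sum (λ (k : Fin N) → g (suc (toℕ k)) -′ g (toℕ k)) ≃ g N -′ g 0
sum-telescope zero g = P.sym (P.-‿inverseʳ (g 0))
sum-telescope (suc N) g = P.trans (P.+-congˡ (sum-telescope N (g ∘ suc)))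
  (PS.solve (λ { (a ∷ b ∷ c ∷ []) → (b ⊖ a) ⊕ (c ⊖ b) , c ⊖ a }) (g 0 ∷ g 1 ∷ g (suc N) ∷ []) ≡.refl)

module _ {c ℓ} (R : Ring c ℓ) where
  open Ring R

  product : ∀ {n} → (Fin n → Carrier) → Carrier
  product {zero} g = 1#
  product {suc n} g = g F.zero * product (g ∘ F.suc)

  product-cong : ∀ {n} {g h : Fin n → Carrier} → (∀ i → g i ≈ h i) → product g ≈ product h
  product-cong {zero} p = refl
  product-cong {suc n} p = *-cong (p F.zero) (product-cong (p ∘ F.suc))

  foldr-tabulate : ∀ {n} {A : Set} (g : A → Carrier) (h : Fin n → A) →
                   L.foldr (λ j acc → g j * acc) 1# (L.tabulate h) ≡ product (g ∘ h)
  foldr-tabulate {zero} g h = ≡.refl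
  foldr-tabulate {suc n} g h = cong (g (h F.zero) *_) (foldr-tabulate g (h ∘ F.suc))

  module _ (q : ℕ → Carrier) (q-central : ∀ i φ → q i * φ ≈ φ * q i) where
    open IntervalProduct R q q-central

    Q-left : ∀ {a b} → suc a < b → Q a b ≈ q a * Q (suc a) b
    Q-left p = trans (Q-split (ℕP.n<1+n _) p) (*-congʳ (Q-one _))

    Q-product : ∀ l a → Q a (suc l ℕ.+ a) ≈ product {suc l} (λ k → q (toℕ k ℕ.+ a))
    Q-product zero a = trans (Q-one a) (sym (*-identityʳ _))
    Q-product (suc l) a = trans (Q-left (s≤s (s≤s (ℕP.m≤n+m a l)))) (*-congˡ (trans (reflexive (cong (λ b → Q (suc a) (suc b)) (≡.sym (ℕP.+-suc l a))))
      (trans (Q-product l (suc a)) (product-cong {suc l} {λ k → q (toℕ k ℕ.+ suc a)} {λ k → q (suc (toℕ k ℕ.+ a))} (λ k → reflexive (cong q (ℕP.+-suc (toℕ k) a)))))))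

    Q-window : ∀ l → (∀ i → q (suc (suc l) ℕ.+ i) ≈ q i) → ∀ a → Q a (suc (suc l) ℕ.+ a) ≈ Q 0 (suc (suc l) ℕ.+ 0)
    Q-window l per zero = refl
    Q-window l per (suc a) = trans (trans (reflexive (cong (λ b → Q (suc a) (suc (suc b))) (ℕP.+-suc l a)))
      (trans (Q-step (s≤s (s≤s (ℕP.m≤n+m a l)))) (trans (*-congʳ (per a)) (sym (Q-left (s≤s (s≤s (ℕP.m≤n+m a l)))))))) (Q-window l per a)

module HK (k : ℕ) where

  n : ℕ
  n = suc (suc k)

  open Flag n public
  open Residue n public

  Y : ℕ → PolyHK
  Y = Yat ιY

  Y-0 : Y 0 ≡ 0′
  Y-0 = ≡.sym 0′≡0ₚ

  Y-suc : ∀ {t} (p : t < r) → Y (suc t) ≡ X (ιY (fromℕ< p))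
  Y-suc {t} p with t ℕ.<? r
  ... | yes q = ≡.sym (X≡var _)
  ... | no q = ⊥-elim (q p)

  Y-top : ∀ {t} → r ≤ t → Y (suc t) ≡ 0′
  Y-top {t} p with t ℕ.<? r
  ... | yes q = ⊥-elim (ℕP.<⇒≱ q p)
  ... | no _ = ≡.sym 0′≡0ₚ

  Y-ι : ∀ i → Y (suc (toℕ i)) ≡ X (ιY i)
  Y-ι i = ≡.trans (Y-suc (FP.toℕ<n i)) (cong (X ∘ ιY) (FP.fromℕ<-toℕ i (FP.toℕ<n i)))

  x-def : ∀ k → x k ≡ Y (suc (toℕ k)) -′ Y (toℕ k)
  x-def k = ≡.sym (-′≡-ₚ _ _)

  dʸ : Fin n → Fin M → ℤ
  dʸ u v = [ (λ j → below u (suc (toℕ j))) , (λ _ → 0ℤ) ]′ (splitAt r v)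

  dʸ-Y : ∀ u i → dʸ u (ιY i) ≡ below u (suc (toℕ i))
  dʸ-Y u i rewrite FP.splitAt-↑ˡ r i n = ≡.refl

  dʸ-q : ∀ u j → dʸ u (ιq j) ≡ 0ℤ
  dʸ-q u j rewrite FP.splitAt-↑ʳ r n j = ≡.refl

  q : Fin n → PolyHK
  q j = X (ιq j)

  module _ (u w : Fin n) where
    open Divided (λ v → dʸ u v ℤ.- dʸ w v) (x u -′ x w)

    -- At t = n the class is 0 and both `below` values are 1, so the formula persists; this reflects
    -- that ∂ respects the relation Σ x = 0.
    ∂-Y : ∀ {t} → t ≤ n → ∂ (Y t) ≃ κ (below u t ℤ.- below w t)
    ∂-Y {zero} _ = P.trans (∂-cong (P.reflexive Y-0)) (P.trans ∂-0 (P.sym (P.trans (P.reflexive (cong κ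
      (cong₂ ℤ._-_ (below-no {u = u} z≤n) (below-no {u = w} z≤n)))) κ-0)))
    ∂-Y {suc t} t≤n with t ℕ.<? r
    ... | yes p = P.trans (∂-cong (P.reflexive (≡.sym (X≡var (ιY (fromℕ< p)))))) (P.trans (∂-X (ιY (fromℕ< p))) (P.reflexive (cong κ (cong₂ ℤ._-_ (eq u) (eq w)))))
      where
      eq : ∀ u → dʸ u (ιY (fromℕ< p)) ≡ below u (suc t)
      eq u = ≡.trans (dʸ-Y u (fromℕ< p)) (cong (λ s → below u (suc s)) (FP.toℕ-fromℕ< p))
    ... | no p = P.trans (∂-cong (P.reflexive (≡.sym 0′≡0ₚ))) (P.trans ∂-0 (P.sym (P.trans (P.reflexive (cong κ
        (cong₂ ℤ._-_ (below-yes {u = u} (small u)) (below-yes {u = w} (small w))))) κ-0)))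
      where
      small : ∀ (u : Fin n) → toℕ u < suc t
      small u = ℕP.≤-trans (FP.toℕ<n u) (s≤s (ℕP.≮⇒≥ p))

    ∂-xʸ : ∀ k → ∂ (x k) ≃ κ (kron u k ℤ.- kron w k)
    ∂-xʸ k = begin
      ∂ (x k) ≡⟨ cong ∂ (x-def k) ⟩
      ∂ (Y (suc (toℕ k)) -′ Y (toℕ k)) ≈⟨ ∂-+ _ _ ⟩
      ∂ (Y (suc (toℕ k))) +′ ∂ (-′ Y (toℕ k)) ≈⟨ P.+-cong (∂-Y (FP.toℕ<n k)) (P.trans neg (P.-‿cong (∂-Y (ℕP.<⇒≤ (FP.toℕ<n k))))) ⟩
      κ (below u (suc (toℕ k)) ℤ.- below w (suc (toℕ k))) +′ -′ κ (below u (toℕ k) ℤ.- below w (toℕ k))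
        ≈⟨ P.trans (P.+-congˡ (P.sym (κ-neg _))) (P.sym (κ-+ _ _)) ⟩
      κ ((below u (suc (toℕ k)) ℤ.- below w (suc (toℕ k))) ℤ.+ ℤ.- (below u (toℕ k) ℤ.- below w (toℕ k)))
        ≡⟨ cong κ (≡.trans (cong₂ (λ a b → (a ℤ.- b) ℤ.+ ℤ.- (below u (toℕ k) ℤ.- below w (toℕ k))) (below-step u k) (below-step w k))
             (lemma (below u (toℕ k)) (below w (toℕ k)) (kron u k) (kron w k))) ⟩
      κ (kron u k ℤ.- kron w k) ∎
      where
      open PR
      lemma : ∀ a b c d → ((a ℤ.+ c) ℤ.- (b ℤ.+ d)) ℤ.+ ℤ.- (a ℤ.- b) ≡ c ℤ.- d
      lemma = solve-∀
      -1≃ : -′ 1′ ≃ κ -1ℤ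
      -1≃ = P.trans (P.-‿cong (P.reflexive (≡.sym κ-1))) (P.sym (κ-neg 1ℤ))
      neg : ∀ {f} → ∂ (-′ f) ≃ -′ ∂ f
      neg {f} = P.trans (∂-cong (P.trans (P.sym (PP.-1*x≈-x f)) (P.*-congʳ -1≃)))
        (P.trans (∂-κ* -1ℤ f) (P.trans (P.*-congʳ (P.sym -1≃)) (PP.-1*x≈-x _)))

    ∂-q : ∀ j → ∂ (q j) ≃ 0′
    ∂-q j = P.trans (∂-X (ιq j)) (P.trans (P.reflexive (cong κ (cong₂ ℤ._-_ (dʸ-q u j) (dʸ-q w j)))) κ-0)

    ∂-product-0 : ∀ {g f} → ∂ g ≃ 0′ → ∂ f ≃ 0′ → ∂ (g *′ f) ≃ 0′
    ∂-product-0 {g} {f} p p′ = P.trans (∂-* g f) (P.trans (P.+-cong (P.trans (P.*-congˡ p′) (P.zeroʳ g)) (P.trans (P.*-congʳ p) (P.zeroˡ _))) (P.+-identityˡ 0′))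

    ∂-qproduct : ∀ {l} (h : Fin l → Fin n) → ∂ (product P.ring (q ∘ h)) ≃ 0′
    ∂-qproduct {zero} h = P.trans (∂-cong (P.reflexive (≡.sym κ-1))) (∂-κ 1ℤ)
    ∂-qproduct {suc l} h = ∂-product-0 (∂-q (h F.zero)) (∂-qproduct (h ∘ F.suc))

    -- Transfers facts about ordinary polynomials in n variables to H ⊗ K; in particular symmetric
    -- polynomials in the x are killed by ∂.
    ∂-natural : ∀ p → ∂ (p [ x ]) ≃ Forms.∂ (variableForms n) u w p [ x ]
    ∂-natural = poly-ind _
      (λ f≃g e → P.trans (P.sym (∂-cong ([]-cong x f≃g))) (P.trans e ([]-cong x (D.∂-cong f≃g))))
      (λ c → P.trans (∂-cong ([]-κ x c)) (P.trans (∂-κ c) (P.sym (P.trans ([]-cong x (D.∂-κ c)) ([]-0 x)))))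
      (λ f g e e′ → P.trans (∂-cong ([]-+ x f g)) (P.trans (∂-+ _ _) (P.trans (P.+-cong e e′)
        (P.sym (P.trans ([]-cong x (D.∂-+ f g)) ([]-+ x _ _))))))
      (λ v f e → P.trans (∂-cong ([]-X* x v f)) (P.trans (∂-* (x v) _) (P.trans
        (P.+-cong (P.*-congˡ e) (P.*-cong (∂-xʸ v) (P.+-congˡ (P.-‿cong (P.*-congˡ e)))))
        (P.sym (P.trans ([]-cong x (D.∂-X* v f)) (P.trans ([]-+ x _ _) (P.+-cong ([]-X* x v _)
          (P.trans ([]-* x _ _) (P.*-cong ([]-κ x _) (P.trans ([]-+ x _ _) (P.+-congˡ (P.trans ([]-neg x _) (P.-‿cong
            (P.trans ([]-* x _ _) (P.*-congʳ (P.trans ([]-+ x _ _) (P.+-cong ([]-X x u) (P.trans ([]-neg x _) (P.-‿cong ([]-X x w))))))))))))))))))))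
      where
      module D = Divided (λ v → kron u v ℤ.- kron w v) (X u -′ X w)

  qprod≡ : qprod ≡ product P.ring q
  qprod≡ = ≡.trans (foldr-cong′ (allFin n)) (foldr-tabulate P.ring q (λ i → i))
    where
    foldr-cong′ : ∀ js → L.foldr (λ j acc → qvar j *ₚ acc) 1ₚ js ≡ L.foldr (λ j acc → q j *′ acc) 1′ js
    foldr-cong′ [] = ≡.sym 1′≡1ₚ
    foldr-cong′ (j ∷ js) = ≡.trans (cong₂ _*ₚ_ (≡.sym (X≡var (ιq j))) (foldr-cong′ js)) (≡.sym (*′≡*ₚ (q j) _))

  -- Since Y_t is a partial sum of the x, closure under multiplication by each x suffices. This is
  -- how statements about the x reach the actual variables.
  Y-gen : ∀ (Q : PolyHK → Set) → (∀ {f g} → f ≃ g → Q f → Q g) → (∀ f g → Q f → Q g → Q (f +′ g)) →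
          Q 0′ → ∀ f → (∀ j → Q (x j *′ f)) → ∀ t → t ≤ n → Q (Y t *′ f)
  Y-gen Q resp plus Q0 f h zero _ = resp (P.sym (P.trans (P.*-congʳ (P.reflexive Y-0)) (P.zeroˡ f))) Q0
  Y-gen Q resp plus Q0 f h (suc t) t<n = resp (P.trans (P.sym (P.distribʳ f (x j) (Y t))) (P.*-congʳ eq))
    (plus _ _ (h j) (Y-gen Q resp plus Q0 f h t (ℕP.<⇒≤ t<n)))
    where
    j = fromℕ< t<n
    eq : x j +′ Y t ≃ Y (suc t)
    eq = P.trans (P.+-congʳ (P.reflexive (≡.trans (x-def j) (cong (λ s → Y (suc s) -′ Y s) (FP.toℕ-fromℕ< t<n)))))
      (PS.solve (λ { (a ∷ b ∷ []) → (a ⊖ b) ⊕ b , a }) (Y (suc t) ∷ Y t ∷ []) ≡.refl)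

  var-cases : ∀ (Q : Fin M → Set) → (∀ i → Q (ιY i)) → (∀ j → Q (ιq j)) → ∀ v → Q v
  var-cases Q hy hq v with splitAt r v in eq
  ... | inj₁ i = subst Q (FP.splitAt⁻¹-↑ˡ eq) (hy i)
  ... | inj₂ j = subst Q (FP.splitAt⁻¹-↑ʳ eq) (hq j)

  forms : Forms n
  forms = record
    { m = M ; G = HKGen ; J = Fin n ; s = q ; x = x ; d = dʸ
    ; ∂-x = ∂-xʸ ; ∂-s = ∂-q ; ∂-G = kill ; gen = gen }
    where
    kill : ∀ {u w} → u ≢ w → ∀ {g} → HKGen g → Divided.∂ (λ v → dʸ u v ℤ.- dʸ w v) (x u -′ x w) g ≃ 0′
    kill {u} {w} u≢w (inj₁ (p , sym-p , ≡.refl)) = P.trans (Divided.∂-cong _ _ (P.reflexive (≡.sym ([]≡substₚ p x))))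
      (P.trans (∂-natural u w p) (P.trans ([]-cong x (symmetric⇒∂≃0 sym-p u≢w)) ([]-0 x)))
    kill {u} {w} u≢w (inj₂ ≡.refl) = P.trans (Divided.∂-cong _ _ (P.reflexive qprod≡)) (∂-qproduct u w (λ i → i))
    gen : ∀ (Q : PolyHK → Set) → (∀ {f g} → f ≃ g → Q f → Q g) → (∀ c → Q (κ c)) → (∀ f g → Q f → Q g → Q (f +′ g)) →
          (∀ k f → Q f → Q (x k *′ f)) → (∀ j f → Q f → Q (q j *′ f)) → ∀ f → Q f
    gen Q resp const plus tx tq = poly-ind Q resp const plus (λ v f h → var-cases (λ v → Q (X v *′ f))
      (λ i → subst (λ y → Q (y *′ f)) (Y-ι i) (Y-gen Q resp plus (resp κ-0 (const 0ℤ)) f (λ j → tx j f h) (suc (toℕ i)) (ℕP.m≤n⇒m≤1+n (FP.toℕ<n i))))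
      (λ j → tq j f h) v)

  open FormOps forms public hiding (nilHecke; s′)
  module O = Ring opRing

  2≤n : 2 ≤ n
  2≤n = s≤s (s≤s z≤n)

  sum-op : ∀ {l} (φ : Fin l → Op) f → fn (FinSum.sum opRing φ) f ≡ PSum.sum (λ i → fn (φ i) f)
  sum-op {zero} φ f = ≡.refl
  sum-op {suc l} φ f = cong (fn (φ F.zero) f +′_) (sum-op (φ ∘ F.suc) f)

  product-op : ∀ {l} (g : Fin l → PolyHK) f → fn (product opRing (mul ∘ g)) f ≋[ HKGen ] product P.ring g *′ f
  product-op {zero} g f = A.sym (A.*-identityˡ f)
  product-op {suc l} g f = A.trans (A.*-congˡ (product-op (g ∘ F.suc) f)) (A.sym (A.*-assoc _ _ _))

  qⁿ : ℕ → Op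
  qⁿ i = mul (q (fin i))

  x-sum≃0 : PSum.sum x ≃ 0′
  x-sum≃0 = P.trans (PSum.sum-cong (λ k → P.reflexive (x-def k))) (P.trans (sum-telescope n Y)
    (P.trans (P.+-cong (P.reflexive (Y-top ℕP.≤-refl)) (P.-‿cong (P.reflexive Y-0))) (P.-‿inverseʳ 0′)))

  opaque
    -- Sealed so that the operators do not unfold in later goals; `quantum-x`, `quantum-∂` and
    -- `quantum-q` are the interface.
    quantum : QuantumNilHecke opRing n
    quantum = record
      { nilHecke = FormOps.nilHecke forms 2≤n
      ; q = qⁿ
      ; q-central = qⁿ-central
      ; x-per = λ i → O.reflexive (cong xᵒ (fin-per i))
      ; ∂-per = λ i → mkᵒ λ f → ≃⇒≋ (P.reflexive (cong₂ (λ u w → Forms.∂ forms u w f) (fin-per i) (≡.trans (cong fin (≡.sym (ℕP.+-suc n i))) (fin-per (suc i)))))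
      ; q-per = λ i → O.reflexive (cong (mul ∘ q) (fin-per i))
      ; Q-full = λ a → O.trans (Q-window opRing qⁿ qⁿ-central k (λ i → O.reflexive (cong (mul ∘ q) (fin-per i))) a) full
      ; x-sum = mkᵒ λ f → ≃⇒≋ (P.trans (P.reflexive (sum-op (λ (j : Fin n) → xᵒ (fin (toℕ j))) f)) (P.trans (PSum.sum-cong {f = λ j → x (fin (toℕ j)) *′ f} {λ j → x j *′ f} (λ k → P.*-congʳ {x = f} (P.reflexive (cong x (fin-toℕ k)))))
          (P.trans (P.sym (PSum.sum-*ʳ f x)) (P.trans (P.*-congʳ x-sum≃0) (P.zeroˡ f)))))
      }
      where
      qⁿ-central : ∀ i φ → qⁿ i O.* φ O.≈ φ O.* qⁿ i
      qⁿ-central i φ = mul-central (inj₂ (fin i)) φ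
      full : IntervalProduct.Q opRing qⁿ qⁿ-central 0 (n ℕ.+ 0) O.≈ 0ᵒ
      full = O.trans (Q-product opRing qⁿ qⁿ-central (suc k) 0) (O.trans (product-cong opRing (λ j → O.reflexive (cong (mul ∘ q) (≡.trans (cong fin (ℕP.+-identityʳ (toℕ j))) (fin-toℕ j)))))
        (mkᵒ λ f → A.trans (product-op q f) (A.trans (A.*-congʳ (≋0 (⟨⟩-resp (P.reflexive qprod≡) (⟨⟩-gen (inj₂ ≡.refl))))) (A.zeroˡ f))))

    quantum-x : ∀ i → QuantumNilHecke.x quantum i ≡ xᵒ (fin i)
    quantum-x i = ≡.refl

    quantum-∂ : ∀ i → QuantumNilHecke.∂ quantum i ≡ ∂ᵒ (next≢ 2≤n i)
    quantum-∂ i = ≡.refl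

    quantum-q : ∀ i → QuantumNilHecke.q quantum i ≡ qⁿ i
    quantum-q i = ≡.refl

-- Coefficients of q-monomials, and separation of H ⊗ K by them

-- Polynomials in a + b variables as polynomials in the last b variables with coefficients
-- in the first a; slice d extracts the coefficient of the monomial d.

module Slice (a b : ℕ) where

  unit-↑ˡ : ∀ {a} (i : Fin a) → unit (i ↑ˡ b) ≡ unit i V.++ 0ᵐ
  unit-↑ˡ {suc a} F.zero = cong (1 ∷_) (zeros a)
    where
    zeros : ∀ a → tabulate {n = a ℕ.+ b} (λ _ → 0) ≡ tabulate {n = a} (λ _ → 0) V.++ 0ᵐ
    zeros zero = vec-ext λ i → ≡.trans (VP.lookup∘tabulate _ i) (≡.sym (lookup-0ᵐ i))
    zeros (suc a) = cong (0 ∷_) (zeros a)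
  unit-↑ˡ {suc a} (F.suc i) = cong (0 ∷_) (unit-↑ˡ i)

  unit-↑ʳ : ∀ a (j : Fin b) → unit (a ↑ʳ j) ≡ 0ᵐ {a} V.++ unit j
  unit-↑ʳ zero j = ≡.refl
  unit-↑ʳ (suc a) j = cong (0 ∷_) (unit-↑ʳ a j)

  ++-+ᵐ : ∀ {a} (u u′ : Mon a) (w w′ : Mon b) → (u V.++ w) +ᵐ (u′ V.++ w′) ≡ (u +ᵐ u′) V.++ (w +ᵐ w′)
  ++-+ᵐ [] [] w w′ = ≡.refl
  ++-+ᵐ (x ∷ u) (y ∷ u′) w w′ = cong (x ℕ.+ y ∷_) (++-+ᵐ u u′ w w′)

  take-++ : ∀ {a} (u : Mon a) (w : Mon b) → take a (u V.++ w) ≡ u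
  take-++ [] w = ≡.refl
  take-++ (x ∷ u) w = cong (x ∷_) (take-++ u w)

  drop-++ : ∀ {a} (u : Mon a) (w : Mon b) → drop a (u V.++ w) ≡ w
  drop-++ [] w = ≡.refl
  drop-++ (x ∷ u) w = drop-++ u w

  +ᵐ-identityʳ : ∀ {m} (e : Mon m) → e +ᵐ 0ᵐ ≡ e
  +ᵐ-identityʳ e = ≡.trans (+ᵐ-comm e 0ᵐ) (+ᵐ-identityˡ e)

  ++-ind : ∀ (Q : Mon (a ℕ.+ b) → Set) → (∀ u w → Q (u V.++ w)) → ∀ e → Q e
  ++-ind Q h e = subst Q (VP.take++drop≡id a e) (h (take a e) (drop a e))

  slice : Mon b → Poly (a ℕ.+ b) → Poly a
  slice d [] = []
  slice d ((c , e) ∷ f) with drop a e ≟ᵐ d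
  ... | yes _ = (c , take a e) ∷ slice d f
  ... | no _ = slice d f

  -- The transpose of `slice d` acting on functionals.
  restrict : Mon b → (Mon a → ℤ) → Mon (a ℕ.+ b) → ℤ
  restrict d ψ e with drop a e ≟ᵐ d
  ... | yes _ = ψ (take a e)
  ... | no _ = 0ℤ

  restrict-yes : ∀ {d} ψ e → drop a e ≡ d → restrict d ψ e ≡ ψ (take a e)
  restrict-yes {d} ψ e p with drop a e ≟ᵐ d
  ... | yes _ = ≡.refl
  ... | no q = ⊥-elim (q p)

  restrict-no : ∀ {d} ψ e → drop a e ≢ d → restrict d ψ e ≡ 0ℤ
  restrict-no {d} ψ e p with drop a e ≟ᵐ d
  ... | yes q = ⊥-elim (p q)
  ... | no _ = ≡.refl

  ext-slice : ∀ d ψ f → ext ψ (slice d f) ≡ ext (restrict d ψ) f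
  ext-slice d ψ [] = ≡.refl
  ext-slice d ψ ((c , e) ∷ f) with drop a e ≟ᵐ d
  ... | yes _ = cong (ℤ._+_ (c ℤ.* ψ (take a e))) (ext-slice d ψ f)
  ... | no _ = ≡.trans (ext-slice d ψ f) (≡.sym (≡.trans (cong (ℤ._+ ext (restrict d ψ) f) (ℤP.*-zeroʳ c)) (ℤP.+-identityˡ _)))

  module _ (d : Mon b) where

    slice-cong : ∀ {f g} → f ≃ g → slice d f ≃ slice d g
    slice-cong {f} {g} p = ext-≃ λ ψ → ≡.trans (ext-slice d ψ f) (≡.trans (ext-resp p _) (≡.sym (ext-slice d ψ g)))

    slice-+ : ∀ f g → slice d (f +′ g) ≃ slice d f +′ slice d g
    slice-+ f g = ext-≃ λ ψ → ≡.trans (ext-slice d ψ (f +′ g)) (≡.trans (ext-+′ _ f g)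
      (≡.sym (≡.trans (ext-+′ ψ (slice d f) (slice d g)) (cong₂ ℤ._+_ (ext-slice d ψ f) (ext-slice d ψ g)))))

    slice-neg : ∀ f → slice d (-′ f) ≃ -′ slice d f
    slice-neg f = ext-≃ λ ψ → ≡.trans (ext-slice d ψ (-′ f)) (≡.trans (ext--′ _ f)
      (≡.sym (≡.trans (ext--′ ψ (slice d f)) (cong ℤ.-_ (ext-slice d ψ f)))))

    slice-κ* : ∀ c f → slice d (κ c *′ f) ≃ κ c *′ slice d f
    slice-κ* c f = ext-≃ λ ψ → ≡.trans (ext-slice d ψ (κ c *′ f)) (≡.trans (ext-κ-* _ c f)
      (≡.trans (cong (c ℤ.*_) (≡.sym (ext-slice d ψ f))) (≡.sym (ext-κ-* ψ c (slice d f)))))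

    slice-0 : slice d 0′ ≃ 0′
    slice-0 = P.reflexive (≡.trans (cong (slice d) (≡.sym []≡0)) []≡0)

    slice-Xˡ : ∀ i f → slice d (X (i ↑ˡ b) *′ f) ≃ X i *′ slice d f
    slice-Xˡ i f = ext-≃ λ ψ → begin
      ext ψ (slice d (X (i ↑ˡ b) *′ f)) ≡⟨ ext-slice d ψ (X (i ↑ˡ b) *′ f) ⟩
      ext (restrict d ψ) (X (i ↑ˡ b) *′ f) ≡⟨ ext-X* (restrict d ψ) (i ↑ˡ b) f ⟩
      ext (λ e → restrict d ψ (unit (i ↑ˡ b) +ᵐ e)) f ≡⟨ ext-cong (++-ind (λ e → restrict d ψ (unit (i ↑ˡ b) +ᵐ e) ≡ restrict d (λ e → ψ (unit i +ᵐ e)) e) (each ψ)) f ⟩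
      ext (restrict d (λ e → ψ (unit i +ᵐ e))) f ≡⟨ ext-slice d _ f ⟨
      ext (λ e → ψ (unit i +ᵐ e)) (slice d f) ≡⟨ ext-X* ψ i (slice d f) ⟨
      ext ψ (X i *′ slice d f) ∎
      where
      open ≡-Reasoning
      each : ∀ ψ (u : Mon a) (w : Mon b) → restrict d ψ (unit (i ↑ˡ b) +ᵐ (u V.++ w)) ≡ restrict d (λ e → ψ (unit i +ᵐ e)) (u V.++ w)
      each ψ u w rewrite unit-↑ˡ i | ++-+ᵐ (unit i) u 0ᵐ w | +ᵐ-identityˡ w with w ≟ᵐ d
      ... | yes p = ≡.trans (restrict-yes ψ _ (≡.trans (drop-++ (unit i +ᵐ u) w) p)) (≡.trans (cong ψ (take-++ (unit i +ᵐ u) w))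
              (≡.sym (≡.trans (restrict-yes _ (u V.++ w) (≡.trans (drop-++ u w) p)) (cong (λ e → ψ (unit i +ᵐ e)) (take-++ u w)))))
      ... | no p = ≡.trans (restrict-no ψ _ (λ q → p (≡.trans (≡.sym (drop-++ (unit i +ᵐ u) w)) q)))
              (≡.sym (restrict-no _ (u V.++ w) (λ q → p (≡.trans (≡.sym (drop-++ u w)) q))))

  embed : Poly a → Poly (a ℕ.+ b)
  embed f = f [ (λ i → X (i ↑ˡ b)) ]

  slice-embed : ∀ d g f → slice d (embed g *′ f) ≃ g *′ slice d f
  slice-embed d g f = poly-ind (λ g → slice d (embed g *′ f) ≃ g *′ slice d f)
    (λ p q → P.trans (slice-cong d (P.*-congʳ ([]-cong σ (P.sym p)))) (P.trans q (P.*-congʳ p)))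
    (λ c → P.trans (slice-cong d (P.*-congʳ ([]-κ σ c))) (slice-κ* d c f))
    (λ g h p q → P.trans (slice-cong d (P.trans (P.*-congʳ ([]-+ σ g h)) (P.distribʳ f _ _))) (P.trans (slice-+ d _ _)
      (P.trans (P.+-cong p q) (P.sym (P.distribʳ _ g h)))))
    (λ v g p → P.trans (slice-cong d (P.trans (P.*-congʳ ([]-X* σ v g)) (P.*-assoc _ _ f))) (P.trans (slice-Xˡ d v _)
      (P.trans (P.*-congˡ p) (P.sym (P.*-assoc (X v) g _)))))
    g
    where
    σ : Fin a → Poly (a ℕ.+ b)
    σ i = X (i ↑ˡ b)

  qmon : Mon b → Poly (a ℕ.+ b)
  qmon d = mono 1ℤ (0ᵐ V.++ d)

  opaque
    unfolding mono 0′ _+′_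

    slice-mono-≡ : ∀ c u d → slice d (mono c (u V.++ d)) ≡ mono c u
    slice-mono-≡ c u d with drop a (u V.++ d) ≟ᵐ d
    ... | yes _ = cong (λ u → (c , u) ∷ []) (take-++ u d)
    ... | no p = ⊥-elim (p (drop-++ u d))

    slice-mono-≢ : ∀ c u d {d′} → d′ ≢ d → slice d (mono c (u V.++ d′)) ≡ 0′
    slice-mono-≢ c u d {d′} p with drop a (u V.++ d′) ≟ᵐ d
    ... | yes q = ⊥-elim (p (≡.trans (≡.sym (drop-++ u d′)) q))
    ... | no _ = ≡.refl

  mono-1 : ∀ {m} → mono 1ℤ (0ᵐ {m}) ≃ 1′
  mono-1 = P.reflexive (≡.trans (mono-0ᵐ 1ℤ) κ-1)

  slice-qmon-≡ : ∀ d g → slice d (embed g *′ qmon d) ≃ g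
  slice-qmon-≡ d g = P.trans (slice-embed d g (qmon d)) (P.trans (P.*-congˡ (P.trans (P.reflexive (slice-mono-≡ 1ℤ 0ᵐ d)) mono-1)) (P.*-identityʳ g))

  slice-qmon-≢ : ∀ d {d′} g → d′ ≢ d → slice d (embed g *′ qmon d′) ≃ 0′
  slice-qmon-≢ d g p = P.trans (slice-embed d g _) (P.trans (P.*-congˡ (P.reflexive (slice-mono-≢ 1ℤ 0ᵐ d p))) (P.zeroʳ g))

  0ᵐ-++ : ∀ a → 0ᵐ {a} V.++ 0ᵐ {b} ≡ 0ᵐ
  0ᵐ-++ zero = ≡.refl
  0ᵐ-++ (suc a) = cong (0 ∷_) (0ᵐ-++ a)

  qmon-0 : qmon 0ᵐ ≃ 1′
  qmon-0 = P.trans (P.reflexive (cong (mono 1ℤ) (0ᵐ-++ a))) mono-1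

  qmon-+ : ∀ d d′ → qmon (d +ᵐ d′) ≃ qmon d *′ qmon d′
  qmon-+ d d′ = P.sym (P.reflexive (≡.trans (mono-* 1ℤ 1ℤ (0ᵐ {a} V.++ d) (0ᵐ V.++ d′))
    (cong (mono 1ℤ) (≡.trans (++-+ᵐ (0ᵐ {a}) 0ᵐ d d′) (cong (V._++ (d +ᵐ d′)) (+ᵐ-identityˡ (0ᵐ {a})))))))

  qmon-unit : ∀ j → qmon (unit j) ≡ X (a ↑ʳ j)
  qmon-unit j = ≡.trans (cong (mono 1ℤ) (≡.sym (unit-↑ʳ a j))) (≡.sym (X-mono (a ↑ʳ j)))

  embed-mono : ∀ c u → embed (mono c u) ≃ mono c (u V.++ 0ᵐ)
  embed-mono c u = P.trans (mono-[] σ c u) (P.trans (P.*-congˡ (mon-ind (λ u → evalMon u σ ≃ mono 1ℤ (u V.++ 0ᵐ)) base step u))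
    (P.reflexive (≡.trans (≡.sym (κ-mono c 1ℤ (u V.++ 0ᵐ))) (cong (λ c → mono c (u V.++ 0ᵐ)) (ℤP.*-identityʳ c)))))
    where
    σ : Fin a → Poly (a ℕ.+ b)
    σ i = X (i ↑ˡ b)
    base : evalMon 0ᵐ σ ≃ mono 1ℤ (0ᵐ {a} V.++ 0ᵐ {b})
    base = P.trans (evalMon-0 σ) (P.sym qmon-0)
    step : ∀ i u → evalMon u σ ≃ mono 1ℤ (u V.++ 0ᵐ) → evalMon (unit i +ᵐ u) σ ≃ mono 1ℤ ((unit i +ᵐ u) V.++ 0ᵐ)
    step i u p = P.trans (evalMon-+ (unit i) u σ) (P.trans (P.*-cong (evalMon-unit i σ) p) (P.reflexive (≡.trans (X*mono (i ↑ˡ b) 1ℤ _)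
      (cong (mono 1ℤ) (≡.trans (cong (_+ᵐ (u V.++ 0ᵐ)) (unit-↑ˡ i)) (≡.trans (++-+ᵐ (unit i) u 0ᵐ 0ᵐ) (cong ((unit i +ᵐ u) V.++_) (+ᵐ-identityˡ 0ᵐ))))))))

  mono-split : ∀ c u d → mono c (u V.++ d) ≃ embed (mono c u) *′ qmon d
  mono-split c u d = P.sym (P.trans (P.*-congʳ (embed-mono c u)) (P.reflexive (≡.trans (mono-* c 1ℤ (u V.++ 0ᵐ) (0ᵐ V.++ d))
    (cong₂ mono (ℤP.*-identityʳ c) (≡.trans (++-+ᵐ u 0ᵐ 0ᵐ d) (cong₂ V._++_ (+ᵐ-identityʳ u) (+ᵐ-identityˡ d)))))))

  unslice : Mon b → Poly (a ℕ.+ b) → Poly (a ℕ.+ b)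
  unslice d [] = []
  unslice d ((c , e) ∷ f) with drop a e ≟ᵐ d
  ... | yes _ = unslice d f
  ... | no _ = (c , e) ∷ unslice d f

  length-unslice : ∀ d f → length (unslice d f) ≤ length f
  length-unslice d [] = z≤n
  length-unslice d ((c , e) ∷ f) with drop a e ≟ᵐ d
  ... | yes _ = ℕP.m≤n⇒m≤1+n (length-unslice d f)
  ... | no _ = s≤s (length-unslice d f)

  slice-decompose : ∀ d f → f ≃ embed (slice d f) *′ qmon d +′ unslice d f
  slice-decompose d [] = P.sym (P.trans (P.+-cong (P.trans (P.*-congʳ (P.trans (P.reflexive (cong embed []≡0)) ([]-0 _))) (P.zeroˡ _))
    (P.reflexive []≡0)) (P.trans (P.+-identityˡ 0′) (P.reflexive (≡.sym []≡0))))
  slice-decompose d ((c , e) ∷ f) with drop a e ≟ᵐ d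
  ... | yes ≡.refl = begin
    (c , e) ∷ f ≡⟨ ∷≡+ c e f ⟩
    mono c e +′ f ≈⟨ P.+-cong (P.trans (P.reflexive (cong (mono c) (≡.sym (VP.take++drop≡id a e)))) (mono-split c (take a e) d)) (slice-decompose d f) ⟩
    embed t *′ qmon d +′ (embed (slice d f) *′ qmon d +′ unslice d f) ≈⟨ P.+-assoc _ _ _ ⟨
    (embed t *′ qmon d +′ embed (slice d f) *′ qmon d) +′ unslice d f
      ≈⟨ P.+-congʳ (P.trans (P.sym (P.distribʳ _ _ _)) (P.*-congʳ (P.sym (P.trans ([]-cong σ (P.reflexive (∷≡+ c (take a e) (slice d f)))) ([]-+ σ _ _))))) ⟩
    embed ((c , take a e) ∷ slice d f) *′ qmon d +′ unslice d f ∎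
    where
    open PR
    t = mono c (take a e)
    σ : Fin a → Poly (a ℕ.+ b)
    σ i = X (i ↑ˡ b)
  ... | no _ = begin
    (c , e) ∷ f ≡⟨ ∷≡+ c e f ⟩
    mono c e +′ f ≈⟨ P.+-congˡ (slice-decompose d f) ⟩
    mono c e +′ (s +′ unslice d f) ≈⟨ PS.solve (λ { (x ∷ y ∷ z ∷ []) → x ⊕ (y ⊕ z) , y ⊕ (x ⊕ z) }) (mono c e ∷ s ∷ unslice d f ∷ []) ≡.refl ⟩
    s +′ (mono c e +′ unslice d f) ≡⟨ cong (s +′_) (∷≡+ c e (unslice d f)) ⟨
    s +′ ((c , e) ∷ unslice d f) ∎
    where
    open PR
    s = embed (slice d f) *′ qmon d

  slice-unslice-≡ : ∀ d f → slice d (unslice d f) ≡ []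
  slice-unslice-≡ d [] = ≡.refl
  slice-unslice-≡ d ((c , e) ∷ f) with drop a e ≟ᵐ d in eq
  ... | yes _ = slice-unslice-≡ d f
  ... | no _ rewrite eq = slice-unslice-≡ d f

  slice-unslice-≢ : ∀ d d′ f → d ≢ d′ → slice d′ (unslice d f) ≡ slice d′ f
  slice-unslice-≢ d d′ [] p = ≡.refl
  slice-unslice-≢ d d′ ((c , e) ∷ f) p with drop a e ≟ᵐ d
  slice-unslice-≢ d d′ ((c , e) ∷ f) p | yes ≡.refl with drop a e ≟ᵐ d′
  ... | yes q = ⊥-elim (p q)
  ... | no _ = slice-unslice-≢ d d′ f p
  slice-unslice-≢ d d′ ((c , e) ∷ f) p | no _ with drop a e ≟ᵐ d′
  ... | yes _ = cong ((c , take a e) ∷_) (slice-unslice-≢ d d′ f p)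
  ... | no _ = slice-unslice-≢ d d′ f p

  unslice-all : ∀ d f → All (λ t → drop a (proj₂ t) ≡ d) f → unslice d f ≡ []
  unslice-all d [] [] = ≡.refl
  unslice-all d ((c , e) ∷ f) (p ∷ ps) with drop a e ≟ᵐ d
  ... | yes _ = unslice-all d f ps
  ... | no q = ⊥-elim (q p)

  slice-Xʳ-zero : ∀ d j f → lookup d j ≡ 0 → slice d (X (a ↑ʳ j) *′ f) ≃ 0′
  slice-Xʳ-zero d j f p = ext-≃ λ ψ → ≡.trans (ext-slice d ψ (X (a ↑ʳ j) *′ f)) (≡.trans (ext-X* (restrict d ψ) (a ↑ʳ j) f)
    (≡.trans (ext-cong (++-ind (λ e → restrict d ψ (unit (a ↑ʳ j) +ᵐ e) ≡ 0ℤ) (each ψ)) f) (≡.trans (ext-0 f) (≡.sym (ext-0′ ψ)))))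
    where
    each : ∀ ψ (u : Mon a) (w : Mon b) → restrict d ψ (unit (a ↑ʳ j) +ᵐ (u V.++ w)) ≡ 0ℤ
    each ψ u w rewrite unit-↑ʳ a j | ++-+ᵐ 0ᵐ u (unit j) w = restrict-no ψ _ λ q →
      ℕP.1+n≢0 (≡.trans (cong (ℕ._+ lookup w j) (≡.sym (lookup-unit-≡ j))) (≡.trans (≡.sym (lookup-+ᵐ (unit j) w j))
        (≡.trans (cong (λ v → lookup v j) (≡.trans (≡.sym (drop-++ (0ᵐ +ᵐ u) (unit j +ᵐ w))) q)) p)))

anyZero-true : ∀ {m} (d : Vec ℕ m) → anyZero d ≡ true → Σ (Fin m) λ j → lookup d j ≡ 0
anyZero-true (zero ∷ d) p = F.zero , ≡.refl
anyZero-true (suc _ ∷ d) p with anyZero-true d p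
... | j , q = F.suc j , q

anyZero-false : ∀ {m} (d : Vec ℕ m) → anyZero d ≡ false → ∀ j → 1 ≤ lookup d j
anyZero-false (suc _ ∷ d) p F.zero = s≤s z≤n
anyZero-false (suc _ ∷ d) p (F.suc j) = anyZero-false d p j

product-factor : ∀ {m l} (g : Fin l → Poly m) j → Σ (Poly m) λ z → product P.ring g ≃ g j *′ z
product-factor g F.zero = _ , P.refl
product-factor g (F.suc j) with product-factor (g ∘ F.suc) j
... | z , p = g F.zero *′ z , P.trans (P.*-congˡ p)
  (PS.solve (λ { (a ∷ b ∷ z ∷ []) → a ⊗ (b ⊗ z) , b ⊗ (a ⊗ z) }) (g F.zero ∷ g (F.suc j) ∷ z ∷ []) ≡.refl)

module Coefficients (k : ℕ) where
  open HK k public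
  open Slice r n public

  idY : Fin r → Fin r
  idY i = i

  GH : PolyH → Set
  GH = BorelGen idY

  module AH = CommutativeRing (quotientRing GH)

  opaque
    unfolding _+′_ -′_ X _[_] 0′

    embH≡embed : ∀ a → embH a ≡ embed a
    embH≡embed a = ≡.refl

    ≈⇒≋ : ∀ {f g} → f ≈ g → f ≋[ HKGen ] g
    ≈⇒≋ p = mk≋ (fromInIdeal p)

    ≋⇒≈ : ∀ {f g} → f ≋[ HKGen ] g → f ≈ g
    ≋⇒≈ p = toInIdeal (diff p)

    ≈H⇒≋ : ∀ {f g} → f ≈H g → f ≋[ GH ] g
    ≈H⇒≋ p = mk≋ (fromInIdeal p)

    ≋⇒≈H : ∀ {f g} → f ≋[ GH ] g → f ≈H g
    ≋⇒≈H p = toInIdeal (diff p)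

  z0 : Fin M → PolyH
  z0 v = Sum.[ var , (λ _ → 0ₚ) ] (splitAt r v)

  q↦0≡ : ∀ f → q↦0 f ≡ f [ z0 ]
  q↦0≡ f = ≡.sym ([]≡substₚ f z0)

  z0-Y : ∀ i → z0 (ιY i) ≡ X i
  z0-Y i rewrite FP.splitAt-↑ˡ r i n = ≡.sym (X≡var i)

  z0-q : ∀ j → z0 (ιq j) ≡ 0′
  z0-q j rewrite FP.splitAt-↑ʳ r n j = ≡.sym 0′≡0ₚ

  YH : ℕ → PolyH
  YH = Yat idY

  xH : Fin n → PolyH
  xH = Xat idY

  xH-def : ∀ k → xH k ≡ YH (suc (toℕ k)) -′ YH (toℕ k)
  xH-def k = ≡.sym (-′≡-ₚ _ _)

  embed-Y : ∀ t → embed (YH t) ≃ Y t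
  embed-Y zero = P.trans (P.reflexive (cong embed (≡.sym 0′≡0ₚ))) (P.trans ([]-0 _) (P.reflexive (≡.sym Y-0)))
  embed-Y (suc t) with t ℕ.<? r
  ... | yes p = P.trans (P.reflexive (cong embed (≡.sym (X≡var (fromℕ< p))))) (P.trans ([]-X _ (fromℕ< p)) (P.reflexive (X≡var (ιY (fromℕ< p)))))
  ... | no p = P.trans (P.reflexive (cong embed (≡.sym 0′≡0ₚ))) (P.trans ([]-0 _) (P.reflexive 0′≡0ₚ))

  z0-Yt : ∀ t → Y t [ z0 ] ≃ YH t
  z0-Yt zero = P.trans (P.reflexive (cong _[ z0 ] Y-0)) (P.trans ([]-0 z0) (P.reflexive 0′≡0ₚ))
  z0-Yt (suc t) with t ℕ.<? r
  ... | yes p = P.trans (P.reflexive (cong _[ z0 ] (≡.sym (X≡var (ιY (fromℕ< p)))))) (P.trans ([]-X z0 (ιY (fromℕ< p))) (P.reflexive (≡.trans (z0-Y (fromℕ< p)) (X≡var (fromℕ< p)))))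
  ... | no p = P.trans (P.reflexive (cong _[ z0 ] (≡.sym 0′≡0ₚ))) (P.trans ([]-0 z0) (P.reflexive 0′≡0ₚ))

  embed-x : ∀ k → embed (xH k) ≃ x k
  embed-x k = P.trans (P.reflexive (cong embed (xH-def k))) (P.trans ([]-+ _ _ _) (P.trans (P.+-cong (embed-Y _) (P.trans ([]-neg _ _) (P.-‿cong (embed-Y (toℕ k)))))
    (P.reflexive (≡.sym (x-def k)))))

  z0-x : ∀ k → x k [ z0 ] ≃ xH k
  z0-x k = P.trans (P.reflexive (cong _[ z0 ] (x-def k))) (P.trans ([]-+ _ _ _) (P.trans (P.+-cong (z0-Yt _) (P.trans ([]-neg _ _) (P.-‿cong (z0-Yt (toℕ k)))))
    (P.reflexive (≡.sym (xH-def k)))))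

  embed-px : ∀ p → embed (p [ xH ]) ≃ p [ x ]
  embed-px p = P.trans ([]-∘ xH _ p) ([]-ext embed-x p)

  z0-embed : ∀ a → embed a [ z0 ] ≃ a
  z0-embed a = P.trans ([]-∘ _ z0 a) (P.trans ([]-ext (λ i → P.trans ([]-X z0 (ιY i)) (P.reflexive (z0-Y i))) a) ([]-id a))

  qprod∈ : HKGen (product P.ring q)
  qprod∈ = subst HKGen qprod≡ (inj₂ ≡.refl)

  embed-≋ : ∀ {f g} → f ≋[ GH ] g → embed f ≋[ HKGen ] embed g
  embed-≋ p = mk≋ (⟨⟩-resp (P.trans ([]-+ _ _ _) (P.+-congˡ ([]-neg _ _))) (⟨⟩-[] _ borel (diff p)))
    where
    borel : ∀ {g} → GH g → ⟨ HKGen ⟩ (embed g)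
    borel (p , s , ≡.refl) = ⟨⟩-resp (P.sym (P.trans (P.reflexive (cong embed (≡.sym ([]≡substₚ p xH)))) (embed-px p)))
      (⟨⟩-gen (inj₁ (p , s , []≡substₚ p x)))

  z0-≋ : ∀ {f g} → f ≋[ HKGen ] g → f [ z0 ] ≋[ GH ] g [ z0 ]
  z0-≋ p = mk≋ (⟨⟩-resp (P.trans ([]-+ _ _ _) (P.+-congˡ ([]-neg _ _))) (⟨⟩-[] z0 kill (diff p)))
    where
    kill : ∀ {g} → HKGen g → ⟨ GH ⟩ (g [ z0 ])
    kill (inj₁ (p , s , ≡.refl)) = ⟨⟩-resp (P.sym (P.trans (P.reflexive (cong _[ z0 ] (≡.sym ([]≡substₚ p x)))) (P.trans ([]-∘ x z0 p) ([]-ext z0-x p))))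
      (⟨⟩-gen (p , s , []≡substₚ p xH))
    kill (inj₂ ≡.refl) = nil (P.trans ([]-cong z0 (P.reflexive qprod≡)) (P.trans ([]-* z0 _ _)
      (P.trans (P.*-congʳ (P.trans ([]-X z0 _) (P.reflexive (z0-q F.zero)))) (P.zeroˡ _))))

  -- Borel generators contain no q and factor out of the slice. A multiple of q_1 ⋯ q_n is a
  -- multiple of the q_j with d_j = 0 and contributes nothing to q^d.
  slice-≋ : ∀ d → anyZero d ≡ true → ∀ {f g} → f ≋[ HKGen ] g → slice d f ≋[ GH ] slice d g
  slice-≋ d z {f} {g} p = mk≋ (⟨⟩-resp (P.trans (slice-+ d f (-′ g)) (P.+-congˡ (slice-neg d g)))
    (⟨⟩-map (slice d) (slice-cong d) (slice-+ d) (slice-0 d) gens (diff p)))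
    where
    gens : ∀ h {g} → HKGen g → ⟨ GH ⟩ (slice d (h *′ g))
    gens h (inj₁ (p , s , ≡.refl)) = ⟨⟩-resp (P.sym (P.trans (slice-cong d (P.trans (P.*-comm h _) (P.*-congʳ (P.sym (P.trans (embed-px p) (P.reflexive ([]≡substₚ p x)))))))
      (P.trans (slice-embed d (p [ xH ]) h) (P.*-comm _ (slice d h))))) (⟨⟩-* (slice d h) (⟨⟩-gen (p , s , []≡substₚ p xH)))
    gens h (inj₂ ≡.refl) with anyZero-true d z
    ... | j , dj with product-factor q j
    ...   | w , e = nil (P.trans (slice-cong d (P.trans (P.*-congˡ (P.trans (P.reflexive qprod≡) e))
              (PS.solve (λ { (h ∷ q ∷ w ∷ []) → h ⊗ (q ⊗ w) , q ⊗ (h ⊗ w) }) (h ∷ q j ∷ w ∷ []) ≡.refl))) (slice-Xʳ-zero d j (h *′ w) dj))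

  -- Stated for an injective selection `h` of the variables, so that splitting off one variable
  -- leaves the other exponents unchanged and the induction goes through.
  qmon-full : ∀ {l} (h : Fin l → Fin n) → (∀ {i i′} → h i ≡ h i′ → i ≡ i′) → ∀ d → (∀ i → 1 ≤ lookup d (h i)) →
              Σ (Mon n) λ d′ → qmon d ≃ product P.ring (q ∘ h) *′ qmon d′
  qmon-full {zero} h inj d p = d , P.sym (P.*-identityˡ _)
  qmon-full {suc l} h inj d p with lookup d (h F.zero) in eq | p F.zero
  ... | suc t | _ with take-var (h F.zero) d t eq
  ...   | d″ , ≡.refl , _ with qmon-full (h ∘ F.suc) (FP.suc-injective ∘ inj) d″ rest
    where
    rest : ∀ i → 1 ≤ lookup d″ (h (F.suc i))
    rest i = subst (1 ≤_) (≡.trans (lookup-+ᵐ (unit (h F.zero)) d″ (h (F.suc i)))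
      (cong (ℕ._+ lookup d″ (h (F.suc i))) (lookup-unit-≢ {v = h F.zero} {h (F.suc i)} λ e → FP.0≢1+n (inj e)))) (p (F.suc i))
  ...     | d′ , e = d′ , P.trans (qmon-+ (unit (h F.zero)) d″) (P.trans (P.*-cong (P.reflexive (qmon-unit (h F.zero))) e) (P.sym (P.*-assoc (q (h F.zero)) _ _)))

  -- Split off the q-exponent of the first term: its slice vanishes by hypothesis if some exponent
  -- is 0, and otherwise q^d is divisible by q_1 ⋯ q_n. The rest is a shorter list.
  separate : ∀ f → (∀ d → anyZero d ≡ true → slice d f ≋[ GH ] 0′) → f ≋[ HKGen ] 0′
  separate f = go (length f) f ℕP.≤-refl
    where
    go : ∀ N f → length f ≤ N → (∀ d → anyZero d ≡ true → slice d f ≋[ GH ] 0′) → f ≋[ HKGen ] 0′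
    go N [] _ _ = ≃⇒≋ (P.reflexive []≡0)
    go (suc N) f@((c , e) ∷ f′) (s≤s len) h = A.trans (≃⇒≋ (slice-decompose d f))
      (A.trans (A.+-cong first (go N (unslice d f) len′ rest)) (A.+-identityˡ 0′))
      where
      d = drop r e
      first : embed (slice d f) *′ qmon d ≋[ HKGen ] 0′
      first with anyZero d in z
      ... | true = A.trans (A.*-congʳ (A.trans (embed-≋ (h d z)) (≃⇒≋ ([]-0 _)))) (A.zeroˡ (qmon d))
      ... | false with qmon-full (λ j → j) (λ p → p) d (anyZero-false d z)
      ...   | d′ , p = A.trans (A.*-congˡ (A.trans (≃⇒≋ p) (A.trans (A.*-congʳ (≋0 (⟨⟩-gen qprod∈))) (A.zeroˡ (qmon d′))))) (A.zeroʳ _)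
      len′ : length (unslice d f) ≤ N
      len′ with drop r e ≟ᵐ d
      ... | yes _ = ℕP.≤-trans (length-unslice d f′) len
      ... | no p = ⊥-elim (p ≡.refl)
      rest : ∀ d′ → anyZero d′ ≡ true → slice d′ (unslice d f) ≋[ GH ] 0′
      rest d′ z with d ≟ᵐ d′
      ... | yes p = subst (λ d′ → slice d′ (unslice d f) ≋[ GH ] 0′) p (≃⇒≋ (P.reflexive (≡.trans (slice-unslice-≡ d f) []≡0)))
      ... | no p = subst (_≋[ GH ] 0′) (≡.sym (slice-unslice-≢ d d′ f p)) (h d′ z)

  coeffQ-yes : ∀ d → anyZero d ≡ true → ∀ f → coeffQ d f ≡ slice d f
  coeffQ-yes d z f rewrite z = go f
    where
    go : ∀ f → L.concatMap (λ { (c , e) → if does (VP.≡-dec ℕ._≟_ (drop r e) d) then (c , take r e) ∷ [] else [] }) f ≡ slice d f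
    go [] = ≡.refl
    go ((c , e) ∷ f) with drop r e ≟ᵐ d
    ... | yes _ = cong ((c , take r e) ∷_) (go f)
    ... | no _ = go f

  coeffQ-no : ∀ d → anyZero d ≡ false → ∀ f → coeffQ d f ≡ []
  coeffQ-no d z f rewrite z = ≡.refl

-- Degrees of the operators, and cyclicity of 1

wdeg-nonneg : ∀ {m} (w : Fin m → ℤ) → (∀ v → 0ℤ ℤ.≤ w v) → ∀ e → 0ℤ ℤ.≤ wdeg w e
wdeg-nonneg w p [] = ℤP.≤-refl
wdeg-nonneg w p (a ∷ e) = ℤP.+-mono-≤ (subst (ℤ._≤ + a ℤ.* w F.zero) (ℤP.*-zeroʳ (+ a)) (ℤP.*-monoˡ-≤-nonNeg (+ a) (p F.zero)))
  (wdeg-nonneg (w ∘ F.suc) (p ∘ F.suc) e)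

module Operators (k : ℕ) where
  open Coefficients k public
  open Commutation quantum public using (𝒳; 𝒳-comm; T; Q; U; V; Vᶠ; TQ-elim; V-elim; V-interval; T-one; T-step; Q-one; Q-step; U-def)

  weight : ℤ → ℤ → Fin M → ℤ
  weight a b v = [ (λ _ → a) , (λ _ → b) ]′ (splitAt r v)

  weight-Y : ∀ a b i → weight a b (ιY i) ≡ a
  weight-Y a b i rewrite FP.splitAt-↑ˡ r i n = ≡.refl

  weight-q : ∀ a b j → weight a b (ιq j) ≡ b
  weight-q a b j rewrite FP.splitAt-↑ʳ r n j = ≡.refl

  yw : Fin M → ℤ
  yw = weight 1ℤ 0ℤ

  -- A bound on the y-degree combined with a grading in which each y has weight `ω` and each q
  -- weight `ρ`: the pair 2, 4 gives the cohomological degree, the pair 0, 1 the degree in q.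
  module Weighted (ω ρ : ℤ) where
    w : Fin M → ℤ
    w = weight ω ρ
    open Graded yw w public

    Bd-XY : ∀ i → Bd 1ℤ ω (X (ιY i))
    Bd-XY i = Bd-≡ (weight-Y 1ℤ 0ℤ i) (weight-Y ω ρ i) (Bd-X (ιY i))

    Bd-q : ∀ j → Bd 0ℤ ρ (q j)
    Bd-q j = Bd-≡ (weight-q 1ℤ 0ℤ j) (weight-q ω ρ j) (Bd-X (ιq j))

    Bd-Y : ∀ t → Bd 1ℤ ω (Y t)
    Bd-Y zero = subst (Bd 1ℤ ω) (≡.sym Y-0) Bd-0
    Bd-Y (suc t) with t ℕ.<? r
    ... | yes p = subst (Bd 1ℤ ω) (X≡var _) (Bd-XY (fromℕ< p))
    ... | no p = subst (Bd 1ℤ ω) 0′≡0ₚ Bd-0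

    Bd-x : ∀ k → Bd 1ℤ ω (x k)
    Bd-x k = subst (Bd 1ℤ ω) (≡.sym (x-def k)) (Bd-+ (Bd-Y _) (Bd-neg (Bd-Y (toℕ k))))

    Bd-∂ᵒ : ∀ u w {N z f} → Bd N z f → Bd (N ℤ.- 1ℤ) (z ℤ.- ω) (Forms.∂ forms u w f)
    Bd-∂ᵒ u v = Bd-∂ yw w (λ s → dʸ u s ℤ.- dʸ v s) (Bd-+ (Bd-x u) (Bd-neg (Bd-x v)))
      (var-cases (λ s → dʸ u s ℤ.- dʸ v s ≡ 0ℤ ⊎ (yw s ≡ 1ℤ × w s ≡ ω))
        (λ i → inj₂ (weight-Y 1ℤ 0ℤ i , weight-Y ω ρ i)) (λ j → inj₁ (cong₂ ℤ._-_ (dʸ-q u j) (dʸ-q v j))))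

    N-1≤N : ∀ N → N ℤ.- 1ℤ ℤ.≤ N
    N-1≤N N = ℤP.i≤j⇒i-k≤j 1ℤ (ℤP.≤-refl {N})

    Shift : ℤ → Op → Set
    Shift t φ = ∀ {N z f} → Bd N z f → Bd N (z ℤ.+ t) (fn φ f)

    Shift-∂ : ∀ i → Shift (ℤ.- ω) (∂ᵒ (next≢ 2≤n i))
    Shift-∂ i b = Bd-mono (N-1≤N _) (Bd-∂ᵒ (fin i) (fin (suc i)) b)

    Shift-* : ∀ {s t φ ψ} → Shift s φ → Shift t ψ → Shift (t ℤ.+ s) (φ *ᵒ ψ)
    Shift-* {s} {t} h h′ {z = z} b = Bd-≡ ≡.refl (ℤP.+-assoc z t s) (h (h′ b))

    Shift-≡ : ∀ {s t φ} → s ≡ t → Shift s φ → Shift t φ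
    Shift-≡ ≡.refl h = h

    Shift-q : ∀ i → Shift ρ (qⁿ i)
    Shift-q i {N} {z} b = Bd-≡ (ℤP.+-identityˡ N) (ℤP.+-comm ρ z) (Bd-* (Bd-q (fin i)) b)

    -- An interval of length l + 1 contributes 2 l + 1 divided differences and l + 1 variables q.
    ShiftPair : Op → Op → Set
    ShiftPair t s = Σ ℤ λ l → Shift (ℤ.- ((+ 2 ℤ.* l ℤ.+ 1ℤ) ℤ.* ω)) t × Shift ((l ℤ.+ 1ℤ) ℤ.* ρ) s

    Shift-TQ : ∀ {a b} → a < b → ShiftPair (T a b) (Q a b)
    Shift-TQ = TQ-elim ShiftPair base step
      where
      base : ∀ b → ShiftPair (QuantumNilHecke.∂ quantum b) (QuantumNilHecke.q quantum b)
      base b = ≡.subst₂ ShiftPair (≡.sym (quantum-∂ b)) (≡.sym (quantum-q b)) (0ℤ , Shift-≡ {φ = ∂ᵒ (next≢ 2≤n b)} (lemma ω) (Shift-∂ b) , Shift-≡ {φ = qⁿ b} (lemma′ ρ) (Shift-q b))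
        where
        lemma : ∀ ω → ℤ.- ω ≡ ℤ.- ((+ 2 ℤ.* 0ℤ ℤ.+ 1ℤ) ℤ.* ω)
        lemma = solve-∀
        lemma′ : ∀ ρ → ρ ≡ (0ℤ ℤ.+ 1ℤ) ℤ.* ρ
        lemma′ = solve-∀
      step : ∀ b {t s} → ShiftPair t s → ShiftPair ((QuantumNilHecke.∂ quantum b *ᵒ t) *ᵒ QuantumNilHecke.∂ quantum b) (QuantumNilHecke.q quantum b *ᵒ s)
      step b {t} {s} (l , hT , hQ) = ≡.subst₂ (λ d e → ShiftPair ((d *ᵒ t) *ᵒ d) (e *ᵒ s)) (≡.sym (quantum-∂ b)) (≡.sym (quantum-q b)) (l ℤ.+ 1ℤ ,
        Shift-≡ {φ = (d *ᵒ t) *ᵒ d} (lemma l ω) (Shift-* {φ = d *ᵒ t} {d} (Shift-* {φ = d} {t} (Shift-∂ b) hT) (Shift-∂ b)) ,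
        Shift-≡ {φ = qⁿ b *ᵒ s} (lemma′ l ρ) (Shift-* {φ = qⁿ b} {s} (Shift-q b) hQ))
        where
        d = ∂ᵒ (next≢ 2≤n b)
        lemma : ∀ l ω → ℤ.- ω ℤ.+ (ℤ.- ((+ 2 ℤ.* l ℤ.+ 1ℤ) ℤ.* ω) ℤ.+ ℤ.- ω) ≡ ℤ.- ((+ 2 ℤ.* (l ℤ.+ 1ℤ) ℤ.+ 1ℤ) ℤ.* ω)
        lemma = solve-∀
        lemma′ : ∀ l ρ → (l ℤ.+ 1ℤ) ℤ.* ρ ℤ.+ ρ ≡ ((l ℤ.+ 1ℤ) ℤ.+ 1ℤ) ℤ.* ρ
        lemma′ = solve-∀

  module Deg = Weighted (+ 2) (+ 4)
  module QDeg = Weighted 0ℤ 1ℤ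
  open Deg using (Shift; Bd)

  -- The balance -2 (2 l + 1) + 4 (l + 1) = 2 is independent of the length, so every quantum
  -- correction has the degree of x.
  Shift-QT : ∀ {t s} → Deg.ShiftPair t s → Shift (+ 2) (s *ᵒ t)
  Shift-QT {t} {s} (l , hT , hQ) = Deg.Shift-≡ {φ = s *ᵒ t} (lemma l) (Deg.Shift-* {φ = s} {t} hQ hT)
    where
    lemma : ∀ l → ℤ.- ((+ 2 ℤ.* l ℤ.+ 1ℤ) ℤ.* + 2) ℤ.+ (l ℤ.+ 1ℤ) ℤ.* + 4 ≡ + 2
    lemma = solve-∀

  Shift-U : ∀ {a b} → a < b → Shift (+ 2) (U a b)
  Shift-U {a} {b} a<b = Shift-QT {T a b} {Q a b} (Deg.Shift-TQ a<b)

  Shift-V : ∀ i j → Shift (+ 2) (Vᶠ i j)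
  Shift-V i j = V-elim (Shift (+ 2)) Shift-U {toℕ i} {toℕ j} (FP.toℕ<n i)

  A-op : Fin n → Fin n → Op
  A-op i j = Vᶠ i j O.- Vᶠ j i

  Lower : Fin n → Op
  Lower i = FinSum.sum opRing (A-op i)

  𝒳-fn : ∀ i f → fn (𝒳 i) f ≡ x i *′ f +′ fn (Lower i) f
  𝒳-fn i f = cong (λ φ → fn φ f +′ fn (Lower i) f) (≡.trans (quantum-x (toℕ i)) (cong xᵒ (fin-toℕ i)))

  -- Everything in H ⊗ K arises from constants by sums, negation, the q and the operators `𝒳`, since
  -- x j m = `𝒳 j` m - `Lower j` m and `Lower` does not raise the y-degree. The predicate carries a
  -- cohomological degree, so that gradedness of ⋆ follows from the same induction.
  module CyclicInduction
    (P : ℤ → PolyHK → Set)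
    (P-resp : ∀ {z f g} → f ≋[ HKGen ] g → P z f → P z g)
    (P-0 : ∀ z → P z 0′)
    (P-κ : ∀ c → P 0ℤ (κ c))
    (P-+ : ∀ {z f g} → P z f → P z g → P z (f +′ g))
    (P-neg : ∀ {z f} → P z f → P z (-′ f))
    (P-q : ∀ {z f} j → P z f → P (z ℤ.+ + 4) (q j *′ f))
    (P-𝒳 : ∀ {z f} i → P z f → P (z ℤ.+ + 2) (fn (𝒳 i) f))
    where

    P-sum : ∀ {z l} (g : Fin l → PolyHK) → (∀ i → P z (g i)) → P z (PSum.sum g)
    P-sum {z} {zero} g h = P-0 z
    P-sum {z} {suc l} g h = P-+ (h F.zero) (P-sum (g ∘ F.suc) (h ∘ F.suc))

    Terms : ℤ → Set
    Terms N = ∀ e c → wdeg yw e ℤ.≤ N → P (wdeg Deg.w e) (mono c e)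

    from-terms : ∀ {N} → Terms N → ∀ {z f} → Bd N z f → P z f
    from-terms {N} h {z} (g , p , a) = P-resp (≃⇒≋ (P.sym p)) (go g a)
      where
      go : ∀ g → All (Deg.Ok N z) g → P z g
      go [] [] = subst (P z) (≡.sym []≡0) (P-0 z)
      go ((c , e) ∷ g) ((le , eq) ∷ a) = subst (P z) (≡.sym (∷≡+ c e g)) (P-+ (subst (λ z → P z (mono c e)) eq (h e c le)) (go g a))

    yw≥0 : ∀ e → 0ℤ ℤ.≤ wdeg yw e
    yw≥0 = wdeg-nonneg yw (var-cases (λ v → 0ℤ ℤ.≤ yw v) (λ i → subst (0ℤ ℤ.≤_) (≡.sym (weight-Y 1ℤ 0ℤ i)) (ℤ.+≤+ z≤n))
      (λ j → subst (0ℤ ℤ.≤_) (≡.sym (weight-q 1ℤ 0ℤ j)) ℤP.≤-refl))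

    -- Here `rec` covers the corrections `Lower j m`, whose y-degree is at most that of `m`, hence
    -- smaller than that allowed for x j m.
    P-Y : ∀ {N′} e c i → (∀ {z f} → Bd (+ N′) z f → P z f) → wdeg yw e ℤ.≤ + N′ → P (wdeg Deg.w e) (mono c e) →
          P (wdeg Deg.w e ℤ.+ + 2) (X (ιY i) *′ mono c e)
    P-Y {N′} e c i rec le pm = subst (λ y → P z (y *′ m)) (Y-ι i) (Y-gen (P z) (λ p → P-resp (≃⇒≋ p)) (λ _ _ → P-+) (P-0 z) m each (suc (toℕ i)) (ℕP.m≤n⇒m≤1+n (FP.toℕ<n i)))
      where
      z = wdeg Deg.w e ℤ.+ + 2
      m = mono c e
      bm : Bd (+ N′) (wdeg Deg.w e) m
      bm = Deg.Bd-mono-term c e le ≡.refl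
      lower : ∀ j → P z (fn (Lower j) m)
      lower j = subst (P z) (≡.sym (sum-op (A-op j) m)) (P-sum _ λ l → rec (Deg.Bd-+ (Shift-V j l bm) (Deg.Bd-neg (Shift-V l j bm))))
      each : ∀ j → P z (x j *′ m)
      each j = P-resp (≃⇒≋ (P.trans (P.+-congʳ (P.reflexive (𝒳-fn j m)))
        (PS.solve (λ { (a ∷ b ∷ []) → (a ⊕ b) ⊖ b , a }) (x j *′ m ∷ fn (Lower j) m ∷ []) ≡.refl)))
        (P-+ (P-𝒳 j pm) (P-neg (lower j)))

    terms : ∀ N → Terms (+ N)
    terms N e c le = mon-ind (λ e → ∀ c → wdeg yw e ℤ.≤ + N → P (wdeg Deg.w e) (mono c e))
      (λ c _ → subst (λ z → P z (mono c 0ᵐ)) (≡.sym (wdeg-0 Deg.w)) (subst (P 0ℤ) (≡.sym (mono-0ᵐ c)) (P-κ c)))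
      (λ v e ih c le → subst (P (wdeg Deg.w (unit v +ᵐ e))) (X*mono v c e) (step v e ih c (subst (ℤ._≤ + N) (≡.trans (wdeg-+ yw (unit v) e) (cong (ℤ._+ wdeg yw e) (wdeg-unit yw v))) le)))
      e c le
      where
      Step : Fin M → Set
      Step v = ∀ e → (∀ c → wdeg yw e ℤ.≤ + N → P (wdeg Deg.w e) (mono c e)) → ∀ c → yw v ℤ.+ wdeg yw e ℤ.≤ + N →
               P (wdeg Deg.w (unit v +ᵐ e)) (X v *′ mono c e)
      deg-eq : ∀ v e {s} → Deg.w v ≡ s → wdeg Deg.w e ℤ.+ s ≡ wdeg Deg.w (unit v +ᵐ e)
      deg-eq v e p = ≡.trans (ℤP.+-comm (wdeg Deg.w e) _) (≡.sym (≡.trans (wdeg-+ Deg.w (unit v) e) (cong (ℤ._+ wdeg Deg.w e) (≡.trans (wdeg-unit Deg.w v) p))))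
      step : ∀ v → Step v
      step = var-cases Step stepY stepq
        where
        stepq : ∀ j → Step (ιq j)
        stepq j e ih c le = subst (λ z → P z (q j *′ mono c e)) (deg-eq (ιq j) e (weight-q (+ 2) (+ 4) j))
          (P-q j (ih c (subst (ℤ._≤ + N) (≡.trans (cong (ℤ._+ wdeg yw e) (weight-q 1ℤ 0ℤ j)) (ℤP.+-identityˡ _)) le)))
        stepY : ∀ i → Step (ιY i)
        stepY i e ih c le = subst (λ z → P z (X (ιY i) *′ mono c e)) (deg-eq (ιY i) e (weight-Y (+ 2) (+ 4) i))
          (go N ≡.refl (subst (λ w → w ℤ.+ wdeg yw e ℤ.≤ + N) (weight-Y 1ℤ 0ℤ i) le))
          where
          go : ∀ N₀ → N₀ ≡ N → 1ℤ ℤ.+ wdeg yw e ℤ.≤ + N → P (wdeg Deg.w e ℤ.+ + 2) (X (ιY i) *′ mono c e)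
          go zero ≡.refl le = ⊥-elim (ℤP.<⇒≱ (ℤP.<-≤-trans (ℤ.+<+ (s≤s z≤n)) (ℤP.+-monoʳ-≤ 1ℤ (yw≥0 e))) le)
          go (suc N′) ≡.refl le = P-Y e c i (from-terms (terms N′)) le′ (ih c (ℤP.≤-trans le′ (ℤ.+≤+ (ℕP.n≤1+n N′))))
            where
            le′ : wdeg yw e ℤ.≤ + N′
            le′ = ≡.subst₂ ℤ._≤_ (lemma (wdeg yw e)) ≡.refl (ℤP.+-monoʳ-≤ -1ℤ le)
              where
              lemma : ∀ x → -1ℤ ℤ.+ (1ℤ ℤ.+ x) ≡ x
              lemma = solve-∀

    induction : ∀ N {z f} → Bd (+ N) z f → P z f
    induction N = from-terms (terms N)

-- The product ⋆ and its algebraic properties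

module Product (k : ℕ) where
  open Operators k public

  infix 4 _≋_ _≋H_
  _≋_ : PolyHK → PolyHK → Set
  f ≋ g = f ≋[ HKGen ] g

  _≋H_ : PolyH → PolyH → Set
  f ≋H g = f ≋[ GH ] g

  induction : (P : PolyHK → Set) → (∀ {f g} → f ≋ g → P f → P g) → P 0′ → (∀ c → P (κ c)) →
              (∀ {f g} → P f → P g → P (f +′ g)) → (∀ {f} → P f → P (-′ f)) → (∀ {f} j → P f → P (q j *′ f)) →
              (∀ {f} i → P f → P (fn (𝒳 i) f)) → ∀ f → P f
  induction P resp p0 pκ p+ p- pq p𝒳 = go
    where
    open CyclicInduction (λ _ → P) resp (λ _ → p0) pκ p+ p- pq p𝒳
    go : ∀ f → P f
    go [] = subst P (≡.sym []≡0) p0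
    go ((c , e) ∷ f) = subst P (≡.sym (∷≡+ c e f))
      (p+ (terms ℤ.∣ wdeg yw e ∣ e c (ℤP.≤-reflexive (≡.sym (ℤP.0≤i⇒+∣i∣≡i (yw≥0 e))))) (go f))

  -- An operator commuting with all 𝒳 i is determined by its value at 1; the product f ⋆ g
  -- is the value at g of the one sending 1 to f.
  record Multiplier : Set where
    constructor multiplier
    field
      op : Op
      commutes : ∀ i → (op O.* 𝒳 i) ≈ᵒ (𝒳 i O.* op)
  open Multiplier

  fn-κ : ∀ φ c f → fn φ (κ c *′ f) ≋ κ c *′ fn φ f
  fn-κ φ c f = fn-lin φ (inj₁ c) f

  -- Cyclicity of 1: equality at `f` passes to `𝒳 i` f because both operators commute with `𝒳 i`.
  multiplier-unique : ∀ L L′ → fn (op L) 1′ ≋ fn (op L′) 1′ → ∀ f → fn (op L) f ≋ fn (op L′) f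
  multiplier-unique L L′ p = induction (λ f → fn (op L) f ≋ fn (op L′) f)
    (λ e h → A.trans (fn-cong (op L) (A.sym e)) (A.trans h (fn-cong (op L′) e)))
    (A.trans (fn-0 (op L)) (A.sym (fn-0 (op L′))))
    (λ c → A.trans (κ1 L c) (A.trans (A.*-congˡ p) (A.sym (κ1 L′ c))))
    (λ {f} {g} h h′ → A.trans (fn-+ (op L) f g) (A.trans (A.+-cong h h′) (A.sym (fn-+ (op L′) f g))))
    (λ {f} h → A.trans (fn-neg (op L) f) (A.trans (A.-‿cong h) (A.sym (fn-neg (op L′) f))))
    (λ {f} j h → A.trans (fn-lin (op L) (inj₂ j) f) (A.trans (A.*-congˡ h) (A.sym (fn-lin (op L′) (inj₂ j) f))))
    (λ {f} i h → A.trans (app (commutes L i) f) (A.trans (fn-cong (𝒳 i) h) (A.sym (app (commutes L′ i) f))))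
    where
    κ1 : ∀ L c → fn (op L) (κ c) ≋ κ c *′ fn (op L) 1′
    κ1 L c = A.trans (fn-cong (op L) (A.sym (A.*-identityʳ (κ c)))) (fn-κ (op L) c 1′)

  central-multiplier : ∀ j → Multiplier
  central-multiplier j = multiplier (mul (s″ j)) λ i → mul-central j (𝒳 i)
    where
    s″ : ℤ ⊎ Fin n → PolyHK
    s″ = [ κ , q ]′

  _+ᵐᵘ_ _*ᵐᵘ_ : Multiplier → Multiplier → Multiplier
  L +ᵐᵘ L′ = multiplier (op L O.+ op L′) λ i → O.trans (O.distribʳ (𝒳 i) (op L) (op L′))
    (O.trans (O.+-cong (commutes L i) (commutes L′ i)) (O.sym (O.distribˡ (𝒳 i) (op L) (op L′))))
  L *ᵐᵘ L′ = multiplier (op L O.* op L′) λ i → mkᵒ λ f → A.trans (fn-cong (op L) (app (commutes L′ i) f)) (app (commutes L i) (fn (op L′) f))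

  -ᵐᵘ_ : Multiplier → Multiplier
  -ᵐᵘ L = multiplier (O.- op L) λ i → mkᵒ λ f → A.trans (A.-‿cong (app (commutes L i) f)) (A.sym (fn-neg (𝒳 i) (fn (op L) f)))

  𝒳-multiplier : Fin n → Multiplier
  𝒳-multiplier i = multiplier (𝒳 i) λ j → 𝒳-comm i j

  1-multiplier : Multiplier
  1-multiplier = multiplier 1ᵒ λ i → mkᵒ λ f → A.refl

  opaque
    -- Each construction step of the cyclic induction is itself a multiplier; for `𝒳 i` this is
    -- exactly the commutation of the `𝒳`.
    represent : ∀ f → Σ Multiplier λ L → fn (op L) 1′ ≋ f
    represent = induction (λ f → Σ Multiplier λ L → fn (op L) 1′ ≋ f)
      (λ { e (L , h) → L , A.trans h e })
      (central-multiplier (inj₁ 0ℤ) , A.trans (A.*-identityʳ _) (≃⇒≋ κ-0))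
      (λ c → central-multiplier (inj₁ c) , A.*-identityʳ _)
      (λ { (L , h) (L′ , h′) → L +ᵐᵘ L′ , A.+-cong h h′ })
      (λ { (L , h) → -ᵐᵘ L , A.-‿cong h })
      (λ { j (L , h) → central-multiplier (inj₂ j) *ᵐᵘ L , A.*-congˡ h })
      (λ { i (L , h) → 𝒳-multiplier i *ᵐᵘ L , fn-cong (𝒳 i) h })

  mult : PolyHK → Multiplier
  mult f = proj₁ (represent f)

  infixl 7 _⋆_
  _⋆_ : PolyHK → PolyHK → PolyHK
  f ⋆ g = fn (op (mult f)) g

  ⋆-1 : ∀ f → f ⋆ 1′ ≋ f
  ⋆-1 f = proj₂ (represent f)

  ⋆-unique : ∀ L {f} → fn (op L) 1′ ≋ f → ∀ g → f ⋆ g ≋ fn (op L) g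
  ⋆-unique L {f} p = multiplier-unique (mult f) L (A.trans (⋆-1 f) (A.sym p))

  ⋆-congʳ : ∀ f {g g′} → g ≋ g′ → f ⋆ g ≋ f ⋆ g′
  ⋆-congʳ f = fn-cong (op (mult f))

  ⋆-congˡ : ∀ {f f′} → f ≋ f′ → ∀ g → f ⋆ g ≋ f′ ⋆ g
  ⋆-congˡ {f} {f′} p = ⋆-unique (mult f′) (A.trans (⋆-1 f′) (A.sym p))

  ⋆-+ʳ : ∀ f g h → f ⋆ (g +′ h) ≋ f ⋆ g +′ f ⋆ h
  ⋆-+ʳ f = fn-+ (op (mult f))

  ⋆-+ˡ : ∀ f g h → (f +′ g) ⋆ h ≋ f ⋆ h +′ g ⋆ h
  ⋆-+ˡ f g = ⋆-unique (mult f +ᵐᵘ mult g) (A.+-cong (⋆-1 f) (⋆-1 g))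

  1⋆ : ∀ g → 1′ ⋆ g ≋ g
  1⋆ = ⋆-unique 1-multiplier A.refl

  κ⋆ : ∀ c g → κ c ⋆ g ≋ κ c *′ g
  κ⋆ c = ⋆-unique (central-multiplier (inj₁ c)) (A.*-identityʳ (κ c))

  q*⋆ : ∀ j f g → (q j *′ f) ⋆ g ≋ q j *′ (f ⋆ g)
  q*⋆ j f = ⋆-unique (central-multiplier (inj₂ j) *ᵐᵘ mult f) (A.*-congˡ (⋆-1 f))

  -⋆ : ∀ f g → (-′ f) ⋆ g ≋ -′ (f ⋆ g)
  -⋆ f = ⋆-unique (-ᵐᵘ mult f) (A.-‿cong (⋆-1 f))

  𝒳⋆ : ∀ i f g → fn (𝒳 i) f ⋆ g ≋ fn (𝒳 i) (f ⋆ g)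
  𝒳⋆ i f = ⋆-unique (𝒳-multiplier i *ᵐᵘ mult f) (fn-cong (𝒳 i) (⋆-1 f))

  ⋆-comm : ∀ f g → f ⋆ g ≋ g ⋆ f
  ⋆-comm f = induction (λ g → f ⋆ g ≋ g ⋆ f)
    (λ e h → A.trans (⋆-congʳ f (A.sym e)) (A.trans h (⋆-congˡ e f)))
    (A.trans (fn-0 (op (mult f))) (A.sym (A.trans (⋆-congˡ (≃⇒≋ (P.sym κ-0)) f) (A.trans (κ⋆ 0ℤ f) (A.trans (A.*-congʳ (≃⇒≋ κ-0)) (A.zeroˡ f))))))
    (λ c → A.trans (⋆-congʳ f (A.sym (A.*-identityʳ (κ c)))) (A.trans (fn-κ (op (mult f)) c 1′) (A.trans (A.*-congˡ (⋆-1 f)) (A.sym (κ⋆ c f)))))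
    (λ {g} {h} p p′ → A.trans (⋆-+ʳ f g h) (A.trans (A.+-cong p p′) (A.sym (⋆-+ˡ g h f))))
    (λ {g} p → A.trans (fn-neg (op (mult f)) g) (A.trans (A.-‿cong p) (A.sym (-⋆ g f))))
    (λ {g} j p → A.trans (fn-lin (op (mult f)) (inj₂ j) g) (A.trans (A.*-congˡ p) (A.sym (q*⋆ j g f))))
    (λ {g} i p → A.trans (app (commutes (mult f) i) g) (A.trans (fn-cong (𝒳 i) p) (A.sym (𝒳⋆ i g f))))

  -- Composing the multipliers of `f` and `g` gives a multiplier with value f ⋆ g at 1.
  ⋆-assoc : ∀ f g h → (f ⋆ g) ⋆ h ≋ f ⋆ (g ⋆ h)
  ⋆-assoc f g = ⋆-unique (mult f *ᵐᵘ mult g) (⋆-congʳ f (⋆-1 g))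

  embK≡ : ∀ k → embK k ≡ k [ q ]
  embK≡ k = ≡.trans (≡.sym ([]≡substₚ k qvar)) (cong (k [_]) refl-q)
    where
    opaque
      unfolding X
      refl-q : qvar ≡ q
      refl-q = ≡.refl

  fn-K : ∀ φ k f → fn φ (k [ q ] *′ f) ≋ k [ q ] *′ fn φ f
  fn-K φ k f = poly-ind (λ k → fn φ (k [ q ] *′ f) ≋ k [ q ] *′ fn φ f)
    (λ p h → A.trans (fn-cong φ (≃⇒≋ (P.*-congʳ ([]-cong q (P.sym p))))) (A.trans h (≃⇒≋ (P.*-congʳ ([]-cong q p)))))
    (λ c → A.trans (fn-cong φ (≃⇒≋ (P.*-congʳ ([]-κ q c)))) (A.trans (fn-κ φ c f) (≃⇒≋ (P.*-congʳ (P.sym ([]-κ q c))))))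
    (λ g h p p′ → A.trans (fn-cong φ (≃⇒≋ (P.trans (P.*-congʳ ([]-+ q g h)) (P.distribʳ f _ _)))) (A.trans (fn-+ φ _ _)
      (A.trans (A.+-cong p p′) (≃⇒≋ (P.sym (P.trans (P.*-congʳ ([]-+ q g h)) (P.distribʳ _ _ _)))))))
    (λ j g p → A.trans (fn-cong φ (≃⇒≋ (P.trans (P.*-congʳ ([]-X* q j g)) (P.*-assoc (q j) (g [ q ]) f)))) (A.trans (fn-lin φ (inj₂ j) _)
      (A.trans (A.*-congˡ p) (≃⇒≋ (P.sym (P.trans (P.*-congʳ ([]-X* q j g)) (P.*-assoc (q j) (g [ q ]) _)))))))
    k

  T-1 : ∀ {a b} → a < b → fn (T a b) 1′ ≋ 0′
  T-1 = TQ-elim (λ t _ → fn t 1′ ≋ 0′) ∂1 (λ b {t} _ → A.trans (fn-cong (QuantumNilHecke.∂ quantum b) (A.trans (fn-cong t (∂1 b)) (fn-0 t))) (fn-0 (QuantumNilHecke.∂ quantum b)))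
    where
    ∂1 : ∀ b → fn (QuantumNilHecke.∂ quantum b) 1′ ≋ 0′
    ∂1 b = subst (λ d → fn d 1′ ≋ 0′) (≡.sym (quantum-∂ b)) (≃⇒≋ (∂-1 (fin b) (fin (suc b))))

  Lower-zero : ∀ (P : PolyHK → Set) → (∀ {f g} → P f → P g → P (f +′ g)) → (∀ {f} → P f → P (-′ f)) → P 0′ →
               ∀ f → (∀ {a b} → a < b → P (fn (U a b) f)) → ∀ i → P (fn (Lower i) f)
  Lower-zero P p+ p- p0 f h i = subst P (≡.sym (sum-op (A-op i) f)) (go (λ j → fn (A-op i j) f) λ j → p+ (hV i j) (p- (hV j i)))
    where
    hV : ∀ i j → P (fn (Vᶠ i j) f)
    hV i j = V-elim (λ φ → P (fn φ f)) h {toℕ i} {toℕ j} (FP.toℕ<n i)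
    go : ∀ {l} (g : Fin l → PolyHK) → (∀ j → P (g j)) → P (PSum.sum g)
    go {zero} g h = p0
    go {suc l} g h = p+ (h F.zero) (go (g ∘ F.suc) (h ∘ F.suc))

  -- Every quantum correction applies a divided difference first, and this kills 1. Consequently
  -- `𝒳 i` is ⋆-multiplication by x i.
  𝒳-1 : ∀ i → fn (𝒳 i) 1′ ≋ x i
  𝒳-1 i = A.trans (≃⇒≋ (P.reflexive (𝒳-fn i 1′))) (A.trans (A.+-cong (A.*-identityʳ (x i)) lower) (A.+-identityʳ (x i)))
    where
    lower : fn (Lower i) 1′ ≋ 0′
    lower = Lower-zero (_≋ 0′) (λ p p′ → A.trans (A.+-cong p p′) (A.+-identityˡ 0′))
      (λ p → A.trans (A.-‿cong p) (A.trans (A.sym (A.+-identityˡ (-′ 0′))) (A.-‿inverseʳ 0′))) A.refl 1′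
      (λ {a} {b} a<b → A.trans (fn-cong (Q a b) (T-1 a<b)) (fn-0 (Q a b))) i

  x⋆ : ∀ i f → x i ⋆ f ≋ fn (𝒳 i) f
  x⋆ i = ⋆-unique (𝒳-multiplier i) (𝒳-1 i)

  -- Homogeneity modulo the relations. The bound on the y-degree is existential; it is what
  -- `CyclicInduction` needs to start.
  Hom : ℤ → PolyHK → Set
  Hom z f = Σ PolyHK λ g → f ≋ g × Σ ℕ λ N → Deg.Bd (+ N) z g

  Hom-resp : ∀ {z f g} → f ≋ g → Hom z f → Hom z g
  Hom-resp p (h , e , b) = h , A.trans (A.sym p) e , b

  Hom-≡ : ∀ {z z′ f} → z ≡ z′ → Hom z f → Hom z′ f
  Hom-≡ ≡.refl h = h

  Hom-+ : ∀ {z f g} → Hom z f → Hom z g → Hom z (f +′ g)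
  Hom-+ (h , e , N , b) (h′ , e′ , N′ , b′) = h +′ h′ , A.+-cong e e′ , N ℕ.+ N′ ,
    Deg.Bd-+ (Deg.Bd-mono (ℤ.+≤+ (ℕP.m≤m+n N N′)) b) (Deg.Bd-mono (ℤ.+≤+ (ℕP.m≤n+m N′ N)) b′)

  Hom-neg : ∀ {z f} → Hom z f → Hom z (-′ f)
  Hom-neg (h , e , N , b) = -′ h , A.-‿cong e , N , Deg.Bd-neg b

  Hom-κ* : ∀ c {z f} → Hom z f → Hom z (κ c *′ f)
  Hom-κ* c (h , e , N , b) = κ c *′ h , A.*-congˡ e , N , Deg.Bd-κ* c b

  Hom-q : ∀ j {z f} → Hom z f → Hom (z ℤ.+ + 4) (q j *′ f)
  Hom-q j {z} (h , e , N , b) = q j *′ h , A.*-congˡ e , N , Deg.Bd-≡ (ℤP.+-identityˡ (+ N)) (ℤP.+-comm (+ 4) z) (Deg.Bd-* (Deg.Bd-q j) b)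

  Hom-𝒳 : ∀ i {z f} → Hom z f → Hom (z ℤ.+ + 2) (fn (𝒳 i) f)
  Hom-𝒳 i {z} {f} (h , e , N , b) = fn (𝒳 i) h , fn-cong (𝒳 i) e , suc N ,
    subst (Deg.Bd (+ suc N) (z ℤ.+ + 2)) (≡.sym (𝒳-fn i h)) (Deg.Bd-+
      (Deg.Bd-≡ ≡.refl (ℤP.+-comm (+ 2) z) (Deg.Bd-* (Deg.Bd-x i) b))
      (Deg.Bd-mono (ℤ.+≤+ (ℕP.n≤1+n N)) (Lower-zero (Deg.Bd (+ N) (z ℤ.+ + 2)) Deg.Bd-+ Deg.Bd-neg Deg.Bd-0 h (λ a<b → Shift-U a<b b) i)))

  ⋆-Hom : ∀ {z z′ f g} → Hom z f → Hom z′ g → Hom (z ℤ.+ z′) (f ⋆ g)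
  ⋆-Hom {z} {z′} {f} {g} (h , e , N , b) hg = Hom-resp (⋆-congˡ (A.sym e) g) (CI.induction N b)
    where
    Pr : ℤ → PolyHK → Set
    Pr z f = Hom (z ℤ.+ z′) (f ⋆ g)
    swap : ∀ z s → z ℤ.+ z′ ℤ.+ s ≡ z ℤ.+ s ℤ.+ z′
    swap z s = lemma z z′ s
      where
      lemma : ∀ a b c → a ℤ.+ b ℤ.+ c ≡ a ℤ.+ c ℤ.+ b
      lemma = solve-∀
    module CI = CyclicInduction Pr
      (λ p h → Hom-resp (⋆-congˡ p g) h)
      (λ z → 0′ , A.sym (A.trans (A.sym (A.zeroˡ _)) (A.trans (A.*-congʳ (≃⇒≋ (P.sym κ-0))) (A.trans (A.sym (κ⋆ 0ℤ g)) (⋆-congˡ (≃⇒≋ κ-0) g)))) , 0 , Deg.Bd-0)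
      (λ c → Hom-resp (A.sym (κ⋆ c g)) (Hom-≡ (≡.sym (ℤP.+-identityˡ z′)) (Hom-κ* c hg)))
      (λ {z} {f} {f′} p p′ → Hom-resp (A.sym (⋆-+ˡ f f′ g)) (Hom-+ p p′))
      (λ {z} {f} p → Hom-resp (A.sym (-⋆ f g)) (Hom-neg p))
      (λ {z} {f} j p → Hom-resp (A.sym (q*⋆ j f g)) (Hom-≡ (swap z (+ 4)) (Hom-q j p)))
      (λ {z} {f} i p → Hom-resp (A.sym (𝒳⋆ i f g)) (Hom-≡ (swap z (+ 2)) (Hom-𝒳 i p)))

  -- Each correction contains at least one factor q, so at q = 0 the operator `𝒳 i` becomes
  -- multiplication by x i.
  U-z0 : ∀ {a b} → a < b → ∀ f → fn (U a b) f [ z0 ] ≋H 0′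
  U-z0 {a} {b} a<b f = TQ-elim (λ _ s → ∀ g → fn s g [ z0 ] ≋H 0′)
    (λ b g → q0 b g) (λ b {_} {s} _ g → q0 b (fn s g)) a<b (fn (T a b) f)
    where
    q0 : ∀ b g → fn (QuantumNilHecke.q quantum b) g [ z0 ] ≋H 0′
    q0 b g = subst (λ φ → fn φ g [ z0 ] ≋H 0′) (≡.sym (quantum-q b)) (≃⇒≋ (P.trans ([]-* z0 (q (fin b)) g)
      (P.trans (P.*-congʳ (P.trans ([]-X z0 (ιq (fin b))) (P.reflexive (z0-q (fin b))))) (P.zeroˡ _))))

  𝒳-z0 : ∀ i f → fn (𝒳 i) f [ z0 ] ≋H x i [ z0 ] *′ f [ z0 ]
  𝒳-z0 i f = AH.trans (≃⇒≋ (P.trans (P.reflexive (cong (_[ z0 ]) (𝒳-fn i f))) (P.trans ([]-+ z0 (x i *′ f) (fn (Lower i) f)) (P.+-congʳ ([]-* z0 (x i) f)))))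
    (AH.trans (AH.+-congˡ lower) (AH.+-identityʳ _))
    where
    lower : fn (Lower i) f [ z0 ] ≋H 0′
    lower = Lower-zero (λ g → g [ z0 ] ≋H 0′)
      (λ {f} {g} p p′ → AH.trans (≃⇒≋ ([]-+ z0 f g)) (AH.trans (AH.+-cong p p′) (AH.+-identityˡ 0′)))
      (λ {f} p → AH.trans (≃⇒≋ ([]-neg z0 f)) (AH.trans (AH.-‿cong p) (AH.trans (AH.sym (AH.+-identityˡ (-′ 0′))) (AH.-‿inverseʳ 0′))))
      (≃⇒≋ ([]-0 z0)) f (λ a<b → U-z0 a<b f) i

  ⋆-z0 : ∀ f g → (f ⋆ g) [ z0 ] ≋H f [ z0 ] *′ g [ z0 ]
  ⋆-z0 f g = induction (λ f → (f ⋆ g) [ z0 ] ≋H f [ z0 ] *′ g [ z0 ])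
    (λ {f} {f′} e h → AH.trans (z0-≋ (⋆-congˡ (A.sym e) g)) (AH.trans h (AH.*-congʳ (z0-≋ e))))
    (AH.trans (z0-≋ (A.trans (⋆-congˡ (≃⇒≋ (P.sym κ-0)) g) (κ⋆ 0ℤ g))) (≃⇒≋ (P.trans ([]-* z0 (κ 0ℤ) g) (P.*-congʳ ([]-cong z0 κ-0)))))
    (λ c → AH.trans (z0-≋ (κ⋆ c g)) (≃⇒≋ ([]-* z0 (κ c) g)))
    (λ {f} {f′} h h′ → AH.trans (z0-≋ (⋆-+ˡ f f′ g)) (AH.trans (≃⇒≋ ([]-+ z0 (f ⋆ g) (f′ ⋆ g))) (AH.trans (AH.+-cong h h′)
      (≃⇒≋ (P.trans (P.sym (P.distribʳ _ _ _)) (P.*-congʳ (P.sym ([]-+ z0 f f′))))))))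
    (λ {f} h → AH.trans (z0-≋ (-⋆ f g)) (AH.trans (≃⇒≋ ([]-neg z0 (f ⋆ g))) (AH.trans (AH.-‿cong h)
      (≃⇒≋ (P.trans (PP.-‿distribˡ-* _ _) (P.*-congʳ (P.sym ([]-neg z0 f))))))))
    (λ {f} j h → AH.trans (z0-≋ (q*⋆ j f g)) (AH.trans (≃⇒≋ ([]-* z0 (q j) (f ⋆ g))) (AH.trans (AH.*-congˡ h)
      (≃⇒≋ (P.trans (P.sym (P.*-assoc _ _ _)) (P.*-congʳ (P.sym ([]-* z0 (q j) f))))))))
    (λ {f} i h → AH.trans (z0-≋ (𝒳⋆ i f g)) (AH.trans (𝒳-z0 i (f ⋆ g)) (AH.trans (AH.*-congˡ h)
      (AH.trans (≃⇒≋ (P.sym (P.*-assoc (x i [ z0 ]) (f [ z0 ]) (g [ z0 ])))) (AH.*-congʳ (AH.sym (𝒳-z0 i f)))))))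
    f

-- Sums over pairs and the second elementary symmetric polynomial

-- e₂ is symmetric because 2 e₂ = e₁² − p₂.

pick : ∀ {m} → Bool → Poly m → Poly m
pick true f = f
pick false f = 0′

lt : ∀ {n} → Fin n → Fin n → Bool
lt i j = does (toℕ i ℕ.<? toℕ j)

pairSum : ∀ {m n} → (Fin n → Fin n → Poly m) → Poly m
pairSum F = PSum.sum (λ i → PSum.sum (λ j → pick (lt i j) (F i j)))

pick-cong : ∀ {m} b {f g : Poly m} → f ≃ g → pick b f ≃ pick b g
pick-cong true p = p
pick-cong false p = P.refl

pairSum-cong : ∀ {m n} {F F′ : Fin n → Fin n → Poly m} → (∀ i j → F i j ≃ F′ i j) → pairSum F ≃ pairSum F′
pairSum-cong {F = F} {F′} p = PSum.sum-cong (λ i → PSum.sum-cong (λ j → pick-cong (lt i j) (p i j)))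

lt-yes : ∀ {n} {i j : Fin n} → toℕ i < toℕ j → lt i j ≡ true
lt-yes {i = i} {j} p = dec-true (toℕ i ℕ.<? toℕ j) p

lt-no : ∀ {n} {i j : Fin n} → ¬ (toℕ i < toℕ j) → lt i j ≡ false
lt-no {i = i} {j} p = dec-false (toℕ i ℕ.<? toℕ j) p

sum-[] : ∀ {m l n} (σ : Fin m → Poly l) (f : Fin n → Poly m) → PSum.sum f [ σ ] ≃ PSum.sum (λ i → f i [ σ ])
sum-[] {n = zero} σ f = []-0 σ
sum-[] {n = suc n} σ f = P.trans ([]-+ σ _ _) (P.+-congˡ (sum-[] σ (f ∘ F.suc)))

pick-[] : ∀ {m l} (σ : Fin m → Poly l) b f → pick b f [ σ ] ≃ pick b (f [ σ ])
pick-[] σ true f = P.refl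
pick-[] σ false f = []-0 σ

pairSum-[] : ∀ {m l n} (σ : Fin m → Poly l) (F : Fin n → Fin n → Poly m) → pairSum F [ σ ] ≃ pairSum (λ i j → F i j [ σ ])
pairSum-[] σ F = P.trans (sum-[] σ (λ i → PSum.sum (G i))) (PSum.sum-cong {f = λ i → PSum.sum (G i) [ σ ]} {λ i → PSum.sum (G′ i)} λ i →
  P.trans (sum-[] σ (G i)) (PSum.sum-cong {f = λ j → G i j [ σ ]} {G′ i} λ j → pick-[] σ (lt i j) (F i j)))
  where
  G = λ i j → pick (lt i j) (F i j)
  G′ = λ i j → pick (lt i j) (F i j [ σ ])

coeff-sum-0 : ∀ {m n} (f : Fin n → Poly m) e → (∀ i → coeff (f i) e ≡ 0ℤ) → coeff (PSum.sum f) e ≡ 0ℤ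
coeff-sum-0 {n = zero} f e p = cong (λ f → coeff f e) (≡.sym []≡0)
coeff-sum-0 {n = suc n} f e p = ≡.trans (coeff-+′ (f F.zero) _ e) (cong₂ ℤ._+_ (p F.zero) (coeff-sum-0 (f ∘ F.suc) e (p ∘ F.suc)))

module _ {m n : ℕ} (g : Fin n → Poly m) where

  square-expand : PSum.sum g *′ PSum.sum g ≃
    (pairSum (λ i j → g i *′ g j) +′ pairSum (λ i j → g i *′ g j)) +′ PSum.sum (λ i → g i *′ g i)
  square-expand = begin
    PSum.sum g *′ PSum.sum g ≈⟨ PSum.sum-*ʳ (PSum.sum g) g ⟩
    PSum.sum (λ i → g i *′ PSum.sum g) ≈⟨ PSum.sum-cong (λ i → PSum.sum-*ˡ (g i) g) ⟩
    PSum.sum (λ i → PSum.sum (λ j → g i *′ g j)) ≈⟨ PSum.sum-cong (λ i → PSum.sum-cong (λ j → three i j)) ⟩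
    PSum.sum (λ i → PSum.sum (λ j → (u i j +′ u j i) +′ d i j))
      ≈⟨ PSum.sum-cong (λ i → P.trans (PSum.∑-distrib-+ (λ j → u i j +′ u j i) (d i)) (P.+-cong (PSum.∑-distrib-+ (u i) (λ j → u j i)) (diagonal i))) ⟩
    PSum.sum (λ i → (PSum.sum (u i) +′ PSum.sum (λ j → u j i)) +′ g i *′ g i)
      ≈⟨ P.trans (PSum.∑-distrib-+ (λ i → PSum.sum (u i) +′ PSum.sum (λ j → u j i)) (λ i → g i *′ g i))
           (P.+-congʳ (P.trans (PSum.∑-distrib-+ (λ i → PSum.sum (u i)) (λ i → PSum.sum (λ j → u j i))) (P.+-congˡ (PSum.∑-comm (λ i j → u j i))))) ⟩
    (pairSum (λ i j → g i *′ g j) +′ pairSum (λ i j → g i *′ g j)) +′ PSum.sum (λ i → g i *′ g i) ∎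
    where
    open PR
    u d : Fin n → Fin n → Poly m
    u i j = pick (lt i j) (g i *′ g j)
    d i j = pick (does (i F.≟ j)) (g i *′ g j)
    three : ∀ i j → g i *′ g j ≃ (u i j +′ u j i) +′ d i j
    three i j with ℕP.<-cmp (toℕ i) (toℕ j)
    ... | tri< p q r rewrite lt-yes {i = i} {j} p | lt-no {i = j} {i} r | dec-false (i F.≟ j) (q ∘ cong toℕ) =
      P.sym (P.trans (P.+-identityʳ _) (P.+-identityʳ _))
    ... | tri≈ p q r rewrite lt-no {i = i} {j} p | lt-no {i = j} {i} r | dec-true (i F.≟ j) (FP.toℕ-injective q) =
      P.sym (P.trans (P.+-congʳ (P.+-identityʳ 0′)) (P.+-identityˡ _))
    ... | tri> p q r rewrite lt-no {i = i} {j} p | lt-yes {i = j} {i} r | dec-false (i F.≟ j) (q ∘ cong toℕ) =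
      P.sym (P.trans (P.+-identityʳ _) (P.trans (P.+-identityˡ _) (P.*-comm (g j) (g i))))
    diagonal : ∀ i → PSum.sum (d i) ≃ g i *′ g i
    diagonal i = P.trans (PSum.sum-only (d i) i (λ j j≢i → P.reflexive (cong (λ b → pick b (g i *′ g j)) (dec-false (i F.≟ j) (j≢i ∘ ≡.sym)))))
      (P.reflexive (cong (λ b → pick b (g i *′ g i)) (dec-true (i F.≟ i) ≡.refl)))

e₂ : ∀ n → Poly n
e₂ n = pairSum (λ i j → X i *′ X j)

double-injective : ∀ {m} {f g : Poly m} → f +′ f ≃ g +′ g → f ≃ g
double-injective {f = f} {g} p = mk≃ λ e → ℤP.*-cancelˡ-≡ (+ 2) (coeff f e) (coeff g e)
  (≡.trans (two (coeff f e)) (≡.trans (≡.sym (coeff-+′ f f e)) (≡.trans (coeffs p e) (≡.trans (coeff-+′ g g e) (≡.sym (two (coeff g e)))))))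
  where
  two : ∀ a → + 2 ℤ.* a ≡ a ℤ.+ a
  two = solve-∀

e₂-symmetric : ∀ n → IsSymNoConst (e₂ n)
e₂-symmetric n = (λ π e → ≡.trans (≡.sym (coeff-permute π (e₂ n) e)) (coeffs (invariant π) e)) , no-const
  where
  invariant : ∀ (π : Permutation n n) → e₂ n [ (λ i → X (π ⟨$⟩ʳ i)) ] ≃ e₂ n
  invariant π = double-injective (begin
    e₂ n [ σ ] +′ e₂ n [ σ ] ≈⟨ P.+-cong conv conv ⟩
    E σ +′ E σ ≈⟨ P.trans (P.sym (PS.solve (λ { (a ∷ p ∷ []) → (a ⊕ p) ⊖ p , a }) (E σ +′ E σ ∷ p₂ σ ∷ []) ≡.refl)) (P.+-congʳ (P.sym (square-expand σ))) ⟩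
    PSum.sum σ *′ PSum.sum σ -′ p₂ σ ≈⟨ P.+-cong (P.*-cong (P.sym (PSum.sum-permute X π)) (P.sym (PSum.sum-permute X π)))
      (P.-‿cong (P.sym (PSum.sum-permute (λ i → X i *′ X i) π))) ⟩
    PSum.sum X *′ PSum.sum X -′ p₂ X ≈⟨ P.trans (P.+-congʳ (square-expand X)) (PS.solve (λ { (a ∷ p ∷ []) → (a ⊕ p) ⊖ p , a }) (E X +′ E X ∷ p₂ X ∷ []) ≡.refl) ⟩
    e₂ n +′ e₂ n ∎)
    where
    open PR
    σ : Fin n → Poly n
    σ i = X (π ⟨$⟩ʳ i)
    E p₂ : (Fin n → Poly n) → Poly n
    E g = pairSum (λ i j → g i *′ g j)
    p₂ g = PSum.sum (λ i → g i *′ g i)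
    conv : e₂ n [ σ ] ≃ E σ
    conv = P.trans (pairSum-[] σ (λ i j → X i *′ X j)) (pairSum-cong (λ i j → P.trans ([]-X* σ i (X j)) (P.*-congˡ ([]-X σ j))))
  no-const : coeff (e₂ n) 0ᵐ ≡ 0ℤ
  no-const = coeff-sum-0 (λ (i : Fin n) → PSum.sum (λ j → pick (lt i j) (X i *′ X j))) 0ᵐ λ i → coeff-sum-0 (λ j → pick (lt i j) (X i *′ X j)) 0ᵐ λ j → each (lt i j) i j
    where
    each : ∀ b (i j : Fin n) → coeff (pick b (X i *′ X j)) 0ᵐ ≡ 0ℤ
    each true i j = coeff-X*-zero i (X j) 0ᵐ (lookup-0ᵐ i)
    each false i j = cong (λ f → coeff f 0ᵐ) (≡.sym []≡0)

sum-telescope-below : ∀ {m} N J (g : ℕ → Poly m) → J ≤ N →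
  PSum.sum (λ (i : Fin N) → pick (does (toℕ i ℕ.<? J)) (g (suc (toℕ i)) -′ g (toℕ i))) ≃ g J -′ g 0
sum-telescope-below zero zero g _ = P.sym (P.-‿inverseʳ (g 0))
sum-telescope-below (suc N) zero g _ = P.trans (PSum.sum-zero {n = suc N} {f = λ _ → 0′} (λ i → P.refl)) (P.sym (P.-‿inverseʳ (g 0)))
sum-telescope-below (suc N) (suc J) g (s≤s J≤N) = P.trans (P.+-congˡ (sum-telescope-below N J (g ∘ suc) J≤N))
  (PS.solve (λ { (a ∷ b ∷ c ∷ []) → (b ⊖ a) ⊕ (c ⊖ b) , c ⊖ a }) (g 0 ∷ g 1 ∷ g (suc J) ∷ []) ≡.refl)

sum-last : ∀ {m} N (g : ℕ → Poly m) → PSum.sum (λ (i : Fin (suc N)) → g (toℕ i)) ≃ PSum.sum (λ (i : Fin N) → g (toℕ i)) +′ g N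
sum-last zero g = P.trans (P.+-identityʳ _) (P.sym (P.+-identityˡ _))
sum-last (suc N) g = P.trans (P.+-congˡ (sum-last N (g ∘ suc))) (P.sym (P.+-assoc _ _ _))

module _ {m : ℕ} where
  opaque
    unfolding _+′_ 0′

    sumₚ-++ : (fs gs : List (Poly m)) → sumₚ (fs L.++ gs) ≃ sumₚ fs +′ sumₚ gs
    sumₚ-++ [] gs = ≃-refl
    sumₚ-++ (f ∷ fs) gs = P.trans (P.+-congˡ {x = f} (sumₚ-++ fs gs)) (P.sym (P.+-assoc f (sumₚ fs) (sumₚ gs)))

    sumₚ-concatMap : ∀ {n} {A : Set} (g : A → List (Poly m)) (h : Fin n → A) →
                     sumₚ (L.concatMap g (L.tabulate h)) ≃ PSum.sum (λ i → sumₚ (g (h i)))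
    sumₚ-concatMap {zero} g h = ≃-refl
    sumₚ-concatMap {suc n} g h = P.trans (sumₚ-++ (g (h F.zero)) (L.concatMap g (L.tabulate (h ∘ F.suc)))) (P.+-congˡ {x = sumₚ (g (h F.zero))} (sumₚ-concatMap g (h ∘ F.suc)))

    sumₚ-map : ∀ {n} {A : Set} (g : A → Poly m) (h : Fin n → A) → sumₚ (L.map g (L.tabulate h)) ≃ PSum.sum (λ i → g (h i))
    sumₚ-map {zero} g h = ≃-refl
    sumₚ-map {suc n} g h = P.+-congˡ {x = g (h F.zero)} (sumₚ-map g (h ∘ F.suc))

    sumₚ-if : ∀ b (f : Poly m) → sumₚ (if b then f ∷ [] else []) ≃ pick b f
    sumₚ-if true f = P.+-identityʳ f
    sumₚ-if false f = ≃-refl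

-- Relation (vi) for ⋆

module Relation (k : ℕ) where
  open Product k public

  next-fin : ∀ a → fin (suc (toℕ (fin a))) ≡ fin (suc a)
  next-fin a = fin-≡ {suc (toℕ (fin a))} {suc a} (≡.trans (cong (λ b → suc b DM.% n) (toℕ-fin a))
    (≡.trans (≡.sym (DM.[m+kn]%n≡m%n (suc (a DM.% n)) (a DM./ n) n)) (cong (λ b → suc b DM.% n) (≡.sym (DM.m≡m%n+[m/n]*n a n)))))

  next-injective : ∀ {a b} → a < n → b < n → fin (suc a) ≡ fin (suc b) → a ≡ b
  next-injective {a} {b} a<n b<n p with ℕP.<-cmp a b
  ... | tri< q _ _ = ⊥-elim (fin-≢ (s≤s q) (ℕP.≤-trans (s≤s b<n) (ℕP.m<m+n n (s≤s z≤n))) p)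
  ... | tri≈ _ q _ = q
  ... | tri> _ _ q = ⊥-elim (fin-≢ (s≤s q) (ℕP.≤-trans (s≤s a<n) (ℕP.m<m+n n (s≤s z≤n))) (≡.sym p))

  β : ℕ → PolyHK → PolyHK
  β t f = q (fin t) *′ Forms.∂ forms (fin t) (fin (suc t)) f

  β-≡ : ∀ {s t} → fin s ≡ fin t → fin (suc s) ≡ fin (suc t) → ∀ f → β s f ≡ β t f
  β-≡ p p′ f = cong₂ (λ u w → q u *′ Forms.∂ forms u w f) p p′

  U-x-one : ∀ a j → fn (U a (suc a)) (x j) ≋ β a (x j)
  U-x-one a j = A.trans (fn-cong (Q a (suc a)) (app (T-one a) (x j))) (A.trans (app (Q-one a) (fn (QuantumNilHecke.∂ quantum a) (x j)))
    (≃⇒≋ (P.reflexive (cong₂ (λ φ ψ → fn φ (fn ψ (x j))) (quantum-q a) (quantum-∂ a)))))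

  -- The first letter turns x j into a constant, and the next one kills it. On the classes x only
  -- intervals of length one act.
  U-x-many : ∀ {a b} j → suc a < b → fn (U a b) (x j) ≋ 0′
  U-x-many {a} {suc b} j (s≤s a<b) = A.trans (fn-cong (Q a (suc b)) (A.trans (app (T-step a<b) (x j)) inner)) (fn-0 (Q a (suc b)))
    where
    d = QuantumNilHecke.∂ quantum b
    dx : fn d (x j) ≋ κ (kron (fin b) j ℤ.- kron (fin (suc b)) j)
    dx = subst (λ φ → fn φ (x j) ≋ κ (kron (fin b) j ℤ.- kron (fin (suc b)) j)) (≡.sym (quantum-∂ b)) (≃⇒≋ (Forms.∂-x forms (fin b) (fin (suc b)) j))
    inner : fn d (fn (T a b) (fn d (x j))) ≋ 0′
    inner = A.trans (fn-cong d (A.trans (fn-cong (T a b) (A.trans dx (A.sym (A.*-identityʳ _))))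
      (A.trans (fn-κ (T a b) _ 1′) (A.trans (A.*-congˡ (T-1 a<b)) (A.zeroʳ _))))) (fn-0 d)

  V-x : ∀ i c j → (c ≡ fin (suc (toℕ i)) → fn (Vᶠ i c) (x j) ≋ β (toℕ i) (x j)) × (c ≢ fin (suc (toℕ i)) → fn (Vᶠ i c) (x j) ≋ 0′)
  V-x i c j = go (V-interval (FP.toℕ<n i) (FP.toℕ<n c))
    where
    i′ = toℕ i
    go : (Σ ℕ λ b → i′ < b × b ≤ n ℕ.+ i′ × (b ≡ toℕ c ⊎ b ≡ n ℕ.+ toℕ c) × V i′ (toℕ c) ≡ U i′ b) →
         (c ≡ fin (suc i′) → fn (Vᶠ i c) (x j) ≋ β i′ (x j)) × (c ≢ fin (suc i′) → fn (Vᶠ i c) (x j) ≋ 0′)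
    go (b , i<b , b≤n , ends , eq) = near , far
      where
      fin-b : fin b ≡ c
      fin-b = [ (λ { ≡.refl → fin-toℕ c }) , (λ { ≡.refl → ≡.trans (fin-per (toℕ c)) (fin-toℕ c) }) ]′ ends
      convert : ∀ {f} → fn (U i′ b) (x j) ≋ f → fn (Vᶠ i c) (x j) ≋ f
      convert = A.trans (≃⇒≋ (P.reflexive (cong (λ φ → fn φ (x j)) eq)))
      near : c ≡ fin (suc i′) → fn (Vᶠ i c) (x j) ≋ β i′ (x j)
      near p = [ (λ q → ⊥-elim (fin-≢ q (ℕP.≤-<-trans b≤n (ℕP.+-monoʳ-< n (ℕP.n<1+n i′))) (≡.trans (≡.sym p) (≡.sym fin-b))))
               , (λ e → convert (subst (λ b → fn (U i′ b) (x j) ≋ β i′ (x j)) e (U-x-one i′ j))) ]′ (ℕP.m≤n⇒m<n∨m≡n i<b)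
      far : c ≢ fin (suc i′) → fn (Vᶠ i c) (x j) ≋ 0′
      far p = [ (λ q → convert (U-x-many j q)) , (λ e → ⊥-elim (p (≡.trans (≡.sym fin-b) (cong fin (≡.sym e))))) ]′ (ℕP.m≤n⇒m<n∨m≡n i<b)

  module ASum = FinSum (CommutativeRing.ring A)

  prev : Fin n → Fin n
  prev i = fin (suc k ℕ.+ toℕ i)

  next-prev : ∀ i → fin (suc (toℕ (prev i))) ≡ i
  next-prev i = ≡.trans (next-fin (suc k ℕ.+ toℕ i)) (≡.trans (fin-per (toℕ i)) (fin-toℕ i))

  -- This is `β` at t - 1 modulo n, with suc k = n - 1 in place of a subtraction. With this shift
  -- `Lower i` acts on the x as the difference of γ at i + 1 and at i, ready to telescope.
  γ : ℕ → PolyHK → PolyHK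
  γ t = β (suc k ℕ.+ t)

  Lower-x : ∀ i j → fn (Lower i) (x j) ≋ γ (suc (toℕ i)) (x j) -′ γ (toℕ i) (x j)
  Lower-x i j = A.trans (≃⇒≋ (P.reflexive (sum-op (A-op i) (x j)))) (A.trans (ASum.∑-distrib-+ (λ c → fn (Vᶠ i c) (x j)) (λ c → -′ fn (Vᶠ c i) (x j)))
    (A.+-cong
      (A.trans (ASum.sum-only (λ c → fn (Vᶠ i c) (x j)) (fin (suc (toℕ i))) (λ c p → proj₂ (V-x i c j) p))
        (A.trans (proj₁ (V-x i (fin (suc (toℕ i))) j) ≡.refl) (≃⇒≋ (P.reflexive (≡.sym (≡.trans (cong (λ t → β t (x j)) (ℕP.+-suc (suc k) (toℕ i)))
          (β-≡ {n ℕ.+ toℕ i} {toℕ i} (fin-per (toℕ i)) (≡.trans (cong fin (≡.sym (ℕP.+-suc n (toℕ i)))) (fin-per (suc (toℕ i)))) (x j))))))))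
      (A.trans (ASum.sum-only (λ c → -′ fn (Vᶠ c i) (x j)) (prev i) (λ c p → A.trans (A.-‿cong (proj₂ (V-x c i j)
           (λ e → p (FP.toℕ-injective (next-injective (FP.toℕ<n c) (FP.toℕ<n (prev i)) (≡.trans (≡.sym e) (≡.sym (next-prev i)))))))) -0≋0))
        (A.-‿cong (A.trans (proj₁ (V-x (prev i) i j) (≡.sym (next-prev i)))
          (≃⇒≋ (P.reflexive (β-≡ {toℕ (prev i)} {suc k ℕ.+ toℕ i} (fin-toℕ (prev i)) (next-fin (suc k ℕ.+ toℕ i)) (x j)))))))))
    where
    -0≋0 : -′ 0′ ≋ 0′
    -0≋0 = ≃⇒≋ PP.-0#≈0#

  relationLHS : (PolyHK → PolyHK → PolyHK) → PolyHK
  relationLHS _∗_ =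
    sumₚ (L.concatMap (λ i → L.concatMap (λ j → if does (toℕ i ℕ.<? toℕ j) then (x i ∗ x j) ∷ [] else []) (allFin n)) (allFin n)) +ₚ sumₚ (L.map qvar (allFin n))

  relation-sum : ∀ (_∗_ : PolyHK → PolyHK → PolyHK) → relationLHS _∗_ ≃ pairSum (λ i j → x i ∗ x j) +′ PSum.sum q
  relation-sum _∗_ = P.trans (P.reflexive (≡.sym (+′≡+ₚ _ _))) (P.+-cong
    (P.trans (sumₚ-concatMap (λ i → L.concatMap (row i) (allFin n)) (λ i → i)) (PSum.sum-cong {f = λ i → sumₚ (L.concatMap (row i) (allFin n))} {λ i → PSum.sum (λ j → pick (lt i j) (x i ∗ x j))}
      λ i → P.trans (sumₚ-concatMap (row i) (λ j → j)) (PSum.sum-cong {f = λ j → sumₚ (row i j)} {λ j → pick (lt i j) (x i ∗ x j)} λ j → sumₚ-if (lt i j) (x i ∗ x j))))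
    (P.trans (sumₚ-map qvar (λ j → j)) (PSum.sum-cong {f = qvar} {q} λ j → P.reflexive (≡.sym (X≡var (ιq j))))))
    where
    row : Fin n → Fin n → List PolyHK
    row i j = if does (toℕ i ℕ.<? toℕ j) then (x i ∗ x j) ∷ [] else []

  e₂-x : pairSum (λ i j → x i *′ x j) ≋ 0′
  e₂-x = A.trans (≃⇒≋ (P.sym (P.trans (pairSum-[] x (λ i j → X i *′ X j)) (pairSum-cong λ i j → P.trans ([]-X* x i (X j)) (P.*-congˡ ([]-X x j))))))
    (≋0 (⟨⟩-gen (inj₁ (e₂ n , e₂-symmetric n , []≡substₚ (e₂ n) x))))

  pick-≋ : ∀ b {f g} → f ≋ g → pick b f ≋ pick b g
  pick-≋ true p = p
  pick-≋ false p = A.refl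

  pick-+ : ∀ {m} b (f g : Poly m) → pick b (f +′ g) ≃ pick b f +′ pick b g
  pick-+ true f g = P.refl
  pick-+ false f g = P.sym (P.+-identityˡ 0′)

  γ-own : ∀ j → γ (toℕ j) (x j) ≃ -′ q (fin (suc k ℕ.+ toℕ j))
  γ-own j = P.trans (P.*-congˡ (P.trans (P.reflexive (cong (λ w → Forms.∂ forms (fin a) w (x j)) w≡j)) (P.trans (Forms.∂-x forms (fin a) j j)
      (P.trans (P.reflexive (cong κ (cong₂ ℤ._-_ (kron-≢ u≢j) (kron-≡ j)))) (P.trans (κ-neg 1ℤ) (P.-‿cong (P.reflexive κ-1)))))))
    (PS.solve (λ { (q ∷ []) → q ⊗ ⊝ 𝟙 , ⊝ q }) (q (fin a) ∷ []) ≡.refl)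
    where
    a = suc k ℕ.+ toℕ j
    w≡j : fin (suc a) ≡ j
    w≡j = ≡.trans (fin-per (toℕ j)) (fin-toℕ j)
    u≢j : fin a ≢ j
    u≢j p = next≢ 2≤n a (≡.trans p (≡.sym w≡j))

  ∂-sum : ∀ u w {l} (f : Fin l → PolyHK) → Forms.∂ forms u w (PSum.sum f) ≃ PSum.sum (λ i → Forms.∂ forms u w (f i))
  ∂-sum u w {zero} f = Divided.∂-0 _ _
  ∂-sum u w {suc l} f = P.trans (Divided.∂-+ _ _ _ _) (P.+-congˡ (∂-sum u w (f ∘ F.suc)))

  -- The term with index 0 is one additive operator applied to Σ x = 0. The others are -q_{j-1}, so
  -- the sum runs over all q in rotated order.
  quantum-part : PSum.sum (λ j → γ (toℕ j) (x j) -′ γ 0 (x j)) ≃ -′ PSum.sum q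
  quantum-part = begin
    PSum.sum (λ j → γ (toℕ j) (x j) -′ γ 0 (x j)) ≈⟨ P.trans (PSum.∑-distrib-+ (λ j → γ (toℕ j) (x j)) (λ j → -′ γ 0 (x j)))
      (P.+-cong (PSum.sum-cong γ-own) (P.trans (P.sym (PSum.sum-neg (λ j → γ 0 (x j)))) (P.trans (P.-‿cong γ0) PP.-0#≈0#))) ⟩
    PSum.sum (λ (j : Fin n) → -′ q (fin (suc k ℕ.+ toℕ j))) +′ 0′ ≈⟨ P.trans (P.+-identityʳ _) (P.sym (PSum.sum-neg (λ (j : Fin n) → q (fin (suc k ℕ.+ toℕ j))))) ⟩
    -′ PSum.sum (λ (j : Fin n) → q (fin (suc k ℕ.+ toℕ j))) ≈⟨ P.-‿cong rotate ⟩
    -′ PSum.sum q ∎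
    where
    open PR
    γ0 : PSum.sum (λ j → γ 0 (x j)) ≃ 0′
    γ0 = P.trans (P.sym (P.trans (P.*-congˡ (∂-sum u w x)) (PSum.sum-*ˡ (q u) (λ j → Forms.∂ forms u w (x j)))))
      (P.trans (P.*-congˡ (P.trans (Divided.∂-cong _ _ x-sum≃0) (Divided.∂-0 _ _))) (P.zeroʳ (q u)))
      where
      u = fin (suc k ℕ.+ 0)
      w = fin (suc (suc k ℕ.+ 0))
    rotate : PSum.sum (λ (j : Fin n) → q (fin (suc k ℕ.+ toℕ j))) ≃ PSum.sum q
    rotate = P.sym (P.trans (PSum.sum-cong {f = q} {λ j → q (fin (toℕ j))} (λ j → P.reflexive (cong q (≡.sym (fin-toℕ j)))))
      (P.trans (sum-last (suc k) (λ t → q (fin t))) (P.trans (P.+-comm _ _) (P.+-cong (P.reflexive (cong (q ∘ fin) (≡.sym (ℕP.+-identityʳ (suc k)))))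
        (PSum.sum-cong {f = λ (j : Fin (suc k)) → q (fin (toℕ j))} {λ j → q (fin (suc k ℕ.+ suc (toℕ j)))}
          (λ j → P.reflexive (cong q (≡.sym (≡.trans (cong fin (ℕP.+-suc (suc k) (toℕ j))) (fin-per (toℕ j)))))))))))

  -- The classical part is e₂(x), a Borel relation; for fixed j the corrections telescope over i <
  -- j.
  ⋆-relation : pairSum (λ i j → x i ⋆ x j) +′ PSum.sum q ≋ 0′
  ⋆-relation = A.trans (A.+-congʳ products) (A.-‿inverseˡ (PSum.sum q))
    where
    products : pairSum (λ i j → x i ⋆ x j) ≋ -′ PSum.sum q
    products = A.trans (ASum.sum-cong {f = λ i → PSum.sum (λ j → pick (lt i j) (x i ⋆ x j))} {λ i → PSum.sum (λ j → pick (lt i j) (F i j +′ G i j))}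
        λ i → ASum.sum-cong {f = λ j → pick (lt i j) (x i ⋆ x j)} {λ j → pick (lt i j) (F i j +′ G i j)} λ j → pick-≋ (lt i j)
          (A.trans (x⋆ i (x j)) (A.trans (≃⇒≋ (P.reflexive (𝒳-fn i (x j)))) (A.+-congˡ (Lower-x i j)))))
      (A.trans (≃⇒≋ split) (A.trans (A.+-congʳ e₂-x) (A.trans (A.+-identityˡ _) (≃⇒≋ (P.trans collapse quantum-part)))))
      where
      F G : Fin n → Fin n → PolyHK
      F i j = x i *′ x j
      G i j = γ (suc (toℕ i)) (x j) -′ γ (toℕ i) (x j)
      split : pairSum (λ i j → F i j +′ G i j) ≃ pairSum F +′ pairSum G
      split = P.trans (PSum.sum-cong λ i → P.trans (PSum.sum-cong λ j → pick-+ (lt i j) (F i j) (G i j)) (PSum.∑-distrib-+ (λ j → pick (lt i j) (F i j)) (λ j → pick (lt i j) (G i j))))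
        (PSum.∑-distrib-+ (λ i → PSum.sum (λ j → pick (lt i j) (F i j))) (λ i → PSum.sum (λ j → pick (lt i j) (G i j))))
      collapse : pairSum G ≃ PSum.sum (λ j → γ (toℕ j) (x j) -′ γ 0 (x j))
      collapse = P.trans (PSum.∑-comm (λ i j → pick (lt i j) (G i j))) (PSum.sum-cong λ j →
        sum-telescope-below n (toℕ j) (λ t → γ t (x j)) (ℕP.<⇒≤ (FP.toℕ<n j)))

-- Rule (vii) for ⋆

wdeg-cong : ∀ {m} {v w : Fin m → ℤ} → (∀ i → v i ≡ w i) → ∀ e → wdeg v e ≡ wdeg w e
wdeg-cong p [] = ≡.refl
wdeg-cong p (a ∷ e) = cong₂ (λ x y → + a ℤ.* x ℤ.+ y) (p F.zero) (wdeg-cong (p ∘ F.suc) e)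

wdeg-++ : ∀ a {b} (w : Fin (a ℕ.+ b) → ℤ) u (d : Mon b) →
          wdeg w (u V.++ d) ≡ wdeg (λ i → w (i ↑ˡ b)) u ℤ.+ wdeg (λ j → w (a ↑ʳ j)) d
wdeg-++ zero w [] d = ≡.sym (ℤP.+-identityˡ _)
wdeg-++ (suc a) w (x ∷ u) d = ≡.trans (cong (ℤ._+_ (+ x ℤ.* w F.zero)) (wdeg-++ a (w ∘ F.suc) u d)) (≡.sym (ℤP.+-assoc (+ x ℤ.* w F.zero) _ _))

wdeg-zero-weight : ∀ {m} (e : Mon m) → wdeg (λ _ → 0ℤ) e ≡ 0ℤ
wdeg-zero-weight [] = ≡.refl
wdeg-zero-weight (a ∷ e) = cong₂ ℤ._+_ (ℤP.*-zeroʳ (+ a)) (wdeg-zero-weight e)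

wdeg-one-weight : ∀ {m} (e : Mon m) → wdeg (λ _ → 1ℤ) e ≡ + V.sum e
wdeg-one-weight [] = ≡.refl
wdeg-one-weight (a ∷ e) = ≡.trans (cong₂ ℤ._+_ (ℤP.*-identityʳ (+ a)) (wdeg-one-weight e)) (≡.sym (ℤP.pos-+ a (V.sum e)))

sum-0⇒0ᵐ : ∀ {m} (e : Mon m) → V.sum e ≡ 0 → e ≡ 0ᵐ
sum-0⇒0ᵐ [] _ = ≡.refl
sum-0⇒0ᵐ (a ∷ e) p = cong₂ _∷_ (ℕP.m+n≡0⇒m≡0 a p) (sum-0⇒0ᵐ e (ℕP.m+n≡0⇒n≡0 a p))

bounded : ∀ {m} (v : Fin m → ℤ) (f : Poly m) → Σ ℕ λ N → All (λ t → wdeg v (proj₂ t) ℤ.≤ + N) f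
bounded v [] = 0 , []
bounded v ((c , e) ∷ f) with bounded v f
... | N , a = ℤ.∣ wdeg v e ∣ ℕ.+ N , ℤP.≤-trans (i≤∣i∣ (wdeg v e)) (ℤ.+≤+ (ℕP.m≤m+n _ N)) ∷ All.map (λ p → ℤP.≤-trans p (ℤ.+≤+ (ℕP.m≤n+m N _))) a
  where
  i≤∣i∣ : ∀ i → i ℤ.≤ + ℤ.∣ i ∣
  i≤∣i∣ (+ n) = ℤP.≤-refl
  i≤∣i∣ (-[1+ n ]) = ℤ.-≤+

at-lookup : ∀ {m} (d : Vec ℕ m) i → at d (toℕ i) ≡ lookup d i
at-lookup (a ∷ d) F.zero = ≡.refl
at-lookup (a ∷ d) (F.suc i) = at-lookup d i

module CoefficientRule (k : ℕ) where
  open Relation k public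

  flat : ∀ {N f} → QDeg.Bd N 0ℤ f → Σ PolyH λ h → f ≃ embed h
  flat {N} {f} (g , p , a) = slice 0ᵐ g , P.trans p (P.trans (slice-decompose 0ᵐ g)
    (P.trans (P.+-cong (P.trans (P.*-congˡ qmon-0) (P.*-identityʳ _)) (P.reflexive (≡.trans (unslice-all 0ᵐ g (All.map (λ {t} o → free (proj₂ t) (proj₂ o)) a)) []≡0)))
      (P.+-identityʳ _)))
    where
    free : ∀ e → wdeg QDeg.w e ≡ 0ℤ → drop r e ≡ 0ᵐ
    free e p = sum-0⇒0ᵐ (drop r e) (ℤP.+-injective (≡.trans (≡.sym total) p))
      where
      total : wdeg QDeg.w e ≡ + V.sum (drop r e)
      total = ≡.trans (cong (wdeg QDeg.w) (≡.sym (VP.take++drop≡id r e))) (≡.trans (wdeg-++ r QDeg.w (take r e) (drop r e))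
        (≡.trans (cong₂ ℤ._+_ (≡.trans (wdeg-cong (weight-Y 0ℤ 1ℤ) (take r e)) (wdeg-zero-weight (take r e)))
          (≡.trans (wdeg-cong (weight-q 0ℤ 1ℤ) (drop r e)) (wdeg-one-weight (drop r e)))) (ℤP.+-identityˡ _)))

  embed-Bd : ∀ h → Σ ℕ λ N → QDeg.Bd (+ N) 0ℤ (embed h)
  embed-Bd h with bounded (λ _ → 1ℤ) h
  ... | N , a = N , Bd-[] yw QDeg.w (λ _ → 1ℤ) (λ _ → 0ℤ) (λ i → X (ιY i)) QDeg.Bd-XY
    (h , P.refl , All.map (λ {t} p → p , wdeg-zero-weight (proj₂ t)) a)

  T-Bd : ∀ {a b} → a < b → ∀ {N f} → QDeg.Bd N 0ℤ f → QDeg.Bd N 0ℤ (fn (T a b) f)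
  T-Bd {a} {b} a<b bd = QDeg.Bd-≡ ≡.refl (lemma (proj₁ sh)) (proj₁ (proj₂ sh) bd)
    where
    sh = QDeg.Shift-TQ {a} {b} a<b
    lemma : ∀ l → 0ℤ ℤ.+ ℤ.- ((+ 2 ℤ.* l ℤ.+ 1ℤ) ℤ.* 0ℤ) ≡ 0ℤ
    lemma = solve-∀

  -- Divided differences have q-degree 0, so they preserve the subring H, and `U` applied to a class
  -- of H is concentrated at a single q-monomial.
  T-flat : ∀ {a b} → a < b → ∀ h → Σ PolyH λ h′ → fn (T a b) (embed h) ≃ embed h′
  T-flat a<b h = flat (T-Bd a<b (proj₂ (embed-Bd h)))

  -- d_m − d_{m−1}, indices modulo n
  slope : Fin n → Mon n → ℤ
  slope m d = + lookup d m ℤ.- + lookup d (prev m)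

  slope-+ : ∀ m d e → slope m (d +ᵐ e) ≡ slope m d ℤ.+ slope m e
  slope-+ m d e = ≡.trans (cong₂ ℤ._-_ (≡.trans (cong +_ (lookup-+ᵐ d e m)) (ℤP.pos-+ (lookup d m) _)) (≡.trans (cong +_ (lookup-+ᵐ d e (prev m))) (ℤP.pos-+ (lookup d (prev m)) _)))
    (lemma (+ lookup d m) (+ lookup e m) (+ lookup d (prev m)) (+ lookup e (prev m)))
    where
    lemma : ∀ a b c d → (a ℤ.+ b) ℤ.- (c ℤ.+ d) ≡ (a ℤ.- c) ℤ.+ (b ℤ.- d)
    lemma = solve-∀

  slope-0 : ∀ m → slope m 0ᵐ ≡ 0ℤ
  slope-0 m = cong₂ (λ a b → + a ℤ.- + b) (lookup-0ᵐ m) (lookup-0ᵐ (prev m))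

  lookup-kron : ∀ (j m : Fin n) → + lookup (unit j) m ≡ kron j m
  lookup-kron j m = cases (j F.≟ m)
    where
    cases : Dec (j ≡ m) → + lookup (unit j) m ≡ kron j m
    cases (yes ≡.refl) = ≡.trans (cong +_ (lookup-unit-≡ j)) (≡.sym (kron-≡ j))
    cases (no p) = ≡.trans (cong +_ (lookup-unit-≢ p)) (≡.sym (kron-≢ p))

  kron-prev : ∀ b m → kron (fin b) (prev m) ≡ kron (fin (suc b)) m
  kron-prev b m = cases (fin b F.≟ prev m) (fin (suc b) F.≟ m)
    where
    cases : Dec (fin b ≡ prev m) → Dec (fin (suc b) ≡ m) → kron (fin b) (prev m) ≡ kron (fin (suc b)) m
    cases (yes p) (yes p′) = ≡.trans (cong (λ j → kron j (prev m)) p) (≡.trans (kron-≡ (prev m)) (≡.sym (≡.trans (cong (λ j → kron j m) p′) (kron-≡ m))))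
    cases (no p) (no p′) = ≡.trans (kron-≢ p) (≡.sym (kron-≢ p′))
    cases (yes p) (no p′) = ⊥-elim (p′ (≡.trans (≡.sym (next-fin b)) (≡.trans (cong (λ j → fin (suc (toℕ j))) p) (next-prev m))))
    cases (no p) (yes p′) = ⊥-elim (p (FP.toℕ-injective (next-injective (FP.toℕ<n (fin b)) (FP.toℕ<n (prev m)) (≡.trans (next-fin b) (≡.trans p′ (≡.sym (next-prev m)))))))

  slope-unit : ∀ m b → slope m (unit (fin b)) ≡ kron (fin b) m ℤ.- kron (fin (suc b)) m
  slope-unit m b = cong₂ ℤ._-_ (lookup-kron (fin b) m) (≡.trans (lookup-kron (fin b) (prev m)) (kron-prev b m))

  -- The exponent of `Q a b` counts how often the interval passes each residue; it steps up at `a`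
  -- and down at `b`, which is all that is recorded of it.
  Interval : ℕ → ℕ → Set
  Interval a b = Σ (Mon n) λ e → (∀ g → fn (Q a b) g ≋ qmon e *′ g) × (∀ m → slope m e ≡ kron (fin a) m ℤ.- kron (fin b) m)

  interval : ∀ {a b} → a < b → Interval a b
  interval {a} {suc b} a<b = [ (λ { ≡.refl → base }) , step ]′ (split< a<b)
    where
    q-fn : ∀ b g → fn (QuantumNilHecke.q quantum b) g ≋ qmon (unit (fin b)) *′ g
    q-fn b g = ≃⇒≋ (P.reflexive (≡.trans (cong (λ φ → fn φ g) (quantum-q b)) (cong (_*′ g) (≡.sym (qmon-unit (fin b))))))
    base : Interval b (suc b)
    base = unit (fin b) , (λ g → A.trans (app (Q-one b) g) (q-fn b g)) , λ m → slope-unit m b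
    step : a < b → Interval a (suc b)
    step a<b = go (interval a<b)
      where
      go : Interval a b → Interval a (suc b)
      go (e , fe , se) = unit (fin b) +ᵐ e ,
        (λ g → A.trans (app (Q-step a<b) g) (A.trans (q-fn b _) (A.trans (A.*-congˡ (fe g)) (≃⇒≋ (P.trans (P.sym (P.*-assoc (qmon (unit (fin b))) (qmon e) g)) (P.*-congʳ (P.sym (qmon-+ (unit (fin b)) e)))))))) ,
        λ m → ≡.trans (slope-+ m (unit (fin b)) e) (≡.trans (cong₂ ℤ._+_ (slope-unit m b) (se m)) (lemma (kron (fin b) m) (kron (fin (suc b)) m) (kron (fin a) m)))
        where
        lemma : ∀ x y z → (x ℤ.- y) ℤ.+ (z ℤ.- x) ≡ z ℤ.- y
        lemma = solve-∀

  module _ (d : Mon n) (z : anyZero d ≡ true) (a : PolyH) where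

    W : Fin n → Fin n → PolyH
    W i c = slice d (fn (Vᶠ i c) (embed a))

    -- Either q^d is the monomial of the arc from i to c, and its slopes are known, or `W i c` is 0.
    W-slope : ∀ m i c → κ (slope m d) *′ W i c ≋H κ (kron i m ℤ.- kron c m) *′ W i c
    W-slope m i c = go (V-interval (FP.toℕ<n i) (FP.toℕ<n c))
      where
      Goal : Set
      Goal = κ (slope m d) *′ W i c ≋H κ (kron i m ℤ.- kron c m) *′ W i c
      go : (Σ ℕ λ b → toℕ i < b × b ≤ n ℕ.+ toℕ i × (b ≡ toℕ c ⊎ b ≡ n ℕ.+ toℕ c) × V (toℕ i) (toℕ c) ≡ U (toℕ i) b) → Goal
      go (b , i<b , _ , ends , eq) = finish (interval i<b) (T-flat i<b a)
        where
        fin-b : fin b ≡ c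
        fin-b = [ (λ e → ≡.trans (cong fin e) (fin-toℕ c)) , (λ e → ≡.trans (cong fin e) (≡.trans (fin-per (toℕ c)) (fin-toℕ c))) ]′ ends
        finish : Interval (toℕ i) b → (Σ PolyH λ h → fn (T (toℕ i) b) (embed a) ≃ embed h) → Goal
        finish (e , fe , se) (h , th) = cases (e ≟ᵐ d)
          where
          W≋ : W i c ≋H slice d (embed h *′ qmon e)
          W≋ = slice-≋ d z (A.trans (≃⇒≋ (P.reflexive (cong (λ φ → fn φ (embed a)) (≡.trans eq (U-def (toℕ i) b)))))
            (A.trans (fn-cong (Q (toℕ i) b) (≃⇒≋ th)) (A.trans (fe (embed h)) (A.*-comm (qmon e) (embed h)))))
          cases : Dec (e ≡ d) → Goal
          cases (yes ≡.refl) = ≃⇒≋ (P.*-congʳ (P.reflexive (cong κ (≡.trans (se m) (cong₂ (λ u w → kron u m ℤ.- kron w m) (fin-toℕ i) fin-b)))))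
          cases (no p) = AH.trans (AH.*-congˡ W0) (AH.trans (AH.zeroʳ _) (AH.sym (AH.trans (AH.*-congˡ W0) (AH.zeroʳ _))))
            where
            W0 : W i c ≋H 0′
            W0 = AH.trans W≋ (≃⇒≋ (slice-qmon-≢ d h p))

    module AHSum = FinSum (CommutativeRing.ring (quotientRing GH))

    classical : ∀ m l → κ (slope m d) *′ slice d (x l *′ embed a) ≋H 0′
    classical m l = cases (0ᵐ ≟ᵐ d)
      where
      cases : Dec (0ᵐ ≡ d) → κ (slope m d) *′ slice d (x l *′ embed a) ≋H 0′
      cases (yes ≡.refl) = ≃⇒≋ (P.trans (P.*-congʳ (P.trans (P.reflexive (cong κ (slope-0 m))) κ-0)) (P.zeroˡ _))
      cases (no p) = ≃⇒≋ (P.trans (P.*-congˡ (P.trans (slice-cong d (P.sym (P.trans (P.*-congˡ qmon-0) (P.trans (P.*-identityʳ _)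
        (P.trans ([]-* _ (xH l) a) (P.*-congʳ (embed-x l))))))) (slice-qmon-≢ d (xH l *′ a) p))) (P.zeroʳ _))

    C : Fin n → PolyH
    C l = slice d (fn (𝒳 l) (embed a))

    slice-sum : ∀ {l} (g : Fin l → PolyHK) → slice d (PSum.sum g) ≃ PSum.sum (λ i → slice d (g i))
    slice-sum {zero} g = slice-0 d
    slice-sum {suc l} g = P.trans (slice-+ d _ _) (P.+-congˡ (slice-sum (g ∘ F.suc)))

    C-expand : ∀ l → C l ≃ slice d (x l *′ embed a) +′ PSum.sum (λ c → W l c -′ W c l)
    C-expand l = P.trans (slice-cong d (P.reflexive (𝒳-fn l (embed a)))) (P.trans (slice-+ d _ _) (P.+-congˡ
      (P.trans (slice-cong d (P.reflexive (sum-op (A-op l) (embed a)))) (P.trans (slice-sum (λ c → fn (Vᶠ l c) (embed a) -′ fn (Vᶠ c l) (embed a)))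
        (PSum.sum-cong {f = λ c → slice d (fn (Vᶠ l c) (embed a) -′ fn (Vᶠ c l) (embed a))} {λ c → W l c -′ W c l}
          λ c → P.trans (slice-+ d _ _) (P.+-congˡ (slice-neg d _)))))))

    -- The factor keeps only arcs with an end at `m`; among those occurring in `C l` these are the
    -- two arcs between l and m. The classical term sits at d = 0, where the slope vanishes. The
    -- right side is symmetric in l and m, which yields the rule.
    C-slope : ∀ m l → m ≢ l → κ (slope m d) *′ C l ≋H -′ (W l m +′ W m l)
    C-slope m l m≢l = begin
      κ u *′ C l ≈⟨ AH.*-congˡ (≃⇒≋ (C-expand l)) ⟩
      κ u *′ (slice d (x l *′ embed a) +′ PSum.sum (λ c → W l c -′ W c l)) ≈⟨ AH.distribˡ _ _ _ ⟩
      κ u *′ slice d (x l *′ embed a) +′ κ u *′ PSum.sum (λ c → W l c -′ W c l) ≈⟨ AH.+-cong (classical m l) (≃⇒≋ (PSum.sum-*ˡ (κ u) (λ c → W l c -′ W c l))) ⟩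
      0′ +′ PSum.sum (λ c → κ u *′ (W l c -′ W c l)) ≈⟨ AH.trans (AH.+-identityˡ _) (AHSum.sum-cong each) ⟩
      PSum.sum (λ c → -′ (κ (kron c m) *′ (W l c +′ W c l))) ≈⟨ AHSum.sum-only (λ c → -′ (κ (kron c m) *′ (W l c +′ W c l))) m (λ c p → ≃⇒≋ (P.trans (P.-‿cong (P.trans (P.*-congʳ
          (P.trans (P.reflexive (cong κ (kron-≢ p))) κ-0)) (P.zeroˡ _))) PP.-0#≈0#)) ⟩
      -′ (κ (kron m m) *′ (W l m +′ W m l)) ≈⟨ ≃⇒≋ (P.-‿cong (P.trans (P.*-congʳ (P.reflexive (≡.trans (cong κ (kron-≡ m)) κ-1))) (P.*-identityˡ _))) ⟩
      -′ (W l m +′ W m l) ∎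
      where
      open SetoidReasoning AH.setoid
      u = slope m d
      each : ∀ c → κ u *′ (W l c -′ W c l) ≋H -′ (κ (kron c m) *′ (W l c +′ W c l))
      each c = AH.trans (≃⇒≋ (PS.solve (λ { (u ∷ p ∷ r ∷ []) → u ⊗ (p ⊖ r) , u ⊗ p ⊖ u ⊗ r }) (κ u ∷ W l c ∷ W c l ∷ []) ≡.refl))
        (AH.trans (AH.+-cong (W-slope m l c) (AH.-‿cong (W-slope m c l))) (≃⇒≋ (P.trans
          (P.+-cong (P.*-congʳ (P.trans (P.reflexive (cong κ (cong (ℤ._- kron c m) (kron-≢ (m≢l ∘ ≡.sym))))) (P.trans (κ-+ 0ℤ (ℤ.- kron c m)) (P.+-cong κ-0 (κ-neg (kron c m))))))
            (P.-‿cong (P.*-congʳ (P.trans (P.reflexive (cong κ (cong (ℤ._-_ (kron c m)) (kron-≢ (m≢l ∘ ≡.sym))))) (P.reflexive (cong κ (ℤP.+-identityʳ (kron c m))))))))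
          (PS.solve (λ { (s ∷ p ∷ r ∷ []) → (𝟘 ⊕ ⊝ s) ⊗ p ⊖ s ⊗ r , ⊝ (s ⊗ (p ⊕ r)) }) (κ (kron c m) ∷ W l c ∷ W c l ∷ []) ≡.refl))))

    C-rule : ∀ m l → κ (slope m d) *′ C l ≋H κ (slope l d) *′ C m
    C-rule m l = cases (m F.≟ l)
      where
      cases : Dec (m ≡ l) → κ (slope m d) *′ C l ≋H κ (slope l d) *′ C m
      cases (yes ≡.refl) = AH.refl
      cases (no p) = AH.trans (C-slope m l p) (AH.trans (≃⇒≋ (P.-‿cong (P.+-comm (W l m) (W m l)))) (AH.sym (C-slope l m (p ∘ ≡.sym))))

  -- d_t − d_n, for the coefficient of the t-th class y
  height : Mon n → ℕ → ℤ
  -- The index 0 is read as n, in accordance with Y_0 = Y_n = 0.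
  height d zero = 0ℤ
  height d (suc t) = + at d t ℤ.- + at d (suc k)

  height-step : ∀ d m → height d (suc (toℕ m)) ≡ height d (toℕ m) ℤ.+ slope m d
  height-step d F.zero = ≡.trans (cong (λ a → + at d 0 ℤ.- + a) (≡.trans (cong (at d) (≡.sym top)) (at-lookup d (prev F.zero))))
    (≡.trans (cong (λ a → + a ℤ.- + lookup d (prev F.zero)) (at-lookup d F.zero)) (≡.sym (ℤP.+-identityˡ _)))
    where
    top : toℕ (prev F.zero) ≡ suc k
    top = ≡.trans (toℕ-fin (suc k ℕ.+ 0)) (≡.trans (cong (DM._% n) (ℕP.+-identityʳ (suc k))) (DM.m<n⇒m%n≡m ℕP.≤-refl))
  height-step d (F.suc t) = ≡.trans (lemma (+ at d (suc (toℕ t))) (+ at d (toℕ t)) (+ at d (suc k)))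
    (cong (ℤ._+_ (+ at d (toℕ t) ℤ.- + at d (suc k))) (cong₂ (λ a b → + a ℤ.- + b) (at-lookup d (F.suc t)) (≡.trans (cong (at d) (≡.sym below-top)) (at-lookup d (prev (F.suc t))))))
    where
    lemma : ∀ a b c → a ℤ.- c ≡ (b ℤ.- c) ℤ.+ (a ℤ.- b)
    lemma = solve-∀
    below-top : toℕ (prev (F.suc t)) ≡ toℕ t
    below-top = ≡.trans (cong toℕ (≡.trans (cong fin (ℕP.+-suc (suc k) (toℕ t))) (fin-per (toℕ t))))
      (≡.trans (toℕ-fin (toℕ t)) (DM.m<n⇒m%n≡m (ℕP.m<n⇒m<1+n (FP.toℕ<n t))))

  height-top : ∀ d → height d n ≡ 0ℤ
  height-top d = ℤP.+-inverseʳ (+ at d (suc k))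

  κ-height : ∀ d m → κ {r} (height d (suc (toℕ m))) ≃ κ (height d (toℕ m)) +′ κ (slope m d)
  κ-height d m = P.trans (P.reflexive (cong κ (height-step d m))) (κ-+ (height d (toℕ m)) (slope m d))

  -- Rule (vii) for the classes y amounts to the same rule for the classes x, with the differences
  -- of the heights as weights.
  module Partial (d : Mon n) (c : Fin n → PolyH) (S : ℕ → PolyH) (S-0 : S 0 ≋H 0′)
                 (S-suc : ∀ m → S (suc (toℕ m)) ≋H c m +′ S (toℕ m)) where

    Fin-elim : ∀ {p} (Pr : ℕ → Set p) → (∀ (m : Fin n) → Pr (toℕ m)) → ∀ {t} → t < n → Pr t
    Fin-elim Pr h t<n = subst Pr (FP.toℕ-fromℕ< t<n) (h (fromℕ< t<n))

    forward : (∀ m l → κ (slope m d) *′ c l ≋H κ (slope l d) *′ c m) →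
              ∀ s t → s ≤ n → t ≤ n → κ (height d s) *′ S t ≋H κ (height d t) *′ S s
    forward h zero t _ _ = AH.trans (≃⇒≋ (P.trans (P.*-congʳ κ-0) (P.zeroˡ _))) (AH.sym (AH.trans (AH.*-congˡ S-0) (AH.zeroʳ _)))
    forward h (suc s) t s<n t≤n = Fin-elim (λ s → κ (height d s) *′ S t ≋H κ (height d t) *′ S s → κ (height d (suc s)) *′ S t ≋H κ (height d t) *′ S (suc s))
      (λ m ih → AH.trans (≃⇒≋ (P.trans (P.*-congʳ (κ-height d m)) (P.distribʳ _ _ _))) (AH.trans (AH.+-cong ih (mixed m t t≤n))
        (AH.trans (≃⇒≋ (PS.solve (λ { (h ∷ s ∷ c ∷ []) → h ⊗ s ⊕ h ⊗ c , h ⊗ (c ⊕ s) }) (κ (height d t) ∷ S (toℕ m) ∷ c m ∷ []) ≡.refl)) (AH.*-congˡ (AH.sym (S-suc m))))))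
      s<n (forward h s t (ℕP.<⇒≤ s<n) t≤n)
      where
      mixed : ∀ m t → t ≤ n → κ (slope m d) *′ S t ≋H κ (height d t) *′ c m
      mixed m zero _ = AH.trans (AH.*-congˡ S-0) (AH.trans (AH.zeroʳ _) (AH.sym (≃⇒≋ (P.trans (P.*-congʳ κ-0) (P.zeroˡ _)))))
      mixed m (suc t) t<n = Fin-elim (λ t → κ (slope m d) *′ S t ≋H κ (height d t) *′ c m → κ (slope m d) *′ S (suc t) ≋H κ (height d (suc t)) *′ c m)
        (λ l ih → AH.trans (AH.*-congˡ (S-suc l)) (AH.trans (AH.distribˡ _ _ _) (AH.trans (AH.+-cong (h m l) ih)
          (≃⇒≋ (P.trans (PS.solve (λ { (u ∷ v ∷ c ∷ []) → u ⊗ c ⊕ v ⊗ c , (v ⊕ u) ⊗ c }) (κ (slope l d) ∷ κ (height d (toℕ l)) ∷ c m ∷ []) ≡.refl) (P.*-congʳ (P.sym (κ-height d l))))))))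
        t<n (mixed m t (ℕP.<⇒≤ t<n))

    -- Slope times class is a mixed second difference of the products height times `S`, and each of
    -- its four terms is exchanged by the hypothesis.
    backward : (∀ s t → s ≤ n → t ≤ n → κ (height d s) *′ S t ≋H κ (height d t) *′ S s) →
               ∀ m l → κ (slope m d) *′ c l ≋H κ (slope l d) *′ c m
    backward h m l = AH.trans (expand m l) (AH.trans (AH.+-cong (AH.+-cong (h _ _ (FP.toℕ<n m) (FP.toℕ<n l)) (h _ _ (lo m) (lo l)))
      (AH.-‿cong (AH.+-cong (h _ _ (FP.toℕ<n m) (lo l)) (h _ _ (lo m) (FP.toℕ<n l)))))
      (AH.trans (≃⇒≋ (P.+-congˡ (P.-‿cong (P.+-comm _ _)))) (AH.sym (expand l m))))
      where
      lo : ∀ (m : Fin n) → toℕ m ≤ n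
      lo m = ℕP.<⇒≤ (FP.toℕ<n m)
      H : ℕ → PolyH
      H t = κ (height d t)
      expand : ∀ m l → κ (slope m d) *′ c l ≋H (H (suc (toℕ m)) *′ S (suc (toℕ l)) +′ H (toℕ m) *′ S (toℕ l)) -′ (H (suc (toℕ m)) *′ S (toℕ l) +′ H (toℕ m) *′ S (suc (toℕ l)))
      expand m l = AH.trans (≃⇒≋ (PS.solve (λ { (h ∷ u ∷ s ∷ c ∷ []) → u ⊗ c , ((h ⊕ u) ⊗ (c ⊕ s) ⊕ h ⊗ s) ⊖ ((h ⊕ u) ⊗ s ⊕ h ⊗ (c ⊕ s)) })
        (H (toℕ m) ∷ κ (slope m d) ∷ S (toℕ l) ∷ c l ∷ []) ≡.refl))
        (AH.+-cong (AH.+-cong (AH.*-cong hm (AH.sym (S-suc l))) AH.refl) (AH.-‿cong (AH.+-cong (AH.*-cong hm AH.refl) (AH.*-congˡ (AH.sym (S-suc l))))))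
        where
        hm : H (toℕ m) +′ κ (slope m d) ≋H H (suc (toℕ m))
        hm = ≃⇒≋ (P.sym (κ-height d m))

  Y-step : ∀ m → Y (suc (toℕ m)) ≃ x m +′ Y (toℕ m)
  Y-step m = P.trans (PS.solve (λ { (a ∷ b ∷ []) → a , (a ⊖ b) ⊕ b }) (Y (suc (toℕ m)) ∷ Y (toℕ m) ∷ []) ≡.refl) (P.+-congʳ (P.reflexive (≡.sym (x-def m))))

  0⋆ : ∀ f → 0′ ⋆ f ≋ 0′
  0⋆ f = A.trans (⋆-congˡ (≃⇒≋ (P.sym κ-0)) f) (A.trans (κ⋆ 0ℤ f) (≃⇒≋ (P.trans (P.*-congʳ κ-0) (P.zeroˡ f))))

  ⋆-coefficients : ∀ d → anyZero d ≡ true → ∀ a s t → s ≤ n → t ≤ n →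
                   κ (height d s) *′ slice d (Y t ⋆ embed a) ≋H κ (height d t) *′ slice d (Y s ⋆ embed a)
  ⋆-coefficients d z a = Partial.forward d (C d z a) (λ t → slice d (Y t ⋆ embed a))
    (AH.trans (slice-≋ d z (A.trans (⋆-congˡ (≃⇒≋ (P.reflexive Y-0)) (embed a)) (0⋆ (embed a)))) (≃⇒≋ (slice-0 d)))
    (λ m → AH.trans (slice-≋ d z (A.trans (⋆-congˡ (≃⇒≋ (Y-step m)) (embed a)) (A.trans (⋆-+ˡ (x m) (Y (toℕ m)) (embed a)) (A.+-congʳ (x⋆ m (embed a))))))
      (≃⇒≋ (slice-+ d _ _)))
    (C-rule d z a)

-- Integral symmetrization and torsion-freeness of H

-- The operators E j = ∂ 0 ⋯ ∂ j · x 0 ⋯ x j make a polynomial symmetric one variable at a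
-- time, and they fix everything annihilated by ∂ 0, …, ∂ j.
module Symmetrizer {c ℓ} {R : Ring c ℓ} {n : ℕ} (H : NilHecke R n) where
  open Ring R
  open NilHecke H
  open NilHeckeProps H
  open Intervals H using (Com; com-*; com-cong)
  open Solve R
  open Combination R

  p : ℕ → Carrier
  p zero = 1#
  p (suc j) = p j * x j

  W : ℕ → Carrier
  W zero = ∂ 0
  W (suc j) = W j * ∂ (suc j)

  E : ℕ → Carrier
  E j = W j * p (suc j)

  com-1 : ∀ a → Com a 1#
  com-1 a = trans (*-identityʳ a) (sym (*-identityˡ a))

  ∂p-low : ∀ {i} m → m ≤ i → 2 ℕ.+ i ≤ n → Com (∂ i) (p m)
  ∂p-low zero _ _ = com-1 _
  ∂p-low (suc m) m<i i<n = com-* (∂p-low m (ℕP.<⇒≤ m<i) i<n) (∂x< m<i (ℕP.≤-trans i<n (ℕP.m≤m+n n m)))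

  -- The product contains both x i and x (i + 1), so it is symmetric in them.
  ∂p-high : ∀ {i} m → 2 ℕ.+ i ≤ m → m ≤ n → Com (∂ i) (p m)
  ∂p-high {i} (suc m) (s≤s i<m) m<n = [ later , here ]′ (ℕP.m≤n⇒m<n∨m≡n i<m)
    where
    later : suc i < m → Com (∂ i) (p (suc m))
    later q = com-* (∂p-high m q (ℕP.<⇒≤ m<n)) (∂x> q (ℕP.≤-trans m<n (ℕP.m≤m+n n i)))
    here : suc i ≡ m → Com (∂ i) (p (suc m))
    here ≡.refl = by
      (solve (λ { (d ∷ p ∷ x ∷ y ∷ []) → d ⊗ ((p ⊗ x) ⊗ y) , ((p ⊗ x) ⊗ y) ⊗ d
         ⊕ (𝟙 ⊗ (d ⊗ p ⊖ p ⊗ d) ⊗ (x ⊗ y) ⊕ (p ⊗ (d ⊗ x ⊖ (y ⊗ d ⊕ 𝟙)) ⊗ y ⊕ ((p ⊗ y) ⊗ (d ⊗ y ⊖ (x ⊗ d ⊕ ⊝ 𝟙)) ⊗ 𝟙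
         ⊕ p ⊗ (y ⊗ x ⊖ x ⊗ y) ⊗ d))) })
        (∂ i ∷ p i ∷ x i ∷ x (suc i) ∷ []) ≡.refl)
      (1# ∙⟨ ∂p-low i ℕP.≤-refl m<n ⟩∙ _ ⊞ p i ∙⟨ ∂x i ⟩∙ _ ⊞ _ ∙⟨ ∂x⁺ i ⟩∙ 1# ⊞ p i ∙⟨ x-comm (suc i) i ⟩∙ ∂ i)

  ∂W-far : ∀ {i} j → 2 ℕ.+ j ≤ i → 2 ℕ.+ i ≤ n → Com (∂ i) (W j)
  ∂W-far zero j<i i<n = sym (∂-far j<i (ℕP.≤-trans i<n (ℕP.m≤m+n n 0)))
  ∂W-far (suc j) j<i i<n = com-* (∂W-far j (ℕP.<⇒≤ j<i) i<n) (sym (∂-far j<i (ℕP.≤-trans i<n (ℕP.m≤m+n n (suc j)))))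

  ∂W-first : ∀ j → ∂ 0 * W j ≈ 0#
  ∂W-first zero = ∂² 0
  ∂W-first (suc j) = trans (sym (*-assoc _ _ _)) (trans (*-congʳ (∂W-first j)) (zeroˡ _))

  -- The letter ∂ (i + 1) passes everything before ∂ i, a braid move replaces it by ∂ i on the other
  -- side, and ∂ i passes the rest.
  ∂W-shift : ∀ i j → i < j → 2 ℕ.+ j ≤ n → ∂ (suc i) * W j ≈ W j * ∂ i
  ∂W-shift i (suc j) (s≤s i≤j) j<n = [ inner , (λ e → outer j e j<n) ]′ (ℕP.m≤n⇒m<n∨m≡n i≤j)
    where
    inner : i < j → ∂ (suc i) * W (suc j) ≈ W (suc j) * ∂ i
    inner i<j = by
      (solve (λ { (d ∷ d′ ∷ w ∷ e ∷ []) → d′ ⊗ (w ⊗ e) , (w ⊗ e) ⊗ d ⊕ (𝟙 ⊗ (d′ ⊗ w ⊖ w ⊗ d) ⊗ e ⊕ w ⊗ (d ⊗ e ⊖ e ⊗ d) ⊗ 𝟙) })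
        (∂ i ∷ ∂ (suc i) ∷ W j ∷ ∂ (suc j) ∷ []) ≡.refl)
      (1# ∙⟨ ∂W-shift i j i<j (ℕP.<⇒≤ j<n) ⟩∙ _ ⊞ W j ∙⟨ ∂-far (s≤s i<j) (ℕP.≤-trans j<n (ℕP.m≤m+n n i)) ⟩∙ 1#)
    outer : ∀ j → i ≡ j → 3 ℕ.+ j ≤ n → ∂ (suc i) * W (suc j) ≈ W (suc j) * ∂ i
    outer zero ≡.refl j<n = trans (sym (*-assoc _ _ _)) (sym (braid (ℕP.≤-trans (s≤s (s≤s (s≤s z≤n))) j<n) 0))
    outer (suc j) ≡.refl j<n = by
      (solve (λ { (d ∷ e ∷ w ∷ []) → e ⊗ ((w ⊗ d) ⊗ e) , ((w ⊗ d) ⊗ e) ⊗ d ⊕ (𝟙 ⊗ (e ⊗ w ⊖ w ⊗ e) ⊗ (d ⊗ e) ⊕ ⊝ w ⊗ (d ⊗ e ⊗ d ⊖ e ⊗ d ⊗ e) ⊗ 𝟙) })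
        (∂ (suc j) ∷ ∂ (suc (suc j)) ∷ W j ∷ []) ≡.refl)
      (1# ∙⟨ ∂W-far j ℕP.≤-refl j<n ⟩∙ _ ⊞ (- W j) ∙⟨ braid (ℕP.≤-trans (s≤s (s≤s (s≤s z≤n))) j<n) (suc j) ⟩∙ 1#)

  ∂E-first : ∀ j → ∂ 0 * E j ≈ 0#
  ∂E-first j = trans (sym (*-assoc _ _ _)) (trans (*-congʳ (∂W-first j)) (zeroˡ _))

  ∂E-shift : ∀ i j → i < j → 2 ℕ.+ j ≤ n → ∂ (suc i) * E j ≈ E j * ∂ i
  ∂E-shift i j i<j j<n = by
    (solve (λ { (d ∷ d′ ∷ w ∷ q ∷ []) → d′ ⊗ (w ⊗ q) , (w ⊗ q) ⊗ d ⊕ (𝟙 ⊗ (d′ ⊗ w ⊖ w ⊗ d) ⊗ q ⊕ w ⊗ (d ⊗ q ⊖ q ⊗ d) ⊗ 𝟙) })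
      (∂ i ∷ ∂ (suc i) ∷ W j ∷ p (suc j) ∷ []) ≡.refl)
    (1# ∙⟨ ∂W-shift i j i<j j<n ⟩∙ _ ⊞ W j ∙⟨ ∂p-high (suc j) (s≤s i<j) (ℕP.<⇒≤ j<n) ⟩∙ 1#)

  E-zero : E 0 ≈ 1# + x 1 * ∂ 0
  E-zero = trans (*-congˡ (*-identityˡ (x 0))) (trans (∂x 0) (+-comm _ _))

  -- By induction every `E j` is 1 plus terms ending in one of ∂ 0, ..., ∂ j, so it fixes whatever
  -- these annihilate.
  E-suc : ∀ j → 3 ℕ.+ j ≤ n → E (suc j) ≈ E j + W j * p (suc j) * x (suc (suc j)) * ∂ (suc j)
  E-suc j j<n = by
    (solve (λ { (w ∷ d ∷ q ∷ x ∷ y ∷ []) → (w ⊗ d) ⊗ (q ⊗ x) , (w ⊗ q ⊕ w ⊗ q ⊗ y ⊗ d)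
       ⊕ (w ⊗ (d ⊗ q ⊖ q ⊗ d) ⊗ x ⊕ (w ⊗ q) ⊗ (d ⊗ x ⊖ (y ⊗ d ⊕ 𝟙)) ⊗ 𝟙) })
      (W j ∷ ∂ (suc j) ∷ p (suc j) ∷ x (suc j) ∷ x (suc (suc j)) ∷ []) ≡.refl)
    (W j ∙⟨ ∂p-low (suc j) ℕP.≤-refl j<n ⟩∙ _ ⊞ _ ∙⟨ ∂x (suc j) ⟩∙ 1#)

module TorsionFree (k : ℕ) where
  open CoefficientRule k public

  upForms : Forms n
  upForms = variableForms n

  module Up = FormOps upForms

  ∂↑ : ℕ → Up.Op
  ∂↑ i = Up.∂ᵒ (Up.next≢ 2≤n i)

  ∂↓ : ℕ → Op
  ∂↓ i = ∂ᵒ (next≢ 2≤n i)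

  opaque
    H↑ : NilHecke Up.opRing n
    H↑ = Up.nilHecke 2≤n

    H↓ : NilHecke opRing n
    H↓ = FormOps.nilHecke forms 2≤n

    H↑-∂ : ∀ i → NilHecke.∂ H↑ i ≡ ∂↑ i
    H↑-∂ i = ≡.refl

    H↓-∂ : ∀ i → NilHecke.∂ H↓ i ≡ ∂↓ i
    H↓-∂ i = ≡.refl

    H↑-x : ∀ i → NilHecke.x H↑ i ≡ Up.xᵒ (fin i)
    H↑-x i = ≡.refl

    H↓-x : ∀ i → NilHecke.x H↓ i ≡ xᵒ (fin i)
    H↓-x i = ≡.refl

  module S↑ = Symmetrizer H↑
  module S↓ = Symmetrizer H↓

  record Induces (φ : Up.Op) (ψ : Op) : Set where
    constructor induces
    field compat : ∀ f → Up.fn φ f [ x ] ≋ fn ψ (f [ x ])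
  open Induces

  induces-* : ∀ {φ φ′ ψ ψ′} → Induces φ ψ → Induces φ′ ψ′ → Induces (φ Up.*ᵒ φ′) (ψ *ᵒ ψ′)
  induces-* {φ} {φ′} {ψ} {ψ′} h h′ = induces λ f → A.trans (compat h (Up.fn φ′ f)) (fn-cong ψ (compat h′ f))

  induces-∂ : ∀ i → Induces (NilHecke.∂ H↑ i) (NilHecke.∂ H↓ i)
  induces-∂ i = ≡.subst₂ Induces (≡.sym (H↑-∂ i)) (≡.sym (H↓-∂ i)) (induces λ f → ≃⇒≋ (P.sym (∂-natural (fin i) (fin (suc i)) f)))

  induces-x : ∀ i → Induces (NilHecke.x H↑ i) (NilHecke.x H↓ i)
  induces-x i = ≡.subst₂ Induces (≡.sym (H↑-x i)) (≡.sym (H↓-x i)) (induces λ f → ≃⇒≋ ([]-X* x (fin i) f))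

  induces-p : ∀ j → Induces (S↑.p j) (S↓.p j)
  induces-p zero = induces λ f → A.refl
  induces-p (suc j) = induces-* {S↑.p j} {_} {S↓.p j} (induces-p j) (induces-x j)

  induces-W : ∀ j → Induces (S↑.W j) (S↓.W j)
  induces-W zero = induces-∂ 0
  induces-W (suc j) = induces-* {S↑.W j} {_} {S↓.W j} (induces-W j) (induces-∂ (suc j))

  induces-E : ∀ j → Induces (S↑.E j) (S↓.E j)
  induces-E j = induces-* {S↑.W j} {S↑.p (suc j)} {S↓.W j} {S↓.p (suc j)} (induces-W j) (induces-p (suc j))

  E↓-fixes : ∀ j → 2 ℕ.+ j ≤ n → ∀ g → (∀ i → fn (NilHecke.∂ H↓ i) g ≋ 0′) → fn (S↓.E j) g ≋ g
  E↓-fixes zero _ g h = A.trans (app S↓.E-zero g) (A.trans (A.+-congˡ (A.trans (fn-cong (NilHecke.x H↓ 1) (h 0)) (fn-0 (NilHecke.x H↓ 1)))) (A.+-identityʳ g))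
  E↓-fixes (suc j) j<n g h = A.trans (app (S↓.E-suc j j<n) g) (A.trans (A.+-cong (E↓-fixes j (ℕP.<⇒≤ j<n) g h)
    (A.trans (fn-cong ((S↓.W j *ᵒ S↓.p (suc j)) *ᵒ NilHecke.x H↓ (suc (suc j))) (h (suc j))) (fn-0 ((S↓.W j *ᵒ S↓.p (suc j)) *ᵒ NilHecke.x H↓ (suc (suc j)))))) (A.+-identityʳ g))

  symmetrize : ℕ → Poly n → Poly n
  symmetrize zero F = F
  symmetrize (suc j) F = Up.fn (S↑.E j) (symmetrize j F)

  -- Applying `E` moves the annihilated indices up by one, by `∂E-shift`, and `∂E-first` fills the
  -- place of index 0.
  symmetrize-killed : ∀ j → suc j ≤ n → ∀ F i → i < j → Up.fn (NilHecke.∂ H↑ i) (symmetrize j F) ≋[ Forms.G upForms ] 0′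
  symmetrize-killed (suc j) j<n F zero _ = Up.app (S↑.∂E-first j) (symmetrize j F)
  symmetrize-killed (suc j) j<n F (suc i) (s≤s i<j) = Up.A.trans (Up.app (S↑.∂E-shift i j i<j j<n) (symmetrize j F))
    (Up.A.trans (Up.fn-cong (S↑.E j) (symmetrize-killed j (ℕP.<⇒≤ j<n) F i i<j)) (Up.fn-0 (S↑.E j)))

  -- The polynomial `F` itself need not be symmetric. Only its image in H ⊗ K is annihilated by the
  -- ∂, and there each `E` acts as the identity.
  symmetrize-≋ : ∀ j → suc j ≤ n → ∀ F → (∀ i → fn (NilHecke.∂ H↓ i) (F [ x ]) ≋ 0′) → symmetrize j F [ x ] ≋ F [ x ]
  symmetrize-≋ zero _ F h = A.refl
  symmetrize-≋ (suc j) j<n F h = A.trans (compat (induces-E j) (symmetrize j F)) (A.trans (E↓-fixes j j<n (symmetrize j F [ x ])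
    (λ i → A.trans (fn-cong (NilHecke.∂ H↓ i) ih) (h i))) ih)
    where
    ih = symmetrize-≋ j (ℕP.<⇒≤ j<n) F h

  ≋⊥⇒≃ : ∀ {f} → f ≋[ Forms.G upForms ] 0′ → f ≃ 0′
  ≋⊥⇒≃ p = go (≋0⁻¹ p)
    where
    go : ∀ {f} → ⟨ Forms.G upForms ⟩ f → f ≃ 0′
    go (nil p) = p
    go (cons h p () i)

  at0 : ∀ {m} → Fin m → PolyHK
  at0 _ = 0′

  κ-coeff : ∀ {m} (f : Poly m) → f [ at0 ] ≃ κ (coeff f 0ᵐ)
  κ-coeff {m} = poly-ind _
    (λ p h → P.trans ([]-cong at0 (P.sym p)) (P.trans h (P.reflexive (cong κ (coeffs p 0ᵐ)))))
    (λ c → P.trans ([]-κ at0 c) (P.reflexive (cong κ (≡.sym (≡.trans (coeff-ext (κ c) 0ᵐ) (≡.trans (ext-κ (δ 0ᵐ) c) (≡.trans (cong (c ℤ.*_) (δ-refl {m})) (ℤP.*-identityʳ c))))))))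
    (λ f g p p′ → P.trans ([]-+ at0 f g) (P.trans (P.+-cong p p′) (P.trans (P.sym (κ-+ _ _)) (P.reflexive (cong κ (≡.sym (coeff-+′ f g 0ᵐ)))))))
    (λ v f _ → P.trans ([]-X* at0 v f) (P.trans (P.zeroˡ _) (P.trans (P.sym κ-0) (P.reflexive (cong κ (≡.sym (coeff-X*-zero v f 0ᵐ (lookup-0ᵐ v))))))))
    where
    δ-refl : ∀ {m} → δ {m} 0ᵐ 0ᵐ ≡ 1ℤ
    δ-refl {m} with 0ᵐ {m} ≟ᵐ 0ᵐ
    ... | yes _ = ≡.refl
    ... | no q = ⊥-elim (q ≡.refl)

  κ-injective : ∀ {a b} → κ {M} a ≃ κ b → a ≡ b
  κ-injective {a} {b} p = ≡.trans (≡.sym (value a)) (≡.trans (ext-resp p (λ _ → 1ℤ)) (value b))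
    where
    value : ∀ a → ext (λ _ → 1ℤ) (κ {M} a) ≡ a
    value a = ≡.trans (ext-κ (λ _ → 1ℤ) a) (ℤP.*-identityʳ a)

  Y-at0 : ∀ t → Y t [ at0 ] ≃ 0′
  Y-at0 zero = P.trans (P.reflexive (cong (_[ at0 ]) Y-0)) ([]-0 at0)
  Y-at0 (suc t) with t ℕ.<? r
  ... | yes p = P.trans (P.reflexive (cong (_[ at0 ]) (≡.sym (X≡var (ιY (fromℕ< p)))))) ([]-X at0 (ιY (fromℕ< p)))
  ... | no p = P.trans (P.reflexive (cong (_[ at0 ]) (≡.sym 0′≡0ₚ))) ([]-0 at0)

  x-at0 : ∀ i → x i [ at0 ] ≃ 0′
  x-at0 i = P.trans (P.reflexive (cong (_[ at0 ]) (x-def i))) (P.trans ([]-+ at0 _ _) (P.trans (P.+-cong (Y-at0 (suc (toℕ i))) (P.trans ([]-neg at0 _) (P.-‿cong (Y-at0 (toℕ i)))))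
    (P.-‿inverseʳ 0′)))

  const-x : ∀ F → F [ x ] [ at0 ] ≃ κ (coeff F 0ᵐ)
  const-x F = P.trans ([]-∘ x at0 F) (P.trans ([]-ext x-at0 F) (κ-coeff F))

  -- Constant terms are well defined on H ⊗ K, because no generator of the ideal has one.
  ideal-at0 : ∀ {f} → ⟨ HKGen ⟩ f → f [ at0 ] ≃ 0′
  ideal-at0 i = go (⟨⟩-[] {G′ = λ _ → ⊥} at0 gens i)
    where
    go : ∀ {m} {f : Poly m} → ⟨ (λ _ → ⊥) ⟩ f → f ≃ 0′
    go (nil p) = p
    go (cons h p () i)
    gens : ∀ {g} → HKGen g → ⟨ (λ _ → ⊥) ⟩ (g [ at0 ])
    gens (inj₁ (p , (_ , p0) , ≡.refl)) = nil (P.trans (P.reflexive (cong (_[ at0 ]) (≡.sym ([]≡substₚ p x)))) (P.trans (const-x p) (P.trans (P.reflexive (cong κ p0)) κ-0)))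
    gens (inj₂ ≡.refl) = nil (P.trans ([]-cong at0 (P.reflexive qprod≡)) (P.trans ([]-* at0 _ _) (P.trans (P.*-congʳ ([]-X at0 (ιq F.zero))) (P.zeroˡ _))))

  ≋-at0 : ∀ {f g} → f ≋ g → f [ at0 ] ≃ g [ at0 ]
  ≋-at0 {f} {g} p = P.trans (P.sym (PS.solve (λ { (a ∷ b ∷ []) → (a ⊖ b) ⊕ b , a }) (f [ at0 ] ∷ g [ at0 ] ∷ []) ≡.refl))
    (P.trans (P.+-congʳ (P.trans (P.sym (P.trans ([]-+ at0 f (-′ g)) (P.+-congˡ ([]-neg at0 g)))) (ideal-at0 (diff p)))) (P.+-identityˡ _))

  module UpDeg = Graded {n} (λ _ → 1ℤ) (λ _ → 0ℤ)

  negative-degree : ∀ {F} → UpDeg.Bd -1ℤ 0ℤ F → F ≃ 0′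
  negative-degree ([] , p , _) = P.trans p (P.reflexive []≡0)
  negative-degree (((c , e) ∷ g) , p , (le , _) ∷ _) = ⊥-elim (ℤP.<⇒≱ (ℤP.<-≤-trans ℤ.-<+ (wdeg-nonneg (λ _ → 1ℤ) (λ _ → ℤ.+≤+ z≤n) e)) le)

  -- If c f = 0 then by induction on the degree all divided differences of f vanish,
  -- so f equals its symmetrization, which has no constant term.
  torsion : ∀ c → c ≢ 0ℤ → ∀ N F → UpDeg.Bd (+ N ℤ.- 1ℤ) 0ℤ F → κ c *′ F [ x ] ≋ 0′ → F [ x ] ≋ 0′
  -- The degree bound is N - 1; for N = 0 it is negative and forces F = 0.
  torsion c c≢0 zero F bd _ = ≃⇒≋ (P.trans ([]-cong x (negative-degree bd)) ([]-0 x))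
  torsion c c≢0 (suc N) F bd h = A.trans (A.sym same) (≋0 (⟨⟩-gen (inj₁ (sF , ∂≃0⇒symmetric killed no-const , []≡substₚ sF x))))
    where
    sF = symmetrize (suc k) F
    ∂F : ∀ {u w} → u ≢ w → Forms.∂ forms u w (F [ x ]) ≋ 0′
    ∂F {u} {w} u≢w = A.trans (≃⇒≋ (∂-natural u w F)) (torsion c c≢0 N (Forms.∂ upForms u w F) bd′
      (A.trans (≃⇒≋ (P.*-congˡ (P.sym (∂-natural u w F)))) (A.trans (≃⇒≋ (P.sym (Divided.∂-κ* _ _ c (F [ x ])))) (A.trans (fn-cong (∂ᵒ u≢w) h) (fn-0 (∂ᵒ u≢w))))))
      where
      bd′ : UpDeg.Bd (+ N ℤ.- 1ℤ) 0ℤ (Forms.∂ upForms u w F)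
      bd′ = UpDeg.Bd-≡ (cong (ℤ._- 1ℤ) (suc-1 N)) ≡.refl (Bd-∂ (λ _ → 1ℤ) (λ _ → 0ℤ) (λ v → kron u v ℤ.- kron w v)
        (UpDeg.Bd-+ (UpDeg.Bd-X u) (UpDeg.Bd-neg (UpDeg.Bd-X w))) (λ _ → inj₂ (≡.refl , ≡.refl)) bd)
        where
        suc-1 : ∀ N → + suc N ℤ.- 1ℤ ≡ + N
        suc-1 N = ≡.refl
    allKilled : ∀ i → fn (NilHecke.∂ H↓ i) (F [ x ]) ≋ 0′
    allKilled i = subst (λ φ → fn φ (F [ x ]) ≋ 0′) (≡.sym (H↓-∂ i)) (∂F (next≢ 2≤n i))
    same : sF [ x ] ≋ F [ x ]
    same = symmetrize-≋ (suc k) ℕP.≤-refl F allKilled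
    killed : ∀ u w → toℕ w ≡ suc (toℕ u) → Forms.∂ upForms u w sF ≃ 0′
    killed u w e = ≋⊥⇒≃ (≡.subst₂ (λ u w → Forms.∂ upForms u w sF ≋[ Forms.G upForms ] 0′) (fin-toℕ u) (≡.trans (cong fin (≡.sym e)) (fin-toℕ w))
      (subst (λ φ → Up.fn φ sF ≋[ Forms.G upForms ] 0′) (H↑-∂ (toℕ u)) (symmetrize-killed (suc k) ℕP.≤-refl F (toℕ u) (ℕP.≤-pred (subst (_< n) e (FP.toℕ<n w))))))
    -- Symmetrizing keeps the class and hence the constant term; `c` times that term is the constant
    -- term of c F[x] ≋ 0, and c ≠ 0.
    no-const : coeff sF 0ᵐ ≡ 0ℤ
    no-const = ≡.trans (κ-injective (P.trans (P.sym (const-x sF)) (P.trans (≋-at0 same) (const-x F))))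
      (cancel (coeff F 0ᵐ) (κ-injective (P.trans (P.reflexive (κ-* c _)) (P.trans (P.*-congˡ (P.sym (const-x F))) (P.trans (P.*-congʳ (P.sym ([]-κ at0 c)))
        (P.trans (P.sym ([]-* at0 (κ c) (F [ x ]))) (P.trans (≋-at0 h) (P.trans ([]-0 at0) (P.sym κ-0)))))))))
      where
      cancel : ∀ a → c ℤ.* a ≡ 0ℤ → a ≡ 0ℤ
      cancel a p = [ (λ q → ⊥-elim (c≢0 q)) , (λ q → q) ]′ (ℤP.i*j≡0⇒i≡0∨j≡0 c p)

  -- A preimage of Y_t under X_k ↦ x_k, by which each class of H becomes the value at x of a
  -- polynomial in n variables, as `torsion` requires.
  lift : ℕ → Poly n
  lift zero = 0′
  lift (suc t) = X (fin t) +′ lift t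

  lift-x : ∀ t → t ≤ n → lift t [ x ] ≃ Y t
  lift-x zero _ = P.trans ([]-0 x) (P.reflexive (≡.sym Y-0))
  lift-x (suc t) t<n = P.trans ([]-+ x _ _) (P.trans (P.+-cong ([]-X x (fin t)) (lift-x t (ℕP.<⇒≤ t<n)))
    (subst (λ s → x (fin s) +′ Y s ≃ Y (suc s)) (FP.toℕ-fromℕ< t<n)
      (P.trans (P.+-congʳ (P.reflexive (cong x (fin-toℕ (fromℕ< t<n))))) (P.sym (Y-step (fromℕ< t<n))))))

  torsion-free : ∀ c → c ≢ 0ℤ → ∀ h → κ c *′ h ≋H 0′ → h ≋H 0′
  torsion-free c c≢0 h p = AH.trans (≃⇒≋ (P.sym (z0-embed h))) (AH.trans (z0-≋ (A.trans (≃⇒≋ (P.sym F-x)) (torsion c c≢0 (suc N) F bd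
    (A.trans (≃⇒≋ (P.*-congˡ F-x)) (A.trans (≃⇒≋ (P.sym (P.trans ([]-* _ (κ c) h) (P.*-congʳ ([]-κ _ c))))) (A.trans (embed-≋ p) (≃⇒≋ ([]-0 _)))))))) (≃⇒≋ ([]-0 z0)))
    where
    F : Poly n
    F = h [ (λ i → lift (suc (toℕ i))) ]
    F-x : F [ x ] ≃ embed h
    F-x = P.trans ([]-∘ _ x h) ([]-ext (λ i → P.trans (lift-x (suc (toℕ i)) (ℕP.m≤n⇒m≤1+n (FP.toℕ<n i))) (P.reflexive (Y-ι i))) h)
    bounds = bounded (λ _ → 1ℤ) F
    N = proj₁ bounds
    bd : UpDeg.Bd (+ suc N ℤ.- 1ℤ) 0ℤ F
    bd = F , P.refl , All.map (λ {t} q → q , wdeg-zero-weight (proj₂ t)) (proj₂ bounds)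

-- Translation between the stated properties and the ring operations

weighted-sum : ∀ {m} c (v : Vec ℕ m) → + V.foldr (λ _ → ℕ) (λ a acc → c ℕ.* a ℕ.+ acc) 0 v ≡ wdeg (λ _ → + c) v
weighted-sum c [] = ≡.refl
weighted-sum c (a ∷ v) = ≡.trans (ℤP.pos-+ (c ℕ.* a) _) (cong₂ ℤ._+_ (≡.trans (cong +_ (ℕP.*-comm c a)) (ℤP.pos-* a c)) (weighted-sum c v))

All-coeff : ∀ {m} {Pr : Mon m → Set} (f : Poly m) → All (λ t → Pr (proj₂ t)) f → ∀ e → (coeff f e ≡ 0ℤ → ⊥) → Pr e
All-coeff [] [] e p = ⊥-elim (p ≡.refl)
All-coeff ((c , e′) ∷ f) (h ∷ hs) e p with e′ ≟ᵐ e
... | yes ≡.refl = h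
... | no _ = All-coeff f hs e p

keep : ∀ {m} (Pr : Mon m → Set) → (∀ e → Dec (Pr e)) → Poly m → Poly m
keep Pr dec [] = []
keep Pr dec ((c , e) ∷ f) with dec e
... | yes _ = (c , e) ∷ keep Pr dec f
... | no _ = keep Pr dec f

keep-all : ∀ {m} (Pr : Mon m → Set) dec (f : Poly m) → All (λ t → Pr (proj₂ t)) (keep Pr dec f)
keep-all Pr dec [] = []
keep-all Pr dec ((c , e) ∷ f) with dec e
... | yes p = p ∷ keep-all Pr dec f
... | no _ = keep-all Pr dec f

keep-coeff : ∀ {m} (Pr : Mon m → Set) dec (f : Poly m) e → Pr e → coeff (keep Pr dec f) e ≡ coeff f e
keep-coeff Pr dec [] e p = ≡.refl
keep-coeff Pr dec ((c , e′) ∷ f) e p with dec e′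
keep-coeff Pr dec ((c , e′) ∷ f) e p | yes _ with e′ ≟ᵐ e
... | yes _ = cong (ℤ._+_ c) (keep-coeff Pr dec f e p)
... | no _ = keep-coeff Pr dec f e p
keep-coeff Pr dec ((c , e′) ∷ f) e p | no q with e′ ≟ᵐ e
... | yes ≡.refl = ⊥-elim (q p)
... | no _ = keep-coeff Pr dec f e p

keep-≃ : ∀ {m} (Pr : Mon m → Set) dec (f : Poly m) → (∀ e → (coeff f e ≡ 0ℤ → ⊥) → Pr e) → f ≃ keep Pr dec f
keep-≃ Pr dec f h = mk≃ eq
  where
  eq : ∀ e → coeff f e ≡ coeff (keep Pr dec f) e
  eq e with dec e | coeff f e ℤ.≟ 0ℤ | coeff (keep Pr dec f) e ℤ.≟ 0ℤ
  ... | yes p | _ | _ = ≡.sym (keep-coeff Pr dec f e p)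
  ... | no q | no z | _ = ⊥-elim (q (h e z))
  ... | no q | yes z | yes z′ = ≡.trans z (≡.sym z′)
  ... | no q | yes _ | no z′ = ⊥-elim (q (All-coeff (keep Pr dec f) (keep-all Pr dec f) e z′))

module Uniqueness (k : ℕ) where
  open TorsionFree k public

  degMon-wdeg : ∀ e → + degMon e ≡ wdeg Deg.w e
  degMon-wdeg e = ≡.trans (ℤP.pos-+ (V.foldr (λ _ → ℕ) (λ a acc → 2 ℕ.* a ℕ.+ acc) 0 (take r e)) _)
    (≡.trans (cong₂ ℤ._+_ (≡.trans (weighted-sum 2 (take r e)) (wdeg-cong (λ i → ≡.sym (weight-Y (+ 2) (+ 4) i)) (take r e)))
      (≡.trans (weighted-sum 4 (drop r e)) (wdeg-cong (λ j → ≡.sym (weight-q (+ 2) (+ 4) j)) (drop r e))))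
    (≡.trans (≡.sym (wdeg-++ r Deg.w (take r e) (drop r e))) (cong (wdeg Deg.w) (VP.take++drop≡id r e))))

  IsHomogeneous⇒Hom : ∀ {f s} → IsHomogeneous f s → Hom (+ s) f
  IsHomogeneous⇒Hom {f} {s} (g , e , h) = g′ , ≈⇒≋ e , proj₁ bounds , g″ ,
    keep-≃ Pr dec g h , go g″ (keep-all Pr dec g) (proj₂ bounds)
    where
    g′ = g
    Pr : Mon M → Set
    Pr e = degMon e ≡ s
    dec : ∀ e → Dec (Pr e)
    dec e = degMon e ℕ.≟ s
    g″ = keep Pr dec g
    bounds = bounded yw g″
    go : ∀ l → All (λ t → Pr (proj₂ t)) l → All (λ t → wdeg yw (proj₂ t) ℤ.≤ + proj₁ bounds) l → All (Deg.Ok (+ proj₁ bounds) (+ s)) l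
    go [] [] [] = []
    go ((c , e) ∷ l) (p ∷ ps) (q ∷ qs) = (q , ≡.trans (≡.sym (degMon-wdeg e)) (cong +_ p)) ∷ go l ps qs

  Hom⇒IsHomogeneous : ∀ {f s} → Hom (+ s) f → IsHomogeneous f s
  Hom⇒IsHomogeneous {f} {s} (g , e , N , h , q , a) = h , ≋⇒≈ (A.trans e (≃⇒≋ q)) ,
    All-coeff {Pr = λ e → degMon e ≡ s} h (All.map (λ {t} o → ℤP.+-injective (≡.trans (degMon-wdeg (proj₂ t)) (proj₂ o))) a)

  -- Each q has degree 4, so none can occur below that degree.
  low-degree : ∀ {f s} → s < 4 → IsHomogeneous f s → Σ PolyH λ h → f ≋ embed h
  low-degree {f} {s} s<4 (g , e , h) = go (flat {+ N} (g″ , keep-≃ Pr dec g h , ok g″ (keep-all Pr dec g) (proj₂ bounds)))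
    where
    Pr : Mon M → Set
    Pr e = degMon e ≡ s
    dec : ∀ e → Dec (Pr e)
    dec e = degMon e ℕ.≟ s
    g″ = keep Pr dec g
    bounds = bounded yw g″
    N = proj₁ bounds
    go : (Σ PolyH λ h → g ≃ embed h) → Σ PolyH λ h → f ≋ embed h
    go (h , p) = h , A.trans (≈⇒≋ e) (≃⇒≋ p)
    qdeg0 : ∀ e → degMon e ≡ s → wdeg QDeg.w e ≡ 0ℤ
    qdeg0 e p = ≡.trans (cong (wdeg QDeg.w) (≡.sym (VP.take++drop≡id r e))) (≡.trans (wdeg-++ r QDeg.w (take r e) (drop r e))
      (≡.trans (cong₂ ℤ._+_ (≡.trans (wdeg-cong (weight-Y 0ℤ 1ℤ) (take r e)) (wdeg-zero-weight (take r e)))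
        (≡.trans (wdeg-cong (weight-q 0ℤ 1ℤ) (drop r e)) (≡.trans (wdeg-one-weight (drop r e)) (cong +_ (small (V.sum (drop r e)) le))))) ≡.refl))
      where
      sumQ = V.foldr (λ _ → ℕ) (λ a acc → 4 ℕ.* a ℕ.+ acc) 0 (drop r e)
      sumQ≡ : ∀ {m} (v : Vec ℕ m) → V.foldr (λ _ → ℕ) (λ a acc → 4 ℕ.* a ℕ.+ acc) 0 v ≡ 4 ℕ.* V.sum v
      sumQ≡ [] = ≡.refl
      sumQ≡ (a ∷ v) = ≡.trans (cong (4 ℕ.* a ℕ.+_) (sumQ≡ v)) (≡.sym (ℕP.*-distribˡ-+ 4 a (V.sum v)))
      le : 4 ℕ.* V.sum (drop r e) < 4
      le = ℕP.≤-<-trans (ℕP.≤-trans (ℕP.≤-reflexive (≡.sym (sumQ≡ (drop r e)))) (ℕP.m≤n+m sumQ _)) (subst (_< 4) (≡.sym p) s<4)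
      small : ∀ s → 4 ℕ.* s < 4 → s ≡ 0
      small zero _ = ≡.refl
      small (suc s) q = ⊥-elim (ℕP.<⇒≱ q (ℕP.m≤m*n 4 (suc s)))
    ok : ∀ l → All (λ t → Pr (proj₂ t)) l → All (λ t → wdeg yw (proj₂ t) ℤ.≤ + N) l → All (QDeg.Ok (+ N) 0ℤ) l
    ok [] [] [] = []
    ok ((c , e) ∷ l) (p ∷ ps) (q ∷ qs) = (q , qdeg0 e p) ∷ ok l ps qs

  -- the properties (i)–(vii) in terms of the ring operations of H ⊗ K
  record Laws (_∗_ : PolyHK → PolyHK → PolyHK) : Set where
    field
      ∗-cong : ∀ {a a′ b b′} → a ≋ a′ → b ≋ b′ → a ∗ b ≋ a′ ∗ b′
      ∗-+ˡ : ∀ a b c → (a +′ b) ∗ c ≋ (a ∗ c) +′ (b ∗ c)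
      ∗-+ʳ : ∀ a b c → a ∗ (b +′ c) ≋ (a ∗ b) +′ (a ∗ c)
      ∗-Kˡ : ∀ k a b → (k [ q ] *′ a) ∗ b ≋ k [ q ] *′ (a ∗ b)
      ∗-Kʳ : ∀ k a b → a ∗ (k [ q ] *′ b) ≋ k [ q ] *′ (a ∗ b)
      ∗-graded : ∀ a b s t → IsHomogeneous a s → IsHomogeneous b t → IsHomogeneous (a ∗ b) (s ℕ.+ t)
      ∗-z0 : ∀ a b → (embed a ∗ embed b) [ z0 ] ≋H a *′ b
      ∗-comm : ∀ a b → a ∗ b ≋ b ∗ a
      ∗-assoc : ∀ a b c → (a ∗ b) ∗ c ≋ a ∗ (b ∗ c)
      ∗-relation : pairSum (λ i j → x i ∗ x j) +′ PSum.sum q ≋ 0′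
      ∗-coefficients : ∀ d → anyZero d ≡ true → ∀ a (i j : Fin r) →
        κ (height d (suc (toℕ i))) *′ slice d (Y (suc (toℕ j)) ∗ embed a) ≋H κ (height d (suc (toℕ j))) *′ slice d (Y (suc (toℕ i)) ∗ embed a)

  Y-y : ∀ i → Y (suc (toℕ i)) ≡ y i
  Y-y i = ≡.trans (Y-ι i) (X≡var (ιY i))

  embK-* : ∀ k a → embK k *ₚ a ≡ k [ q ] *′ a
  embK-* k a = ≡.trans (≡.sym (*′≡*ₚ (embK k) a)) (cong (_*′ a) (embK≡ k))

  module _ (_∗_ : PolyHK → PolyHK → PolyHK) (d : Mon n) (a : PolyH) (i j : Fin r) where

    weighted : PolyH
    weighted = ((+ at d (toℕ i)) ℤ.- (+ at d (n ∸ 1))) ·ₚ coeffQ d (y j ∗ embH a)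

    weighted-* : weighted ≡ κ (height d (suc (toℕ i))) *′ coeffQ d (y j ∗ embH a)
    weighted-* = ≡.trans (≡.sym (*′≡*ₚ (constₚ (height d (suc (toℕ i)))) (coeffQ d (y j ∗ embH a))))
      (cong (_*′ coeffQ d (y j ∗ embH a)) (≡.sym (κ≡constₚ (height d (suc (toℕ i))))))

    weighted-slice : anyZero d ≡ true → weighted ≡ κ (height d (suc (toℕ i))) *′ slice d (Y (suc (toℕ j)) ∗ embed a)
    weighted-slice z = ≡.trans weighted-* (cong (κ (height d (suc (toℕ i))) *′_) (≡.trans (coeffQ-yes d z (y j ∗ embH a))
      (cong₂ (λ u v → slice d (u ∗ v)) (≡.sym (Y-y j)) (embH≡embed a))))

    weighted-0 : anyZero d ≡ false → weighted ≋H 0′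
    weighted-0 z = AH.trans (≃⇒≋ (P.reflexive (≡.trans weighted-* (cong (κ (height d (suc (toℕ i))) *′_) (≡.trans (coeffQ-no d z (y j ∗ embH a)) []≡0))))) (AH.zeroʳ (κ (height d (suc (toℕ i)))))

  toLaws : ∀ {_∗_} → IsQuantumProduct _∗_ → Laws _∗_
  toLaws {_∗_} h = record
    { ∗-cong = λ {a} {a′} {b} {b′} p p′ → ≈⇒≋ (well-defined a a′ b b′ (≋⇒≈ p) (≋⇒≈ p′))
    ; ∗-+ˡ = λ a b c → ≡.subst₂ (λ u v → u ∗ c ≋ v) (≡.sym (+′≡+ₚ a b)) (≡.sym (+′≡+ₚ _ _)) (≈⇒≋ (additiveˡ a b c))
    ; ∗-+ʳ = λ a b c → ≡.subst₂ (λ u v → a ∗ u ≋ v) (≡.sym (+′≡+ₚ b c)) (≡.sym (+′≡+ₚ _ _)) (≈⇒≋ (additiveʳ a b c))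
    ; ∗-Kˡ = λ k a b → ≡.subst₂ (λ u v → u ∗ b ≋ v) (embK-* k a) (embK-* k (a ∗ b)) (≈⇒≋ (K-linearˡ k a b))
    ; ∗-Kʳ = λ k a b → ≡.subst₂ (λ u v → a ∗ u ≋ v) (embK-* k b) (embK-* k (a ∗ b)) (≈⇒≋ (K-linearʳ k a b))
    ; ∗-graded = graded
    ; ∗-z0 = λ a b → ≡.subst₂ _≋H_ (≡.trans (q↦0≡ _) (cong₂ (λ u v → (u ∗ v) [ z0 ]) (embH≡embed a) (embH≡embed b))) (≡.sym (*′≡*ₚ a b)) (≈H⇒≋ (deformation a b))
    ; ∗-comm = λ a b → ≈⇒≋ (comm a b)
    ; ∗-assoc = λ a b c → ≈⇒≋ (assoc a b c)
    ; ∗-relation = A.trans (A.sym (≃⇒≋ (relation-sum _∗_))) (subst (relationLHS _∗_ ≋_) (≡.sym 0′≡0ₚ) (≈⇒≋ {relationLHS _∗_} {0ₚ} relation))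
    ; ∗-coefficients = λ d z a i j → ≡.subst₂ _≋H_ (weighted-slice _∗_ d a i j z) (weighted-slice _∗_ d a j i z) (≈H⇒≋ (coefficients d a i j))
    }
    where
    open IsQuantumProduct h

  fromLaws : ∀ {_∗_} → Laws _∗_ → IsQuantumProduct _∗_
  fromLaws {_∗_} h = record
    { well-defined = λ a a′ b b′ p p′ → ≋⇒≈ (∗-cong (≈⇒≋ p) (≈⇒≋ p′))
    ; additiveˡ = λ a b c → ≋⇒≈ (≡.subst₂ (λ u v → u ∗ c ≋ v) (+′≡+ₚ a b) (+′≡+ₚ _ _) (∗-+ˡ a b c))
    ; additiveʳ = λ a b c → ≋⇒≈ (≡.subst₂ (λ u v → a ∗ u ≋ v) (+′≡+ₚ b c) (+′≡+ₚ _ _) (∗-+ʳ a b c))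
    ; K-linearˡ = λ k a b → ≋⇒≈ (≡.subst₂ (λ u v → u ∗ b ≋ v) (≡.sym (embK-* k a)) (≡.sym (embK-* k (a ∗ b))) (∗-Kˡ k a b))
    ; K-linearʳ = λ k a b → ≋⇒≈ (≡.subst₂ (λ u v → a ∗ u ≋ v) (≡.sym (embK-* k b)) (≡.sym (embK-* k (a ∗ b))) (∗-Kʳ k a b))
    ; graded = ∗-graded
    ; deformation = λ a b → ≋⇒≈H (≡.subst₂ _≋H_ (≡.sym (≡.trans (q↦0≡ _) (cong₂ (λ u v → (u ∗ v) [ z0 ]) (embH≡embed a) (embH≡embed b)))) (*′≡*ₚ a b) (∗-z0 a b))
    ; comm = λ a b → ≋⇒≈ (∗-comm a b)
    ; assoc = λ a b c → ≋⇒≈ (∗-assoc a b c)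
    ; relation = ≋⇒≈ {relationLHS _∗_} {0ₚ} (subst (relationLHS _∗_ ≋_) 0′≡0ₚ (A.trans (≃⇒≋ (relation-sum _∗_)) ∗-relation))
    ; coefficients = coefficients′
    }
    where
    open Laws h
    coefficients′ : ∀ d a i j → weighted _∗_ d a i j ≈H weighted _∗_ d a j i
    coefficients′ d a i j = ≋⇒≈H (split (anyZero d) ≡.refl)
      where
      split : ∀ b → anyZero d ≡ b → weighted _∗_ d a i j ≋H weighted _∗_ d a j i
      split true z = ≡.subst₂ _≋H_ (≡.sym (weighted-slice _∗_ d a i j z)) (≡.sym (weighted-slice _∗_ d a j i z)) (∗-coefficients d z a i j)
      split false z = AH.trans (weighted-0 _∗_ d a i j z) (AH.sym (weighted-0 _∗_ d a j i z))

  ⋆-laws : Laws _⋆_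
  ⋆-laws = record
    { ∗-cong = λ {a} {a′} {b} p p′ → A.trans (⋆-congˡ p b) (⋆-congʳ a′ p′)
    ; ∗-+ˡ = ⋆-+ˡ
    ; ∗-+ʳ = ⋆-+ʳ
    ; ∗-Kˡ = λ k a b → A.trans (⋆-comm _ b) (A.trans (fn-K (Multiplier.op (mult b)) k a) (A.*-congˡ (⋆-comm b a)))
    ; ∗-Kʳ = λ k a b → fn-K (Multiplier.op (mult a)) k b
    ; ∗-graded = λ a b s t ha hb → Hom⇒IsHomogeneous (Hom-≡ (≡.sym (ℤP.pos-+ s t)) (⋆-Hom (IsHomogeneous⇒Hom ha) (IsHomogeneous⇒Hom hb)))
    ; ∗-z0 = λ a b → AH.trans (⋆-z0 (embed a) (embed b)) (≃⇒≋ (P.*-cong (z0-embed a) (z0-embed b)))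
    ; ∗-comm = ⋆-comm
    ; ∗-assoc = ⋆-assoc
    ; ∗-relation = ⋆-relation
    ; ∗-coefficients = λ d z a i j → ⋆-coefficients d z a (suc (toℕ i)) (suc (toℕ j)) (ℕP.m≤n⇒m≤1+n (FP.toℕ<n i)) (ℕP.m≤n⇒m≤1+n (FP.toℕ<n j))
    }

-- Uniqueness: an arbitrary product with the seven properties against ⋆

sumSquares : ∀ {m l} (u : Fin l → ℤ) → Σ ℕ λ s → PSum.sum (λ i → κ {m} (u i) *′ κ (u i)) ≃ κ (+ s) × (s ≡ 0 → ∀ i → u i ≡ 0ℤ)
sumSquares {l = zero} u = 0 , P.sym κ-0 , λ _ ()
sumSquares {l = suc l} u with sumSquares (u ∘ F.suc)
... | s , p , h = a ℕ.* a ℕ.+ s ,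
    P.trans (P.+-cong (P.reflexive (≡.trans (≡.sym (κ-* (u F.zero) (u F.zero))) (cong κ (square (u F.zero))))) p) (P.sym (P.trans (P.reflexive (cong κ (ℤP.pos-+ (a ℕ.* a) s))) (κ-+ (+ (a ℕ.* a)) (+ s)))) ,
    λ e → λ { F.zero → ℤP.∣i∣≡0⇒i≡0 ([ (λ z → z) , (λ z → z) ]′ (ℕP.m*n≡0⇒m≡0∨n≡0 a (ℕP.m+n≡0⇒m≡0 (a ℕ.* a) e)))
            ; (F.suc i) → h (ℕP.m+n≡0⇒n≡0 (a ℕ.* a) e) i }
  where
  a = ℤ.∣ u F.zero ∣
  square : ∀ z → z ℤ.* z ≡ + (ℤ.∣ z ∣ ℕ.* ℤ.∣ z ∣)
  square (+ n) = ≡.sym (ℤP.pos-* n n)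
  square (-[1+ n ]) = ≡.refl

module Compare (k : ℕ) (_∗_ : Flag.PolyHK (suc (suc k)) → Flag.PolyHK (suc (suc k)) → Flag.PolyHK (suc (suc k)))
               (laws : Uniqueness.Laws k _∗_) where
  open Uniqueness k public
  open Laws laws

  ∗-congʳ : ∀ a {b b′} → b ≋ b′ → a ∗ b ≋ a ∗ b′
  ∗-congʳ a = ∗-cong A.refl

  ∗-congˡ : ∀ {a a′} b → a ≋ a′ → a ∗ b ≋ a′ ∗ b
  ∗-congˡ b p = ∗-cong p A.refl

  ∗-s : ∀ j a b → a ∗ ([ κ , q ]′ j *′ b) ≋ [ κ , q ]′ j *′ (a ∗ b)
  ∗-s (inj₁ c) a b = A.trans (∗-congʳ a (≃⇒≋ (P.*-congʳ (P.sym ([]-κ q c))))) (A.trans (∗-Kʳ (κ c) a b) (≃⇒≋ (P.*-congʳ ([]-κ q c))))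
  ∗-s (inj₂ j) a b = A.trans (∗-congʳ a (≃⇒≋ (P.*-congʳ (P.sym ([]-X q j))))) (A.trans (∗-Kʳ (X j) a b) (≃⇒≋ (P.*-congʳ ([]-X q j))))

  times : PolyHK → Op
  fn (times a) b = a ∗ b
  fn-cong (times a) = ∗-congʳ a
  fn-+ (times a) b c = ∗-+ʳ a b c
  fn-lin (times a) j b = ∗-s j a b

  Δ : Fin n → Op
  Δ i = times (x i) O.- 𝒳 i

  homogeneous-1 : IsHomogeneous 1′ 0
  homogeneous-1 = Hom⇒IsHomogeneous (1′ , A.refl , 0 , Deg.Bd-1)

  homogeneous-x : ∀ i → IsHomogeneous (x i) 2
  homogeneous-x i = Hom⇒IsHomogeneous (x i , A.refl , 1 , Deg.Bd-x i)

  embed-1 : embed 1′ ≃ 1′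
  embed-1 = []-1 _

  -- Below degree 4 the product has no room for a q, so its value at q = 0 is the whole value. This
  -- gives 1 ∗ 1 = 1 and x i ∗ 1 = x i although no unit is postulated.
  classical-value : ∀ {a b s t} → s ℕ.+ t < 4 → ∀ a′ b′ → embed a′ ≋ a → embed b′ ≋ b → IsHomogeneous a s → IsHomogeneous b t → a ∗ b ≋ embed (a′ *′ b′)
  classical-value {a} {b} {s} {t} lt a′ b′ ea eb ha hb = go (low-degree lt (∗-graded a b s t ha hb))
    where
    go : (Σ PolyH λ h → a ∗ b ≋ embed h) → a ∗ b ≋ embed (a′ *′ b′)
    go (h , p) = A.trans p (embed-≋ (AH.trans (≃⇒≋ (P.sym (z0-embed h))) (AH.trans (z0-≋ (A.trans (A.sym p) (∗-cong (A.sym ea) (A.sym eb)))) (∗-z0 a′ b′))))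

  1∗1 : 1′ ∗ 1′ ≋ 1′
  1∗1 = A.trans (classical-value (s≤s z≤n) 1′ 1′ (≃⇒≋ embed-1) (≃⇒≋ embed-1) homogeneous-1 homogeneous-1) (≃⇒≋ (P.trans ([]-cong _ (P.*-identityˡ 1′)) embed-1))

  x∗1 : ∀ i → x i ∗ 1′ ≋ x i
  x∗1 i = A.trans (classical-value (s≤s (s≤s (s≤s z≤n))) (xH i) 1′ (≃⇒≋ (embed-x i)) (≃⇒≋ embed-1) (homogeneous-x i) homogeneous-1)
    (≃⇒≋ (P.trans ([]-cong _ (P.*-identityʳ (xH i))) (embed-x i)))

  Δ-1 : ∀ i → fn (Δ i) 1′ ≋ 0′
  Δ-1 i = A.trans (A.+-cong (x∗1 i) (A.-‿cong (𝒳-1 i))) (A.-‿inverseʳ (x i))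

  slice-0-z0 : ∀ f → slice 0ᵐ f ≃ f [ z0 ]
  slice-0-z0 = poly-ind (λ f → slice 0ᵐ f ≃ f [ z0 ])
    (λ p h → P.trans (slice-cong 0ᵐ (P.sym p)) (P.trans h ([]-cong z0 p)))
    (λ c → P.trans (slice-cong 0ᵐ (P.sym (P.trans (P.*-congˡ qmon-0) (P.trans (P.*-identityʳ _) ([]-κ _ c))))) (P.trans (slice-qmon-≡ 0ᵐ (κ c)) (P.sym ([]-κ z0 c))))
    (λ f g p p′ → P.trans (slice-+ 0ᵐ f g) (P.trans (P.+-cong p p′) (P.sym ([]-+ z0 f g))))
    (λ v f p → var-cases (λ v → slice 0ᵐ (X v *′ f) ≃ (X v *′ f) [ z0 ])
      (λ i → P.trans (slice-Xˡ 0ᵐ i f) (P.trans (P.*-congˡ p) (P.sym (P.trans ([]-X* z0 (ιY i) f) (P.*-congʳ (P.reflexive (z0-Y i)))))))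
      (λ j → P.trans (slice-Xʳ-zero 0ᵐ j f (lookup-0ᵐ j)) (P.sym (P.trans ([]-X* z0 (ιq j) f) (P.trans (P.*-congʳ (P.reflexive (z0-q j))) (P.zeroˡ _))))) v)

  -- The main step: if Δ i f = 0 and Δ i annihilates the quantum corrections of x j ∗ f for all
  -- i and j, then E i j = Δ i (x j f) vanishes.
  module Step (a : PolyH) (Δf : ∀ i → fn (Δ i) (embed a) ≋ 0′) (Δl : ∀ i j → fn (Δ i) (fn (Lower j) (embed a)) ≋ 0′) where

    f : PolyHK
    f = embed a

    E : Fin n → Fin n → PolyHK
    E i j = x i ∗ (x j ∗ f) -′ fn (𝒳 i) (fn (𝒳 j) f)

    x∗f : ∀ i → x i ∗ f ≋ fn (𝒳 i) f
    x∗f i = Combination.-≈0⇒≈ (CommutativeRing.ring A) (Δf i)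

    -- Adding `Lower j f`, on which `Δ i` vanishes, turns x j f into `𝒳 j` f, and this equals x j ∗
    -- f by `x∗f`.
    Δ-x : ∀ i j → fn (Δ i) (x j *′ f) ≋ E i j
    Δ-x i j = A.trans (A.sym (A.+-identityʳ _)) (A.trans (A.+-congˡ (A.sym (Δl i j))) (A.trans (A.sym (fn-+ (Δ i) _ _))
      (A.trans (fn-cong (Δ i) (≃⇒≋ (P.reflexive (≡.sym (𝒳-fn j f))))) (A.+-congʳ (∗-congʳ (x i) (A.sym (x∗f j)))))))

    E-sym : ∀ i j → E i j ≋ E j i
    E-sym i j = A.+-cong (A.trans (A.sym (∗-assoc (x i) (x j) f)) (A.trans (∗-congˡ f (∗-comm (x i) (x j))) (∗-assoc (x j) (x i) f)))
      (A.-‿cong (app (𝒳-comm i j) f))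

    pick-op : ∀ (φ : PolyHK → PolyHK) → φ 0′ ≋ 0′ → ∀ b g → φ (pick b g) ≋ pick b (φ g)
    pick-op φ φ0 true g = A.refl
    pick-op φ φ0 false g = φ0

    op-sum : ∀ φ {l} (g : Fin l → PolyHK) → fn φ (PSum.sum g) ≋ PSum.sum (λ i → fn φ (g i))
    op-sum φ {zero} g = fn-0 φ
    op-sum φ {suc l} g = A.trans (fn-+ φ _ _) (A.+-congˡ (op-sum φ (g ∘ F.suc)))

    op-pairSum : ∀ φ (F : Fin n → Fin n → PolyHK) → fn φ (pairSum F) ≋ pairSum (λ i j → fn φ (F i j))
    op-pairSum φ F = A.trans (op-sum φ (λ i → PSum.sum (λ j → pick (lt i j) (F i j)))) (ASum.sum-cong {f = λ i → fn φ (PSum.sum (λ j → pick (lt i j) (F i j)))}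
      {λ i → PSum.sum (λ j → pick (lt i j) (fn φ (F i j)))} λ i → A.trans (op-sum φ (λ j → pick (lt i j) (F i j)))
        (ASum.sum-cong {f = λ j → fn φ (pick (lt i j) (F i j))} {λ j → pick (lt i j) (fn φ (F i j))} λ j → pick-op (fn φ) (fn-0 φ) (lt i j) (F i j)))

    pairSum-≋ : ∀ {F G : Fin n → Fin n → PolyHK} → (∀ i j → F i j ≋ G i j) → pairSum F ≋ pairSum G
    pairSum-≋ {F} {G} h = ASum.sum-cong {f = λ i → PSum.sum (λ j → pick (lt i j) (F i j))} {λ i → PSum.sum (λ j → pick (lt i j) (G i j))}
      λ i → ASum.sum-cong {f = λ j → pick (lt i j) (F i j)} {λ j → pick (lt i j) (G i j)} λ j → pick-≋ (lt i j) (h i j)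

    pairSum-+ : ∀ {m} (F G : Fin n → Fin n → Poly m) → pairSum (λ i j → F i j +′ G i j) ≃ pairSum F +′ pairSum G
    pairSum-+ F G = P.trans (PSum.sum-cong λ i → P.trans (PSum.sum-cong λ j → pick-+ (lt i j) (F i j) (G i j)) (PSum.∑-distrib-+ (λ j → pick (lt i j) (F i j)) (λ j → pick (lt i j) (G i j))))
      (PSum.∑-distrib-+ (λ i → PSum.sum (λ j → pick (lt i j) (F i j))) (λ i → PSum.sum (λ j → pick (lt i j) (G i j))))

    pairSum-neg : ∀ {m} (F : Fin n → Fin n → Poly m) → pairSum (λ i j → -′ F i j) ≃ -′ pairSum F
    pairSum-neg F = P.sym (P.trans (PSum.sum-neg (λ i → PSum.sum (λ j → pick (lt i j) (F i j)))) (PSum.sum-cong λ i →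
      P.trans (PSum.sum-neg (λ j → pick (lt i j) (F i j))) (PSum.sum-cong λ j → pick-neg (lt i j) (F i j))))
      where
      pick-neg : ∀ {m} b (g : Poly m) → -′ pick b g ≃ pick b (-′ g)
      pick-neg true g = P.refl
      pick-neg false g = PP.-0#≈0#

    -- relation (vi) multiplied by f
    relation-f : ∀ (_·_ : PolyHK → PolyHK → PolyHK) (Lw : Laws _·_) → pairSum (λ i j → x i · (x j · f)) ≋ -′ (PSum.sum q *′ (1′ · f))
    relation-f _·_ Lw = A.trans (pairSum-≋ (λ i j → A.sym (W.∗-assoc (x i) (x j) f))) (A.trans (A.sym (op-pairSum by-f (λ i j → x i · x j)))
      (A.trans (W.∗-cong (A.trans (A.sym (A.+-identityʳ _)) (A.trans (A.+-congˡ (A.sym (A.-‿inverseʳ (PSum.sum q)))) (A.trans (A.sym (A.+-assoc _ _ _))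
        (A.trans (A.+-congʳ W.∗-relation) (A.+-identityˡ _))))) A.refl) (A.trans (fn-neg by-f (PSum.sum q)) (A.-‿cong sum-q))))
      where
      module W = Laws Lw
      by-f : Op
      fn by-f g = g · f
      fn-cong by-f p = W.∗-cong p A.refl
      fn-+ by-f g h = W.∗-+ˡ g h f
      fn-lin by-f (inj₁ c) g = A.trans (W.∗-cong (≃⇒≋ (P.*-congʳ (P.sym ([]-κ q c)))) A.refl) (A.trans (W.∗-Kˡ (κ c) g f) (≃⇒≋ (P.*-congʳ ([]-κ q c))))
      fn-lin by-f (inj₂ j) g = A.trans (W.∗-cong (≃⇒≋ (P.*-congʳ (P.sym ([]-X q j)))) A.refl) (A.trans (W.∗-Kˡ (X j) g f) (≃⇒≋ (P.*-congʳ ([]-X q j))))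
      sum-q : PSum.sum q · f ≋ PSum.sum q *′ (1′ · f)
      sum-q = A.trans (op-sum by-f q) (A.trans (ASum.sum-cong {f = λ j → q j · f} {λ j → q j *′ (1′ · f)} λ j →
        A.trans (W.∗-cong (A.sym (A.*-identityʳ (q j))) A.refl) (fn-lin by-f (inj₂ j) 1′)) (≃⇒≋ (P.sym (PSum.sum-*ʳ (1′ · f) q))))

    -- Relation (vi), multiplied by f, gives -Σ q times 1 ∗ f for one product and times 1 ⋆ f for
    -- the other; the hypothesis identifies them.
    pairSum-E : 1′ ∗ f ≋ f → pairSum E ≋ 0′
    pairSum-E h = A.trans (≃⇒≋ (pairSum-+ (λ i j → x i ∗ (x j ∗ f)) (λ i j → -′ fn (𝒳 i) (fn (𝒳 j) f)))) (A.trans (A.+-cong (relation-f _∗_ laws)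
      (A.trans (≃⇒≋ (pairSum-neg (λ i j → fn (𝒳 i) (fn (𝒳 j) f)))) (A.-‿cong (A.trans (pairSum-≋ (λ i j → A.trans (fn-cong (𝒳 i) (A.sym (x⋆ j f))) (A.sym (x⋆ i (x j ⋆ f)))))
        (relation-f _⋆_ ⋆-laws))))) (A.trans (A.+-cong (A.-‿cong (A.*-congˡ h)) (A.-‿cong (A.-‿cong (A.*-congˡ (1⋆ f))))) (A.-‿inverseʳ _)))

    module _ (E-sum : pairSum E ≋ 0′) (d : Mon n) (z : anyZero d ≡ true) where

      u : Fin n → ℤ
      u m = slope m d

      e : Fin n → Fin n → PolyH
      e i j = slice d (E i j)

      e-sym : ∀ i j → e i j ≋H e j i
      e-sym i j = slice-≋ d z (E-sym i j)

      -- Rule (vii) extends from the classes y to Y_0 = Y_n = 0, where the heights vanish as well;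
      -- taking differences then gives the rule for all n classes x.
      ∗-rule : ∀ b m l → κ (u m) *′ slice d (x l ∗ embed b) ≋H κ (u l) *′ slice d (x m ∗ embed b)
      ∗-rule b = Partial.backward d (λ l → slice d (x l ∗ embed b)) (λ t → slice d (Y t ∗ embed b)) S0
        (λ m → AH.trans (slice-≋ d z (A.trans (∗-congˡ (embed b) (≃⇒≋ (Y-step m))) (∗-+ˡ (x m) (Y (toℕ m)) (embed b)))) (≃⇒≋ (slice-+ d _ _))) rule
        where
        S : ℕ → PolyH
        S t = slice d (Y t ∗ embed b)
        zero∗ : 0′ ∗ embed b ≋ 0′
        zero∗ = A.trans (∗-comm 0′ (embed b)) (fn-0 (times (embed b)))
        S0 : S 0 ≋H 0′
        S0 = AH.trans (slice-≋ d z (A.trans (∗-congˡ (embed b) (≃⇒≋ (P.reflexive Y-0))) zero∗)) (≃⇒≋ (slice-0 d))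
        Sn : S n ≋H 0′
        Sn = AH.trans (slice-≋ d z (A.trans (∗-congˡ (embed b) (≃⇒≋ (P.reflexive (Y-top ℕP.≤-refl)))) zero∗)) (≃⇒≋ (slice-0 d))
        S-dead : ∀ t → (t ≡ 0) ⊎ (t ≡ n) → (S t ≋H 0′) × (κ (height d t) ≋H 0′)
        S-dead t (inj₁ ≡.refl) = S0 , ≃⇒≋ κ-0
        S-dead t (inj₂ ≡.refl) = Sn , ≃⇒≋ (P.trans (P.reflexive (cong κ (height-top d))) κ-0)
        position : ∀ t → t ≤ n → ((t ≡ 0) ⊎ (t ≡ n)) ⊎ (Σ (Fin r) λ i → suc (toℕ i) ≡ t)
        position zero _ = inj₁ (inj₁ ≡.refl)
        position (suc t) (s≤s t≤r) = [ (λ p → inj₂ (fromℕ< p , cong suc (FP.toℕ-fromℕ< p))) , (λ p → inj₁ (inj₂ (cong suc p))) ]′ (ℕP.m≤n⇒m<n∨m≡n t≤r)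
        rule : ∀ s t → s ≤ n → t ≤ n → κ (height d s) *′ S t ≋H κ (height d t) *′ S s
        rule s t s≤n t≤n = go (position s s≤n) (position t t≤n)
          where
          go : ((s ≡ 0) ⊎ (s ≡ n)) ⊎ (Σ (Fin r) λ i → suc (toℕ i) ≡ s) → ((t ≡ 0) ⊎ (t ≡ n)) ⊎ (Σ (Fin r) λ i → suc (toℕ i) ≡ t) → κ (height d s) *′ S t ≋H κ (height d t) *′ S s
          go (inj₁ p) _ = AH.trans (AH.*-congʳ (proj₂ (S-dead s p))) (AH.trans (AH.zeroˡ _) (AH.sym (AH.trans (AH.*-congˡ (proj₁ (S-dead s p))) (AH.zeroʳ _))))
          go (inj₂ _) (inj₁ p) = AH.trans (AH.*-congˡ (proj₁ (S-dead t p))) (AH.trans (AH.zeroʳ _) (AH.sym (AH.trans (AH.*-congʳ (proj₂ (S-dead t p))) (AH.zeroˡ _))))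
          go (inj₂ (i , ≡.refl)) (inj₂ (j , ≡.refl)) = ∗-coefficients d z b i j

      e-x : ∀ i j → e i j ≋H slice d (x i ∗ embed (xH j *′ a)) -′ slice d (fn (𝒳 i) (embed (xH j *′ a)))
      e-x i j = AH.trans (slice-≋ d z (A.trans (A.sym (Δ-x i j)) (fn-cong (Δ i) (≃⇒≋ (P.sym (P.trans ([]-* _ (xH j) a) (P.*-congʳ (embed-x j))))))))
        (≃⇒≋ (P.trans (slice-+ d _ _) (P.+-congˡ (slice-neg d _))))

      e-rule : ∀ m l j → κ (u m) *′ e l j ≋H κ (u l) *′ e m j
      e-rule m l j = AH.trans (AH.*-congˡ (e-x l j)) (AH.trans (distr (u m) l) (AH.trans (AH.+-cong (∗-rule b m l) (AH.-‿cong (C-rule d z b m l)))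
        (AH.trans (AH.sym (distr (u l) m)) (AH.*-congˡ (AH.sym (e-x m j))))))
        where
        b = xH j *′ a
        distr : ∀ c l → κ c *′ (slice d (x l ∗ embed b) -′ slice d (fn (𝒳 l) (embed b))) ≋H κ c *′ slice d (x l ∗ embed b) -′ κ c *′ slice d (fn (𝒳 l) (embed b))
        distr c l = ≃⇒≋ (PS.solve (λ { (c ∷ s ∷ t ∷ []) → c ⊗ (s ⊖ t) , c ⊗ s ⊖ c ⊗ t }) (κ c ∷ slice d (x l ∗ embed b) ∷ slice d (fn (𝒳 l) (embed b)) ∷ []) ≡.refl)

      -- `e-rule` replaces one index at a time, and symmetry of `e` makes it available for the
      -- second index.
      exchange : ∀ i j l m → (κ (u i) *′ κ (u j)) *′ e l m ≋H (κ (u l) *′ κ (u m)) *′ e i j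
      exchange i j l m = begin
        (κ (u i) *′ κ (u j)) *′ e l m ≈⟨ ≃⇒≋ (P.trans (P.*-congʳ (P.*-comm (κ (u i)) (κ (u j)))) (P.*-assoc (κ (u j)) (κ (u i)) (e l m))) ⟩
        κ (u j) *′ (κ (u i) *′ e l m) ≈⟨ AH.*-congˡ (AH.trans (e-rule i l m) (AH.*-congˡ (e-sym i m))) ⟩
        κ (u j) *′ (κ (u l) *′ e m i) ≈⟨ ≃⇒≋ (PS.solve (λ { (a ∷ b ∷ c ∷ []) → a ⊗ (b ⊗ c) , b ⊗ (a ⊗ c) }) (κ (u j) ∷ κ (u l) ∷ e m i ∷ []) ≡.refl) ⟩
        κ (u l) *′ (κ (u j) *′ e m i) ≈⟨ AH.*-congˡ (AH.trans (e-rule j m i) (AH.*-congˡ (e-sym j i))) ⟩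
        κ (u l) *′ (κ (u m) *′ e i j) ≈⟨ ≃⇒≋ (P.sym (P.*-assoc (κ (u l)) (κ (u m)) (e i j))) ⟩
        (κ (u l) *′ κ (u m)) *′ e i j ∎
        where open SetoidReasoning AH.setoid

      module HSum = FinSum (CommutativeRing.ring (quotientRing GH))

      pairs : PolyH
      pairs = pairSum (λ i j → κ (u i) *′ κ (u j))

      pairSum-*ʳ : ∀ (F : Fin n → Fin n → PolyH) g → pairSum F *′ g ≃ pairSum (λ i j → F i j *′ g)
      pairSum-*ʳ F g = P.trans (PSum.sum-*ʳ g (λ i → PSum.sum (λ j → pick (lt i j) (F i j)))) (PSum.sum-cong λ i →
        P.trans (PSum.sum-*ʳ g (λ j → pick (lt i j) (F i j))) (PSum.sum-cong λ j → pick-* (lt i j) (F i j)))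
        where
        pick-* : ∀ b h → pick b h *′ g ≃ pick b (h *′ g)
        pick-* true h = P.refl
        pick-* false h = P.zeroˡ g

      slice-pairSum : ∀ (F : Fin n → Fin n → PolyHK) → slice d (pairSum F) ≃ pairSum (λ i j → slice d (F i j))
      slice-pairSum F = P.trans (slice-sum d z a (λ i → PSum.sum (λ j → pick (lt i j) (F i j)))) (PSum.sum-cong λ i →
        P.trans (slice-sum d z a (λ j → pick (lt i j) (F i j))) (PSum.sum-cong λ j → pick-slice (lt i j) (F i j)))
        where
        pick-slice : ∀ b h → slice d (pick b h) ≃ pick b (slice d h)
        pick-slice true h = P.refl
        pick-slice false h = slice-0 d

      pairs-e : ∀ l m → pairs *′ e l m ≋H 0′
      pairs-e l m = AH.trans (≃⇒≋ (pairSum-*ʳ (λ i j → κ (u i) *′ κ (u j)) (e l m))) (AH.trans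
        (HSum.sum-cong {f = λ i → PSum.sum (λ j → pick (lt i j) ((κ (u i) *′ κ (u j)) *′ e l m))} {λ i → PSum.sum (λ j → pick (lt i j) (e i j *′ c))}
          λ i → HSum.sum-cong {f = λ j → pick (lt i j) ((κ (u i) *′ κ (u j)) *′ e l m)} {λ j → pick (lt i j) (e i j *′ c)} λ j → pick-H (lt i j) (AH.trans (exchange i j l m) (AH.*-comm c (e i j))))
        (AH.trans (≃⇒≋ (P.sym (pairSum-*ʳ e c))) (AH.trans (AH.*-congʳ (AH.trans (≃⇒≋ (P.sym (slice-pairSum E))) (AH.trans (slice-≋ d z E-sum) (≃⇒≋ (slice-0 d))))) (AH.zeroˡ c))))
        where
        c = κ (u l) *′ κ (u m)
        pick-H : ∀ b {g h} → g ≋H h → pick b g ≋H pick b h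
        pick-H true p = p
        pick-H false p = AH.refl

      squares : PolyH
      squares = PSum.sum (λ i → κ (u i) *′ κ (u i))

      sum-u : PSum.sum (λ i → κ {r} (u i)) ≃ 0′
      sum-u = P.trans (PSum.sum-cong {f = λ i → κ (u i)} {λ i → κ (height d (suc (toℕ i))) -′ κ (height d (toℕ i))}
          λ i → P.trans (PS.solve (λ { (a ∷ b ∷ []) → b , (a ⊕ b) ⊖ a }) (κ (height d (toℕ i)) ∷ κ (u i) ∷ []) ≡.refl) (P.+-congʳ (P.sym (κ-height d i))))
        (P.trans (sum-telescope n (λ t → κ (height d t))) (P.trans (P.+-congʳ (P.reflexive (cong κ (height-top d)))) (P.-‿inverseʳ (κ 0ℤ))))

      squares-pairs : squares ≃ -′ (pairs +′ pairs)
      squares-pairs = P.trans (PS.solve (λ { (p ∷ s ∷ []) → s , ((p ⊕ p) ⊕ s) ⊖ (p ⊕ p) }) (pairs ∷ squares ∷ []) ≡.refl)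
        (P.trans (P.+-congʳ (P.trans (P.sym (square-expand (λ i → κ (u i)))) (P.trans (P.*-congʳ sum-u) (P.zeroˡ _)))) (P.+-identityˡ _))

      squares-e : ∀ l m → squares *′ e l m ≋H 0′
      squares-e l m = AH.trans (≃⇒≋ (P.trans (P.*-congʳ squares-pairs) (PS.solve (λ { (p ∷ e ∷ []) → ⊝ (p ⊕ p) ⊗ e , ⊝ (p ⊗ e ⊕ p ⊗ e) }) (pairs ∷ e l m ∷ []) ≡.refl)))
        (AH.trans (AH.-‿cong (AH.trans (AH.+-cong (pairs-e l m) (pairs-e l m)) (AH.+-identityˡ 0′))) (≃⇒≋ PP.-0#≈0#))

      flat-d : (∀ i → u i ≡ 0ℤ) → d ≡ 0ᵐ
      flat-d h = go (anyZero-true d z)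
        where
        height-0 : ∀ t → t ≤ n → height d t ≡ 0ℤ
        height-0 zero _ = ≡.refl
        height-0 (suc t) t<n = ≡.trans (cong (λ s → height d (suc s)) (≡.sym (FP.toℕ-fromℕ< t<n))) (≡.trans (height-step d (fromℕ< t<n))
          (cong₂ ℤ._+_ (≡.trans (cong (height d) (FP.toℕ-fromℕ< t<n)) (height-0 t (ℕP.<⇒≤ t<n))) (h (fromℕ< t<n))))
        same : ∀ i → lookup d i ≡ at d (suc k)
        same i = ≡.trans (≡.sym (at-lookup d i)) (ℤP.+-injective (ℤP.i-j≡0⇒i≡j (+ at d (toℕ i)) (+ at d (suc k)) (height-0 (suc (toℕ i)) (FP.toℕ<n i))))
        go : (Σ (Fin n) λ j → lookup d j ≡ 0) → d ≡ 0ᵐ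
        go (j , p) = vec-ext λ i → ≡.trans (same i) (≡.trans (≡.sym (same j)) (≡.trans p (≡.sym (lookup-0ᵐ i))))

      e-0 : ∀ l m → e l m ≋H 0′
      e-0 l m = go (sumSquares {r} u)
        where
        classical-case : d ≡ 0ᵐ → e l m ≋H 0′
        classical-case ≡.refl = AH.trans (e-x l m) (AH.trans (AH.+-cong (AH.trans (≃⇒≋ (slice-0-z0 _)) (AH.trans (z0-≋ (∗-congˡ _ (≃⇒≋ (P.sym (embed-x l))))) (∗-z0 (xH l) b)))
          (AH.-‿cong (AH.trans (≃⇒≋ (slice-0-z0 _)) (AH.trans (𝒳-z0 l (embed b)) (≃⇒≋ (P.*-cong (z0-x l) (z0-embed b))))))) (AH.-‿inverseʳ _))
          where
          b = xH m *′ a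
        go : (Σ ℕ λ s → squares ≃ κ (+ s) × (s ≡ 0 → ∀ i → u i ≡ 0ℤ)) → e l m ≋H 0′
        go (zero , _ , h) = classical-case (flat-d (h ≡.refl))
        go (suc s , p , _) = torsion-free (+ suc s) (λ ()) (e l m) (AH.trans (≃⇒≋ (P.*-congʳ (P.sym p))) (squares-e l m))

    E-0 : pairSum E ≋ 0′ → ∀ i j → E i j ≋ 0′
    E-0 E-sum i j = separate (E i j) (λ d z → e-0 E-sum d z i j)

module Comparison (k : ℕ) (_∗_ : Flag.PolyHK (suc (suc k)) → Flag.PolyHK (suc (suc k)) → Flag.PolyHK (suc (suc k)))
                  (laws : Uniqueness.Laws k _∗_) where
  open Compare k _∗_ laws
  open Uniqueness.Laws laws

  -- The case `nothing` measures the failure of the unit law, which has to be carried along: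
  -- `pairSum-E` uses it at f when the x j f are treated.
  Defect : Maybe (Fin n) → Op
  Defect (just i) = Δ i
  Defect nothing = times 1′ O.- 1ᵒ

  Good : PolyHK → Set
  Good g = ∀ s → fn (Defect s) g ≋ 0′

  Good-resp : ∀ {f g} → f ≋ g → Good f → Good g
  Good-resp p h s = A.trans (fn-cong (Defect s) (A.sym p)) (h s)

  Good-0 : Good 0′
  Good-0 s = fn-0 (Defect s)

  Good-+ : ∀ {f g} → Good f → Good g → Good (f +′ g)
  Good-+ h h′ s = A.trans (fn-+ (Defect s) _ _) (A.trans (A.+-cong (h s) (h′ s)) (A.+-identityˡ 0′))

  Good-neg : ∀ {f} → Good f → Good (-′ f)
  Good-neg h s = A.trans (fn-neg (Defect s) _) (A.trans (A.-‿cong (h s)) (≃⇒≋ PP.-0#≈0#))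

  fn-qmon : ∀ φ e g → fn φ (qmon e *′ g) ≋ qmon e *′ fn φ g
  fn-qmon φ e g = mon-ind (λ e → fn φ (qmon e *′ g) ≋ qmon e *′ fn φ g)
    (A.trans (fn-cong φ (A.trans (A.*-congʳ (≃⇒≋ qmon-0)) (A.*-identityˡ g))) (A.sym (A.trans (A.*-congʳ (≃⇒≋ qmon-0)) (A.*-identityˡ _))))
    (λ j e h → A.trans (fn-cong φ (expand j e g)) (A.trans (fn-lin φ (inj₂ j) _) (A.trans (A.*-congˡ h) (A.sym (expand j e (fn φ g))))))
    e
    where
    expand : ∀ j e g → qmon (unit j +ᵐ e) *′ g ≋ q j *′ (qmon e *′ g)
    expand j e g = ≃⇒≋ (P.trans (P.*-congʳ (P.trans (qmon-+ (unit j) e) (P.*-congʳ (P.reflexive (qmon-unit j))))) (P.*-assoc (q j) (qmon e) g))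

  Good-qmon : ∀ e {g} → Good g → Good (qmon e *′ g)
  Good-qmon e h s = A.trans (fn-qmon (Defect s) e _) (A.trans (A.*-congˡ (h s)) (A.zeroʳ (qmon e)))

  Good-κ : ∀ c → Good (κ c)
  Good-κ c s = A.trans (fn-cong (Defect s) (A.sym (A.*-identityʳ (κ c)))) (A.trans (fn-κ (Defect s) c 1′) (A.trans (A.*-congˡ (one s)) (A.zeroʳ (κ c))))
    where
    one : ∀ s → fn (Defect s) 1′ ≋ 0′
    one (just i) = Δ-1 i
    one nothing = A.trans (A.+-congʳ 1∗1) (A.-‿inverseʳ 1′)

  Good-Lower : ∀ {N f} → (∀ {g} → QDeg.Bd N 0ℤ g → Good g) → QDeg.Bd N 0ℤ f → ∀ j → Good (fn (Lower j) f)
  Good-Lower {f = f} rec b = Lower-zero Good Good-+ Good-neg Good-0 f λ {a} {c} a<c → go a<c (interval a<c)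
    where
    go : ∀ {a c} → a < c → Interval a c → Good (fn (U a c) f)
    go {a} {c} a<c (e , fe , _) = Good-resp (A.sym (A.trans (≃⇒≋ (P.reflexive (cong (λ φ → fn φ f) (U-def a c)))) (fe (fn (T a c) f))))
      (Good-qmon e (rec (T-Bd a<c b)))

  -- For the classes x this is `Step`. For the unit law x j f is completed to `𝒳 j` f = x j ∗ f, and
  -- associativity reduces the claim to x j ∗ 1 = x j.
  Good-x : ∀ a → Good (embed a) → (∀ j → Good (fn (Lower j) (embed a))) → ∀ j → Good (x j *′ embed a)
  Good-x a h hl j (just i) = A.trans (S.Δ-x i j) (S.E-0 (S.pairSum-E unit-f) i j)
    where
    module S = Step a (λ i → h (just i)) (λ i j → hl j (just i))
    unit-f : 1′ ∗ embed a ≋ embed a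
    unit-f = Combination.-≈0⇒≈ (CommutativeRing.ring A) (h nothing)
  Good-x a h hl j nothing = A.trans (A.sym (A.+-identityʳ _)) (A.trans (A.+-congˡ (A.sym (hl j nothing))) (A.trans (A.sym (fn-+ (Defect nothing) _ _))
    (A.trans (fn-cong (Defect nothing) (≃⇒≋ (P.reflexive (≡.sym (𝒳-fn j f))))) (A.trans (A.+-congʳ unit-𝒳) (A.-‿inverseʳ _)))))
    where
    f = embed a
    x∗f : x j ∗ f ≋ fn (𝒳 j) f
    x∗f = Combination.-≈0⇒≈ (CommutativeRing.ring A) (h (just j))
    unit-𝒳 : 1′ ∗ fn (𝒳 j) f ≋ fn (𝒳 j) f
    unit-𝒳 = A.trans (∗-congʳ 1′ (A.sym x∗f)) (A.trans (A.sym (∗-assoc 1′ (x j) f)) (A.trans (∗-congˡ f (A.trans (∗-comm 1′ (x j)) (x∗1 j))) x∗f))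

  -- Restricted to terms free of q, because (vii) concerns products with classes of H; powers of q
  -- are restored by K-linearity in `good`.
  FlatTerms : ℕ → Set
  FlatTerms N = ∀ e c → wdeg yw e ℤ.≤ + N → wdeg QDeg.w e ≡ 0ℤ → Good (mono c e)

  from-flat : ∀ {N} → FlatTerms N → ∀ {f} → QDeg.Bd (+ N) 0ℤ f → Good f
  from-flat {N} h (g , p , a) = Good-resp (≃⇒≋ (P.sym p)) (go g a)
    where
    go : ∀ g → All (QDeg.Ok (+ N) 0ℤ) g → Good g
    go [] [] = subst Good (≡.sym []≡0) Good-0
    go ((c , e) ∷ g) ((le , eq) ∷ a) = subst Good (≡.sym (∷≡+ c e g)) (Good-+ (h e c le eq) (go g a))

  weights-nonneg : ∀ {a b} → 0ℤ ℤ.≤ a → 0ℤ ℤ.≤ b → ∀ e → 0ℤ ℤ.≤ wdeg (weight a b) e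
  weights-nonneg {a} {b} pa pb = wdeg-nonneg (weight a b) (var-cases (λ v → 0ℤ ℤ.≤ weight a b v)
    (λ i → subst (0ℤ ℤ.≤_) (≡.sym (weight-Y a b i)) pa) (λ j → subst (0ℤ ℤ.≤_) (≡.sym (weight-q a b j)) pb))

  1+nonneg : ∀ {z} → 0ℤ ℤ.≤ z → ¬ (1ℤ ℤ.+ z ℤ.≤ 0ℤ)
  1+nonneg p le = ℤP.<⇒≱ (ℤP.<-≤-trans (ℤ.+<+ (s≤s z≤n)) (ℤP.+-monoʳ-≤ 1ℤ p)) le

  terms-from : ∀ N → (∀ {N′} → suc N′ ≡ N → FlatTerms N′) → FlatTerms N
  terms-from N rec = mon-ind (λ e → ∀ c → wdeg yw e ℤ.≤ + N → wdeg QDeg.w e ≡ 0ℤ → Good (mono c e))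
    (λ c _ _ → subst Good (≡.sym (mono-0ᵐ c)) (Good-κ c))
    (λ v e ih c le eq → subst Good (X*mono v c e) (step v e ih c (subst (ℤ._≤ + N) (shift yw v e) le) (≡.trans (≡.sym (shift QDeg.w v e)) eq)))
    where
    shift : ∀ w v e → wdeg w (unit v +ᵐ e) ≡ w v ℤ.+ wdeg w e
    shift w v e = ≡.trans (wdeg-+ w (unit v) e) (cong (ℤ._+ wdeg w e) (wdeg-unit w v))
    StepAt : Fin M → Set
    StepAt v = ∀ e → (∀ c → wdeg yw e ℤ.≤ + N → wdeg QDeg.w e ≡ 0ℤ → Good (mono c e)) → ∀ c →
               yw v ℤ.+ wdeg yw e ℤ.≤ + N → QDeg.w v ℤ.+ wdeg QDeg.w e ≡ 0ℤ → Good (X v *′ mono c e)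
    stepq : ∀ j → StepAt (ιq j)
    stepq j e ih c le eq = ⊥-elim (1+nonneg (weights-nonneg ℤP.≤-refl (ℤ.+≤+ z≤n) e)
      (ℤP.≤-reflexive (≡.trans (cong (ℤ._+ wdeg QDeg.w e) (≡.sym (weight-q 0ℤ 1ℤ j))) eq)))
    stepY : ∀ i → StepAt (ιY i)
    stepY i e ih c le eq = go N ≡.refl (subst (λ w → w ℤ.+ wdeg yw e ℤ.≤ + N) (weight-Y 1ℤ 0ℤ i) le)
      where
      flat-e : wdeg QDeg.w e ≡ 0ℤ
      flat-e = ≡.trans (≡.sym (≡.trans (cong (ℤ._+ wdeg QDeg.w e) (weight-Y 0ℤ 1ℤ i)) (ℤP.+-identityˡ _))) eq
      go : ∀ N₀ → N₀ ≡ N → 1ℤ ℤ.+ wdeg yw e ℤ.≤ + N₀ → Good (X (ιY i) *′ mono c e)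
      go zero _ le = ⊥-elim (1+nonneg (weights-nonneg (ℤ.+≤+ z≤n) ℤP.≤-refl e) le)
      go (suc N′) p le = finish (flat bd)
        where
        le′ : wdeg yw e ℤ.≤ + N′
        le′ = subst (ℤ._≤ + N′) (lemma (wdeg yw e)) (ℤP.+-monoʳ-≤ -1ℤ le)
          where
          lemma : ∀ x → -1ℤ ℤ.+ (1ℤ ℤ.+ x) ≡ x
          lemma = solve-∀
        m = mono c e
        bd : QDeg.Bd (+ N′) 0ℤ m
        bd = QDeg.Bd-mono-term c e le′ flat-e
        good-m : Good m
        good-m = from-flat (rec p) bd
        finish : (Σ PolyH λ a → m ≃ embed a) → Good (X (ιY i) *′ m)
        finish (a , m≃a) = subst (λ y → Good (y *′ m)) (Y-ι i) (Y-gen Good (λ p → Good-resp (≃⇒≋ p)) (λ _ _ → Good-+) Good-0 m each (suc (toℕ i)) (ℕP.m≤n⇒m≤1+n (FP.toℕ<n i)))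
          where
          each : ∀ j → Good (x j *′ m)
          each j = Good-resp (A.*-congˡ (≃⇒≋ (P.sym m≃a))) (Good-x a (Good-resp (≃⇒≋ m≃a) good-m)
            (λ j → Good-resp (fn-cong (Lower j) (≃⇒≋ m≃a)) (Good-Lower (from-flat (rec p)) bd j)) j)
    step : ∀ v → StepAt v
    step = var-cases StepAt stepY stepq

  flat-terms : ∀ N → FlatTerms N
  flat-terms zero = terms-from zero λ ()
  flat-terms (suc N) = terms-from (suc N) λ { ≡.refl → flat-terms N }

  good : ∀ f → Good f
  good [] = subst Good (≡.sym []≡0) Good-0
  good ((c , e) ∷ f) = subst Good (≡.sym (∷≡+ c e f)) (Good-+ (++-ind (λ e → Good (mono c e)) split e) (good f))
    where
    split : ∀ u d → Good (mono c (u V.++ d))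
    split u d = Good-resp (≃⇒≋ (P.trans (P.*-comm (qmon d) (embed (mono c u))) (P.sym (mono-split c u d))))
      (Good-qmon d (from-flat (flat-terms _) (proj₂ (embed-Bd (mono c u)))))

  -- Once x i ∗ coincides with `𝒳 i`, commutativity and associativity make ∗-multiplication by `a`
  -- commute with every `𝒳 i`. It is then a multiplier with value `a` at 1, and such a multiplier is
  -- unique.
  ∗≋⋆ : ∀ a b → a ∗ b ≋ a ⋆ b
  ∗≋⋆ a b = A.sym (⋆-unique (multiplier (times a) λ i → mkᵒ (commute i)) (A.trans (∗-comm a 1′) (unital a)) b)
    where
    unital : ∀ a → 1′ ∗ a ≋ a
    unital a = Combination.-≈0⇒≈ (CommutativeRing.ring A) (good a nothing)
    x∗ : ∀ i b → x i ∗ b ≋ fn (𝒳 i) b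
    x∗ i b = Combination.-≈0⇒≈ (CommutativeRing.ring A) (good b (just i))
    commute : ∀ i b → a ∗ fn (𝒳 i) b ≋ fn (𝒳 i) (a ∗ b)
    commute i b = A.trans (∗-congʳ a (A.sym (x∗ i b))) (A.trans (A.sym (∗-assoc a (x i) b)) (A.trans (∗-congˡ b (∗-comm a (x i)))
      (A.trans (∗-assoc (x i) a b) (x∗ i (a ∗ b)))))

theorem1p1 : ∀ (n : ℕ) → 2 ≤ n →
  Σ (Flag.PolyHK n → Flag.PolyHK n → Flag.PolyHK n) (Flag.IsQuantumProduct n)
  × (∀ (_⋆_ _⋆′_ : Flag.PolyHK n → Flag.PolyHK n → Flag.PolyHK n) →
       Flag.IsQuantumProduct n _⋆_ → Flag.IsQuantumProduct n _⋆′_ →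
       ∀ a b → Flag._≈_ n (a ⋆ b) (a ⋆′ b))
theorem1p1 (suc (suc k)) _ = (_⋆_ , fromLaws ⋆-laws) , λ _∗_ _∗′_ h h′ a b →
  ≋⇒≈ (A.trans (Comparison.∗≋⋆ k _∗_ (toLaws h) a b) (A.sym (Comparison.∗≋⋆ k _∗′_ (toLaws h′) a b)))
  where open Uniqueness k
theorem1p1 (suc zero) (s≤s ())
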